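{- Let $P(t),Q(t)\in\mathbb{Q}(t)$ be rational functions such that $P(t)$, $Q(t)$ and the constant function $1$ are linearly independent over $\mathbb{Q}$, and let $Y(\mathbb{F}_p)$ be the set of $\mathbb{F}_p$-points of the Roth variety for corners associated to $P,Q$. Then $|Y(\mathbb{F}_p)|\ll p^6$, where the implied constant depends only on $P,Q$.
   Context: $P,Q$ are reduced modulo the prime $p$. The Roth variety: 16 variables $y_1,\dots,y_{16}$ (none a pole of $P$ or $Q$) satisfying the ten equations $P(y_1)-P(y_3)-P(y_9)+P(y_{11})=0$; $P(y_2)-P(y_4)-P(y_{10})+P(y_{12})=0$; $P(y_5)-P(y_7)-P(y_{13})+P(y_{15})=0$; $P(y_6)-P(y_8)-P(y_{14})+P(y_{16})=0$; $Q(y_1)-Q(y_2)-Q(y_9)+Q(y_{10})=0$; $Q(y_3)-Q(y_7)-Q(y_{11})+Q(y_{15})=0$; $Q(y_4)-Q(y_8)-Q(y_{12})+Q(y_{16})=0$; $Q(y_5)-Q(y_6)-Q(y_{13})+Q(y_{14})=0$; $P(y_9)-P(y_{10})-P(y_{11})+P(y_{12})-P(y_{13})+P(y_{14})+P(y_{15})-P(y_{16})=0$; $Q(y_9)-Q(y_{10})-Q(y_{11})+Q(y_{12})-Q(y_{13})+Q(y_{14})+Q(y_{15})-Q(y_{16})=0$. $Y(\mathbb{F}_p)\subset\mathbb{F}_p^{16}$ is the set of solutions. -}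

module Defs where

open import Data.Nat as ℕ using (ℕ; zero; suc; NonZero)
open import Data.Integer as ℤ using (ℤ; +_)
open import Data.Integer.Base using (_%ℕ_)
open import Data.Rational as ℚ using (ℚ; 0ℚ; 1ℚ)
open import Data.List as List using (List; []; _∷_; allFin)
open import Data.List.Relation.Unary.All using (All)
open import Data.Fin using (Fin; toℕ; #_)
open import Data.Fin.Properties using (all?)
open import Data.Vec.Functional as V using (Vector)
open import Data.Nat.ListAction using (sum)
open import Data.Bool using (Bool; if_then_else_)
open import Data.Product using (Σ; _×_; ∃-syntax)
open import Relation.Nullary using (¬_; Dec; does; ¬?; _×-dec_)
open import Relation.Binary.PropositionalEquality using (_≡_)

-- Polynomials with integer coefficients, coefficient lists, lowest
-- degree first:  c₀ ∷ c₁ ∷ … ↦ c₀ + c₁ t + …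

ZPoly : Set
ZPoly = List ℤ

-- Rational function in ℚ(t), written as num/den with num, den ∈ ℤ[t]
-- (every element of ℚ(t) has such a representation).
record RatFun : Set where
  constructor _⁄_
  field
    num : ZPoly
    den : ZPoly
open RatFun public

QPoly : Set
QPoly = List ℚ

toQ : ZPoly → QPoly
toQ = List.map (λ z → z ℚ./ 1)

_+ₚ_ : QPoly → QPoly → QPoly
[] +ₚ g = g
(a ∷ f) +ₚ [] = a ∷ f
(a ∷ f) +ₚ (b ∷ g) = (a ℚ.+ b) ∷ (f +ₚ g)

_·ₚ_ : ℚ → QPoly → QPoly
c ·ₚ f = List.map (c ℚ.*_) f

_*ₚ_ : QPoly → QPoly → QPoly
[] *ₚ g = []
(a ∷ f) *ₚ g = (a ·ₚ g) +ₚ (0ℚ ∷ (f *ₚ g))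

IsZeroPoly : QPoly → Set
IsZeroPoly f = All (_≡ 0ℚ) f

_≈ₚ_ : QPoly → QPoly → Set
f ≈ₚ g = IsZeroPoly (f +ₚ ((ℚ.- 1ℚ) ·ₚ g))

-- num/den is a genuine rational function written in lowest terms:
-- den ≠ 0 and gcd(num, den) = 1 in ℚ[t] (Bézout form, ℚ[t] is a PID).
WellFormed : RatFun → Set
WellFormed R =
  ¬ IsZeroPoly (toQ (den R)) ×
  (∃[ A ] ∃[ B ] (((A *ₚ toQ (num R)) +ₚ (B *ₚ toQ (den R))) ≈ₚ (1ℚ ∷ [])))

-- P, Q, 1 linearly independent over ℚ (as elements of ℚ(t)):
-- a·Pn/Pd + b·Qn/Qd + c = 0 in ℚ(t)  iff
-- a·Pn·Qd + b·Qn·Pd + c·Pd·Qd = 0 in ℚ[t].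
LinIndep1 : RatFun → RatFun → Set
LinIndep1 P Q = ∀ (a b c : ℚ) →
  IsZeroPoly ((a ·ₚ (Pn *ₚ Qd)) +ₚ ((b ·ₚ (Qn *ₚ Pd)) +ₚ (c ·ₚ (Pd *ₚ Qd)))) →
  (a ≡ 0ℚ) × (b ≡ 0ℚ) × (c ≡ 0ℚ)
  where
  Pn = toQ (num P)
  Pd = toQ (den P)
  Qn = toQ (num Q)
  Qd = toQ (den Q)

evalℤ : ZPoly → ℤ → ℤ
evalℤ [] x = + 0
evalℤ (c ∷ cs) x = c ℤ.+ x ℤ.* evalℤ cs x

module _ (p : ℕ) .{{_ : NonZero p}} where

  elt : Fin p → ℤ
  elt y = + toℕ y

  IsPole : RatFun → Fin p → Set
  IsPole R y = evalℤ (den R) (elt y) %ℕ p ≡ 0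

  -- value of the reduction of R mod p at a non-pole y, as an element
  -- of {0,…,p-1} ⊂ ℤ; the inverse of d in 𝔽ₚ is d^(p-2) (Fermat).
  val : RatFun → Fin p → ℤ
  val R y = + ((evalℤ (num R) (elt y) ℤ.* (evalℤ (den R) (elt y) ℤ.^ (p ℕ.∸ 2))) %ℕ p)

  Z : ℤ → Set
  Z e = e %ℕ p ≡ 0

  Z? : ∀ e → Dec (Z e)
  Z? e = (e %ℕ p) ℕ.≟ 0

  -- points y = (y₁,…,y₁₆); yᵢ is  y (# (i-1))
  module _ (P Q : RatFun) (y : Vector (Fin p) 16) where
    Pv Qv : Fin 16 → ℤ
    Pv i = val P (y i)
    Qv i = val Q (y i)

    e1 e2 e3 e4 e5 e6 e7 e8 e9 e10 : ℤ
    e1 = Pv (# 0) ℤ.- Pv (# 2) ℤ.- Pv (# 8) ℤ.+ Pv (# 10)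
    e2 = Pv (# 1) ℤ.- Pv (# 3) ℤ.- Pv (# 9) ℤ.+ Pv (# 11)
    e3 = Pv (# 4) ℤ.- Pv (# 6) ℤ.- Pv (# 12) ℤ.+ Pv (# 14)
    e4 = Pv (# 5) ℤ.- Pv (# 7) ℤ.- Pv (# 13) ℤ.+ Pv (# 15)
    e5 = Qv (# 0) ℤ.- Qv (# 1) ℤ.- Qv (# 8) ℤ.+ Qv (# 9)
    e6 = Qv (# 2) ℤ.- Qv (# 6) ℤ.- Qv (# 10) ℤ.+ Qv (# 14)
    e7 = Qv (# 3) ℤ.- Qv (# 7) ℤ.- Qv (# 11) ℤ.+ Qv (# 15)
    e8 = Qv (# 4) ℤ.- Qv (# 5) ℤ.- Qv (# 12) ℤ.+ Qv (# 13)
    e9 = Pv (# 8) ℤ.- Pv (# 9) ℤ.- Pv (# 10) ℤ.+ Pv (# 11)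
         ℤ.- Pv (# 12) ℤ.+ Pv (# 13) ℤ.+ Pv (# 14) ℤ.- Pv (# 15)
    e10 = Qv (# 8) ℤ.- Qv (# 9) ℤ.- Qv (# 10) ℤ.+ Qv (# 11)
          ℤ.- Qv (# 12) ℤ.+ Qv (# 13) ℤ.+ Qv (# 14) ℤ.- Qv (# 15)

    InY : Set
    InY = (∀ i → ¬ IsPole P (y i)) × (∀ i → ¬ IsPole Q (y i)) ×
          Z e1 × Z e2 × Z e3 × Z e4 × Z e5 × Z e6 × Z e7 × Z e8 × Z e9 × Z e10

    InY? : Dec InY
    InY? = all? (λ i → ¬? (Z? (evalℤ (den P) (elt (y i))))) ×-dec
           all? (λ i → ¬? (Z? (evalℤ (den Q) (elt (y i))))) ×-dec
           Z? e1 ×-dec Z? e2 ×-dec Z? e3 ×-dec Z? e4 ×-dec Z? e5 ×-dec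
           Z? e6 ×-dec Z? e7 ×-dec Z? e8 ×-dec Z? e9 ×-dec Z? e10

count : (n k : ℕ) → (Vector (Fin n) k → Bool) → ℕ
count n zero f = if f V.[] then 1 else 0
count n (suc k) f = sum (List.map (λ i → count n k (λ v → f (i V.∷ v))) (allFin n))

cardY : (p : ℕ) .{{_ : NonZero p}} → RatFun → RatFun → ℕ
cardY p P Q = count p 16 (λ y → does (InY? p P Q y))

{-# OPTIONS --safe #-}
-- In the cyclic order in which the equations link them, the sixteen variables form pairs
-- (xᵢ, wᵢ), i mod 8, with P(xᵢ) − P(xᵢ₊₁) = P(wᵢ) − P(wᵢ₊₁) for odd i, the same for Q for
-- even i, and Σ (−1)ⁱ P(wᵢ) = Σ (−1)ⁱ Q(wᵢ) = 0.  Thus x and w are two points of the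
-- variety W cut out by the last two equations that have the same image under
-- Φ(x) = (P(x₁) − P(x₂), Q(x₂) − Q(x₃), …, Q(x₈) − Q(x₁)).  Put m = Q′/P′.  The Jacobian
-- of Φ vanishes exactly where m(x₁)m(x₃)m(x₅)m(x₇) = m(x₂)m(x₄)m(x₆)m(x₈).  Elsewhere a
-- fibre of Φ has O(1) points (nonsingular zeros of a square system), and in any case it has
-- O(p) points, because x₁ determines the other xᵢ up to O(1) choices.  So it suffices that
-- W has O(p⁶) points and that O(p⁵) of them are singular.  Both follow by counting
-- nonsingular zeros again, in two and in three variables.  In three variables one needs
-- P′, Q′ and m′/m to be linearly independent: a relation αP′ + βQ′ = m′/m would make m the
-- exponential of the rational function αP + βQ, which a dimension count excludes.  All
-- non-degeneracy statements are about polynomials of bounded degree and hold modulo every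
-- large p; for small p the trivial bound p¹⁶ is enough.

module Submission where

open import Defs
open import Data.Bool using (Bool; true; false; if_then_else_)
open import Data.Empty using (⊥; ⊥-elim)
open import Data.Fin as Fin using (Fin; zero; suc; toℕ; fromℕ; fromℕ<; inject₁; combine; remQuot; finToFun; funToFin; _↑ˡ_; _↑ʳ_; #_)
open import Data.Fin.Patterns using (0F; 1F; 2F; 3F; 4F; 5F; 6F; 7F)
import Data.Fin.Properties as Finₚ
open import Data.Integer using (ℤ; +_; _+_; _*_; _-_; -_; _^_; ∣_∣; _%ℕ_; _/ℕ_)
import Data.Integer.Properties as ℤₚ
open import Data.Integer.DivMod using (a≡a%ℕn+[a/ℕn]*n; n%ℕd<d)
open import Data.Integer.Divisibility.Signed using (_∣_; divides; ∣⇒∣ᵤ; ∣ᵤ⇒∣)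
open import Data.Integer.Tactic.RingSolver using (solve-∀)
open import Data.List as List using (List; []; _∷_; length; replicate; _++_; concatMap; deduplicate)
import Data.List.Properties as Listₚ
open import Data.List.Membership.Propositional using (_∈_)
open import Data.List.Membership.Propositional.Properties using (∈-lookup; ∈-deduplicate⁺; ∈-deduplicate⁻; ∈-map⁺; ∈-map⁻)
open import Data.List.Relation.Unary.All as All using (All; []; _∷_)
import Data.List.Relation.Unary.All.Properties as Allₚ
open import Data.List.Relation.Unary.AllPairs using (AllPairs; []; _∷_)
open import Data.List.Relation.Unary.Any using (here; there)
open import Data.List.Relation.Unary.Unique.Propositional using (Unique)
import Data.List.Relation.Unary.Unique.Propositional.Properties as Uniqueₚ
import Data.List.Relation.Unary.Unique.DecPropositional.Properties as DecUniqueₚ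
open import Data.Nat as ℕ using (ℕ; zero; suc; NonZero)
import Data.Nat.Combinatorics as Comb
import Data.Nat.Divisibility as ℕᵈ
open import Data.Nat.Induction using (<-rec)
open import Data.Nat.ListAction using () renaming (sum to sumL)
open import Data.Nat.Primality using (Prime; euclidsLemma; prime⇒nonTrivial)
import Data.Nat.Properties as ℕₚ
import Data.Nat.Tactic.RingSolver as ℕS
open import Data.Product using (_×_; _,_; proj₁; proj₂; Σ; ∃-syntax)
open import Data.Product.Properties using () renaming (≡-dec to ×-≡-dec)
open import Data.Rational as ℚ using (ℚ; 0ℚ; toℚᵘ)
import Data.Rational.Properties as ℚₚ
open import Data.Rational.Unnormalised as ℚᵘ using (mkℚᵘ; *≡*)
import Data.Rational.Unnormalised.Properties as ℚᵘₚ
open import Data.Sum using (_⊎_; inj₁; inj₂)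
open import Data.Unit using (⊤; tt)
open import Data.Vec as Vec using (Vec; []; _∷_; lookup; zipWith)
import Data.Vec.Functional as V
import Data.Vec.Properties as Vecₚ
open import Function using (_∘_; _$_)
open import Relation.Binary.Definitions using (DecidableEquality; tri<; tri≈; tri>)
open import Relation.Binary.PropositionalEquality
open import Relation.Nullary using (¬_; Dec; yes; no; does)
open import Relation.Nullary.Decidable using (map′; _⊎-dec_)
open import Algebra.Properties.CommutativeSemiring.Binomial ℕₚ.+-*-commutativeSemiring using () renaming (theorem to binomialTheorem)
import Algebra.Properties.Semiring.Binomial ℕₚ.+-*-semiring as Bino
import Algebra.Properties.Semiring.Sum ℕₚ.+-*-semiring as ℕΣ
import Algebra.Properties.Semiring.Exp ℕₚ.+-*-semiring as Expo
import Algebra.Properties.Semiring.Mult ℕₚ.+-*-semiring as Mult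
open import Algebra.Properties.Semiring.Sum ℤₚ.+-*-semiring using (sum; sum-cong-≗; *-distribˡ-sum)

-- Congruences and the little theorem of Fermat

-- No algebraic geometry enters: the O(1) bounds for nonsingular zeros come from linear dependence
-- alone, so all that is used about a system is its degree along lines and the surjectivity of its
-- differential. The hypothesis over ℚ reaches 𝔽ₚ through one integer, a non-zero 3×3 determinant of
-- values of P, Q, 1 with denominators cleared; every larger p inherits the independence, and all
-- other non-degeneracy is derived modulo p from it. The delicate count is that of the singular
-- points of W. The condition on m is multiplicative while the equations in P and Q are additive,
-- which is why the logarithmic derivative of m appears next to P′ and Q′. Solving three equations
-- for three variables leaves five free ones, unless the three points are dependent in the sense of
-- the determinant `D`. One dependent triple saves a single factor p out of p⁸, where three must be
-- saved. Hence two disjoint triples are tried: if both are dependent, each has O(p²) values, and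
-- the remaining pair has O(p) by the P-equation.

module Mod (p : ℕ) where

  infix 4 _≈0
  record _≈0 (x : ℤ) : Set where
    constructor ⟨_⟩
    field dvd : + p ∣ x
  open _≈0 public

  0≈0 : + 0 ≈0
  0≈0 = ⟨ divides (+ 0) refl ⟩

  ≈0-+ : ∀ {x y} → x ≈0 → y ≈0 → x + y ≈0
  ≈0-+ ⟨ divides q refl ⟩ ⟨ divides r refl ⟩ = ⟨ divides (q + r) (sym (ℤₚ.*-distribʳ-+ (+ p) q r)) ⟩

  ≈0-* : ∀ c {x} → x ≈0 → c * x ≈0
  ≈0-* c ⟨ divides q refl ⟩ = ⟨ divides (c * q) (sym (ℤₚ.*-assoc c q (+ p))) ⟩

  ≈0-*ʳ : ∀ {x} c → x ≈0 → x * c ≈0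
  ≈0-*ʳ {x} c h = subst _≈0 (ℤₚ.*-comm c x) (≈0-* c h)

  ≈0-neg : ∀ {x} → x ≈0 → - x ≈0
  ≈0-neg {x} h = subst _≈0 (ℤₚ.-1*i≡-i x) (≈0-* (- (+ 1)) h)

  ≈0-- : ∀ {x y} → x ≈0 → y ≈0 → x - y ≈0
  ≈0-- h k = ≈0-+ h (≈0-neg k)

  ≈0? : ∀ x → Dec (x ≈0)
  ≈0? x = map′ (λ d → ⟨ ∣ᵤ⇒∣ d ⟩) (λ h → ∣⇒∣ᵤ (dvd h)) (p ℕᵈ.∣? ∣ x ∣)

  ≈0-transport : ∀ {x y} → (x - y) ≈0 → y ≈0 → x ≈0
  ≈0-transport {x} {y} h k = subst _≈0 (e x y) (≈0-+ h k)
    where e : ∀ x y → (x - y) + y ≡ x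
          e = solve-∀

  small≉0 : ∀ k → 0 ℕ.< k → k ℕ.< p → ¬ (+ k ≈0)
  small≉0 k 0<k k<p ⟨ d ⟩ = ℕᵈ.>⇒∤ {{ℕ.>-nonZero 0<k}} k<p (∣⇒∣ᵤ d)

  module _ .{{_ : NonZero p}} where
    %ℕ≡0⇒≈0 : ∀ e → e %ℕ p ≡ 0 → e ≈0
    %ℕ≡0⇒≈0 e h = ⟨ divides (e /ℕ p) (trans (a≡a%ℕn+[a/ℕn]*n e p) (trans (cong (λ r → + r + (e /ℕ p) * + p) h) (ℤₚ.+-identityˡ _))) ⟩

    %ℕ-≈ : ∀ e → (+ (e %ℕ p) - e) ≈0
    %ℕ-≈ e = ⟨ divides (- (e /ℕ p)) (trans (cong (λ u → + (e %ℕ p) - u) (a≡a%ℕn+[a/ℕn]*n e p)) (lem (+ (e %ℕ p)) (e /ℕ p) (+ p))) ⟩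
      where lem : ∀ r q p → r - (r + q * p) ≡ - q * p
            lem = solve-∀

    ≈0⇒%ℕ≡0 : ∀ e → e ≈0 → e %ℕ p ≡ 0
    ≈0⇒%ℕ≡0 e h with e %ℕ p in eq
    ... | zero = refl
    ... | suc r = ⊥-elim (small≉0 (suc r) (ℕ.s≤s ℕ.z≤n) (subst (ℕ._< p) eq (n%ℕd<d e p))
            (≈0-transport (subst (λ k → (+ k - e) ≈0) eq (%ℕ-≈ e)) h))

IsDomain : ℕ → Set
IsDomain p = ∀ {a b} → Mod._≈0 p (a * b) → Mod._≈0 p a ⊎ Mod._≈0 p b

domain-0 : IsDomain 0
domain-0 {a} {b} Mod.⟨ divides q e ⟩ with ℤₚ.i*j≡0⇒i≡0∨j≡0 a (trans e (ℤₚ.*-zeroʳ q))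
... | inj₁ refl = inj₁ Mod.⟨ divides (+ 0) refl ⟩
... | inj₂ refl = inj₂ Mod.⟨ divides (+ 0) refl ⟩

domain-prime : ∀ {p} → Prime p → IsDomain p
domain-prime {p} pr {a} {b} Mod.⟨ d ⟩ with euclidsLemma ∣ a ∣ ∣ b ∣ pr (subst (p ℕᵈ.∣_) (ℤₚ.abs-* a b) (∣⇒∣ᵤ d))
... | inj₁ h = inj₁ Mod.⟨ ∣ᵤ⇒∣ h ⟩
... | inj₂ h = inj₂ Mod.⟨ ∣ᵤ⇒∣ h ⟩

module Fermat {p : ℕ} (pr : Prime p) where
  open Mod p

  1<p : 1 ℕ.< p
  1<p = ℕ.nonTrivial⇒n>1 p {{prime⇒nonTrivial pr}}

  [1+n]C[1+k] : ∀ n k → suc k ℕ.* (suc n Comb.C suc k) ≡ suc n ℕ.* (n Comb.C k)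
  [1+n]C[1+k] n zero = trans (ℕₚ.*-identityˡ _) (trans (Comb.nC1≡n (suc n)) (trans (sym (ℕₚ.*-identityʳ _)) (cong (suc n ℕ.*_) refl)))
  [1+n]C[1+k] zero (suc k) = trans (cong (suc (suc k) ℕ.*_) (Comb.k>n⇒nCk≡0 {1} {suc (suc k)} (ℕ.s≤s (ℕ.s≤s ℕ.z≤n)))) (trans (ℕₚ.*-zeroʳ (suc (suc k))) (sym (trans (ℕₚ.*-identityˡ _) (Comb.k>n⇒nCk≡0 {0} {suc k} (ℕ.s≤s ℕ.z≤n)))))
  [1+n]C[1+k] (suc n) (suc k) = begin
      suc (suc k) ℕ.* (suc (suc n) Comb.C suc (suc k))
    ≡⟨ cong (suc (suc k) ℕ.*_) (sym (Comb.nCk+nC[k+1]≡[n+1]C[k+1] (suc n) (suc k))) ⟩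
      suc (suc k) ℕ.* (x ℕ.+ y)
    ≡⟨ ℕₚ.*-distribˡ-+ (suc (suc k)) x y ⟩
      (x ℕ.+ suc k ℕ.* x) ℕ.+ suc (suc k) ℕ.* y
    ≡⟨ cong₂ (λ u v → (x ℕ.+ u) ℕ.+ v) ([1+n]C[1+k] n k) ([1+n]C[1+k] n (suc k)) ⟩
      (x ℕ.+ suc n ℕ.* u) ℕ.+ suc n ℕ.* v
    ≡⟨ trans (ℕₚ.+-assoc x _ _) (cong (x ℕ.+_) (sym (ℕₚ.*-distribˡ-+ (suc n) u v))) ⟩
      x ℕ.+ suc n ℕ.* (u ℕ.+ v)
    ≡⟨ cong (λ w → x ℕ.+ suc n ℕ.* w) (Comb.nCk+nC[k+1]≡[n+1]C[k+1] n k) ⟩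
      suc (suc n) ℕ.* x
    ∎
    where
    open ≡-Reasoning
    x = suc n Comb.C suc k
    y = suc n Comb.C suc (suc k)
    u = n Comb.C k
    v = n Comb.C suc k

  -- By absorption q + 1 divides (k + 1) times this binomial coefficient, and the prime q + 1 cannot
  -- divide the smaller number k + 1.
  p∣pCk : ∀ q k → suc q ≡ p → k ℕ.< q → p ℕᵈ.∣ (suc q Comb.C suc k)
  p∣pCk q k refl k<q with euclidsLemma (suc k) (suc q Comb.C suc k) pr
       (ℕᵈ.divides (q Comb.C k) (trans ([1+n]C[1+k] q k) (ℕₚ.*-comm (suc q) _)))
  ... | inj₁ d = ⊥-elim (ℕᵈ.>⇒∤ (ℕ.s≤s k<q) d)
  ... | inj₂ d = d

  ×≡* : ∀ m x → m Mult.× x ≡ m ℕ.* x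
  ×≡* zero x = refl
  ×≡* (suc m) x = cong (x ℕ.+_) (×≡* m x)

  ^≡^ : ∀ x m → x Expo.^ m ≡ x ℕ.^ m
  ^≡^ x zero = refl
  ^≡^ x (suc m) = cong (x ℕ.*_) (^≡^ x m)

  ∣-sum : ∀ {n} (t : Fin n → ℕ) → (∀ i → p ℕᵈ.∣ t i) → p ℕᵈ.∣ ℕΣ.sum t
  ∣-sum {zero} t h = p ℕᵈ.∣0
  ∣-sum {suc n} t h = ℕᵈ.∣m∣n⇒∣m+n (h zero) (∣-sum (t ∘ suc) (h ∘ suc))

  freshman : ∀ a → ∃[ m ] (p ℕᵈ.∣ m × (a ℕ.+ 1) ℕ.^ p ≡ 1 ℕ.+ (m ℕ.+ a ℕ.^ p))
  freshman a = go p refl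
    where
    go : ∀ q → q ≡ p → ∃[ m ] (p ℕᵈ.∣ m × (a ℕ.+ 1) ℕ.^ q ≡ 1 ℕ.+ (m ℕ.+ a ℕ.^ q))
    go zero e = ⊥-elim (ℕₚ.<⇒≢ (ℕₚ.<-trans (ℕ.s≤s ℕ.z≤n) 1<p) e)
    go (suc q) e = m , ∣-sum _ mid , (begin
        (a ℕ.+ 1) ℕ.^ suc q
      ≡⟨ trans (sym (^≡^ (a ℕ.+ 1) (suc q))) (binomialTheorem (suc q) a 1) ⟩
        t zero ℕ.+ ℕΣ.sum (t ∘ suc)
      ≡⟨ cong₂ ℕ._+_ t₀ (trans (ℕΣ.sum-init-last (t ∘ suc)) (cong (m ℕ.+_) tₗ)) ⟩
        1 ℕ.+ (m ℕ.+ a ℕ.^ suc q)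
      ∎)
      where
      open ≡-Reasoning
      t = Bino.binomialTerm a 1 (suc q)
      m = ℕΣ.sum (λ (i : Fin q) → t (suc (inject₁ i)))
      1^ : ∀ k → 1 Expo.^ k ≡ 1
      1^ k = trans (^≡^ 1 k) (ℕₚ.^-zeroˡ k)
      t₀ : t zero ≡ 1
      t₀ = trans (×≡* (suc q Comb.C 0) _) (cong₂ ℕ._*_ {x = suc q Comb.C 0} {y = 1} refl (trans (ℕₚ.*-identityˡ _) (1^ (suc q))))
      tₗ : t (suc (fromℕ q)) ≡ a ℕ.^ suc q
      tₗ = begin
          t (suc (fromℕ q))
        ≡⟨ ×≡* (suc q Comb.C toℕ (suc (fromℕ q))) _ ⟩
          (suc q Comb.C toℕ (suc (fromℕ q))) ℕ.* (a Expo.^ toℕ (suc (fromℕ q)) ℕ.* 1 Expo.^ (suc q ℕ.∸ toℕ (suc (fromℕ q))))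
        ≡⟨ cong (λ k → (suc q Comb.C suc k) ℕ.* (a Expo.^ suc k ℕ.* 1 Expo.^ (q ℕ.∸ k))) (Finₚ.toℕ-fromℕ q) ⟩
          (suc q Comb.C suc q) ℕ.* (a Expo.^ suc q ℕ.* 1 Expo.^ (q ℕ.∸ q))
        ≡⟨ cong₂ ℕ._*_ (Comb.nCn≡1 (suc q)) (cong₂ ℕ._*_ (^≡^ a (suc q)) (1^ (q ℕ.∸ q))) ⟩
          1 ℕ.* (a ℕ.^ suc q ℕ.* 1)
        ≡⟨ trans (ℕₚ.*-identityˡ _) (ℕₚ.*-identityʳ _) ⟩
          a ℕ.^ suc q
        ∎
      mid : ∀ i → p ℕᵈ.∣ t (suc (inject₁ i))
      mid i = subst (p ℕᵈ.∣_) (sym (×≡* (suc q Comb.C suc (toℕ (inject₁ i))) _))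
        (ℕᵈ.∣m⇒∣m*n _ (p∣pCk q (toℕ (inject₁ i)) e (subst (ℕ._< q) (sym (Finₚ.toℕ-inject₁ i)) (Finₚ.toℕ<n i))))

  fermatℕ : ∀ a → ((+ a) ^ p - + a) ≈0
  fermatℕ zero = subst _≈0 (sym (0^ p (ℕₚ.<-trans (ℕ.s≤s ℕ.z≤n) 1<p))) 0≈0
    where
    0^ : ∀ q → 0 ℕ.< q → (+ 0) ^ q - + 0 ≡ + 0
    0^ (suc q) _ = refl
  fermatℕ (suc a) with freshman a
  ... | m , d , e = subst _≈0 eq (≈0-+ ⟨ ∣ᵤ⇒∣ {i = + m} d ⟩ (fermatℕ a))
    where
    +^ : ∀ x k → + (x ℕ.^ k) ≡ (+ x) ^ k
    +^ x zero = refl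
    +^ x (suc k) = trans (ℤₚ.pos-* x (x ℕ.^ k)) (cong (+ x *_) (+^ x k))
    lem : ∀ m y a → m + (y - a) ≡ (+ 1 + (m + y)) - (+ 1 + a)
    lem = solve-∀
    eq : + m + ((+ a) ^ p - + a) ≡ (+ suc a) ^ p - + suc a
    eq = trans (lem (+ m) ((+ a) ^ p) (+ a)) (cong (_- + suc a)
          (sym (trans (sym (+^ (suc a) p)) (trans (cong (λ b → + (b ℕ.^ p)) (ℕₚ.+-comm 1 a)) (trans (cong +_ e)
            (cong (λ y → + 1 + (+ m + y)) (+^ a p)))))))

  ≈0-^ : ∀ {x y} k → (x - y) ≈0 → (x ^ k - y ^ k) ≈0
  ≈0-^ zero h = 0≈0
  ≈0-^ {x} {y} (suc k) h = subst _≈0 (lem x y (x ^ k) (y ^ k)) (≈0-+ (≈0-* (x ^ k) h) (≈0-* y (≈0-^ k h)))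
    where lem : ∀ x y u v → u * (x - y) + y * (u - v) ≡ x * u - y * v
          lem = solve-∀

  -- Cancel one factor a in aᵖ ≡ a. As `fermatℕ` concerns natural numbers, a is first compared with
  -- its residue. This is what makes the exponent p - 2 in `val` an inversion.
  inverse : .{{_ : NonZero p}} → ∀ {a} → ¬ a ≈0 → (a * a ^ (p ℕ.∸ 2) - + 1) ≈0
  inverse {a} a≉0 = go (domain-prime pr {a} {a * a ^ q - + 1} (subst _≈0 (lem a (a ^ q)) (subst (λ k → (a ^ k - a) ≈0) p≡ fermat)))
    where
    q = p ℕ.∸ 2
    p≡ : p ≡ suc (suc q)
    p≡ = sym (ℕₚ.m+[n∸m]≡n 1<p)
    lem : ∀ a y → a * (a * y) - a ≡ a * (a * y - + 1)
    lem = solve-∀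
    r = + (a %ℕ p)
    lem₂ : ∀ r R a A → (R - r) - (R - A) + (r - a) ≡ A - a
    lem₂ = solve-∀
    fermat : (a ^ p - a) ≈0
    fermat = subst _≈0 (lem₂ r (r ^ p) a (a ^ p)) (≈0-+ (≈0-- (fermatℕ (a %ℕ p)) (≈0-^ p (%ℕ-≈ a))) (%ℕ-≈ a))
    go : a ≈0 ⊎ (a * a ^ q - + 1) ≈0 → (a * a ^ q - + 1) ≈0
    go (inj₁ h) = ⊥-elim (a≉0 h)
    go (inj₂ h) = h

-- Cardinality bounds

-- Quantifying over repetition-free lists bounds a set that need be neither enumerated nor decided;
-- `NonsingularZero`, for instance, asks for solutions of a linear system for every right-hand side.
record AtMost {A : Set} (S : A → Set) (m : ℕ) : Set where
  constructor atMost
  field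
    bounded : ∀ xs → Unique xs → All S xs → length xs ℕ.≤ m
open AtMost public

atMost-⊆ : ∀ {A : Set} {S T : A → Set} {m} → (∀ {x} → S x → T x) → AtMost T m → AtMost S m
atMost-⊆ h (atMost b) = atMost λ xs u s → b xs u (All.map h s)

atMost-≤ : ∀ {A : Set} {S : A → Set} {k m} → k ℕ.≤ m → AtMost S k → AtMost S m
atMost-≤ l (atMost b) = atMost λ xs u s → ℕₚ.≤-trans (b xs u s) l

atMost-∅ : ∀ {A : Set} {S : A → Set} → (∀ {x} → ¬ S x) → AtMost S 0
atMost-∅ h = atMost λ { [] _ _ → ℕ.z≤n ; (x ∷ xs) _ (s ∷ _) → ⊥-elim (h s) }

-- The pairwise relation is left arbitrary because two of them occur: inequality of elements in
-- unions and fibres, and incongruence modulo p in `zero-product`.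
record Split {A : Set} (_#_ : A → A → Set) (P Q : A → Set) (xs : List A) : Set₁ where
  field
    ys zs : List A
    lengths : length xs ≡ length ys ℕ.+ length zs
    allˡ : All P ys
    allʳ : All Q zs
    restrictˡ : ∀ {R : A → Set} → All R xs → All R ys
    restrictʳ : ∀ {R : A → Set} → All R xs → All R zs
    pairsˡ : AllPairs _#_ ys
    pairsʳ : AllPairs _#_ zs
open Split

split : ∀ {A : Set} {_#_ : A → A → Set} {P Q : A → Set} xs → AllPairs _#_ xs → All (λ x → P x ⊎ Q x) xs → Split _#_ P Q xs
split [] u [] = record { ys = [] ; zs = [] ; lengths = refl ; allˡ = [] ; allʳ = [] ; restrictˡ = λ a → a ; restrictʳ = λ a → a ; pairsˡ = [] ; pairsʳ = [] }
split (x ∷ xs) (n ∷ u) (inj₁ h ∷ hs) = let r = split xs u hs in record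
  { ys = x ∷ ys r ; zs = zs r ; lengths = cong suc (lengths r) ; allˡ = h ∷ allˡ r ; allʳ = allʳ r
  ; restrictˡ = λ { (a ∷ as) → a ∷ restrictˡ r as } ; restrictʳ = λ { (a ∷ as) → restrictʳ r as }
  ; pairsˡ = restrictˡ r n ∷ pairsˡ r ; pairsʳ = pairsʳ r }
split (x ∷ xs) (n ∷ u) (inj₂ h ∷ hs) = let r = split xs u hs in record
  { ys = ys r ; zs = x ∷ zs r ; lengths = trans (cong suc (lengths r)) (sym (ℕₚ.+-suc _ _)) ; allˡ = allˡ r ; allʳ = h ∷ allʳ r
  ; restrictʳ = λ { (a ∷ as) → a ∷ restrictʳ r as } ; restrictˡ = λ { (a ∷ as) → restrictˡ r as }
  ; pairsˡ = pairsˡ r ; pairsʳ = restrictʳ r n ∷ pairsʳ r }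

atMost-∪ : ∀ {A : Set} {S P Q : A → Set} {k m} → (∀ {x} → S x → P x ⊎ Q x) → AtMost P k → AtMost Q m → AtMost S (k ℕ.+ m)
atMost-∪ h (atMost a) (atMost b) = atMost λ xs u s → let r = split xs u (All.map h s) in
  subst (ℕ._≤ _) (sym (lengths r)) (ℕₚ.+-mono-≤ (a (ys r) (pairsˡ r) (allˡ r)) (b (zs r) (pairsʳ r) (allʳ r)))

-- The distinct images of a list number at most k by the bound on T; going through them one by one,
-- each accounts for at most c members of the list.
atMost-fibre : ∀ {A B : Set} {S : A → Set} {T : B → Set} {k c} (_≟_ : DecidableEquality B) (g : A → B) → (∀ {x} → S x → T (g x)) → AtMost T k →
               (∀ b → AtMost (λ x → S x × g x ≡ b) c) → AtMost S (k ℕ.* c)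
atMost-fibre {A} {B} {S} {T} {k} {c} _≟_ g h (atMost t) fib = atMost λ xs u s →
  ℕₚ.≤-trans (cover (deduplicate _≟_ (List.map g xs)) xs u
     (All.tabulate (λ x∈ → All.lookup s x∈ , ∈-deduplicate⁺ _≟_ (∈-map⁺ g x∈))))
   (ℕₚ.*-monoˡ-≤ c (t _ (DecUniqueₚ.deduplicate-! _≟_ (List.map g xs))
     (All.tabulate (λ {b} b∈ → let (x , x∈ , e) = ∈-map⁻ g (∈-deduplicate⁻ _≟_ (List.map g xs) b∈) in subst T (sym e) (h (All.lookup s x∈))))))
  where
  cover : ∀ bs xs → Unique xs → All (λ x → S x × g x ∈ bs) xs → length xs ℕ.≤ length bs ℕ.* c
  cover [] [] u s = ℕ.z≤n
  cover [] (x ∷ xs) u ((_ , ()) ∷ _)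
  cover (b ∷ bs) xs u s = subst (ℕ._≤ c ℕ.+ length bs ℕ.* c) (sym (lengths r))
      (ℕₚ.+-mono-≤ (bounded (fib b) (ys r) (pairsˡ r) (allˡ r)) (cover bs (zs r) (pairsʳ r) (allʳ r)))
    where
    decide : ∀ {x} → S x × g x ∈ b ∷ bs → (S x × g x ≡ b) ⊎ (S x × g x ∈ bs)
    decide (s , here e) = inj₁ (s , e)
    decide (s , there e) = inj₂ (s , e)
    r = split xs u (All.map decide s)

atMost-one : ∀ {A : Set} {S : A → Set} → (∀ {x y} → S x → S y → x ≡ y) → AtMost S 1
atMost-one h = atMost λ { [] _ _ → ℕ.z≤n ; (x ∷ []) _ _ → ℕ.s≤s ℕ.z≤n ; (x ∷ y ∷ xs) ((n ∷ _) ∷ _) (s ∷ s′ ∷ _) → ⊥-elim (n (h s s′)) }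

atMost-injection : ∀ {A B : Set} {S : A → Set} {T : B → Set} {k} (_≟_ : DecidableEquality B) (g : A → B) → (∀ {x y} → S x → S y → g x ≡ g y → x ≡ y) → (∀ {x} → S x → T (g x)) → AtMost T k → AtMost S k
atMost-injection {k = k} _≟_ g inj h t = atMost-≤ (ℕₚ.≤-reflexive (ℕₚ.*-identityʳ k))
  (atMost-fibre _≟_ g h t (λ b → atMost-one (λ { (s , e) (s′ , e′) → inj s s′ (trans e (sym e′)) })))

by-cases : ∀ {X R : Set} → Dec X → (X → R) → (¬ X → R) → R
by-cases (yes x) f g = f x
by-cases (no n) f g = g n

Full : ∀ {A : Set} → A → Set
Full _ = ⊤

lookup-injective : ∀ {A : Set} {xs : List A} → Unique xs → ∀ i j → List.lookup xs i ≡ List.lookup xs j → i ≡ j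
lookup-injective (n ∷ u) zero zero e = refl
lookup-injective {xs = x ∷ xs} (n ∷ u) zero (suc j) e = ⊥-elim (All.lookup n (∈-lookup j) e)
lookup-injective {xs = x ∷ xs} (n ∷ u) (suc i) zero e = ⊥-elim (All.lookup n (∈-lookup i) (sym e))
lookup-injective (n ∷ u) (suc i) (suc j) e = cong suc (lookup-injective u i j e)

atMost-Fin : ∀ n → AtMost {Fin n} Full n
atMost-Fin n = atMost λ xs u _ → Finₚ.injective⇒≤ {f = List.lookup xs} (λ {i} {j} → lookup-injective u i j)

atMost-cons : ∀ {A : Set} {n k c} {S : Vec A (suc n) → Set} {T : A → Set} → DecidableEquality A → (∀ {a v} → S (a ∷ v) → T a) → AtMost T k →
              (∀ a → AtMost (λ v → S (a ∷ v)) c) → AtMost S (k ℕ.* c)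
atMost-cons {S = S} _≟_ h t fib = atMost-fibre _≟_ Vec.head (λ { {a ∷ v} s → h s }) t
  tail
  where
  tail : ∀ a → AtMost (λ v → S v × Vec.head v ≡ a) _
  tail a = atMost λ xs u s → subst (ℕ._≤ _) (Listₚ.length-map Vec.tail xs) (bounded (fib a) (List.map Vec.tail xs) (unique a xs u s) (allS a xs s))
    where
    allS : ∀ a xs → All (λ v → S v × Vec.head v ≡ a) xs → All (λ v → S (a ∷ v)) (List.map Vec.tail xs)
    allS a [] [] = []
    allS a ((_ ∷ v) ∷ xs) ((s , refl) ∷ ss) = s ∷ allS a xs ss
    unique : ∀ a xs → Unique xs → All (λ v → S v × Vec.head v ≡ a) xs → Unique (List.map Vec.tail xs)
    unique a [] [] [] = []
    unique a ((_ ∷ v) ∷ xs) (n ∷ u) ((_ , refl) ∷ ss) = Allₚ.map⁺ (All.zipWith (λ { {_ ∷ w} (ne , (_ , refl)) refl → ne refl }) (n , ss)) ∷ unique a xs u ss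

atMost-∷ : ∀ {n k c p} {S : Vec (Fin p) (suc n) → Set} {T : Fin p → Set} → (∀ {a v} → S (a ∷ v) → T a) → AtMost T k →
           (∀ a → AtMost (λ v → S (a ∷ v)) c) → AtMost S (k ℕ.* c)
atMost-∷ {S = S} = atMost-cons {S = S} Fin._≟_

atMost-[] : ∀ {A : Set} {S : Vec A 0 → Set} → AtMost S 1
atMost-[] = atMost-one (λ { {[]} {[]} _ _ → refl })

atMost-Vec : ∀ p n → AtMost {Vec (Fin p) n} Full (p ℕ.^ n)
atMost-Vec p zero = atMost-[]
atMost-Vec p (suc n) = atMost-∷ {T = Full} (λ _ → tt) (atMost-Fin p) (λ a → atMost-Vec p n)

-- From the Boolean count to a list of distinct points

toVector : ∀ {A : Set} {n} → Vec A n → V.Vector A n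
toVector [] = V.[]
toVector (a ∷ v) = a V.∷ toVector v

true-points : ∀ n k → (V.Vector (Fin n) k → Bool) → List (Vec (Fin n) k)
true-points n zero f = if f V.[] then [] ∷ [] else []
true-points n (suc k) f = concatMap (λ i → List.map (i ∷_) (true-points n k (λ v → f (i V.∷ v)))) (List.allFin n)

length-true-points : ∀ n k f → count n k f ≡ length (true-points n k f)
length-true-points n zero f with f V.[]
... | true = refl
... | false = refl
length-true-points n (suc k) f = go (List.allFin n)
  where
  go : ∀ is → sumL (List.map (λ i → count n k (λ v → f (i V.∷ v))) is) ≡ length (concatMap (λ i → List.map (i ∷_) (true-points n k (λ v → f (i V.∷ v)))) is)
  go [] = refl
  go (i ∷ is) = trans (cong₂ ℕ._+_ (trans (length-true-points n k (λ v → f (i V.∷ v))) (sym (Listₚ.length-map (Vec._∷_ i) (true-points n k (λ v → f (i V.∷ v)))))) (go is))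
    (sym (Listₚ.length-++ (List.map (i ∷_) (true-points n k (λ v → f (i V.∷ v))))))

true-points-true : ∀ n k f → All (λ v → f (toVector v) ≡ true) (true-points n k f)
true-points-true n zero f with f V.[] in e
... | true = e ∷ []
... | false = []
true-points-true n (suc k) f = Allₚ.concat⁺ (Allₚ.map⁺ (All.universal (λ i → Allₚ.map⁺ (true-points-true n k (λ v → f (i V.∷ v)))) (List.allFin n)))

true-points-unique : ∀ n k f → Unique (true-points n k f)
true-points-unique n zero f with f V.[]
... | true = [] ∷ []
... | false = []
true-points-unique n (suc k) f = go (List.allFin n) (Uniqueₚ.allFin⁺ n)
  where
  fam : Fin n → List (Vec (Fin n) (suc k))
  fam i = List.map (i ∷_) (true-points n k (λ v → f (i V.∷ v)))
  heads : ∀ i → All (λ v → Vec.head v ≡ i) (fam i)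
  heads i = Allₚ.map⁺ (All.universal (λ _ → refl) _)
  others : ∀ i is → All (i ≢_) is → All (λ v → Vec.head v ≢ i) (concatMap fam is)
  others i is n = Allₚ.concat⁺ (Allₚ.map⁺ (All.map (λ {j} i≢j → All.map (λ e e′ → i≢j (trans (sym e′) e)) (heads j)) n))
  go : ∀ is → Unique is → Unique (concatMap fam is)
  go [] [] = []
  go (i ∷ is) (n ∷ u) = Uniqueₚ.++⁺ (Uniqueₚ.map⁺ Vecₚ.∷-injectiveʳ (true-points-unique _ k _)) (go is u)
    (λ { (x , y) → All.lookup (others i is n) y (All.lookup (heads i) x) })

count-≤ : ∀ {n k m} f → AtMost (λ (v : Vec (Fin n) k) → f (toVector v) ≡ true) m → count n k f ℕ.≤ m
count-≤ {n} {k} f (atMost b) = subst (ℕ._≤ _) (sym (length-true-points n k f)) (b _ (true-points-unique n k f) (true-points-true n k f))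

-- Polynomials and jets

infixl 6 _⊕_
infixl 7 _⊗_

_⊕_ : ZPoly → ZPoly → ZPoly
[] ⊕ g = g
(a ∷ f) ⊕ [] = a ∷ f
(a ∷ f) ⊕ (b ∷ g) = (a + b) ∷ (f ⊕ g)

scale : ℤ → ZPoly → ZPoly
scale c = List.map (c *_)

_⊗_ : ZPoly → ZPoly → ZPoly
[] ⊗ g = []
(a ∷ f) ⊗ g = scale a g ⊕ (+ 0 ∷ (f ⊗ g))

deriv : ZPoly → ZPoly
deriv [] = []
deriv (c ∷ f) = f ⊕ (+ 0 ∷ deriv f)

eval-⊕ : ∀ f g x → evalℤ (f ⊕ g) x ≡ evalℤ f x + evalℤ g x
eval-⊕ [] g x = sym (ℤₚ.+-identityˡ _)
eval-⊕ (a ∷ f) [] x = sym (ℤₚ.+-identityʳ _)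
eval-⊕ (a ∷ f) (b ∷ g) x rewrite eval-⊕ f g x = lem a b x (evalℤ f x) (evalℤ g x)
  where lem : ∀ a b x u v → (a + b) + x * (u + v) ≡ (a + x * u) + (b + x * v)
        lem = solve-∀

eval-scale : ∀ c f x → evalℤ (scale c f) x ≡ c * evalℤ f x
eval-scale c [] x = sym (ℤₚ.*-zeroʳ c)
eval-scale c (a ∷ f) x rewrite eval-scale c f x = lem c a x (evalℤ f x)
  where lem : ∀ c a x u → c * a + x * (c * u) ≡ c * (a + x * u)
        lem = solve-∀

eval-⊗ : ∀ f g x → evalℤ (f ⊗ g) x ≡ evalℤ f x * evalℤ g x
eval-⊗ [] g x = sym (ℤₚ.*-zeroˡ (evalℤ g x))
eval-⊗ (a ∷ f) g x rewrite eval-⊕ (scale a g) (+ 0 ∷ (f ⊗ g)) x | eval-scale a g x | eval-⊗ f g x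
  = lem a x (evalℤ f x) (evalℤ g x)
  where lem : ∀ a x u v → a * v + (+ 0 + x * (u * v)) ≡ (a + x * u) * v
        lem = solve-∀

length-⊕ : ∀ f g {d} → length f ℕ.≤ d → length g ℕ.≤ d → length (f ⊕ g) ℕ.≤ d
length-⊕ [] g h k = k
length-⊕ (a ∷ f) [] h k = h
length-⊕ (a ∷ f) (b ∷ g) (ℕ.s≤s h) (ℕ.s≤s k) = ℕ.s≤s (length-⊕ f g h k)

length-scale : ∀ c f {d} → length f ℕ.≤ d → length (scale c f) ℕ.≤ d
length-scale c [] h = h
length-scale c (a ∷ f) (ℕ.s≤s h) = ℕ.s≤s (length-scale c f h)

length-⊗ : ∀ f g {d e} → length f ℕ.≤ d → length g ℕ.≤ e → length (f ⊗ g) ℕ.≤ d ℕ.+ e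
length-⊗ [] g h k = ℕ.z≤n
length-⊗ (a ∷ f) g {suc d} {e} (ℕ.s≤s h) k =
  length-⊕ (scale a g) _ (length-scale a g (ℕₚ.≤-trans k (ℕₚ.m≤n+m e (suc d)))) (ℕ.s≤s (length-⊗ f g h k))

-- A jet: along every line of the family the function is a polynomial with value
-- a and first derivative b at ε = 0, of degree bounded uniformly in the index.

record Jet {I : Set} (u : I → ℤ → ℤ) (a b : I → ℤ) : Set where
  constructor _,_
  field
    bound : ℕ
    expand : ∀ i → Σ ZPoly λ cs → length cs ℕ.≤ bound × (∀ ε → u i ε ≡ evalℤ (a i ∷ b i ∷ cs) ε)
open Jet public

module _ {I : Set} where

  jet-const : (k : I → ℤ) → Jet (λ i _ → k i) k (λ _ → + 0)
  jet-const k = 0 , λ i → [] , ℕ.z≤n , λ ε → lem (k i) ε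
    where lem : ∀ k e → k ≡ k + e * (+ 0 + e * + 0)
          lem = solve-∀

  jet-line : (a b : I → ℤ) → Jet (λ i ε → a i + ε * b i) a b
  jet-line a b = 0 , λ i → [] , ℕ.z≤n , λ ε → lem (a i) (b i) ε
    where lem : ∀ a b e → a + e * b ≡ a + e * (b + e * + 0)
          lem = solve-∀

  jet-cong : ∀ {u u′ : I → ℤ → ℤ} {a a′ b b′ : I → ℤ} → (∀ i ε → u i ε ≡ u′ i ε) → (∀ i → a i ≡ a′ i) → (∀ i → b i ≡ b′ i) →
             Jet u a b → Jet u′ a′ b′
  jet-cong eu ea eb (d , J) = d , λ i → let (cs , l , e) = J i in cs , l , λ ε →
    trans (sym (eu i ε)) (trans (e ε) (cong₂ (λ x y → x + ε * (y + ε * evalℤ cs ε)) (ea i) (eb i)))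

  jet-+ : ∀ {u v : I → ℤ → ℤ} {a b a′ b′} → Jet u a b → Jet v a′ b′ →
          Jet (λ i ε → u i ε + v i ε) (λ i → a i + a′ i) (λ i → b i + b′ i)
  jet-+ {u} {v} {a} {b} {a′} {b′} (d , J) (d′ , J′) = d ℕ.+ d′ , λ i → let (cs , l , e) = J i ; (cs′ , l′ , e′) = J′ i in
    cs ⊕ cs′ , length-⊕ cs cs′ (ℕₚ.≤-trans l (ℕₚ.m≤m+n d d′)) (ℕₚ.≤-trans l′ (ℕₚ.m≤n+m d′ d)) ,
    λ ε → trans (cong₂ _+_ (e ε) (e′ ε)) (sym (eval-⊕ (a i ∷ b i ∷ cs) (a′ i ∷ b′ i ∷ cs′) ε))

  jet-* : ∀ {u v : I → ℤ → ℤ} {a b a′ b′} → Jet u a b → Jet v a′ b′ →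
          Jet (λ i ε → u i ε * v i ε) (λ i → a i * a′ i) (λ i → a i * b′ i + b i * a′ i)
  jet-* {u} {v} {a} {b} {a′} {b′} (d , J) (d′ , J′) = suc (suc d) ℕ.+ suc (suc d′) , λ i →
    let (cs , l , e) = J i ; (cs′ , l′ , e′) = J′ i
        q = (a i ∷ b i ∷ cs) ⊗ (a′ i ∷ b′ i ∷ cs′)
    -- Up to adding 0, the first two coefficients of the product are the value and the derivative
    -- given by the Leibniz rule; the rest is the higher-order tail.
    in List.drop 2 q
     , ℕₚ.≤-trans (ℕₚ.≤-trans (ℕₚ.n≤1+n _) (ℕₚ.n≤1+n _)) (length-⊗ (a i ∷ b i ∷ cs) (a′ i ∷ b′ i ∷ cs′) (ℕ.s≤s (ℕ.s≤s l)) (ℕ.s≤s (ℕ.s≤s l′)))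
     , λ ε → trans (cong₂ _*_ (e ε) (e′ ε)) (trans (sym (eval-⊗ (a i ∷ b i ∷ cs) (a′ i ∷ b′ i ∷ cs′) ε))
         (cong₂ (λ x y → x + ε * (y + ε * evalℤ (List.drop 2 q) ε)) (ℤₚ.+-identityʳ (a i * a′ i)) (cong (λ w → a i * b′ i + w) (ℤₚ.+-identityʳ (b i * a′ i)))))

  jet-neg : ∀ {u : I → ℤ → ℤ} {a b} → Jet u a b → Jet (λ i ε → - u i ε) (λ i → - a i) (λ i → - b i)
  jet-neg {u} {a} {b} J = jet-cong (λ i ε → ℤₚ.-1*i≡-i (u i ε)) (λ i → ℤₚ.-1*i≡-i (a i)) (λ i → lem (a i) (b i))
    (jet-* (jet-const (λ _ → - (+ 1))) J)
    where lem : ∀ a b → - (+ 1) * b + + 0 * a ≡ - b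
          lem = solve-∀

  jet-- : ∀ {u v : I → ℤ → ℤ} {a b a′ b′} → Jet u a b → Jet v a′ b′ →
          Jet (λ i ε → u i ε - v i ε) (λ i → a i - a′ i) (λ i → b i - b′ i)
  jet-- J J′ = jet-+ J (jet-neg J′)

  jet-eval : ∀ f {u : I → ℤ → ℤ} {a b} → Jet u a b →
             Jet (λ i ε → evalℤ f (u i ε)) (λ i → evalℤ f (a i)) (λ i → b i * evalℤ (deriv f) (a i))
  jet-eval [] {u} {a} {b} J = jet-cong (λ _ _ → refl) (λ _ → refl) (λ i → sym (ℤₚ.*-zeroʳ (b i))) (jet-const (λ _ → + 0))
  jet-eval (c ∷ f) {u} {a} {b} J = jet-cong (λ _ _ → refl) (λ _ → refl)
    (λ i → trans (lem (a i) (b i) (evalℤ (deriv f) (a i)) (evalℤ f (a i))) (cong (b i *_) (sym (eval-⊕ f (+ 0 ∷ deriv f) (a i)))))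
    (jet-+ (jet-const (λ _ → c)) (jet-* J (jet-eval f J)))
    where lem : ∀ a b v u → + 0 + (a * (b * v) + b * u) ≡ b * (u + (+ 0 + a * v))
          lem = solve-∀

-- Univariate polynomials modulo p and their roots

Poly : ℕ → (ℤ → ℤ) → Set
Poly d u = Σ ZPoly λ cs → length cs ℕ.≤ d × (∀ x → u x ≡ evalℤ cs x)

poly-cong : ∀ {d u v} → (∀ x → u x ≡ v x) → Poly d u → Poly d v
poly-cong h (cs , l , e) = cs , l , λ x → trans (sym (h x)) (e x)

poly-≤ : ∀ {d e u} → d ℕ.≤ e → Poly d u → Poly e u
poly-≤ d≤e (cs , l , e) = cs , ℕₚ.≤-trans l d≤e , e

poly-const : ∀ k → Poly 1 (λ _ → k)
poly-const k = k ∷ [] , ℕₚ.≤-refl , λ x → lem k x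
  where lem : ∀ k x → k ≡ k + x * + 0
        lem = solve-∀

poly-+ : ∀ {d u v} → Poly d u → Poly d v → Poly d (λ x → u x + v x)
poly-+ (f , l , e) (g , l′ , e′) = f ⊕ g , length-⊕ f g l l′ , λ x → trans (cong₂ _+_ (e x) (e′ x)) (sym (eval-⊕ f g x))

poly-* : ∀ {d d′ u v} → Poly d u → Poly d′ v → Poly (d ℕ.+ d′) (λ x → u x * v x)
poly-* (f , l , e) (g , l′ , e′) = f ⊗ g , length-⊗ f g l l′ , λ x → trans (cong₂ _*_ (e x) (e′ x)) (sym (eval-⊗ f g x))

poly-scale : ∀ {d u} c → Poly d u → Poly d (λ x → c * u x)
poly-scale c (f , l , e) = scale c f , length-scale c f l , λ x → trans (cong (c *_) (e x)) (sym (eval-scale c f x))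

poly-^ : ∀ {d u} k → Poly d u → Poly (k ℕ.* d ℕ.+ 1) (λ x → u x ^ k)
poly-^ zero P = poly-const (+ 1)
poly-^ {d} (suc k) P = poly-≤ (ℕₚ.≤-reflexive (sym (ℕₚ.+-assoc d (k ℕ.* d) 1))) (poly-* P (poly-^ k P))

poly-sum : ∀ {d n} {u : Fin n → ℤ → ℤ} → (∀ i → Poly d (u i)) → Poly d (λ x → sum (λ i → u i x))
poly-sum {n = zero} P = [] , ℕ.z≤n , λ _ → refl
poly-sum {n = suc n} P = poly-+ (P zero) (poly-sum (P ∘ suc))

module Roots (p : ℕ) (dom : IsDomain p) where
  open Mod p

  -- Synthetic division: `quot cs r` is the quotient of `c ∷ cs` by x - r. It does not depend on the
  -- constant term c, which only affects the remainder.
  quot : ZPoly → ℤ → ZPoly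
  quot [] r = []
  quot (d ∷ ds) r = evalℤ (d ∷ ds) r ∷ quot ds r

  length-quot : ∀ cs r → length (quot cs r) ≡ length cs
  length-quot [] r = refl
  length-quot (d ∷ ds) r = cong suc (length-quot ds r)

  eval-quot : ∀ c cs r x → evalℤ (c ∷ cs) x ≡ evalℤ (c ∷ cs) r + (x - r) * evalℤ (quot cs r) x
  eval-quot c [] r x = lem c x r
    where lem : ∀ c x r → c + x * + 0 ≡ (c + r * + 0) + (x - r) * + 0
          lem = solve-∀
  eval-quot c (d ∷ ds) r x = trans (cong (λ v → c + x * v) (eval-quot d ds r x)) (lem c x r (evalℤ (d ∷ ds) r) (evalℤ (quot ds r) x))
    where lem : ∀ c x r g q → c + x * (g + (x - r) * q) ≡ (c + r * g) + (x - r) * (g + x * q)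
          lem = solve-∀

  eval-≈0 : ∀ {cs} → All _≈0 cs → ∀ x → evalℤ cs x ≈0
  eval-≈0 [] x = 0≈0
  eval-≈0 (c ∷ cs) x = ≈0-+ c (≈0-* x (eval-≈0 cs x))

  ≈0-cancelʳ : ∀ {c} y → c + y ≈0 → y ≈0 → c ≈0
  ≈0-cancelʳ {c} y h k = subst _≈0 (lem c y) (≈0-- h k)
    where lem : ∀ c y → (c + y) - y ≡ c
          lem = solve-∀

  -- Passing from cs to its quotient is a unitriangular substitution, so it loses no information
  -- over any ring.
  quot-≈0 : ∀ cs r → All _≈0 (quot cs r) → All _≈0 cs
  quot-≈0 [] r [] = []
  quot-≈0 (d ∷ ds) r (h ∷ hs) = ≈0-cancelʳ (r * evalℤ ds r) h (≈0-* r (eval-≈0 (quot-≈0 ds r hs) r)) ∷ quot-≈0 ds r hs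

  Distinct : List ℤ → Set
  Distinct = AllPairs (λ r s → ¬ (s - r) ≈0)

  -- Split off the root r; in a domain the remaining roots are roots of the quotient. The conclusion
  -- is about coefficients rather than values, so that it passes to derivatives.
  roots⇒≈0 : ∀ cs rs → Distinct rs → length cs ℕ.≤ length rs → All (λ r → evalℤ cs r ≈0) rs → All _≈0 cs
  roots⇒≈0 [] rs D l h = []
  roots⇒≈0 (c ∷ cs) (r ∷ rs) (D ∷ Ds) (ℕ.s≤s l) (h ∷ hs) =
    ≈0-cancelʳ (r * evalℤ cs r) h (≈0-* r (eval-≈0 cs≈0 r)) ∷ cs≈0
    where
    quot-root : ∀ {rs} → All (λ s → ¬ (s - r) ≈0) rs → All (λ s → evalℤ (c ∷ cs) s ≈0) rs → All (λ s → evalℤ (quot cs r) s ≈0) rs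
    quot-root [] [] = []
    quot-root {s ∷ _} (d ∷ ds) (k ∷ ks) with dom (≈0-cancelʳ {(s - r) * evalℤ (quot cs r) s} (evalℤ (c ∷ cs) r)
       (subst _≈0 (trans (eval-quot c cs r s) (ℤₚ.+-comm (evalℤ (c ∷ cs) r) _)) k) h)
    ... | inj₁ s≡r = ⊥-elim (d s≡r)
    ... | inj₂ q = q ∷ quot-root ds ks
    cs≈0 : All _≈0 cs
    cs≈0 = quot-≈0 cs r (roots⇒≈0 (quot cs r) rs Ds (subst (ℕ._≤ length rs) (sym (length-quot cs r)) l) (quot-root D hs))

  range : ℕ → ℕ → List ℤ
  range a zero = []
  range a (suc n) = + a ∷ range (suc a) n

  -- The characteristic p is 0 or at least T.
  Large : ℕ → Set
  Large T = ∀ k → 0 ℕ.< k → k ℕ.< T → ¬ (+ k ≈0)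

  All-range : ∀ {P : ℤ → Set} n a → (∀ k → k ℕ.< n → P (+ (a ℕ.+ k))) → All P (range a n)
  All-range zero a h = []
  All-range {P} (suc n) a h = subst (P ∘ +_) (ℕₚ.+-identityʳ a) (h 0 (ℕ.s≤s ℕ.z≤n)) ∷
    All-range n (suc a) (λ k k<n → subst (P ∘ +_) (ℕₚ.+-suc a k) (h (suc k) (ℕ.s≤s k<n)))

  length-range : ∀ n a → length (range a n) ≡ n
  length-range zero a = refl
  length-range (suc n) a = cong suc (length-range n (suc a))

  range-distinct : ∀ {T} n a → n ℕ.≤ T → Large T → Distinct (range a n)
  range-distinct zero a n≤T L = []
  range-distinct (suc n) a n≤T L = All-range n (suc a)
    (λ k k<n h → L (suc k) (ℕ.s≤s ℕ.z≤n) (ℕₚ.<-≤-trans (ℕ.s≤s k<n) n≤T) (subst _≈0 (lem (+ a) (+ k)) h))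
    ∷ range-distinct n (suc a) (ℕₚ.≤-trans (ℕₚ.n≤1+n n) n≤T) L
    where lem : ∀ a k → (+ 1 + (a + k)) - a ≡ + 1 + k
          lem = solve-∀

  -- The sample interval may start anywhere: later it starts at 1, or just after a root y, so that a
  -- factor ε or t - y can be cancelled at every sample point.
  vanish-coeffs : ∀ {T a} cs → Large T → length cs ℕ.≤ T → (∀ k → k ℕ.< T → evalℤ cs (+ (a ℕ.+ k)) ≈0) → All _≈0 cs
  vanish-coeffs {T} {a} cs L l h = roots⇒≈0 cs (range a T) (range-distinct T a ℕₚ.≤-refl L)
    (subst (length cs ℕ.≤_) (sym (length-range T a)) l) (All-range T a h)

  vanish : ∀ {d T u} → Large T → d ℕ.≤ T → Poly d u → (∀ k → k ℕ.< T → u (+ k) ≈0) → ∀ x → u x ≈0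
  vanish L d≤T (cs , l , e) h x = subst _≈0 (sym (e x))
    (eval-≈0 (vanish-coeffs {a = 0} cs L (ℕₚ.≤-trans l d≤T) (λ k k<T → subst _≈0 (e (+ k)) (h k k<T))) x)

  nonzero-or-vanish : ∀ {d T u} → Large T → d ℕ.≤ T → Poly d u → (∃[ y ] ¬ (u (+ y) ≈0)) ⊎ (∀ x → u x ≈0)
  nonzero-or-vanish {d} {T} {u} L d≤T P with Finₚ.all? {n = T} (λ i → ≈0? (u (+ toℕ i)))
  ... | yes h = inj₂ (vanish L d≤T P (λ k k<T → subst (λ m → u (+ m) ≈0) (Finₚ.toℕ-fromℕ< k<T) (h (fromℕ< k<T))))
  ... | no h = let (i , n) = Finₚ.¬∀⟶∃¬ T _ (λ i → ≈0? (u (+ toℕ i))) h in inj₁ (toℕ i , n)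

  ≉0-* : ∀ {a b} → ¬ a ≈0 → ¬ b ≈0 → ¬ a * b ≈0
  ≉0-* na nb h with dom h
  ... | inj₁ k = na k
  ... | inj₂ k = nb k

  cancel : ∀ {a b} → ¬ a ≈0 → a * b ≈0 → b ≈0
  cancel na h with dom h
  ... | inj₁ k = ⊥-elim (na k)
  ... | inj₂ k = k

-- Linear dependence modulo p

sumV : ∀ {k} m → (Vec (Fin k) m → ℤ) → ℤ
sumV zero f = f []
sumV (suc m) f = sum (λ i → sumV m (λ α → f (i ∷ α)))

sumV-cong : ∀ {k} m {f g : Vec (Fin k) m → ℤ} → (∀ α → f α ≡ g α) → sumV m f ≡ sumV m g
sumV-cong zero h = h []
sumV-cong {k} (suc m) h = sum-cong-≗ {k} (λ i → sumV-cong m (λ α → h (i ∷ α)))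

sum-↑ : ∀ m n (g : Fin (m ℕ.+ n) → ℤ) → sum g ≡ sum (λ i → g (i ↑ˡ n)) + sum (λ j → g (m ↑ʳ j))
sum-↑ zero n g = sym (ℤₚ.+-identityˡ _)
sum-↑ (suc m) n g = trans (cong (λ u → g zero + u) (sum-↑ m n (g ∘ suc))) (sym (ℤₚ.+-assoc (g zero) _ _))

sum-combine : ∀ m n (g : Fin (m ℕ.* n) → ℤ) → sum g ≡ sum (λ i → sum (λ j → g (combine {m} i j)))
sum-combine zero n g = refl
sum-combine (suc m) n g = trans (sum-↑ n (m ℕ.* n) g) (cong (λ u → sum (λ j → g (j ↑ˡ (m ℕ.* n))) + u) (sum-combine m n (g ∘ (n ↑ʳ_))))

enc : ∀ {k m} → Vec (Fin k) m → Fin (k ℕ.^ m)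
enc [] = zero
enc (i ∷ α) = combine i (enc α)

dec : ∀ {k} m → Fin (k ℕ.^ m) → Vec (Fin k) m
dec zero _ = []
dec {k} (suc m) i = proj₁ (remQuot (k ℕ.^ m) i) ∷ dec m (proj₂ (remQuot {k} (k ℕ.^ m) i))

dec∘enc : ∀ {k m} (α : Vec (Fin k) m) → dec m (enc α) ≡ α
dec∘enc [] = refl
dec∘enc {k} {suc m} (i ∷ α) = cong₂ _∷_ (cong proj₁ e) (trans (cong (dec m ∘ proj₂) e) (dec∘enc α))
  where e = Finₚ.remQuot-combine {k} i (enc α)

enc∘dec : ∀ {k} m (i : Fin (k ℕ.^ m)) → enc (dec m i) ≡ i
enc∘dec zero zero = refl
enc∘dec {k} (suc m) i = trans (cong (combine (proj₁ (remQuot {k} (k ℕ.^ m) i))) (enc∘dec m _)) (Finₚ.combine-remQuot {k} (k ℕ.^ m) i)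

sumV-enc : ∀ {k} m (g : Fin (k ℕ.^ m) → ℤ) → sum g ≡ sumV m (g ∘ enc)
sumV-enc zero g = ℤₚ.+-identityʳ _
sumV-enc {k} (suc m) g = trans (sum-combine k (k ℕ.^ m) g) (sum-cong-≗ {k} (λ i → sumV-enc m (λ j → g (combine i j))))

module Dependence (p : ℕ) .{{_ : NonZero p}} (1<p : 1 ℕ.< p) where
  open Mod p

  ≈0-sum : ∀ {n} {f : Fin n → ℤ} → (∀ i → f i ≈0) → sum f ≈0
  ≈0-sum {zero} h = 0≈0
  ≈0-sum {suc n} h = ≈0-+ (h zero) (≈0-sum (h ∘ suc))

  ≈0-sumV : ∀ {k} m {f : Vec (Fin k) m → ℤ} → (∀ α → f α ≈0) → sumV m f ≈0
  ≈0-sumV zero h = h []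
  ≈0-sumV (suc m) h = ≈0-sum (λ i → ≈0-sumV m (λ α → h (i ∷ α)))

  residue-unique : ∀ {x y} → x ℕ.< p → y ℕ.< p → (+ x - + y) ≈0 → x ≡ y
  residue-unique {x} {y} x<p y<p h with ℕₚ.<-cmp x y
  ... | tri≈ _ e _ = e
  ... | tri> _ _ y<x = ⊥-elim (small≉0 (x ℕ.∸ y) (ℕₚ.m<n⇒0<n∸m y<x) (ℕₚ.≤-<-trans (ℕₚ.m∸n≤m x y) x<p)
      (subst _≈0 (trans (ℤₚ.m-n≡m⊖n x y) (ℤₚ.⊖-≥ (ℕₚ.<⇒≤ y<x))) h))
  ... | tri< x<y _ _ = ⊥-elim (small≉0 (y ℕ.∸ x) (ℕₚ.m<n⇒0<n∸m x<y) (ℕₚ.≤-<-trans (ℕₚ.m∸n≤m y x) y<p)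
      (subst _≈0 (trans (lem (+ x) (+ y)) (trans (ℤₚ.m-n≡m⊖n y x) (ℤₚ.⊖-≥ (ℕₚ.<⇒≤ x<y)))) (≈0-neg h)))
    where lem : ∀ x y → - (x - y) ≡ y - x
          lem = solve-∀

  sum-linear : ∀ {n} (a b v : Fin n → ℤ) → sum (λ i → a i * v i) - sum (λ i → b i * v i) ≡ sum (λ i → (a i - b i) * v i)
  sum-linear {zero} a b v = refl
  sum-linear {suc n} a b v = trans (lem (a zero) (b zero) (v zero) _ _) (cong (λ u → (a zero - b zero) * v zero + u) (sum-linear (a ∘ suc) (b ∘ suc) (v ∘ suc)))
    where lem : ∀ a b v s t → (a * v + s) - (b * v + t) ≡ (a - b) * v + (s - t)
          lem = solve-∀

  -- Pigeonhole instead of elimination: there are p^N combinations with coefficients in [0, p), but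
  -- only p^D vectors of values modulo p. Two combinations collide, and their difference is a
  -- relation; it is non-trivial because distinct digit vectors are incongruent.
  dependence-Fin : ∀ {N D} → D ℕ.< N → (V : Fin N → Fin D → ℤ) →
    ∃[ c ] (∀ j → sum (λ i → c i * V i j) ≈0) × (∃[ i ] ¬ (c i ≈0))
  dependence-Fin {N} {D} D<N V = c , relation , nonzero
    where
    digit : Fin (p ℕ.^ N) → Fin N → ℕ
    digit a i = toℕ (finToFun {p} {N} a i)
    combination : Fin (p ℕ.^ N) → Fin D → ℤ
    combination a j = sum (λ i → + digit a i * V i j)
    image : Fin (p ℕ.^ N) → Fin D → Fin p
    image a j = fromℕ< (n%ℕd<d (combination a j) p)
    collision = Finₚ.pigeonhole (ℕₚ.^-monoʳ-< p 1<p D<N) (λ a → funToFin (image a))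
    a = proj₁ collision
    b = proj₁ (proj₂ collision)
    c : Fin N → ℤ
    c i = + digit a i - + digit b i
    same : ∀ j → combination a j %ℕ p ≡ combination b j %ℕ p
    same j = trans (sym (Finₚ.toℕ-fromℕ< _)) (trans (cong toℕ
      (trans (sym (Finₚ.finToFun-funToFin (image a) j)) (trans (cong (λ q → finToFun {p} {D} q j) (proj₂ (proj₂ (proj₂ collision)))) (Finₚ.finToFun-funToFin (image b) j))))
      (Finₚ.toℕ-fromℕ< _))
    relation : ∀ j → sum (λ i → c i * V i j) ≈0
    relation j = subst _≈0 (sum-linear (λ i → + digit a i) (λ i → + digit b i) (λ i → V i j))
      (subst _≈0 (trans (cong (λ r → (+ r - y) - (+ (x %ℕ p) - x)) (sym (same j))) (lem (+ (x %ℕ p)) x y)) (≈0-- (%ℕ-≈ y) (%ℕ-≈ x)))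
      where x = combination a j
            y = combination b j
            lem : ∀ r x y → (r - y) - (r - x) ≡ x - y
            lem = solve-∀
    funToFin-cong : ∀ {m n} {f g : Fin m → Fin n} → (∀ i → f i ≡ g i) → funToFin f ≡ funToFin g
    funToFin-cong {zero} h = refl
    funToFin-cong {suc m} h = cong₂ combine (h zero) (funToFin-cong (h ∘ suc))
    nonzero : ∃[ i ] ¬ (c i ≈0)
    nonzero with Finₚ.all? (λ i → ≈0? (c i))
    ... | no n = Finₚ.¬∀⟶∃¬ N _ (λ i → ≈0? (c i)) n
    ... | yes h = ⊥-elim (Finₚ.<⇒≢ (proj₁ (proj₂ (proj₂ collision)))
       (trans (sym (Finₚ.funToFin-finToFin {N} {p} a)) (trans (funToFin-cong (λ i → Finₚ.toℕ-injective
          (residue-unique (Finₚ.toℕ<n (finToFun {p} {N} a i)) (Finₚ.toℕ<n (finToFun {p} {N} b i)) (h i)))) (Finₚ.funToFin-finToFin {N} {p} b))))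

  dependence : ∀ {k e} m n → e ℕ.^ n ℕ.< k ℕ.^ m → (V : Vec (Fin k) m → Vec (Fin e) n → ℤ) →
    ∃[ c ] (∀ g → sumV m (λ α → c α * V α g) ≈0) × (∃[ α ] ¬ (c α ≈0))
  dependence {k} {e} m n lt V = go (dependence-Fin lt (λ i j → V (dec m i) (dec n j)))
    where
    go : (∃[ c ] (∀ j → sum (λ i → c i * V (dec m i) (dec n j)) ≈0) × (∃[ i ] ¬ (c i ≈0))) →
      ∃[ c ] (∀ g → sumV m (λ α → c α * V α g) ≈0) × (∃[ α ] ¬ (c α ≈0))
    go (c , r , (i , ci)) = c ∘ enc ,
      (λ g → subst _≈0 (trans (sumV-enc m _) (sumV-cong m (λ α → cong₂ (λ β γ → c (enc α) * V β γ) (dec∘enc α) (dec∘enc g)))) (r (enc g))) ,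
      dec m i , subst (λ q → ¬ (c q ≈0)) (sym (enc∘dec m i)) ci

-- Nonsingular zeros of square systems

line : ∀ {n} → Vec ℤ n → Vec ℤ n → ℤ → Vec ℤ n
line z v ε = zipWith (λ a b → a + ε * b) z v

line-0 : ∀ {n} (z v : Vec ℤ n) → line z v (+ 0) ≡ z
line-0 [] [] = refl
line-0 (a ∷ z) (b ∷ v) = cong₂ _∷_ (lem a b) (line-0 z v)
  where lem : ∀ a b → a + + 0 * b ≡ a
        lem = solve-∀

line-still : ∀ {n} (z : Vec ℤ n) ε → line z (Vec.replicate n (+ 0)) ε ≡ z
line-still [] ε = refl
line-still (a ∷ z) ε = cong₂ _∷_ (lem a ε) (line-still z ε)
  where lem : ∀ a e → a + e * + 0 ≡ a
        lem = solve-∀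

-- Multivariate polynomials never appear as data. What is used of a function is that its restriction
-- to every line is a polynomial of bounded length.
LinePoly : ∀ {n} → ℕ → (Vec ℤ n → ℤ) → Set
LinePoly d f = ∀ z v → Poly d (λ ε → f (line z v ε))

mono : ∀ {n k} → (Fin n → ℤ) → Vec (Fin k) n → ℤ
mono g [] = + 1
mono g (a ∷ α) = g zero ^ toℕ a * mono (g ∘ suc) α

weight : ∀ {n k} → Vec (Fin k) n → ℕ
weight [] = 0
weight (a ∷ α) = toℕ a ℕ.+ weight α

weight-≤ : ∀ {n k} (α : Vec (Fin k) n) → weight α ℕ.≤ n ℕ.* k
weight-≤ [] = ℕ.z≤n
weight-≤ (a ∷ α) = ℕₚ.+-mono-≤ (ℕₚ.<⇒≤ (Finₚ.toℕ<n a)) (weight-≤ α)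

prod : ∀ {n} → (Fin n → ℤ) → ℤ
prod {zero} f = + 1
prod {suc n} f = f zero * prod (f ∘ suc)

poly-prod : ∀ {d n} {u : Fin n → ℤ → ℤ} → (∀ i → Poly d (u i)) → Poly (n ℕ.* d ℕ.+ 1) (λ x → prod (λ i → u i x))
poly-prod {n = zero} P = poly-const (+ 1)
poly-prod {d} {suc n} P = poly-≤ (ℕₚ.≤-reflexive (sym (ℕₚ.+-assoc d (n ℕ.* d) 1))) (poly-* (P zero) (poly-prod (P ∘ suc)))

poly-mono : ∀ {d n k} {u : Fin n → ℤ → ℤ} → (∀ i → Poly d (u i)) → (α : Vec (Fin k) n) →
            Poly (n ℕ.* (k ℕ.* d ℕ.+ 1) ℕ.+ 1) (λ x → mono (λ i → u i x) α)
poly-mono P [] = poly-const (+ 1)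
poly-mono {d} {suc n} {k} P (a ∷ α) = poly-≤ (ℕₚ.≤-reflexive (sym (ℕₚ.+-assoc (k ℕ.* d ℕ.+ 1) _ 1)))
  (poly-* (poly-≤ (ℕₚ.+-monoˡ-≤ 1 (ℕₚ.*-monoˡ-≤ d (ℕₚ.<⇒≤ (Finₚ.toℕ<n a)))) (poly-^ (toℕ a) (P zero))) (poly-mono (P ∘ suc) α))

poly-sumV : ∀ {d k} m {u : Vec (Fin k) m → ℤ → ℤ} → (∀ α → Poly d (u α)) → Poly d (λ x → sumV m (λ α → u α x))
poly-sumV zero P = P []
poly-sumV (suc m) P = poly-sum (λ i → poly-sumV m (λ α → P (i ∷ α)))

eval-tabulate : ∀ {n} (G : Fin n → ℤ) t → sum (λ i → t ^ toℕ i * G i) ≡ evalℤ (List.tabulate G) t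
eval-tabulate {zero} G t = refl
eval-tabulate {suc n} G t = cong₂ _+_ (ℤₚ.*-identityˡ (G zero))
  (trans (trans (sum-cong-≗ {n} (λ i → ℤₚ.*-assoc t (t ^ toℕ i) (G (suc i)))) (sym (*-distribˡ-sum {n} t (λ i → t ^ toℕ i * G (suc i)))))
         (cong (t *_) (eval-tabulate (G ∘ suc) t)))

sumV-*ˡ : ∀ {k} m x (f : Vec (Fin k) m → ℤ) → x * sumV m f ≡ sumV m (λ α → x * f α)
sumV-*ˡ zero x f = refl
sumV-*ˡ {k} (suc m) x f = trans (*-distribˡ-sum {k} x _) (sum-cong-≗ {k} (λ i → sumV-*ˡ m x (λ α → f (i ∷ α))))

length-tabulate : ∀ {n} (G : Fin n → ℤ) → length (List.tabulate G) ≡ n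
length-tabulate = Listₚ.length-tabulate

module Vanishing (p : ℕ) .{{_ : NonZero p}} (1<p : 1 ℕ.< p) (dom : IsDomain p) where
  open Mod p public
  open Roots p dom public
  open Dependence p 1<p public

  -- Along a line that moves only the first coordinate F has T zeros, so the first coordinate may
  -- take any integer value while the others stay on the grid; then recurse on the others.
  grid-vanish : ∀ {n T d} {F : Vec ℤ n → ℤ} → Large T → d ℕ.≤ T → LinePoly d F →
    (∀ (g : Vec (Fin T) n) → F (Vec.map (λ i → + toℕ i) g) ≈0) → ∀ x → F x ≈0
  grid-vanish L d≤T P h [] = h []
  grid-vanish {suc n} {T} {d} {F} L d≤T P h (a ∷ r) = grid-vanish {F = λ r → F (a ∷ r)} L d≤T P′ h′ r
    where
    P′ : LinePoly d (λ r → F (a ∷ r))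
    P′ z v = poly-cong (λ ε → cong (λ t → F (t ∷ line z v ε)) (lem a ε)) (P (a ∷ z) (+ 0 ∷ v))
      where lem : ∀ a e → a + e * + 0 ≡ a
            lem = solve-∀
    h′ : ∀ g → F (a ∷ Vec.map (λ i → + toℕ i) g) ≈0
    h′ g = vanish {u = λ t → F (t ∷ y)} L d≤T
       (poly-cong (λ ε → cong₂ (λ t r → F (t ∷ r)) (lem ε) (line-still y ε)) (P (+ 0 ∷ y) (+ 1 ∷ Vec.replicate n (+ 0))))
       (λ k k<T → subst (λ m → F (+ m ∷ y) ≈0) (Finₚ.toℕ-fromℕ< k<T) (h (fromℕ< k<T ∷ g))) a
      where y = Vec.map (λ i → + toℕ i) g
            lem : ∀ e → + 0 + e * + 1 ≡ e
            lem = solve-∀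

  All-tabulate⁻ : ∀ {n} {G : Fin n → ℤ} → All _≈0 (List.tabulate G) → ∀ i → G i ≈0
  All-tabulate⁻ (h ∷ hs) zero = h
  All-tabulate⁻ (h ∷ hs) (suc i) = All-tabulate⁻ hs i

  power-independence : ∀ {M T} → Large T → M ℕ.≤ T → (G : Fin M → ℤ) → (∀ t → sum (λ i → t ^ toℕ i * G i) ≈0) → ∀ i → G i ≈0
  power-independence {M} {T} L M≤T G h = All-tabulate⁻ (vanish-coeffs {a = 0} (List.tabulate G) L
    (subst (ℕ._≤ T) (sym (length-tabulate G)) M≤T) (λ k _ → subst _≈0 (eval-tabulate G (+ k)) (h (+ k))))

  -- Separating the first variable reduces the claim to independence of the powers of t, that is, to
  -- the bound on the number of roots.
  mono-independence : ∀ {M T} n → Large T → M ℕ.≤ T → (c : Vec (Fin M) n → ℤ) →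
    (∀ η → sumV n (λ α → c α * mono η α) ≈0) → ∀ α → c α ≈0
  mono-independence zero L M≤T c h [] = subst _≈0 (ℤₚ.*-identityʳ (c [])) (h (λ ()))
  mono-independence {M} (suc n) L M≤T c h (i ∷ α) = mono-independence n L M≤T (λ α → c (i ∷ α))
    (λ η → power-independence L M≤T (λ i → sumV n (λ α → c (i ∷ α) * mono η α))
      (λ t → subst _≈0 (sum-cong-≗ {M} (λ i → trans (sumV-cong n (λ α → lem (c (i ∷ α)) (t ^ toℕ i) (mono η α))) (sym (sumV-*ˡ n (t ^ toℕ i) _)))) (h (t V.∷ η))) i) α
    where lem : ∀ c t m → c * (t * m) ≡ t * (c * m)
          lem = solve-∀

  ≉0-^ : ∀ {t} k → ¬ t ≈0 → 1 ℕ.< p → ¬ t ^ k ≈0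
  ≉0-^ zero n 1<p = small≉0 1 (ℕ.s≤s ℕ.z≤n) 1<p
  ≉0-^ (suc k) n 1<p = ≉0-* n (≉0-^ k n 1<p)

  -- An expansion of order at least k in ε. The coefficient a may be 0, so that terms of different
  -- orders can be brought to the same k and added.
  record Lead (L k : ℕ) (a : ℤ) (u : ℤ → ℤ) : Set where
    constructor lead
    field
      rest : ZPoly
      short : length rest ℕ.≤ L
      expansion : ∀ ε → (u ε - ε ^ k * evalℤ (a ∷ rest) ε) ≈0

  lead-* : ∀ {L L′ k k′ a a′ u u′} → Lead L k a u → Lead L′ k′ a′ u′ → Lead (suc (L ℕ.+ L′)) (k ℕ.+ k′) (a * a′) (λ ε → u ε * u′ ε)
  lead-* {L} {L′} {k} {k′} {a} {a′} {u} {u′} (lead r l e) (lead r′ l′ e′) = lead (List.drop 1 q)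
    (length-⊕ (scale a r′) (r ⊗ (a′ ∷ r′)) (ℕₚ.≤-trans (length-scale a r′ l′) (ℕₚ.≤-trans (ℕₚ.m≤n+m L′ L) (ℕₚ.n≤1+n _)))
       (ℕₚ.≤-trans (length-⊗ r (a′ ∷ r′) l (ℕ.s≤s l′)) (ℕₚ.≤-reflexive (ℕₚ.+-suc L L′))))
    (λ ε → subst _≈0 (eq ε) (≈0-+ (≈0-*ʳ (u′ ε) (e ε)) (≈0-* (ε ^ k * evalℤ (a ∷ r) ε) (e′ ε))))
    where
    q = (a ∷ r) ⊗ (a′ ∷ r′)
    lem : ∀ u u′ x y s t → (u - x * s) * u′ + (x * s) * (u′ - y * t) ≡ u * u′ - (x * y) * (s * t)
    lem = solve-∀
    eq : ∀ ε → (u ε - ε ^ k * evalℤ (a ∷ r) ε) * u′ ε + (ε ^ k * evalℤ (a ∷ r) ε) * (u′ ε - ε ^ k′ * evalℤ (a′ ∷ r′) ε)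
             ≡ u ε * u′ ε - ε ^ (k ℕ.+ k′) * evalℤ (a * a′ ∷ List.drop 1 q) ε
    eq ε = trans (lem (u ε) (u′ ε) (ε ^ k) (ε ^ k′) (evalℤ (a ∷ r) ε) (evalℤ (a′ ∷ r′) ε))
      (cong₂ (λ x y → u ε * u′ ε - x * y) (sym (ℤₚ.^-distribˡ-+-* ε k k′))
        (trans (sym (eval-⊗ (a ∷ r) (a′ ∷ r′) ε)) (cong (λ w → w + ε * evalℤ (List.drop 1 q) ε) (ℤₚ.+-identityʳ (a * a′)))))

  lead-const : ∀ {L} a → Lead L 0 a (λ _ → a)
  lead-const a = lead [] ℕ.z≤n (λ ε → subst _≈0 (lem a ε) 0≈0)
    where lem : ∀ a e → + 0 ≡ a - + 1 * (a + e * + 0)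
          lem = solve-∀

  lead-≤ : ∀ {L L′ k a u} → L ℕ.≤ L′ → Lead L k a u → Lead L′ k a u
  lead-≤ l (lead r s e) = lead r (ℕₚ.≤-trans s l) e

  lead-^ : ∀ {L a u} m → Lead L 1 a u → Lead (m ℕ.* suc L) m (a ^ m) (λ ε → u ε ^ m)
  lead-^ zero ℓ = lead-const (+ 1)
  lead-^ (suc m) ℓ = lead-* ℓ (lead-^ m ℓ)

  lead-mono : ∀ {L n k} {η : Fin n → ℤ} {u : Fin n → ℤ → ℤ} → (∀ j → Lead L 1 (η j) (u j)) → (α : Vec (Fin k) n) →
    Lead (n ℕ.* suc (k ℕ.* suc L)) (weight α) (mono η α) (λ ε → mono (λ j → u j ε) α)
  lead-mono ℓ [] = lead-const (+ 1)
  lead-mono {L} {suc n} {k} ℓ (a ∷ α) = lead-* (lead-≤ (ℕₚ.*-monoˡ-≤ (suc L) (ℕₚ.<⇒≤ (Finₚ.toℕ<n a))) (lead-^ (toℕ a) (ℓ zero))) (lead-mono (ℓ ∘ suc) α)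

  lead-zero : ∀ {L k u} → (∀ ε → u ε ≈0) → Lead L k (+ 0) u
  lead-zero {k = k} {u = u} h = lead [] ℕ.z≤n (λ ε → subst _≈0 (lem (u ε) (ε ^ k) ε) (h ε))
    where lem : ∀ u x e → u ≡ u - x * (+ 0 + e * + 0)
          lem = solve-∀

  lead-+ : ∀ {L k a a′ u u′} → Lead L k a u → Lead L k a′ u′ → Lead L k (a + a′) (λ ε → u ε + u′ ε)
  lead-+ {L} {k} {a} {a′} {u} {u′} (lead r l e) (lead r′ l′ e′) = lead (r ⊕ r′) (length-⊕ r r′ l l′)
    (λ ε → subst _≈0 (trans (lem (u ε) (u′ ε) (ε ^ k) (evalℤ (a ∷ r) ε) (evalℤ (a′ ∷ r′) ε)) (cong (λ w → (u ε + u′ ε) - ε ^ k * w) (sym (eval-⊕ (a ∷ r) (a′ ∷ r′) ε)))) (≈0-+ (e ε) (e′ ε)))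
    where lem : ∀ u u′ x s t → (u - x * s) + (u′ - x * t) ≡ (u + u′) - x * (s + t)
          lem = solve-∀

  lead-sum : ∀ {L k n} {a : Fin n → ℤ} {u : Fin n → ℤ → ℤ} → (∀ i → Lead L k (a i) (u i)) → Lead L k (sum a) (λ ε → sum (λ i → u i ε))
  lead-sum {n = zero} ℓ = lead-zero (λ _ → 0≈0)
  lead-sum {n = suc n} ℓ = lead-+ (ℓ zero) (lead-sum (ℓ ∘ suc))

  lead-sumV : ∀ {L k c} m {a : Vec (Fin c) m → ℤ} {u : Vec (Fin c) m → ℤ → ℤ} → (∀ α → Lead L k (a α) (u α)) →
    Lead L k (sumV m a) (λ ε → sumV m (λ α → u α ε))
  lead-sumV zero ℓ = ℓ []
  lead-sumV (suc m) ℓ = lead-sum (λ i → lead-sumV m (λ α → ℓ (i ∷ α)))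

  lead-cong : ∀ {L k a a′ u u′} → a ≡ a′ → (∀ ε → u ε ≡ u′ ε) → Lead L k a u → Lead L k a′ u′
  lead-cong {k = k} {a = a} refl h (lead r l e) = lead r l (λ ε → subst (λ w → (w - ε ^ k * evalℤ (a ∷ r) ε) ≈0) (h ε) (e ε))

  -- A term of order k + m + 1 counts as a term of order k with leading coefficient 0, at the price
  -- of m padding zeros in the tail.
  lead-drop : ∀ {L k m a u} → Lead L (k ℕ.+ suc m) a u → Lead (m ℕ.+ suc L) k (+ 0) u
  lead-drop {L} {k} {m} {a} {u} (lead r l e) = lead (replicate m (+ 0) ++ a ∷ r)
    (subst (ℕ._≤ m ℕ.+ suc L) (sym (trans (Listₚ.length-++ (replicate m (+ 0))) (cong (ℕ._+ suc (length r)) (Listₚ.length-replicate m)))) (ℕₚ.+-monoʳ-≤ m (ℕ.s≤s l)))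
    (λ ε → subst _≈0 (cong (λ w → u ε - w) (eq ε)) (e ε))
    where
    eval-pad : ∀ m ε → evalℤ (replicate m (+ 0) ++ a ∷ r) ε ≡ ε ^ m * evalℤ (a ∷ r) ε
    eval-pad zero ε = sym (ℤₚ.*-identityˡ _)
    eval-pad (suc m) ε = trans (ℤₚ.+-identityˡ _) (trans (cong (ε *_) (eval-pad m ε)) (sym (ℤₚ.*-assoc ε _ _)))
    lem : ∀ x e y s → (x * (e * y)) * s ≡ x * (+ 0 + e * (y * s))
    lem = solve-∀
    eq : ∀ ε → ε ^ (k ℕ.+ suc m) * evalℤ (a ∷ r) ε ≡ ε ^ k * (+ 0 + ε * evalℤ (replicate m (+ 0) ++ a ∷ r) ε)
    eq ε = trans (cong (λ w → w * evalℤ (a ∷ r) ε) (ℤₚ.^-distribˡ-+-* ε k (suc m)))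
           (trans (lem (ε ^ k) ε (ε ^ m) (evalℤ (a ∷ r) ε)) (cong (λ w → ε ^ k * (+ 0 + ε * w)) (sym (eval-pad m ε))))

  -- Sampling at ε = 1, 2, ... instead of from 0 allows the factor εᵏ to be cancelled; the remaining
  -- polynomial has a as its constant term.
  lead-vanish : ∀ {L T k a u} → Large T → suc (suc L) ℕ.≤ T → Lead L k a u → (∀ ε → u ε ≈0) → a ≈0
  lead-vanish {L} {T} {k} {a} {u} large L≤T (lead r l e) h = All.head (vanish-coeffs {suc L} {1} (a ∷ r)
      (λ i 0<i i<L → large i 0<i (ℕₚ.<-≤-trans i<L (ℕₚ.≤-trans (ℕₚ.n≤1+n _) L≤T))) (ℕ.s≤s l)
      (λ i i<L → cancel (≉0-^ k (large (suc i) (ℕ.s≤s ℕ.z≤n) (ℕₚ.<-≤-trans (ℕ.s≤s i<L) L≤T)) 1<p)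
        (subst _≈0 (lem (u (+ suc i)) ((+ suc i) ^ k * evalℤ (a ∷ r) (+ suc i))) (≈0-- (h (+ suc i)) (e (+ suc i))))))
    where lem : ∀ u x → u - (u - x) ≡ x
          lem = solve-∀

  poly⇒lead : ∀ {d u} → Poly d u → Lead d 0 (u (+ 0)) u
  poly⇒lead {d} {u} ([] , l , e) = lead-cong {a = + 0} (sym (e (+ 0))) (λ _ → refl) (lead-zero (λ ε → subst _≈0 (sym (e ε)) 0≈0))
  poly⇒lead {d} {u} (c ∷ cs , l , e) = lead cs (ℕₚ.≤-trans (ℕₚ.n≤1+n _) l) (λ ε → subst _≈0 (trans (sym (ℤₚ.+-inverseʳ (u ε))) (cong (λ w → u ε - w)
    (trans (e ε) (trans (cong (λ w → w + ε * evalℤ cs ε) (trans (lem c (evalℤ cs (+ 0))) (sym (e (+ 0))))) (sym (ℤₚ.*-identityˡ _)))))) 0≈0)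
    where lem : ∀ c y → c ≡ c + + 0 * y
          lem = solve-∀

  sum-single : ∀ {n} (f : Fin n → ℤ) i → (∀ j → j ≢ i → f j ≈0) → sum f ≈0 → f i ≈0
  sum-single f zero h s = ≈0-cancelʳ _ s (≈0-sum (λ j → h (suc j) (λ ())))
  sum-single {suc n} f (suc i) h s = sum-single (f ∘ suc) i (λ j j≢i → h (suc j) (j≢i ∘ Finₚ.suc-injective))
    (≈0-cancelʳ (f zero) (subst _≈0 (ℤₚ.+-comm (f zero) _) s) (h zero (λ ())))

  prod-≉0 : ∀ {n} {f : Fin n → ℤ} → (∀ i → ¬ f i ≈0) → ¬ prod f ≈0
  prod-≉0 {zero} h = small≉0 1 (ℕ.s≤s ℕ.z≤n) 1<p
  prod-≉0 {suc n} h = ≉0-* (h zero) (prod-≉0 (h ∘ suc))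

  prod-≈0 : ∀ {n} {f : Fin n → ℤ} i → f i ≈0 → prod f ≈0
  prod-≈0 {suc n} {f} zero h = ≈0-*ʳ (prod (f ∘ suc)) h
  prod-≈0 {suc n} {f} (suc i) h = ≈0-* (f zero) (prod-≈0 i h)

^-distribʳ-* : ∀ n a b → (a ℕ.* b) ℕ.^ n ≡ a ℕ.^ n ℕ.* b ℕ.^ n
^-distribʳ-* zero a b = refl
^-distribʳ-* (suc n) a b = trans (cong (a ℕ.* b ℕ.*_) (^-distribʳ-* n a b)) (ℕₚ.[m*n]*[o*p]≡[m*o]*[n*p] a b (a ℕ.^ n) (b ℕ.^ n))

interpolant-length : ℕ → ℕ
interpolant-length M = M ℕ.* 2 ℕ.+ 1

-- Length along a line of an interpolant times a monomial in the equations: M linear factors, then n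
-- powers with exponents below M of functions of length at most 2 + D.
degree : (n D M : ℕ) → ℕ
degree n D M = interpolant-length M ℕ.+ (n ℕ.* (M ℕ.* (2 ℕ.+ D) ℕ.+ 1) ℕ.+ 1)

degree-≤ : ∀ n D M → 1 ℕ.≤ M → degree n D M ℕ.≤ (n ℕ.* (3 ℕ.+ D) ℕ.+ 4) ℕ.* M
degree-≤ n D M 1≤M = begin
    degree n D M
  ≡⟨ lem n M D ⟩
    (n ℕ.* (2 ℕ.+ D) ℕ.+ 2) ℕ.* M ℕ.+ (n ℕ.+ 2) ℕ.* 1
  ≤⟨ ℕₚ.+-monoʳ-≤ ((n ℕ.* (2 ℕ.+ D) ℕ.+ 2) ℕ.* M) (ℕₚ.*-monoʳ-≤ (n ℕ.+ 2) 1≤M) ⟩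
    (n ℕ.* (2 ℕ.+ D) ℕ.+ 2) ℕ.* M ℕ.+ (n ℕ.+ 2) ℕ.* M
  ≡⟨ lem₂ n M D ⟩
    (n ℕ.* (3 ℕ.+ D) ℕ.+ 4) ℕ.* M
  ∎
  where
  open ℕₚ.≤-Reasoning
  lem : ∀ n M D → (M ℕ.* 2 ℕ.+ 1) ℕ.+ (n ℕ.* (M ℕ.* (2 ℕ.+ D) ℕ.+ 1) ℕ.+ 1) ≡ (n ℕ.* (2 ℕ.+ D) ℕ.+ 2) ℕ.* M ℕ.+ (n ℕ.+ 2) ℕ.* 1
  lem = ℕS.solve-∀
  lem₂ : ∀ n M D → (n ℕ.* (2 ℕ.+ D) ℕ.+ 2) ℕ.* M ℕ.+ (n ℕ.+ 2) ℕ.* M ≡ (n ℕ.* (3 ℕ.+ D) ℕ.+ 4) ℕ.* M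
  lem₂ = ℕS.solve-∀

-- With K = n(3 + D) + 4 the degree is at most K·M, so degreeⁿ ≤ Kⁿ·Mⁿ, which is less than Mⁿ⁺¹ as
-- soon as M exceeds Kⁿ.
bezout-bound : (n D : ℕ) → ℕ
bezout-bound n D = (n ℕ.* (3 ℕ.+ D) ℕ.+ 4) ℕ.^ n

degree-count : ∀ n D M → M ≡ suc (bezout-bound n D) → degree n D M ℕ.^ n ℕ.< M ℕ.^ suc n
degree-count n D M e = begin-strict
    degree n D M ℕ.^ n
  ≤⟨ ℕₚ.^-monoˡ-≤ n (degree-≤ n D M (subst (1 ℕ.≤_) (sym e) (ℕ.s≤s ℕ.z≤n))) ⟩
    (K ℕ.* M) ℕ.^ n
  ≡⟨ ^-distribʳ-* n K M ⟩
    K ℕ.^ n ℕ.* M ℕ.^ n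
  <⟨ ℕₚ.*-monoˡ-< (M ℕ.^ n) {{ℕₚ.m^n≢0 M n {{subst NonZero (sym e) _}}}} (subst (K ℕ.^ n ℕ.<_) (sym e) (ℕₚ.n<1+n (K ℕ.^ n))) ⟩
    M ℕ.^ suc n
  ∎
  where open ℕₚ.≤-Reasoning
        K = n ℕ.* (3 ℕ.+ D) ℕ.+ 4

-- Tail lengths of a single term and of a whole relation along a line. The summand n·M pays for
-- `lead-drop`, since no weight exceeds n·M. The threshold majorises every length that has to be
-- compared with the characteristic.
term-length sum-length bezout-threshold : (n D M : ℕ) → ℕ
term-length n D M = suc (interpolant-length M ℕ.+ n ℕ.* suc (M ℕ.* suc D))
sum-length n D M = n ℕ.* M ℕ.+ suc (term-length n D M)
bezout-threshold n D M = degree n D M ℕ.+ M ℕ.+ suc (suc (sum-length n D M))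

-- M nonsingular zeros z_s are too many: the M^(n+1) functions f^α h_s, with α ∈ [0,M)^n
-- and h_s interpolating at z_s, are dependent because they live in a space of dimension
-- degree^n.  Along a line through z_s with f(z_s + εv) = εη + O(ε²), the terms of lowest
-- weight |α| = w of a relation contribute ε^w Σ_α c_{s,α} η^α h_s(z_s); as η is arbitrary,
-- all c_{s,α} vanish, by induction on w.
module Zeros
  (p : ℕ) .{{_ : NonZero p}} (1<p : 1 ℕ.< p) (dom : IsDomain p)
  (n D M : ℕ) (f : Fin n → Vec ℤ n → ℤ) (df : Fin n → Vec ℤ n → Vec ℤ n → ℤ)
  (expand : ∀ j z v → Σ ZPoly λ cs → length cs ℕ.≤ D × (∀ ε → f j (line z v ε) ≡ evalℤ (f j z ∷ df j z v ∷ cs) ε))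
  where
  open Vanishing p 1<p dom

  -- Surjectivity of the differential rather than a non-zero determinant: the argument needs a
  -- direction v for each prescribed η, and each application supplies it by solving its own linear
  -- system.
  Nonsingular : Vec ℤ n → Set
  Nonsingular z = ∀ (η : Fin n → ℤ) → ∃[ v ] (∀ j → (df j z v - η j) ≈0)

  private
    d = degree n D M
    L₂ = term-length n D M
    L₃ = sum-length n D M
    threshold = bezout-threshold n D M

  module _ (large : Large threshold) (dimension-count : d ℕ.^ n ℕ.< M ℕ.^ suc n) (z : Fin M → Vec ℤ n)
           (key : ∀ s s′ → s ≢ s′ → Fin n)
           (distinct : ∀ s s′ (ne : s ≢ s′) → ¬ (lookup (z s) (key s s′ ne) - lookup (z s′) (key s s′ ne)) ≈0)
           (zero-z : ∀ s j → f j (z s) ≈0) (nonsing : ∀ s → Nonsingular (z s)) where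

    large≤ : ∀ {T} → T ℕ.≤ threshold → Large T
    large≤ l k 0<k k<T = large k 0<k (ℕₚ.<-≤-trans k<T l)

    -- A linear form that separates the two points: the coordinate in which they differ, minus its
    -- value at `z s′`. The product over all s′ vanishes at every chosen point except `z s`.
    factor : Fin M → Fin M → Vec ℤ n → ℤ
    factor s s′ x with s Fin.≟ s′
    ... | yes _ = + 1
    ... | no ne = lookup x (key s s′ ne) - lookup (z s′) (key s s′ ne)

    interpolant : Fin M → Vec ℤ n → ℤ
    interpolant s x = prod (λ s′ → factor s s′ x)

    interpolant-≈0 : ∀ s s′ → s ≢ s′ → interpolant s (z s′) ≈0
    interpolant-≈0 s s′ s≢s′ = prod-≈0 s′ go
      where
      go : factor s s′ (z s′) ≈0
      go with s Fin.≟ s′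
      ... | yes e = ⊥-elim (s≢s′ e)
      ... | no ne = subst _≈0 (sym (ℤₚ.+-inverseʳ (lookup (z s′) (key s s′ ne)))) 0≈0

    interpolant-≉0 : ∀ s → ¬ interpolant s (z s) ≈0
    interpolant-≉0 s = prod-≉0 go
      where
      go : ∀ s′ → ¬ factor s s′ (z s) ≈0
      go s′ with s Fin.≟ s′
      ... | yes _ = small≉0 1 (ℕ.s≤s ℕ.z≤n) 1<p
      ... | no n = distinct s s′ n

    poly-factor : ∀ s s′ → LinePoly 2 (factor s s′)
    poly-factor s s′ x v with s Fin.≟ s′
    ... | yes _ = poly-≤ (ℕ.s≤s ℕ.z≤n) (poly-const (+ 1))
    ... | no ne = (lookup x k - lookup (z s′) k) ∷ lookup v k ∷ [] , ℕₚ.≤-refl , λ ε →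
        trans (cong (λ w → w - lookup (z s′) k) (Vecₚ.lookup-zipWith _ k x v)) (lem (lookup x k) (lookup v k) ε (lookup (z s′) k))
      where k = key s s′ ne
            lem : ∀ a b e c → (a + e * b) - c ≡ (a - c) + e * (b + e * + 0)
            lem = solve-∀

    poly-interpolant : ∀ s → LinePoly (interpolant-length M) (interpolant s)
    poly-interpolant s x v = poly-prod {n = M} {u = λ s′ ε → factor s s′ (line x v ε)} (λ s′ → poly-factor s s′ x v)

    poly-f : ∀ j → LinePoly (2 ℕ.+ D) (f j)
    poly-f j x v = let (cs , l , e) = expand j x v in f j x ∷ df j x v ∷ cs , ℕ.s≤s (ℕ.s≤s l) , e

    F : Vec (Fin M) (suc n) → Vec ℤ n → ℤ
    F (s ∷ α) x = interpolant s x * mono (λ j → f j x) α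

    poly-F : ∀ ι → LinePoly d (F ι)
    poly-F (s ∷ α) x v = poly-* (poly-interpolant s x v) (poly-mono {u = λ j ε → f j (line x v ε)} (λ j → poly-f j x v) α)

    module Relation (c : Vec (Fin M) (suc n) → ℤ)
      (grid : ∀ (g : Vec (Fin d) n) → sumV (suc n) (λ ι → c ι * F ι (Vec.map (λ i → + toℕ i) g)) ≈0) where

     R : Vec ℤ n → ℤ
     R x = sumV (suc n) (λ ι → c ι * F ι x)

     R≈0 : ∀ x → R x ≈0
     R≈0 = grid-vanish (large≤ (ℕₚ.≤-trans (ℕₚ.m≤m+n d M) (ℕₚ.m≤m+n (d ℕ.+ M) _))) ℕₚ.≤-refl
       (λ x v → poly-sumV (suc n) {u = λ ι ε → c ι * F ι (line x v ε)} (λ ι → poly-scale (c ι) (poly-F ι x v))) grid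

     lead-f : ∀ s (η : Fin n → ℤ) v → (∀ j → (df j (z s) v - η j) ≈0) → ∀ j → Lead D 1 (η j) (λ ε → f j (line (z s) v ε))
     lead-f s η v h j = lead cs (proj₁ (proj₂ X)) (λ ε → subst _≈0 (eq ε) (≈0-+ (zero-z s j) (≈0-* ε (h j))))
       where
       X = expand j (z s) v
       cs = proj₁ X
       lem : ∀ a e b h y → a + e * (b - h) ≡ (a + e * (b + e * y)) - (e * + 1) * (h + e * y)
       lem = solve-∀
       eq : ∀ ε → f j (z s) + ε * (df j (z s) v - η j) ≡ f j (line (z s) v ε) - ε ^ 1 * evalℤ (η j ∷ cs) ε
       eq ε = trans (lem (f j (z s)) ε (df j (z s) v) (η j) (evalℤ cs ε)) (cong (_- (ε * + 1) * (η j + ε * evalℤ cs ε)) (sym (proj₂ (proj₂ X) ε)))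

     lead-F : ∀ s₀ s (η : Fin n → ℤ) v → (∀ j → (df j (z s₀) v - η j) ≈0) → ∀ α →
       Lead L₂ (weight α) (interpolant s (z s₀) * mono η α) (λ ε → F (s ∷ α) (line (z s₀) v ε))
     lead-F s₀ s η v h α = lead-* (lead-cong (cong (interpolant s) (line-0 (z s₀) v)) (λ _ → refl) (poly⇒lead (poly-interpolant s (z s₀) v)))
        (lead-mono {u = λ j ε → f j (line (z s₀) v ε)} (lead-f s₀ η v h) α)

     -- Selects weight w while sums still run over the full cube of exponents, which is the form
     -- that `mono-independence` accepts.
     indicator : ℕ → Vec (Fin M) n → ℤ
     indicator w α with weight α ℕ.≟ w
     ... | yes _ = + 1
     ... | no _ = + 0

     indicator-≡ : ∀ {w} α → weight α ≡ w → indicator w α ≡ + 1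
     indicator-≡ {w} α e with weight α ℕ.≟ w
     ... | yes _ = refl
     ... | no n = ⊥-elim (n e)

     indicator-≢ : ∀ {w} α → weight α ≢ w → indicator w α ≡ + 0
     indicator-≢ {w} α e with weight α ℕ.≟ w
     ... | yes e′ = ⊥-elim (e e′)
     ... | no n = refl

     module Step (w : ℕ) (IH : ∀ {w′} → w′ ℕ.< w → ∀ s α → weight α ≡ w′ → c (s ∷ α) ≈0) (s₀ : Fin M) where

       leading : (Fin n → ℤ) → Fin M → Vec (Fin M) n → ℤ
       leading η s α = c (s ∷ α) * (indicator w α * (interpolant s (z s₀) * mono η α))

       -- Below weight w the coefficient c vanishes by the induction hypothesis; at weight w the
       -- true leading coefficient appears; above it the term has order greater than w and
       -- contributes 0.
       lead-term : ∀ (η : Fin n → ℤ) v → (∀ j → (df j (z s₀) v - η j) ≈0) → ∀ s α →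
         Lead L₃ w (leading η s α) (λ ε → c (s ∷ α) * F (s ∷ α) (line (z s₀) v ε))
       lead-term η v h s α with ℕₚ.<-cmp (weight α) w
       ... | tri< lt ne _ = lead-cong (sym (trans (cong (λ i → c (s ∷ α) * (i * (interpolant s (z s₀) * mono η α))) (indicator-≢ α ne)) (ℤₚ.*-zeroʳ (c (s ∷ α)))))
           (λ _ → refl) (lead-zero (λ ε → ≈0-*ʳ {c (s ∷ α)} (F (s ∷ α) (line (z s₀) v ε)) (IH lt s α refl)))
       ... | tri≈ _ e _ = lead-cong (cong (c (s ∷ α) *_) (sym (trans (cong (λ i → i * (interpolant s (z s₀) * mono η α)) (indicator-≡ α e)) (ℤₚ.*-identityˡ _)))) (λ _ → refl)
           (subst (λ k → Lead L₃ k (c (s ∷ α) * (interpolant s (z s₀) * mono η α)) (λ ε → c (s ∷ α) * F (s ∷ α) (line (z s₀) v ε))) e (lead-≤ {L = suc L₂} (ℕₚ.m≤n+m _ (n ℕ.* M)) (lead-* (lead-const {0} (c (s ∷ α))) (lead-F s₀ s η v h α))))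
       ... | tri> _ ne gt = lead-cong (sym (trans (cong (λ i → c (s ∷ α) * (i * (interpolant s (z s₀) * mono η α))) (indicator-≢ α ne)) (ℤₚ.*-zeroʳ (c (s ∷ α)))))
           (λ ε → refl) (lead-scale {λ ε → F (s ∷ α) (line (z s₀) v ε)} (lead-≤ (ℕₚ.+-monoˡ-≤ (suc L₂) m≤) (lead-drop {m = m} (subst (λ k → Lead L₂ k (interpolant s (z s₀) * mono η α) (λ ε → F (s ∷ α) (line (z s₀) v ε))) weight≡ (lead-F s₀ s η v h α)))))
         where
         m = weight α ℕ.∸ suc w
         weight≡ : weight α ≡ w ℕ.+ suc m
         weight≡ = trans (sym (ℕₚ.m+[n∸m]≡n gt)) (sym (ℕₚ.+-suc w m))
         m≤ : m ℕ.≤ n ℕ.* M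
         m≤ = ℕₚ.≤-trans (ℕₚ.m∸n≤m (weight α) (suc w)) (weight-≤ α)
         lead-scale : ∀ {u} → Lead L₃ w (+ 0) u → Lead L₃ w (+ 0) (λ ε → c (s ∷ α) * u ε)
         lead-scale {u} (lead r l e) = lead (scale (c (s ∷ α)) r) (length-scale (c (s ∷ α)) r l) (λ ε →
            subst _≈0 (trans (lem (c (s ∷ α)) (u ε) (ε ^ w) ε (evalℤ r ε)) (cong (λ y → c (s ∷ α) * u ε - ε ^ w * (+ 0 + ε * y)) (sym (eval-scale (c (s ∷ α)) r ε)))) (≈0-* (c (s ∷ α)) (e ε)))
           where lem : ∀ c u x e y → c * (u - x * (+ 0 + e * y)) ≡ c * u - x * (+ 0 + e * (c * y))
                 lem = solve-∀

       sum-leading : ∀ η → sumV n (λ α → leading η s₀ α) ≈0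
       sum-leading η = let (v , h) = nonsing s₀ η in
         -- Only the summand s = s₀ survives, since the other interpolants vanish at `z s₀`.
         sum-single (λ s → sumV n (λ α → leading η s α)) s₀
           (λ s s≢s₀ → ≈0-sumV n (λ α → ≈0-* (c (s ∷ α)) (≈0-* (indicator w α) (≈0-*ʳ (mono η α) (interpolant-≈0 s s₀ s≢s₀)))))
           (lead-vanish {L = L₃} (large≤ (ℕₚ.m≤n+m _ (d ℕ.+ M))) ℕₚ.≤-refl
             (lead-sumV (suc n) {a = λ { (s ∷ α) → leading η s α }} {u = λ ι ε → c ι * F ι (line (z s₀) v ε)} (λ { (s ∷ α) → lead-term η v h s α }))
             (λ ε → R≈0 (line (z s₀) v ε)))

       conclusion : ∀ α → weight α ≡ w → c (s₀ ∷ α) ≈0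
       conclusion α e = cancel (interpolant-≉0 s₀) (subst _≈0 (trans (cong (λ i → c (s₀ ∷ α) * (i * h)) (indicator-≡ α e)) (lem₂ (c (s₀ ∷ α)) h))
           (mono-independence {T = threshold} n large (ℕₚ.≤-trans (ℕₚ.m≤n+m M d) (ℕₚ.m≤m+n (d ℕ.+ M) _)) (λ α → c (s₀ ∷ α) * (indicator w α * h))
             (λ η → subst _≈0 (sumV-cong n (λ α → lem (c (s₀ ∷ α)) (indicator w α) h (mono η α))) (sum-leading η)) α))
         where h = interpolant s₀ (z s₀)
               lem : ∀ c i h m → c * (i * (h * m)) ≡ (c * (i * h)) * m
               lem = solve-∀
               lem₂ : ∀ c h → c * (+ 1 * h) ≡ h * c
               lem₂ = solve-∀

     coefficients-≈0 : ∀ w s α → weight α ≡ w → c (s ∷ α) ≈0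
     coefficients-≈0 = <-rec (λ w → ∀ s α → weight α ≡ w → c (s ∷ α) ≈0) (λ w IH s α e → Step.conclusion w IH s α e)

    too-many-zeros : ⊥
    too-many-zeros = go (dependence (suc n) n dimension-count (λ ι g → F ι (Vec.map (λ i → + toℕ i) g)))
      where
      go : (∃[ c ] (∀ (g : Vec (Fin d) n) → sumV (suc n) (λ ι → c ι * F ι (Vec.map (λ i → + toℕ i) g)) ≈0) × (∃[ ι ] ¬ (c ι ≈0))) → ⊥
      go (c , grid , (s ∷ α) , nz) = nz (Relation.coefficients-≈0 c grid (weight α) s α refl)

bound-all : ∀ {n} (g : Fin n → ℕ) → ∃[ D ] (∀ j → g j ℕ.≤ D)
bound-all {zero} g = 0 , λ ()
bound-all {suc n} g = let (D , h) = bound-all (g ∘ suc) in g zero ℕ.+ D ,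
  λ { zero → ℕₚ.m≤m+n (g zero) D ; (suc j) → ℕₚ.≤-trans (h j) (ℕₚ.m≤n+m D (g zero)) }

point : ∀ {p n} .{{_ : NonZero p}} → Vec (Fin p) n → Vec ℤ n
point {p} = Vec.map (elt p)

LineJet : ∀ {I : Set} {n} → (I → Vec ℤ n → ℤ) → (I → Vec ℤ n → Vec ℤ n → ℤ) → Set
LineJet {I} {n} f df = Jet {I × Vec ℤ n × Vec ℤ n} (λ { (i , z , v) ε → f i (line z v ε) }) (λ { (i , z , v) → f i z }) (λ { (i , z , v) → df i z v })

lookup-ext : ∀ {A : Set} {n} (x y : Vec A n) → (∀ k → lookup x k ≡ lookup y k) → x ≡ y
lookup-ext x y h = trans (sym (Vecₚ.tabulate∘lookup x)) (trans (Vecₚ.tabulate-cong h) (Vecₚ.tabulate∘lookup y))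

NonsingularZero : ∀ {I : Set} {n} (p : ℕ) (f : Fin n → I → Vec ℤ n → ℤ) (df : Fin n → I → Vec ℤ n → Vec ℤ n → ℤ) → I → Vec ℤ n → Set
NonsingularZero {n = n} p f df i z = (∀ j → Mod._≈0 p (f j i z)) × (∀ (η : Fin n → ℤ) → ∃[ v ] (∀ j → Mod._≈0 p (df j i z v - η j)))

-- The bound depends only on n and on the common length bound of the jets, not on the parameter i or
-- on p: one constant serves all right-hand sides of a system. More than C zeros would supply the C
-- + 1 points excluded by `too-many-zeros`.
nonsingular-zeros : ∀ {I : Set} {n} (f : Fin n → I → Vec ℤ n → ℤ) (df : Fin n → I → Vec ℤ n → Vec ℤ n → ℤ) →
  (∀ j → LineJet (f j) (df j)) →
  ∃[ C ] ∃[ T ] (∀ p .{{_ : NonZero p}} → 1 ℕ.< p → (dom : IsDomain p) → Roots.Large p dom T →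
    ∀ i → AtMost {Vec (Fin p) n} (λ x → NonsingularZero p f df i (point x)) C)
nonsingular-zeros {I} {n} f df J = C , bezout-threshold n D (suc C) , λ p 1<p dom large i → atMost λ xs u h →
    ℕₚ.≮⇒≥ (λ C<len → contra p 1<p dom large i xs u h C<len (suc C) refl)
  where
  D = proj₁ (bound-all (λ j → bound (J j)))
  D-bound = proj₂ (bound-all (λ j → bound (J j)))
  C = bezout-bound n D
  contra : ∀ p .{{_ : NonZero p}} (1<p : 1 ℕ.< p) (dom : IsDomain p) → Roots.Large p dom (bezout-threshold n D (suc C)) → ∀ i xs → Unique xs →
    All (λ x → NonsingularZero p f df i (point x)) xs → C ℕ.< length xs → ∀ M → M ≡ suc C → ⊥
  contra p 1<p dom large i xs u h C<len M M≡ = Zeros.too-many-zeros p 1<p dom n D M (λ j → f j i) (λ j → df j i)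
      (λ j z v → let (cs , l , e) = expand (J j) (i , z , v) in cs , ℕₚ.≤-trans l (D-bound j) , e)
      (subst (λ M → Roots.Large p dom (bezout-threshold n D M)) (sym M≡) large) (degree-count n D M M≡)
      (λ s → point (x s)) (λ s s′ ne → proj₁ (separate s s′ ne))
      (λ s s′ ne e → proj₂ (separate s s′ ne) (Finₚ.toℕ-injective (Dependence.residue-unique p 1<p (Finₚ.toℕ<n _) (Finₚ.toℕ<n _)
         (subst₂ (λ a b → Mod._≈0 p (a - b)) (Vecₚ.lookup-map (proj₁ (separate s s′ ne)) (elt p) (x s)) (Vecₚ.lookup-map (proj₁ (separate s s′ ne)) (elt p) (x s′)) e))))
      (λ s → proj₁ (All.lookup h (∈-lookup (index s)))) (λ s → proj₂ (All.lookup h (∈-lookup (index s))))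
    where
    index : Fin M → Fin (length xs)
    index s = Fin.inject≤ s (subst (ℕ._≤ length xs) (sym M≡) C<len)
    x : Fin M → Vec (Fin p) n
    x s = List.lookup xs (index s)
    separate : ∀ s s′ → s ≢ s′ → ∃[ k ] (lookup (x s) k ≢ lookup (x s′) k)
    separate s s′ ne = Finₚ.¬∀⟶∃¬ n _ (λ k → lookup (x s) k Fin.≟ lookup (x s′) k)
      (λ e → ne (Finₚ.inject≤-injective _ _ s s′ (lookup-injective u (index s) (index s′) (lookup-ext (x s) (x s′) e))))

-- Derivatives of polynomials modulo p

eval-deriv-⊕ : ∀ f g x → evalℤ (deriv (f ⊕ g)) x ≡ evalℤ (deriv f) x + evalℤ (deriv g) x
eval-deriv-⊕ [] g x = sym (ℤₚ.+-identityˡ _)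
eval-deriv-⊕ (a ∷ f) [] x = sym (ℤₚ.+-identityʳ _)
eval-deriv-⊕ (a ∷ f) (b ∷ g) x rewrite eval-⊕ (f ⊕ g) (+ 0 ∷ deriv (f ⊕ g)) x | eval-⊕ f g x | eval-deriv-⊕ f g x
  | eval-⊕ f (+ 0 ∷ deriv f) x | eval-⊕ g (+ 0 ∷ deriv g) x = lem x (evalℤ f x) (evalℤ g x) (evalℤ (deriv f) x) (evalℤ (deriv g) x)
  where lem : ∀ x f g f′ g′ → (f + g) + (+ 0 + x * (f′ + g′)) ≡ (f + (+ 0 + x * f′)) + (g + (+ 0 + x * g′))
        lem = solve-∀

eval-deriv-scale : ∀ c f x → evalℤ (deriv (scale c f)) x ≡ c * evalℤ (deriv f) x
eval-deriv-scale c [] x = sym (ℤₚ.*-zeroʳ c)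
eval-deriv-scale c (a ∷ f) x rewrite eval-⊕ (scale c f) (+ 0 ∷ deriv (scale c f)) x | eval-scale c f x | eval-deriv-scale c f x
  | eval-⊕ f (+ 0 ∷ deriv f) x = lem c x (evalℤ f x) (evalℤ (deriv f) x)
  where lem : ∀ c x f f′ → c * f + (+ 0 + x * (c * f′)) ≡ c * (f + (+ 0 + x * f′))
        lem = solve-∀

eval-deriv-∷ : ∀ c f x → evalℤ (deriv (c ∷ f)) x ≡ evalℤ f x + x * evalℤ (deriv f) x
eval-deriv-∷ c f x = trans (eval-⊕ f (+ 0 ∷ deriv f) x) (cong (λ w → evalℤ f x + w) (ℤₚ.+-identityˡ _))

eval-deriv-⊗ : ∀ f g x → evalℤ (deriv (f ⊗ g)) x ≡ evalℤ (deriv f) x * evalℤ g x + evalℤ f x * evalℤ (deriv g) x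
eval-deriv-⊗ [] g x = trans refl (sym (lem (evalℤ g x) (evalℤ (deriv g) x)))
  where lem : ∀ u v → + 0 * u + + 0 * v ≡ + 0
        lem = solve-∀
eval-deriv-⊗ (a ∷ f) g x rewrite eval-deriv-⊕ (scale a g) (+ 0 ∷ (f ⊗ g)) x | eval-deriv-scale a g x | eval-deriv-∷ (+ 0) (f ⊗ g) x
  | eval-⊗ f g x | eval-deriv-⊗ f g x | eval-deriv-∷ a f x = lem a x (evalℤ f x) (evalℤ g x) (evalℤ (deriv f) x) (evalℤ (deriv g) x)
  where lem : ∀ a x f g f′ g′ → a * g′ + (f * g + x * (f′ * g + f * g′)) ≡ (f + x * f′) * g + (a + x * f) * g′
        lem = solve-∀

pow : ZPoly → ℕ → ZPoly
pow f zero = + 1 ∷ []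
pow f (suc k) = f ⊗ pow f k

eval-pow : ∀ f k x → evalℤ (pow f k) x ≡ evalℤ f x ^ k
eval-pow f zero x = lem x
  where lem : ∀ x → + 1 + x * + 0 ≡ + 1
        lem = solve-∀
eval-pow f (suc k) x = trans (eval-⊗ f (pow f k) x) (cong (evalℤ f x *_) (eval-pow f k x))

length-pow : ∀ f k {ℓ} → length f ℕ.≤ ℓ → length (pow f k) ℕ.≤ k ℕ.* ℓ ℕ.+ 1
length-pow f zero h = ℕₚ.≤-refl
length-pow f (suc k) {ℓ} h = ℕₚ.≤-trans (length-⊗ f (pow f k) h (length-pow f k h)) (ℕₚ.≤-reflexive (sym (ℕₚ.+-assoc ℓ (k ℕ.* ℓ) 1)))

eval-deriv-pow : ∀ f k x → evalℤ (deriv (pow f k)) x ≡ + k * (evalℤ f x ^ ℕ.pred k * evalℤ (deriv f) x)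
eval-deriv-pow f zero x = lem x (evalℤ (deriv f) x)
  where lem : ∀ x f′ → + 0 + x * + 0 ≡ + 0 * (+ 1 * f′)
        lem = solve-∀
eval-deriv-pow f (suc k) x rewrite eval-deriv-⊗ f (pow f k) x | eval-pow f k x | eval-deriv-pow f k x = go k
  where
  u = evalℤ f x
  u′ = evalℤ (deriv f) x
  lem : ∀ u u′ → u′ * + 1 + u * (+ 0 * (+ 1 * u′)) ≡ + 1 * (+ 1 * u′)
  lem = solve-∀
  lem₂ : ∀ u u′ v k → u′ * (u * v) + u * (k * (v * u′)) ≡ (+ 1 + k) * ((u * v) * u′)
  lem₂ = solve-∀
  go : ∀ k → u′ * u ^ k + u * (+ k * (u ^ ℕ.pred k * u′)) ≡ + suc k * (u ^ k * u′)
  go zero = lem u u′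
  go (suc k) = lem₂ u u′ (u ^ k) (+ suc k)

length-deriv : ∀ f {d} → length f ℕ.≤ d → length (deriv f) ℕ.≤ d
length-deriv [] h = h
length-deriv (c ∷ f) {suc d} (ℕ.s≤s h) = length-⊕ f (+ 0 ∷ deriv f) (ℕₚ.≤-trans h (ℕₚ.n≤1+n d)) (ℕ.s≤s (length-deriv f h))

-- The numerator of the derivative of E/G over the denominator G².
wronskian : ZPoly → ZPoly → ZPoly
wronskian E G = (deriv E ⊗ G) ⊕ scale (- (+ 1)) (E ⊗ deriv G)

eval-wronskian : ∀ E G t → evalℤ (wronskian E G) t ≡ evalℤ (deriv E) t * evalℤ G t - evalℤ E t * evalℤ (deriv G) t
eval-wronskian E G t = trans (eval-⊕ (deriv E ⊗ G) _ t) (cong₂ _+_ (eval-⊗ (deriv E) G t)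
   (trans (eval-scale (- (+ 1)) (E ⊗ deriv G) t) (trans (ℤₚ.-1*i≡-i _) (cong -_ (eval-⊗ E (deriv G) t)))))

length-wronskian : ∀ E G {ℓ m} → length E ℕ.≤ ℓ → length G ℕ.≤ m → length (wronskian E G) ℕ.≤ ℓ ℕ.+ m
length-wronskian E G h k = length-⊕ (deriv E ⊗ G) _ (length-⊗ (deriv E) G (length-deriv E h) k)
  (length-scale (- (+ 1)) (E ⊗ deriv G) (length-⊗ E (deriv G) h (length-deriv G k)))

sumₚ : ∀ {n} → (Fin n → ZPoly) → ZPoly
sumₚ {zero} f = []
sumₚ {suc n} f = f zero ⊕ sumₚ (f ∘ suc)

eval-sumₚ : ∀ {n} (f : Fin n → ZPoly) x → evalℤ (sumₚ f) x ≡ sum (λ i → evalℤ (f i) x)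
eval-sumₚ {zero} f x = refl
eval-sumₚ {suc n} f x = trans (eval-⊕ (f zero) _ x) (cong (λ w → evalℤ (f zero) x + w) (eval-sumₚ (f ∘ suc) x))

eval-deriv-sumₚ : ∀ {n} (f : Fin n → ZPoly) x → evalℤ (deriv (sumₚ f)) x ≡ sum (λ i → evalℤ (deriv (f i)) x)
eval-deriv-sumₚ {zero} f x = refl
eval-deriv-sumₚ {suc n} f x = trans (eval-deriv-⊕ (f zero) _ x) (cong (λ w → evalℤ (deriv (f zero)) x + w) (eval-deriv-sumₚ (f ∘ suc) x))

length-sumₚ : ∀ {n d} (f : Fin n → ZPoly) → (∀ i → length (f i) ℕ.≤ d) → length (sumₚ f) ℕ.≤ d
length-sumₚ {zero} f h = ℕ.z≤n
length-sumₚ {suc n} f h = length-⊕ (f zero) _ (h zero) (length-sumₚ (f ∘ suc) (h ∘ suc))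

sum-shift : ∀ n (F : ℕ → ℤ) → sum {n} (λ i → F (suc (toℕ i))) + F 0 ≡ sum {n} (λ i → F (toℕ i)) + F n
sum-shift zero F = refl
sum-shift (suc n) F = trans (lem (F 1) _ (F 0)) (trans (cong (λ w → F 0 + w) (sum-shift n (F ∘ suc))) (sym (ℤₚ.+-assoc (F 0) _ _)))
  where lem : ∀ a s b → (a + s) + b ≡ b + (s + a)
        lem = solve-∀

module PolyDomain (p : ℕ) .{{_ : NonZero p}} (1<p : 1 ℕ.< p) (dom : IsDomain p) where
  open Vanishing p 1<p dom public

  Zero : ZPoly → Set
  Zero f = ∀ x → evalℤ f x ≈0

  zero⇒coeffs : ∀ {T} f → Large T → length f ℕ.≤ T → Zero f → All _≈0 f
  zero⇒coeffs f L l h = vanish-coeffs {a = 0} f L l (λ k _ → h (+ k))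

  coeffs-deriv : ∀ {f} → All _≈0 f → ∀ x → evalℤ (deriv f) x ≈0
  coeffs-deriv [] x = 0≈0
  coeffs-deriv {c ∷ f} (h ∷ hs) x = subst _≈0 (sym (eval-deriv-∷ c f x)) (≈0-+ (eval-≈0 hs x) (≈0-* x (coeffs-deriv hs x)))

  zero-deriv : ∀ {T} f → Large T → length f ℕ.≤ T → Zero f → Zero (deriv f)
  zero-deriv f L l h = coeffs-deriv (zero⇒coeffs f L l h)

  -- Each of T distinct points is a root of f or of g, and T is at least the sum of the two lengths,
  -- so one of the two has as many roots as its length.
  zero-product : ∀ {T} f g → Large T → length f ℕ.+ length g ℕ.≤ T → (∀ x → evalℤ f x * evalℤ g x ≈0) → Zero f ⊎ Zero g
  zero-product {T} f g L l h with length f ℕ.≤? length (ys q)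
    where q = split {P = λ r → evalℤ f r ≈0} {Q = λ r → evalℤ g r ≈0} (range 0 T) (range-distinct T 0 ℕₚ.≤-refl L) (All.universal (λ r → dom (h r)) (range 0 T))
  ... | yes f≤ = inj₁ (eval-≈0 (roots⇒≈0 f (ys q) (pairsˡ q) f≤ (allˡ q)))
    where q = split {P = λ r → evalℤ f r ≈0} {Q = λ r → evalℤ g r ≈0} (range 0 T) (range-distinct T 0 ℕₚ.≤-refl L) (All.universal (λ r → dom (h r)) (range 0 T))
  ... | no f≰ = inj₂ (eval-≈0 (roots⇒≈0 g (zs q) (pairsʳ q) g≤ (allʳ q)))
    where
    q = split {P = λ r → evalℤ f r ≈0} {Q = λ r → evalℤ g r ≈0} (range 0 T) (range-distinct T 0 ℕₚ.≤-refl L) (All.universal (λ r → dom (h r)) (range 0 T))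
    g≤ : length g ℕ.≤ length (zs q)
    g≤ = ℕₚ.+-cancelˡ-≤ (length (ys q)) _ _ (ℕₚ.≤-trans (ℕₚ.+-monoˡ-≤ (length g) (ℕₚ.<⇒≤ (ℕₚ.≰⇒> f≰)))
       (ℕₚ.≤-trans l (ℕₚ.≤-reflexive (trans (sym (length-range T 0)) (lengths q)))))

  eval-deriv-quot : ∀ c cs r x → evalℤ (deriv (c ∷ cs)) x ≡ evalℤ (quot cs r) x + (x - r) * evalℤ (deriv (quot cs r)) x
  eval-deriv-quot c [] r x = lem x r
    where lem : ∀ x r → + 0 + x * + 0 ≡ + 0 + (x - r) * + 0
          lem = solve-∀
  eval-deriv-quot c (d ∷ ds) r x = trans (eval-deriv-∷ c (d ∷ ds) x)
     (trans (cong₂ (λ u v → u + x * v) (eval-quot d ds r x) (eval-deriv-quot d ds r x))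
     (trans (lem x r (evalℤ (d ∷ ds) r) (evalℤ (quot ds r) x) (evalℤ (deriv (quot ds r)) x))
     (cong (λ w → evalℤ (quot (d ∷ ds) r) x + (x - r) * w) (sym (eval-deriv-∷ (evalℤ (d ∷ ds) r) (quot ds r) x)))))
    where lem : ∀ x r g q q′ → (g + (x - r) * q) + x * (q + (x - r) * q′) ≡ (g + x * q) + (x - r) * (q + x * q′)
          lem = solve-∀

  divide-root : ∀ {T} f y → Large T → suc (length f) ℕ.≤ T → (∀ x → (x - + y) * evalℤ f x ≈0) → Zero f
  divide-root {T} f y L l h = eval-≈0 (vanish-coeffs {length f} {suc y} f (λ k 0<k k<d → L k 0<k (ℕₚ.<-≤-trans k<d (ℕₚ.≤-trans (ℕₚ.n≤1+n _) l))) ℕₚ.≤-refl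
     (λ k k<d → cancel (λ e → L (suc k) (ℕ.s≤s ℕ.z≤n) (ℕₚ.<-≤-trans (ℕ.s≤s k<d) l) (subst _≈0 (lem (+ y) (+ k)) e)) (h (+ (suc y ℕ.+ k)))))
    where lem : ∀ y k → (+ 1 + (y + k)) - y ≡ + 1 + k
          lem = solve-∀

  -- The hypothesis is the Wronskian of (t - y)ᵏU and G, divided by (t - y)ᵏ⁻¹. At t = y it reads
  -- k·U(y)·G(y) = 0, so U = (t - y)q modulo p, and dividing by t - y gives the same hypothesis for
  -- q and k + 1. As k + length U stays constant, k remains invertible throughout.
  lowest-coefficient : ∀ {T} n k U G y → length U ℕ.≤ n → Large T → ¬ evalℤ G (+ y) ≈0 → 0 ℕ.< k → k ℕ.+ length U ℕ.+ (length G ℕ.+ 4) ℕ.≤ T →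
    (∀ t → (+ k * evalℤ U t + (t - + y) * evalℤ (deriv U) t) * evalℤ G t - (t - + y) * evalℤ U t * evalℤ (deriv G) t ≈0) → Zero U
  lowest-coefficient n k [] G y _ L gy 0<k l h = λ _ → 0≈0
  lowest-coefficient {T} (suc n) k (u ∷ us) G y (ℕ.s≤s us≤n) L gy 0<k l h = λ t → subst _≈0 (sym (eval-quot u us r t)) (≈0-+ Ur (≈0-* (t - r) (IH t)))
    where
    r = + y
    U = u ∷ us
    q = quot us r
    X : ZPoly
    X = - r ∷ + 1 ∷ []
    lem₀ : ∀ k U U′ G G′ r → (k * U + (r - r) * U′) * G - (r - r) * U * G′ ≡ k * (U * G)
    lem₀ = solve-∀
    k≉0 : ¬ (+ k ≈0)
    k≉0 = L k 0<k (ℕₚ.<-≤-trans (ℕₚ.m<m+n k (ℕ.s≤s ℕ.z≤n)) (ℕₚ.≤-trans (ℕₚ.m≤m+n (k ℕ.+ length U) _) l))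
    Ur : evalℤ U r ≈0
    Ur = cancel gy (subst _≈0 (ℤₚ.*-comm (evalℤ U r) (evalℤ G r)) (cancel k≉0
       (subst _≈0 (lem₀ (+ k) (evalℤ U r) (evalℤ (deriv U) r) (evalℤ G r) (evalℤ (deriv G) r) r) (h r))))
    -- The left-hand side of the hypothesis for q and k + 1, as a coefficient list: `divide-root`
    -- needs a polynomial of known length.
    bracket : ZPoly
    bracket = ((scale (+ suc k) q ⊕ (X ⊗ deriv q)) ⊗ G) ⊕ scale (- (+ 1)) ((X ⊗ q) ⊗ deriv G)
    length-q : length q ℕ.≤ length us
    length-q = ℕₚ.≤-reflexive (length-quot us r)
    bracket-length : length bracket ℕ.≤ (2 ℕ.+ length us) ℕ.+ length G
    bracket-length = length-⊕ ((scale (+ suc k) q ⊕ (X ⊗ deriv q)) ⊗ G) _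
      (length-⊗ (scale (+ suc k) q ⊕ (X ⊗ deriv q)) G (length-⊕ (scale (+ suc k) q) _ (length-scale (+ suc k) q (ℕₚ.≤-trans length-q (ℕₚ.m≤n+m _ 2)))
         (length-⊗ X (deriv q) {2} ℕₚ.≤-refl (length-deriv q length-q))) ℕₚ.≤-refl)
      (length-scale (- (+ 1)) ((X ⊗ q) ⊗ deriv G) (length-⊗ (X ⊗ q) (deriv G) (length-⊗ X q {2} ℕₚ.≤-refl length-q) (length-deriv G ℕₚ.≤-refl)))
    bracket-eval : ∀ t → evalℤ bracket t ≡ (+ suc k * evalℤ q t + (t - r) * evalℤ (deriv q) t) * evalℤ G t - (t - r) * evalℤ q t * evalℤ (deriv G) t
    bracket-eval t rewrite eval-⊕ ((scale (+ suc k) q ⊕ (X ⊗ deriv q)) ⊗ G) (scale (- (+ 1)) ((X ⊗ q) ⊗ deriv G)) t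
      | eval-⊗ (scale (+ suc k) q ⊕ (X ⊗ deriv q)) G t | eval-⊕ (scale (+ suc k) q) (X ⊗ deriv q) t | eval-scale (+ suc k) q t | eval-⊗ X (deriv q) t
      | eval-scale (- (+ 1)) ((X ⊗ q) ⊗ deriv G) t | eval-⊗ (X ⊗ q) (deriv G) t | eval-⊗ X q t
      = lem t r (+ suc k) (evalℤ q t) (evalℤ (deriv q) t) (evalℤ G t) (evalℤ (deriv G) t)
      where lem : ∀ t r k q q′ G G′ → (k * q + (- r + t * (+ 1 + t * + 0)) * q′) * G + - (+ 1) * ((- r + t * (+ 1 + t * + 0)) * q * G′) ≡ (k * q + (t - r) * q′) * G - (t - r) * q * G′
            lem = solve-∀
    bracket-zero : Zero bracket
    bracket-zero = divide-root bracket y L (ℕₚ.≤-trans (ℕ.s≤s bracket-length)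
        (ℕₚ.≤-trans (ℕₚ.≤-trans (ℕₚ.m≤m+n _ (k ℕ.+ 2)) (ℕₚ.≤-reflexive (eqn k (length us) (length G)))) l))
      (λ t → subst _≈0 (trans (cong₂ (λ U U′ → ((+ k * U + (t - r) * U′) * evalℤ G t - (t - r) * U * evalℤ (deriv G) t) - evalℤ (u ∷ us) r * (+ k * evalℤ G t - (t - r) * evalℤ (deriv G) t)) (eval-quot u us r t) (eval-deriv-quot u us r t))
         (trans (lem (+ k) (evalℤ U r) t r (evalℤ q t) (evalℤ (deriv q) t) (evalℤ G t) (evalℤ (deriv G) t)) (cong ((t - r) *_) (sym (bracket-eval t)))))
        (≈0-- (h t) (≈0-*ʳ (+ k * evalℤ G t - (t - r) * evalℤ (deriv G) t) Ur)))
      where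
      eqn : ∀ k u g → suc (2 ℕ.+ u ℕ.+ g) ℕ.+ (k ℕ.+ 2) ≡ k ℕ.+ suc u ℕ.+ (g ℕ.+ 4)
      eqn = ℕS.solve-∀
      lem : ∀ k v t r q q′ G G′ → ((k * (v + (t - r) * q) + (t - r) * (q + (t - r) * q′)) * G - (t - r) * (v + (t - r) * q) * G′) - v * (k * G - (t - r) * G′)
            ≡ (t - r) * (((+ 1 + k) * q + (t - r) * q′) * G - (t - r) * q * G′)
      lem = solve-∀
    IH : Zero q
    IH = lowest-coefficient n (suc k) q G y (ℕₚ.≤-trans length-q us≤n) L gy (ℕ.s≤s ℕ.z≤n)
      (ℕₚ.≤-trans (ℕₚ.≤-reflexive (trans (cong (λ m → suc k ℕ.+ m ℕ.+ (length G ℕ.+ 4)) (length-quot us r)) (cong (ℕ._+ (length G ℕ.+ 4)) (sym (ℕₚ.+-suc k (length us)))))) l)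
      (λ t → subst _≈0 (bracket-eval t) (bracket-zero t))

  -- A fraction with zero derivative is constant. H = G(y)·E - E(y)·G vanishes at y and still has
  -- zero Wronskian with G, so its order at y cannot be finite. Largeness of the characteristic
  -- excludes fractions such as tᵖ.
  zero-wronskian : ∀ {T ℓ} E G y → Large T → length E ℕ.≤ ℓ → length G ℕ.≤ ℓ → ℓ ℕ.+ ℓ ℕ.+ 5 ℕ.≤ T → ¬ evalℤ G (+ y) ≈0 →
    Zero (wronskian E G) → ∀ t → evalℤ G (+ y) * evalℤ E t - evalℤ E (+ y) * evalℤ G t ≈0
  zero-wronskian {T} {ℓ} E G y L lE lG l gy h t = subst _≈0 (H-eval t) (go H refl t)
    where
    g = evalℤ G (+ y)
    e = evalℤ E (+ y)
    H = scale g E ⊕ scale (- e) G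
    H-eval : ∀ t → evalℤ H t ≡ g * evalℤ E t - e * evalℤ G t
    H-eval t = trans (eval-⊕ (scale g E) (scale (- e) G) t) (cong₂ _+_ (eval-scale g E t) (trans (eval-scale (- e) G t) (sym (ℤₚ.neg-distribˡ-* e (evalℤ G t)))))
    H′-eval : ∀ t → evalℤ (deriv H) t ≡ g * evalℤ (deriv E) t - e * evalℤ (deriv G) t
    H′-eval t = trans (eval-deriv-⊕ (scale g E) (scale (- e) G) t) (cong₂ _+_ (eval-deriv-scale g E t) (trans (eval-deriv-scale (- e) G t) (sym (ℤₚ.neg-distribˡ-* e (evalℤ (deriv G) t)))))
    H-root : evalℤ H (+ y) ≡ + 0
    H-root = trans (H-eval (+ y)) (lem g e)
      where lem : ∀ g e → g * e - e * g ≡ + 0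
            lem = solve-∀
    H-length : length H ℕ.≤ ℓ
    H-length = length-⊕ (scale g E) _ (length-scale g E lE) (length-scale (- e) G lG)
    W-H : ∀ t → evalℤ (deriv H) t * evalℤ G t - evalℤ H t * evalℤ (deriv G) t ≈0
    W-H t = subst _≈0 (sym (trans (cong₂ (λ a b → a * evalℤ G t - b * evalℤ (deriv G) t) (H′-eval t) (H-eval t))
        (trans (lem g e (evalℤ E t) (evalℤ (deriv E) t) (evalℤ G t) (evalℤ (deriv G) t)) (cong (g *_) (sym (eval-wronskian E G t)))))) (≈0-* g (h t))
      where lem : ∀ g e E E′ G G′ → (g * E′ - e * G′) * G - (g * E - e * G) * G′ ≡ g * (E′ * G - E * G′)
            lem = solve-∀
    go : ∀ H′ → H ≡ H′ → Zero H′
    go [] eq = λ _ → 0≈0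
    go (c ∷ cs) eq = λ t → subst _≈0 (sym (eval-quot c cs (+ y) t)) (≈0-+ root (≈0-* (t - + y) (U-zero t)))
      where
      U = quot cs (+ y)
      root : evalℤ (c ∷ cs) (+ y) ≈0
      root = subst _≈0 (trans (sym H-root) (cong (λ K → evalℤ K (+ y)) eq)) 0≈0
      bound′ : 1 ℕ.+ length U ℕ.+ (length G ℕ.+ 4) ℕ.≤ T
      bound′ = ℕₚ.≤-trans (ℕₚ.+-mono-≤ (ℕₚ.≤-trans (ℕₚ.≤-reflexive (trans (cong suc (length-quot cs (+ y))) (cong length (sym eq)))) H-length) (ℕₚ.+-monoˡ-≤ 4 lG))
        (ℕₚ.≤-trans (ℕₚ.≤-reflexive (sym (ℕₚ.+-assoc ℓ ℓ 4))) (ℕₚ.≤-trans (ℕₚ.+-monoʳ-≤ (ℓ ℕ.+ ℓ) (ℕₚ.n≤1+n 4)) l))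
      U-zero : Zero U
      U-zero = lowest-coefficient (length U) 1 U G y ℕₚ.≤-refl L gy (ℕ.s≤s ℕ.z≤n) bound′ (λ t → subst _≈0
         (trans (cong₂ (λ a b → (a * evalℤ G t - b * evalℤ (deriv G) t) + evalℤ (c ∷ cs) (+ y) * evalℤ (deriv G) t)
             (trans (cong (λ K → evalℤ (deriv K) t) eq) (eval-deriv-quot c cs (+ y) t)) (trans (cong (λ K → evalℤ K t) eq) (eval-quot c cs (+ y) t)))
            (lem (evalℤ (c ∷ cs) (+ y)) (t - + y) (evalℤ U t) (evalℤ (deriv U) t) (evalℤ G t) (evalℤ (deriv G) t)))
         (≈0-+ (W-H t) (≈0-*ʳ (evalℤ (deriv G) t) root)))
        where lem : ∀ v s U U′ G G′ → ((U + s * U′) * G - (v + s * U) * G′) + v * G′ ≡ (+ 1 * U + s * U′) * G - s * U * G′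
              lem = solve-∀

-- No rational function is the exponential of another one

sum-+ : ∀ {n} (f g : Fin n → ℤ) → sum (λ i → f i + g i) ≡ sum f + sum g
sum-+ {zero} f g = refl
sum-+ {suc n} f g = trans (cong (λ w → (f zero + g zero) + w) (sum-+ (f ∘ suc) (g ∘ suc))) (lem (f zero) (g zero) (sum (f ∘ suc)) (sum (g ∘ suc)))
  where lem : ∀ a b s t → (a + b) + (s + t) ≡ (a + s) + (b + t)
        lem = solve-∀

double-sum : ℕ → (ℕ → ℕ → ℤ) → ℤ
double-sum N F = sum {N} (λ i → sum {N} (λ j → F (toℕ i) (toℕ j)))

double-sum-+ : ∀ N (F H : ℕ → ℕ → ℤ) → double-sum N (λ i j → F i j + H i j) ≡ double-sum N F + double-sum N H
double-sum-+ N F H = trans (sum-cong-≗ {N} (λ i → sum-+ {N} (λ j → F (toℕ i) (toℕ j)) (λ j → H (toℕ i) (toℕ j)))) (sum-+ {N} (λ i → sum {N} (λ j → F (toℕ i) (toℕ j))) (λ i → sum {N} (λ j → H (toℕ i) (toℕ j))))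

double-sum-* : ∀ N x (F : ℕ → ℕ → ℤ) → x * double-sum N F ≡ double-sum N (λ i j → x * F i j)
double-sum-* N x F = trans (*-distribˡ-sum {N} x (λ i → sum {N} (λ j → F (toℕ i) (toℕ j)))) (sum-cong-≗ {N} (λ i → *-distribˡ-sum {N} x (λ j → F (toℕ i) (toℕ j))))

-- This is g² times the derivative of gᵐ(e/g)ⁱ: the first term comes from gᵐ, the second from
-- (e/g)ⁱ. For i = 0 the truncated exponent `pred i` is harmless, because it is multiplied by i.
derive-power-quotient : ∀ i k {m} e e′ g g′ → m ≡ i ℕ.+ k →
  g * g * ((+ i * (e ^ ℕ.pred i * e′)) * g ^ k + e ^ i * (+ k * (g ^ ℕ.pred k * g′)))
  ≡ + m * (g * g′) * (e ^ i * g ^ k) + (e′ * g - e * g′) * (+ i * (e ^ ℕ.pred i * g ^ (m ℕ.∸ ℕ.pred i)))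
derive-power-quotient zero zero e e′ g g′ refl = lem e e′ g g′
  where lem : ∀ e e′ g g′ → g * g * ((+ 0 * (+ 1 * e′)) * + 1 + + 1 * (+ 0 * (+ 1 * g′))) ≡ + 0 * (g * g′) * (+ 1 * + 1) + (e′ * g - e * g′) * (+ 0 * (+ 1 * + 1))
        lem = solve-∀
derive-power-quotient zero (suc k) e e′ g g′ refl = lem e e′ g g′ (g ^ k) (+ suc k)
  where lem : ∀ e e′ g g′ y k → g * g * ((+ 0 * (+ 1 * e′)) * (g * y) + + 1 * (k * (y * g′))) ≡ k * (g * g′) * (+ 1 * (g * y)) + (e′ * g - e * g′) * (+ 0 * (+ 1 * (g * y)))
        lem = solve-∀
derive-power-quotient (suc i) zero e e′ g g′ refl = trans (lem e e′ g g′ (e ^ i) (+ suc i))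
   (cong₂ (λ a b → + a * (g * g′) * (e ^ suc i * + 1) + (e′ * g - e * g′) * (+ suc i * (e ^ i * b))) (sym (ℕₚ.+-identityʳ (suc i)))
     (sym (trans (cong (g ^_) (trans (cong (ℕ._∸ i) (ℕₚ.+-comm (suc i) 0)) (ℕₚ.m+n∸n≡m 1 i))) refl)))
  where lem : ∀ e e′ g g′ x n → g * g * ((n * (x * e′)) * + 1 + (e * x) * (+ 0 * (+ 1 * g′))) ≡ n * (g * g′) * ((e * x) * + 1) + (e′ * g - e * g′) * (n * (x * (g * + 1)))
        lem = solve-∀
derive-power-quotient (suc i) (suc k) e e′ g g′ refl = trans (lem e e′ g g′ (e ^ i) (g ^ k) (+ suc i) (+ suc k))
   (cong (λ b → (+ suc i + + suc k) * (g * g′) * (e ^ suc i * g ^ suc k) + (e′ * g - e * g′) * (+ suc i * (e ^ i * b))) (sym (cong (g ^_) (trans (cong (ℕ._∸ i) (shift i k)) (ℕₚ.m+n∸n≡m (suc (suc k)) i)))))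
  where lem : ∀ e e′ g g′ x y n k → g * g * ((n * (x * e′)) * (g * y) + (e * x) * (k * (y * g′))) ≡ (n + k) * (g * g′) * ((e * x) * (g * y)) + (e′ * g - e * g′) * (n * (x * (g * (g * y))))
        lem = solve-∀
        shift : ∀ i k → suc i ℕ.+ suc k ≡ suc (suc k) ℕ.+ i
        shift = ℕS.solve-∀

-- If (a/b)′ were (a/b)·w/g², then b·g² times the derivative of bᵐ(a/b)ʲ would be the bracket
-- subtracted on the left. The difference is therefore a multiple of the defect in that differential
-- equation.
derive-product : ∀ j k {m} a a′ b b′ g w → m ≡ j ℕ.+ k →
  b * (g * g) * ((+ j * (a ^ ℕ.pred j * a′)) * b ^ k + a ^ j * (+ k * (b ^ ℕ.pred k * b′)))
  - (+ m * (g * g * b′) * (a ^ j * b ^ k) + w * b * (+ j * (a ^ j * b ^ k)))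
  ≡ (+ j * (a ^ ℕ.pred j * b ^ k)) * ((a′ * b - a * b′) * (g * g) - a * b * w)
derive-product zero zero a a′ b b′ g w refl = lem a a′ b b′ g w
  where lem : ∀ a a′ b b′ g w → b * (g * g) * ((+ 0 * (+ 1 * a′)) * + 1 + + 1 * (+ 0 * (+ 1 * b′))) - (+ 0 * (g * g * b′) * (+ 1 * + 1) + w * b * (+ 0 * (+ 1 * + 1))) ≡ (+ 0 * (+ 1 * + 1)) * ((a′ * b - a * b′) * (g * g) - a * b * w)
        lem = solve-∀
derive-product zero (suc k) a a′ b b′ g w refl = lem a a′ b b′ g w (b ^ k) (+ suc k)
  where lem : ∀ a a′ b b′ g w y k → b * (g * g) * ((+ 0 * (+ 1 * a′)) * (b * y) + + 1 * (k * (y * b′))) - (k * (g * g * b′) * (+ 1 * (b * y)) + w * b * (+ 0 * (+ 1 * (b * y)))) ≡ (+ 0 * (+ 1 * (b * y))) * ((a′ * b - a * b′) * (g * g) - a * b * w)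
        lem = solve-∀
derive-product (suc j) zero a a′ b b′ g w refl = trans (cong (λ m → b * (g * g) * ((+ suc j * (a ^ j * a′)) * + 1 + a ^ suc j * (+ 0 * (+ 1 * b′))) - (+ m * (g * g * b′) * (a ^ suc j * + 1) + w * b * (+ suc j * (a ^ suc j * + 1)))) (ℕₚ.+-identityʳ (suc j)))
    (lem a a′ b b′ g w (a ^ j) (+ suc j))
  where lem : ∀ a a′ b b′ g w x n → b * (g * g) * ((n * (x * a′)) * + 1 + (a * x) * (+ 0 * (+ 1 * b′))) - (n * (g * g * b′) * ((a * x) * + 1) + w * b * (n * ((a * x) * + 1))) ≡ (n * (x * + 1)) * ((a′ * b - a * b′) * (g * g) - a * b * w)
        lem = solve-∀
derive-product (suc j) (suc k) a a′ b b′ g w refl = lem a a′ b b′ g w (a ^ j) (b ^ k) (+ suc j) (+ suc k)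
  where lem : ∀ a a′ b b′ g w x y n k → b * (g * g) * ((n * (x * a′)) * (b * y) + (a * x) * (k * (y * b′))) - ((n + k) * (g * g * b′) * ((a * x) * (b * y)) + w * b * (n * ((a * x) * (b * y)))) ≡ (n * (x * (b * y))) * ((a′ * b - a * b′) * (g * g) - a * b * w)
        lem = solve-∀

relation-degree : (ℓ N : ℕ) → ℕ
relation-degree ℓ N = (N ℕ.* ℓ ℕ.+ 2) ℕ.+ (N ℕ.* ℓ ℕ.+ 2)

-- With f = E/G and m = A/B, the hypothesis reads m′/m = f′: then m = exp f, and the
-- algebraic relation between f and m forced by a dimension count is destroyed by
-- applying ∂_f + m∂_m − b repeatedly.
module Exponential
  (p : ℕ) .{{_ : NonZero p}} (1<p : 1 ℕ.< p) (dom : IsDomain p)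
  (A B E G : ZPoly) (ℓ N T : ℕ)
  (lA : length A ℕ.≤ ℓ) (lB : length B ℕ.≤ ℓ) (lE : length E ℕ.≤ ℓ) (lG : length G ℕ.≤ ℓ)
  where
  open PolyDomain p 1<p dom

  -- The product fⁱmʲ brought to the common denominator GᴺBᴺ, with f = E/G and m = A/B.
  monomial : ℕ → ℕ → ZPoly
  monomial i j = (pow E i ⊗ pow G (N ℕ.∸ i)) ⊗ (pow A j ⊗ pow B (N ℕ.∸ j))

  M : ℕ → ℕ → ℤ → ℤ
  M i j t = (evalℤ E t ^ i * evalℤ G t ^ (N ℕ.∸ i)) * (evalℤ A t ^ j * evalℤ B t ^ (N ℕ.∸ j))

  eval-half : ∀ F H i k t → evalℤ (pow F i ⊗ pow H k) t ≡ evalℤ F t ^ i * evalℤ H t ^ k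
  eval-half F H i k t = trans (eval-⊗ (pow F i) (pow H k) t) (cong₂ _*_ (eval-pow F i t) (eval-pow H k t))

  eval-monomial : ∀ i j t → evalℤ (monomial i j) t ≡ M i j t
  eval-monomial i j t = trans (eval-⊗ (pow E i ⊗ pow G (N ℕ.∸ i)) _ t) (cong₂ _*_ (eval-half E G i (N ℕ.∸ i) t) (eval-half A B j (N ℕ.∸ j) t))

  length-half : ∀ F H i → length F ℕ.≤ ℓ → length H ℕ.≤ ℓ → i ℕ.≤ N → length (pow F i ⊗ pow H (N ℕ.∸ i)) ℕ.≤ N ℕ.* ℓ ℕ.+ 2
  length-half F H i lF lH i≤N = ℕₚ.≤-trans (length-⊗ (pow F i) (pow H (N ℕ.∸ i)) (length-pow F i lF) (length-pow H (N ℕ.∸ i) lH))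
    (ℕₚ.≤-reflexive (trans (lem i (N ℕ.∸ i) ℓ) (cong (λ m → m ℕ.* ℓ ℕ.+ 2) (ℕₚ.m+[n∸m]≡n i≤N))))
    where lem : ∀ i k ℓ → (i ℕ.* ℓ ℕ.+ 1) ℕ.+ (k ℕ.* ℓ ℕ.+ 1) ≡ (i ℕ.+ k) ℕ.* ℓ ℕ.+ 2
          lem = ℕS.solve-∀

  length-monomial : ∀ i j → i ℕ.≤ N → j ℕ.≤ N → length (monomial i j) ℕ.≤ relation-degree ℓ N
  length-monomial i j i≤ j≤ = length-⊗ (pow E i ⊗ pow G (N ℕ.∸ i)) (pow A j ⊗ pow B (N ℕ.∸ j)) (length-half E G i lE lG i≤) (length-half A B j lA lB j≤)

  half′ : ZPoly → ZPoly → ℕ → ℕ → ℤ → ℤ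
  half′ F H i k t = (+ i * (evalℤ F t ^ ℕ.pred i * evalℤ (deriv F) t)) * evalℤ H t ^ k + evalℤ F t ^ i * (+ k * (evalℤ H t ^ ℕ.pred k * evalℤ (deriv H) t))

  M′ : ℕ → ℕ → ℤ → ℤ
  M′ i j t = half′ E G i (N ℕ.∸ i) t * (evalℤ A t ^ j * evalℤ B t ^ (N ℕ.∸ j)) + (evalℤ E t ^ i * evalℤ G t ^ (N ℕ.∸ i)) * half′ A B j (N ℕ.∸ j) t

  eval-deriv-half : ∀ F H i k t → evalℤ (deriv (pow F i ⊗ pow H k)) t ≡ half′ F H i k t
  eval-deriv-half F H i k t = trans (eval-deriv-⊗ (pow F i) (pow H k) t)
    (cong₂ _+_ (cong₂ _*_ (eval-deriv-pow F i t) (eval-pow H k t)) (cong₂ _*_ (eval-pow F i t) (eval-deriv-pow H k t)))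

  eval-deriv-monomial : ∀ i j t → evalℤ (deriv (monomial i j)) t ≡ M′ i j t
  eval-deriv-monomial i j t = trans (eval-deriv-⊗ (pow E i ⊗ pow G (N ℕ.∸ i)) (pow A j ⊗ pow B (N ℕ.∸ j)) t)
    (cong₂ _+_ (cong₂ _*_ (eval-deriv-half E G i (N ℕ.∸ i) t) (eval-half A B j (N ℕ.∸ j) t)) (cong₂ _*_ (eval-half E G i (N ℕ.∸ i) t) (eval-deriv-half A B j (N ℕ.∸ j) t)))

  relation : (ℕ → ℕ → ℤ) → ZPoly
  relation c = sumₚ {N} (λ i → sumₚ {N} (λ j → scale (c (toℕ i) (toℕ j)) (monomial (toℕ i) (toℕ j))))

  eval-relation : ∀ c t → evalℤ (relation c) t ≡ double-sum N (λ i j → c i j * M i j t)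
  eval-relation c t = trans (eval-sumₚ {N} _ t) (sum-cong-≗ {N} (λ i → trans (eval-sumₚ {N} _ t) (sum-cong-≗ {N} (λ j →
    trans (eval-scale (c (toℕ i) (toℕ j)) (monomial (toℕ i) (toℕ j)) t) (cong (c (toℕ i) (toℕ j) *_) (eval-monomial (toℕ i) (toℕ j) t))))))

  eval-deriv-relation : ∀ c t → evalℤ (deriv (relation c)) t ≡ double-sum N (λ i j → c i j * M′ i j t)
  eval-deriv-relation c t = trans (eval-deriv-sumₚ {N} _ t) (sum-cong-≗ {N} (λ i → trans (eval-deriv-sumₚ {N} _ t) (sum-cong-≗ {N} (λ j →
    trans (eval-deriv-scale (c (toℕ i) (toℕ j)) (monomial (toℕ i) (toℕ j)) t) (cong (c (toℕ i) (toℕ j) *_) (eval-deriv-monomial (toℕ i) (toℕ j) t))))))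

  length-relation : ∀ c → length (relation c) ℕ.≤ relation-degree ℓ N
  length-relation c = length-sumₚ {N} _ (λ i → length-sumₚ {N} _ (λ j → length-scale (c (toℕ i) (toℕ j)) (monomial (toℕ i) (toℕ j)) (length-monomial (toℕ i) (toℕ j) (ℕₚ.<⇒≤ (Finₚ.toℕ<n i)) (ℕₚ.<⇒≤ (Finₚ.toℕ<n j)))))

  module _ (L : Large T) (degree≤T : relation-degree ℓ N ℕ.≤ T) (product≤T : ((ℓ ℕ.+ ℓ) ℕ.+ ℓ) ℕ.+ relation-degree ℓ N ℕ.≤ T) (N≤T : N ℕ.≤ T)
    (exponential : ∀ t → evalℤ (wronskian A B) t * (evalℤ G t * evalℤ G t) - evalℤ A t * evalℤ B t * evalℤ (wronskian E G) t ≈0)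
    (A≢0 : ¬ Zero A) (B≢0 : ¬ Zero B) (G≢0 : ¬ Zero G) (W≢0 : ¬ Zero (wronskian E G)) where

    -- When m′ = m·f′, differentiation acts on polynomials in f and m as f′ times ∂_f + m∂_m; these
    -- are the coefficients of the image under the latter operator.
    shifted : (ℕ → ℕ → ℤ) → ℕ → ℕ → ℤ
    shifted c i j = + suc i * c (suc i) j + + j * c i j

    -- Leibniz rule for GᴺBᴺ·fⁱmʲ. The factor of M i j coming from the common denominator is the
    -- same for all i and j, so in a relation it only contributes a multiple of the relation itself.
    M-derivative : ∀ i j t → i ℕ.≤ N → j ℕ.≤ N →
      (evalℤ B t * (evalℤ G t * evalℤ G t)) * M′ i j t
      - ((+ N * (evalℤ G t * evalℤ (deriv G) t * evalℤ B t + evalℤ G t * evalℤ G t * evalℤ (deriv B) t)) * M i j t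
         + evalℤ (wronskian E G) t * evalℤ B t * (+ i * M (ℕ.pred i) j t + + j * M i j t)) ≈0
    M-derivative i j t i≤N j≤N = subst _≈0 (sym eq) (≈0-* X (≈0-* (+ j * (a ^ ℕ.pred j * b ^ (N ℕ.∸ j))) exp′))
      where
      e = evalℤ E t
      e′ = evalℤ (deriv E) t
      g = evalℤ G t
      g′ = evalℤ (deriv G) t
      a = evalℤ A t
      a′ = evalℤ (deriv A) t
      b = evalℤ B t
      b′ = evalℤ (deriv B) t
      w = e′ * g - e * g′
      X = e ^ i * g ^ (N ℕ.∸ i)
      X⁻ = e ^ ℕ.pred i * g ^ (N ℕ.∸ ℕ.pred i)
      Y = a ^ j * b ^ (N ℕ.∸ j)
      X′ = half′ E G i (N ℕ.∸ i) t
      Y′ = half′ A B j (N ℕ.∸ j) t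
      exp′ : (a′ * b - a * b′) * (g * g) - a * b * w ≈0
      exp′ = subst₂ (λ u v → u * (g * g) - a * b * v ≈0) (eval-wronskian A B t) (eval-wronskian E G t) (exponential t)
      lem : ∀ b gg X X′ Y Y′ P w i X⁻ Q j → gg * X′ ≡ P * X + w * (i * X⁻) →
        (b * gg) * (X′ * Y + X * Y′) - ((P * b + Q) * (X * Y) + w * b * (i * (X⁻ * Y) + j * (X * Y))) ≡ X * (b * gg * Y′ - (Q * Y + w * b * (j * Y)))
      lem b gg X X′ Y Y′ P w i X⁻ Q j h = trans (r₁ b gg X X′ Y Y′ P w i X⁻ Q j) (trans (cong (λ z → b * Y * z + X * (b * gg * Y′) - ((P * b + Q) * (X * Y) + w * b * (i * (X⁻ * Y) + j * (X * Y)))) h) (r₂ b gg X Y Y′ P w i X⁻ Q j))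
        where
        r₁ : ∀ b gg X X′ Y Y′ P w i X⁻ Q j → (b * gg) * (X′ * Y + X * Y′) - ((P * b + Q) * (X * Y) + w * b * (i * (X⁻ * Y) + j * (X * Y)))
           ≡ b * Y * (gg * X′) + X * (b * gg * Y′) - ((P * b + Q) * (X * Y) + w * b * (i * (X⁻ * Y) + j * (X * Y)))
        r₁ = solve-∀
        r₂ : ∀ b gg X Y Y′ P w i X⁻ Q j → b * Y * (P * X + w * (i * X⁻)) + X * (b * gg * Y′) - ((P * b + Q) * (X * Y) + w * b * (i * (X⁻ * Y) + j * (X * Y)))
           ≡ X * (b * gg * Y′ - (Q * Y + w * b * (j * Y)))
        r₂ = solve-∀
      distribute : ∀ n g g′ b gg b′ → n * (g * g′ * b + gg * b′) ≡ n * (g * g′) * b + n * (gg * b′)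
      distribute = solve-∀
      eq : (b * (g * g)) * M′ i j t - ((+ N * (g * g′ * b + g * g * b′)) * M i j t + evalℤ (wronskian E G) t * b * (+ i * M (ℕ.pred i) j t + + j * M i j t))
         ≡ X * ((+ j * (a ^ ℕ.pred j * b ^ (N ℕ.∸ j))) * ((a′ * b - a * b′) * (g * g) - a * b * w))
      eq = trans (cong₂ (λ u v → (b * (g * g)) * M′ i j t - (u * M i j t + v * b * (+ i * M (ℕ.pred i) j t + + j * M i j t))) (distribute (+ N) g g′ b (g * g) b′) (eval-wronskian E G t))
          (trans (lem b (g * g) X X′ Y Y′ (+ N * (g * g′)) w (+ i) X⁻ (+ N * (g * g * b′)) (+ j) (derive-power-quotient i (N ℕ.∸ i) e e′ g g′ (sym (ℕₚ.m+[n∸m]≡n i≤N))))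
           (cong (X *_) (derive-product j (N ℕ.∸ j) a a′ b b′ g w (sym (ℕₚ.m+[n∸m]≡n j≤N)))))

    ≈0-double-sum : ∀ {F : ℕ → ℕ → ℤ} → (∀ i j → i ℕ.< N → j ℕ.< N → F i j ≈0) → double-sum N F ≈0
    ≈0-double-sum h = ≈0-sum {N} (λ i → ≈0-sum {N} (λ j → h (toℕ i) (toℕ j) (Finₚ.toℕ<n i) (Finₚ.toℕ<n j)))

    double-sum-≈ : ∀ {F H : ℕ → ℕ → ℤ} → (∀ i j → i ℕ.< N → j ℕ.< N → F i j - H i j ≈0) → double-sum N F ≈0 → double-sum N H ≈0
    double-sum-≈ {F} {H} h z = subst _≈0 (lem (double-sum N F) (double-sum N H)) (≈0-- z (subst _≈0 eq (≈0-double-sum h)))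
      where
      eq : double-sum N (λ i j → F i j - H i j) ≡ double-sum N F - double-sum N H
      eq = trans (double-sum-+ N F (λ i j → - H i j)) (cong (λ w → double-sum N F + w)
        (trans (sum-cong-≗ {N} (λ i → sum-cong-≗ {N} (λ j → sym (ℤₚ.-1*i≡-i (H (toℕ i) (toℕ j)))))) (trans (sym (double-sum-* N (- (+ 1)) H)) (ℤₚ.-1*i≡-i (double-sum N H)))))
      lem : ∀ x y → x - (x - y) ≡ y
      lem = solve-∀

    -- Differentiate the relation, remove the multiple of the relation due to the common
    -- denominator, and cancel the non-zero polynomial `wronskian E G ⊗ B`. Row N of c has to vanish
    -- because `shifted` reads one row beyond the N×N block.
    relation-shifted : ∀ c → (∀ j → c N j ≈0) → Zero (relation c) → Zero (relation (shifted c))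
    relation-shifted c cN z = result
      where
      derived : ℤ → ℤ
      derived t = double-sum N (λ i j → c i j * (+ i * M (ℕ.pred i) j t + + j * M i j t))
      wb : ℤ → ℤ
      wb t = evalℤ (wronskian E G) t * evalℤ B t
      step₁ : ∀ t → wb t * derived t ≈0
      step₁ t = subst _≈0 (sym (double-sum-* N (wb t) (λ i j → c i j * (+ i * M (ℕ.pred i) j t + + j * M i j t))))
        (double-sum-≈ {F = λ i j → u * (c i j * M′ i j t) + v * (c i j * M i j t)} {H = λ i j → wb t * (c i j * (+ i * M (ℕ.pred i) j t + + j * M i j t))}
          (λ i j i< j< → subst _≈0 (lem (c i j) u (M′ i j t) w (M i j t) (wb t) (+ i * M (ℕ.pred i) j t + + j * M i j t)) (≈0-* (c i j) (M-derivative i j t (ℕₚ.<⇒≤ i<) (ℕₚ.<⇒≤ j<))))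
          (subst _≈0 (sym (double-sum-+ N (λ i j → u * (c i j * M′ i j t)) (λ i j → v * (c i j * M i j t))))
            (≈0-+ (subst _≈0 (double-sum-* N u (λ i j → c i j * M′ i j t)) (≈0-* u (subst _≈0 (eval-deriv-relation c t) (zero-deriv (relation c) L (ℕₚ.≤-trans (length-relation c) degree≤T) z t))))
                  (subst _≈0 (double-sum-* N v (λ i j → c i j * M i j t)) (≈0-* v (subst _≈0 (eval-relation c t) (z t)))))))
        where
        u = evalℤ B t * (evalℤ G t * evalℤ G t)
        w = + N * (evalℤ G t * evalℤ (deriv G) t * evalℤ B t + evalℤ G t * evalℤ G t * evalℤ (deriv B) t)
        v = - w
        lem : ∀ c u m′ w m x s → c * (u * m′ - (w * m + x * s)) ≡ (u * (c * m′) + - w * (c * m)) - x * (c * s)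
        lem = solve-∀
      step₂ : ∀ t → evalℤ (relation (shifted c)) t - derived t ≈0
      step₂ t = subst _≈0 (sym eq) (≈0-- F₀ F_N)
        where
        F : ℕ → ℤ
        F i = sum {N} (λ j → c i (toℕ j) * (+ i * M (ℕ.pred i) (toℕ j) t))
        H : ℕ → ℕ → ℤ
        H i j = c i j * (+ j * M i j t)
        F₀ : F N ≈0
        F₀ = ≈0-sum {N} (λ j → ≈0-*ʳ {c N (toℕ j)} (+ N * M (ℕ.pred N) (toℕ j) t) (cN (toℕ j)))
        F_N : F 0 ≈0
        F_N = ≈0-sum {N} (λ j → subst _≈0 (sym (ℤₚ.*-zeroʳ (c 0 (toℕ j)))) 0≈0)
        split-derived : derived t ≡ sum {N} (λ i → F (toℕ i)) + double-sum N H
        split-derived = trans (sum-cong-≗ {N} (λ i → sum-cong-≗ {N} (λ j → ℤₚ.*-distribˡ-+ (c (toℕ i) (toℕ j)) (+ toℕ i * M (ℕ.pred (toℕ i)) (toℕ j) t) (+ toℕ j * M (toℕ i) (toℕ j) t))))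
          (double-sum-+ N (λ i j → c i j * (+ i * M (ℕ.pred i) j t)) H)
        split-shifted : evalℤ (relation (shifted c)) t ≡ sum {N} (λ i → F (suc (toℕ i))) + double-sum N H
        split-shifted = trans (eval-relation (shifted c) t) (trans (sum-cong-≗ {N} (λ i → sum-cong-≗ {N} (λ j → lem (+ suc (toℕ i)) (c (suc (toℕ i)) (toℕ j)) (+ toℕ j) (c (toℕ i) (toℕ j)) (M (toℕ i) (toℕ j) t))))
          (double-sum-+ N (λ i j → c (suc i) j * (+ suc i * M i j t)) H))
          where lem : ∀ i c j d m → (i * c + j * d) * m ≡ c * (i * m) + d * (j * m)
                lem = solve-∀
        eq : evalℤ (relation (shifted c)) t - derived t ≡ F N - F 0
        eq = trans (cong₂ _-_ split-shifted split-derived) (trans (lem (sum {N} (λ i → F (suc (toℕ i)))) (double-sum N H) (sum {N} (λ i → F (toℕ i))) (F 0))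
          (trans (cong (λ s → s - sum {N} (λ i → F (toℕ i)) - F 0) (sum-shift N F)) (lem₂ (sum {N} (λ i → F (toℕ i))) (F N) (F 0))))
          where lem : ∀ a h b f → (a + h) - (b + h) ≡ (a + f) - b - f
                lem = solve-∀
                lem₂ : ∀ b n f → (b + n) - b - f ≡ n - f
                lem₂ = solve-∀
      WB : ZPoly
      WB = wronskian E G ⊗ B
      step₃ : ∀ t → evalℤ WB t * evalℤ (relation (shifted c)) t ≈0
      step₃ t = subst _≈0 (trans (lem (wb t) (evalℤ (relation (shifted c)) t) (derived t)) (cong (λ w → w * evalℤ (relation (shifted c)) t) (sym (eval-⊗ (wronskian E G) B t)))) (≈0-+ (≈0-* (wb t) (step₂ t)) (step₁ t))
        where lem : ∀ w r d → w * (r - d) + w * d ≡ w * r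
              lem = solve-∀
      result : Zero (relation (shifted c))
      result = go (zero-product WB (relation (shifted c)) L (ℕₚ.≤-trans (ℕₚ.+-mono-≤ (length-⊗ (wronskian E G) B (length-wronskian E G lE lG) lB) (length-relation (shifted c))) product≤T) step₃)
        where
        go₂ : Zero (wronskian E G) ⊎ Zero B → ⊥
        go₂ (inj₁ w) = W≢0 w
        go₂ (inj₂ b) = B≢0 b
        go : Zero WB ⊎ Zero (relation (shifted c)) → Zero (relation (shifted c))
        go (inj₂ r) = r
        go (inj₁ r) = ⊥-elim (go₂ (zero-product (wronskian E G) B L (ℕₚ.≤-trans (ℕₚ.+-mono-≤ (length-wronskian E G lE lG) lB) (ℕₚ.≤-trans (ℕₚ.m≤m+n _ (relation-degree ℓ N)) product≤T)) (λ t → subst _≈0 (eval-⊗ (wronskian E G) B t) (r t))))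

    lowered : ℕ → (ℕ → ℕ → ℤ) → ℕ → ℕ → ℤ
    lowered b c i j = shifted c i j + - (+ b) * c i j

    relation-lowered : ∀ b c → (∀ j → c N j ≈0) → Zero (relation c) → Zero (relation (lowered b c))
    relation-lowered b c cN z t = subst _≈0 (sym eq) (≈0-+ (relation-shifted c cN z t) (≈0-* (- (+ b)) (z t)))
      where
      lem : ∀ s b c m → (s + b * c) * m ≡ s * m + b * (c * m)
      lem = solve-∀
      eq : evalℤ (relation (lowered b c)) t ≡ evalℤ (relation (shifted c)) t + - (+ b) * evalℤ (relation c) t
      eq = trans (eval-relation (lowered b c) t) (trans (sum-cong-≗ {N} (λ i → sum-cong-≗ {N} (λ j → lem (shifted c (toℕ i) (toℕ j)) (- (+ b)) (c (toℕ i) (toℕ j)) (M (toℕ i) (toℕ j) t))))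
        (trans (double-sum-+ N (λ i j → shifted c i j * M i j t) (λ i j → - (+ b) * (c i j * M i j t)))
        (cong₂ _+_ (sym (eval-relation (shifted c) t)) (trans (sym (double-sum-* N (- (+ b)) (λ i j → c i j * M i j t))) (cong (- (+ b) *_) (sym (eval-relation c t)))))))

    M-nonzero : ∀ b → ¬ (∀ t → M 0 b t ≈0)
    M-nonzero b h = go (zero-product G (A ⊗ B) L (ℕₚ.≤-trans (ℕₚ.+-mono-≤ lG (length-⊗ A B lA lB)) bound₁) (λ t → subst (λ w → evalℤ G t * w ≈0) (sym (eval-⊗ A B t)) (pointwise t)))
      where
      bound₁ : ℓ ℕ.+ (ℓ ℕ.+ ℓ) ℕ.≤ T
      bound₁ = ℕₚ.≤-trans (ℕₚ.≤-reflexive (sym (ℕₚ.+-assoc ℓ ℓ ℓ))) (ℕₚ.≤-trans (ℕₚ.m≤m+n _ (relation-degree ℓ N)) product≤T)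
      root : ∀ {u} k → u ^ k ≈0 → u ≈0
      root zero h = ⊥-elim (small≉0 1 (ℕ.s≤s ℕ.z≤n) 1<p h)
      root (suc k) h with dom h
      ... | inj₁ e = e
      ... | inj₂ e = root k e
      pointwise : ∀ t → evalℤ G t * (evalℤ A t * evalℤ B t) ≈0
      pointwise t = go (dom {1g * gN} {aj * bj} (h t))
        where
        1g = + 1
        gN = evalℤ G t ^ N
        aj = evalℤ A t ^ b
        bj = evalℤ B t ^ (N ℕ.∸ b)
        go : (1g * gN ≈0) ⊎ (aj * bj ≈0) → evalℤ G t * (evalℤ A t * evalℤ B t) ≈0
        go₂ : (aj ≈0) ⊎ (bj ≈0) → evalℤ G t * (evalℤ A t * evalℤ B t) ≈0
        go₂ (inj₁ e₁) = ≈0-* (evalℤ G t) (≈0-*ʳ {evalℤ A t} (evalℤ B t) (root b e₁))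
        go₂ (inj₂ e₂) = ≈0-* (evalℤ G t) (≈0-* (evalℤ A t) (root (N ℕ.∸ b) e₂))
        go (inj₁ e) = ≈0-*ʳ {evalℤ G t} (evalℤ A t * evalℤ B t) (root N (subst _≈0 (ℤₚ.*-identityˡ gN) e))
        go (inj₂ e) = go₂ (dom {aj} {bj} e)
      go : Zero G ⊎ Zero (A ⊗ B) → ⊥
      go (inj₁ z) = G≢0 z
      go (inj₂ z) = go₂ (zero-product A B L (ℕₚ.≤-trans (ℕₚ.+-mono-≤ lA lB) (ℕₚ.≤-trans (ℕₚ.m≤n+m (ℓ ℕ.+ ℓ) ℓ) bound₁)) (λ t → subst _≈0 (eval-⊗ A B t) (z t)))
        where
        go₂ : Zero A ⊎ Zero B → ⊥
        go₂ (inj₁ a) = A≢0 a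
        go₂ (inj₂ b) = B≢0 b

    -- Degree at most b in m, with a coefficient of mᵇ of degree below s in f. The pair (b, s),
    -- ordered lexicographically, is the measure of the induction below.
    record Supported (b s : ℕ) (c : ℕ → ℕ → ℤ) : Set where
      field
        rows : ∀ i j → N ℕ.≤ i → c i j ≈0
        columns : ∀ i j → b ℕ.< j → c i j ≈0
        top : ∀ i → s ℕ.≤ i → c i b ≈0
    open Supported

    descend : ∀ {P : ℕ → Set} → (∀ i → N ℕ.≤ i → P i) → (∀ i → P (suc i) → P i) → ∀ i → P i
    descend {P} base step i = go N i (ℕₚ.m≤n+m N i)
      where
      go : ∀ k i → N ℕ.≤ i ℕ.+ k → P i
      go zero i h = base i (subst (N ℕ.≤_) (ℕₚ.+-identityʳ i) h)
      go (suc k) i h = step i (go k (suc i) (subst (N ℕ.≤_) (ℕₚ.+-suc i k) h))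

    -- Applying ∂_f + m∂_m - b lowers the f-degree of the coefficient of mᵇ, so the new relation is
    -- trivial by induction. Hence c is an eigenvector of ∂_f + m∂_m with eigenvalue b. Comparing
    -- coefficients from high powers of f downwards kills everything but the constant multiple of
    -- mᵇ, and that one vanishes because m is not zero.
    relations-trivial : ∀ b s c → b ℕ.< N → Supported b s c → Zero (relation c) → ∀ i j → c i j ≈0
    relations-trivial zero zero c b<N S z i zero = top S i ℕ.z≤n
    relations-trivial zero zero c b<N S z i (suc j) = columns S i (suc j) (ℕ.s≤s ℕ.z≤n)
    relations-trivial (suc b) zero c b<N S z = relations-trivial b N c (ℕₚ.<-trans (ℕₚ.n<1+n b) b<N)
      (record { rows = rows S ; columns = λ i j b<j → column i j b<j ; top = λ i N≤i → rows S i b N≤i }) z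
      where
      column : ∀ i j → b ℕ.< j → c i j ≈0
      column i j b<j with ℕₚ.m≤n⇒m<n∨m≡n b<j
      ... | inj₁ lt = columns S i j lt
      ... | inj₂ refl = top S i ℕ.z≤n
    relations-trivial b (suc s) c b<N S z = conclusion
      where
      c′ = lowered b c
      S′ : Supported b s c′
      S′ = record
        { rows = λ i j N≤i → ≈0-+ (≈0-+ (≈0-* (+ suc i) (rows S (suc i) j (ℕₚ.≤-trans N≤i (ℕₚ.n≤1+n i)))) (≈0-* (+ j) (rows S i j N≤i))) (≈0-* (- (+ b)) (rows S i j N≤i))
        ; columns = λ i j b<j → ≈0-+ (≈0-+ (≈0-* (+ suc i) (columns S (suc i) j b<j)) (≈0-* (+ j) (columns S i j b<j))) (≈0-* (- (+ b)) (columns S i j b<j))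
        ; top = λ i s≤i → subst _≈0 (lem (+ suc i * c (suc i) b) (+ b) (c i b)) (≈0-* (+ suc i) (top S (suc i) (ℕ.s≤s s≤i))) }
        where lem : ∀ x b c → x ≡ (x + b * c) + - b * c
              lem = solve-∀
      c′≈0 : ∀ i j → c′ i j ≈0
      c′≈0 = relations-trivial b s c′ b<N S′ (relation-lowered b c (λ j → rows S N j ℕₚ.≤-refl) z)
      low : ∀ j → j ℕ.< b → ∀ i → c i j ≈0
      low j j<b = descend (λ i → rows S i j) (λ i h → cancel gap≉0 (subst _≈0 (lem (+ suc i) (c (suc i) j) (+ j) (c i j) (+ b)) (≈0-- (≈0-* (+ suc i) h) (c′≈0 i j))))
        where
        gap≉0 : ¬ ((+ b - + j) ≈0)
        gap≉0 h = L (b ℕ.∸ j) (ℕₚ.m<n⇒0<n∸m j<b) (ℕₚ.≤-<-trans (ℕₚ.m∸n≤m b j) (ℕₚ.<-≤-trans b<N N≤T)) (subst _≈0 (trans (ℤₚ.m-n≡m⊖n b j) (ℤₚ.⊖-≥ (ℕₚ.<⇒≤ j<b))) h)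
        lem : ∀ n c′ j c b → n * c′ - ((n * c′ + j * c) + - b * c) ≡ (b - j) * c
        lem = solve-∀
      column-suc : ∀ i → c (suc i) b ≈0
      column-suc i with N ℕ.≤? suc i
      ... | yes N≤i = rows S (suc i) b N≤i
      ... | no N≰i = cancel (L (suc i) (ℕ.s≤s ℕ.z≤n) (ℕₚ.<-≤-trans (ℕₚ.≰⇒> N≰i) N≤T)) (subst _≈0 (lem (+ suc i * c (suc i) b) (+ b) (c i b)) (c′≈0 i b))
        where lem : ∀ x b c → (x + b * c) + - b * c ≡ x
              lem = solve-∀
      others : ∀ i j → ¬ (i ≡ 0 × j ≡ b) → c i j ≈0
      others i j n with ℕₚ.<-cmp j b
      ... | tri< lt _ _ = low j lt i
      ... | tri> _ _ gt = columns S i j gt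
      others zero j n | tri≈ _ e _ = ⊥-elim (n (refl , e))
      others (suc i) j n | tri≈ _ refl _ = column-suc i
      0<N : 0 ℕ.< N
      0<N = ℕₚ.≤-<-trans ℕ.z≤n b<N
      single : ∀ t → c 0 b * M 0 b t ≈0
      single t = subst₂ (λ i j → c i j * M i j t ≈0) (Finₚ.toℕ-fromℕ< 0<N) (Finₚ.toℕ-fromℕ< b<N)
        (sum-single {N} (λ j → c (toℕ i₀) (toℕ j) * M (toℕ i₀) (toℕ j) t) j₀
           (λ j j≢ → ≈0-*ʳ {c (toℕ i₀) (toℕ j)} (M (toℕ i₀) (toℕ j) t) (others (toℕ i₀) (toℕ j) (λ { (_ , e) → j≢ (Finₚ.toℕ-injective (trans e (sym (Finₚ.toℕ-fromℕ< b<N)))) })))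
           (sum-single {N} (λ i → sum {N} (λ j → c (toℕ i) (toℕ j) * M (toℕ i) (toℕ j) t)) i₀
             (λ i i≢ → ≈0-sum {N} (λ j → ≈0-*ʳ {c (toℕ i) (toℕ j)} (M (toℕ i) (toℕ j) t) (others (toℕ i) (toℕ j) (λ { (e , _) → i≢ (Finₚ.toℕ-injective (trans e (sym (Finₚ.toℕ-fromℕ< 0<N)))) }))))
             (subst _≈0 (eval-relation c t) (z t))))
        where i₀ = fromℕ< 0<N
              j₀ = fromℕ< b<N
      corner : c 0 b ≈0
      corner with ≈0? (c 0 b)
      ... | yes h = h
      ... | no h = ⊥-elim (M-nonzero b (λ t → cancel h (single t)))
      conclusion : ∀ i j → c i j ≈0
      conclusion zero j with j ℕ.≟ b
      ... | yes refl = corner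
      ... | no n = others zero j (λ { (_ , e) → n e })
      conclusion (suc i) j = others (suc i) j (λ { (() , _) })

    impossible : 1 ℕ.≤ N → relation-degree ℓ N ℕ.< N ℕ.^ 2 → ⊥
    impossible 1≤N count = go (dependence 2 1 (subst (ℕ._< N ℕ.^ 2) (sym (ℕₚ.*-identityʳ _)) count) V)
      where
      V : Vec (Fin N) 2 → Vec (Fin (relation-degree ℓ N)) 1 → ℤ
      V (i ∷ j ∷ []) (x ∷ []) = M (toℕ i) (toℕ j) (+ toℕ x)
      go : (∃[ c ] (∀ g → sumV 2 (λ α → c α * V α g) ≈0) × (∃[ α ] ¬ (c α ≈0))) → ⊥
      go (c , grid , (i ∷ j ∷ []) , nz) = nz (subst _≈0 (extend-≡ i j) (relations-trivial (ℕ.pred N) N ĉ (ℕₚ.≤-reflexive (suc-pred N 1≤N)) S z (toℕ i) (toℕ j)))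
        where
        ĉ : ℕ → ℕ → ℤ
        ĉ i j with i ℕ.<? N | j ℕ.<? N
        ... | yes i<N | yes j<N = c (fromℕ< i<N ∷ fromℕ< j<N ∷ [])
        ... | _ | _ = + 0
        extend-≡ : ∀ i j → ĉ (toℕ i) (toℕ j) ≡ c (i ∷ j ∷ [])
        extend-≡ i j with toℕ i ℕ.<? N | toℕ j ℕ.<? N
        ... | yes i<N | yes j<N = cong₂ (λ a b → c (a ∷ b ∷ [])) (Finₚ.fromℕ<-toℕ i i<N) (Finₚ.fromℕ<-toℕ j j<N)
        ... | yes _ | no n = ⊥-elim (n (Finₚ.toℕ<n j))
        ... | no n | _ = ⊥-elim (n (Finₚ.toℕ<n i))
        suc-pred : ∀ N → 1 ℕ.≤ N → suc (ℕ.pred N) ≡ N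
        suc-pred (suc N) _ = refl
        zero-rows : ∀ i j → N ℕ.≤ i → ĉ i j ≈0
        zero-rows i j N≤i with i ℕ.<? N | j ℕ.<? N
        ... | yes i<N | _ = ⊥-elim (ℕₚ.<⇒≱ i<N N≤i)
        ... | no _ | yes _ = 0≈0
        ... | no _ | no _ = 0≈0
        zero-columns : ∀ i j → N ℕ.≤ j → ĉ i j ≈0
        zero-columns i j N≤j with i ℕ.<? N | j ℕ.<? N
        ... | yes _ | yes j<N = ⊥-elim (ℕₚ.<⇒≱ j<N N≤j)
        ... | yes _ | no _ = 0≈0
        ... | no _ | yes _ = 0≈0
        ... | no _ | no _ = 0≈0
        S : Supported (ℕ.pred N) N ĉ
        S = record { rows = zero-rows ; columns = λ i j lt → zero-columns i j (subst (ℕ._≤ j) (suc-pred N 1≤N) lt) ; top = λ i → zero-rows i (ℕ.pred N) }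
        z : Zero (relation ĉ)
        -- The relation was imposed at `relation-degree ℓ N` points only, but its length is at most
        -- that number, so it vanishes identically.
        z = vanish {d = relation-degree ℓ N} {T = relation-degree ℓ N} {u = evalℤ (relation ĉ)} (λ k 0<k k<d → L k 0<k (ℕₚ.<-≤-trans k<d degree≤T)) ℕₚ.≤-refl
          (relation ĉ , length-relation ĉ , λ _ → refl)
          (λ k k<d → subst _≈0 (sym (trans (eval-relation ĉ (+ k)) (sum-cong-≗ {N} (λ i → sum-cong-≗ {N} (λ j → cong₂ _*_ (extend-≡ i j) (cong (λ x → M (toℕ i) (toℕ j) (+ x)) (sym (Finₚ.toℕ-fromℕ< k<d))))))))
             (grid (fromℕ< k<d ∷ [])))

-- The plane curve (P, Q) and its tangent directions

det : (a₁ a₂ a₃ b₁ b₂ b₃ c₁ c₂ c₃ : ℤ) → ℤ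
det a₁ a₂ a₃ b₁ b₂ b₃ c₁ c₂ c₃ = (a₂ * b₃ - a₃ * b₂) * c₁ + (a₃ * b₁ - a₁ * b₃) * c₂ + (a₁ * b₂ - a₂ * b₁) * c₃

module Curve (P Q : RatFun) where
  Pn Pd Qn Qd X Y G A B Λ C₁ C₂ C₃ : ZPoly
  Pn = num P
  Pd = den P
  Qn = num Q
  Qd = den Q
  X = Pn ⊗ Qd
  Y = Qn ⊗ Pd
  G = Pd ⊗ Qd
  -- A/B = Q′/P′, over the common denominator (Pd Qd)².
  A = wronskian Qn Qd ⊗ (Pd ⊗ Pd)
  B = wronskian Pn Pd ⊗ (Qd ⊗ Qd)
  Λ = wronskian A B
  -- (P′, Q′, (A/B)′/(A/B)) up to the factor AB(Pd Qd)².
  C₁ = A ⊗ (B ⊗ B)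
  C₂ = (A ⊗ A) ⊗ B
  C₃ = Λ ⊗ (G ⊗ G)

  D : ℤ → ℤ → ℤ → ℤ
  D x y z = det (evalℤ C₁ x) (evalℤ C₂ x) (evalℤ C₃ x) (evalℤ C₁ y) (evalℤ C₂ y) (evalℤ C₃ y) (evalℤ C₁ z) (evalℤ C₂ z) (evalℤ C₃ z)

  tangents-independent : ℤ → ℤ → ℤ
  tangents-independent x y = evalℤ A x * evalℤ B y - evalℤ A y * evalℤ B x

  -- N is chosen for the dimension count: N² = 2ℓN + 3N exceeds `relation-degree ℓ N` = 2ℓN + 4
  -- because N is at least 3. T majorises all lengths that are compared with the characteristic.
  ℓ N T : ℕ
  ℓ = length A ℕ.+ (length B ℕ.+ (length G ℕ.+ (length X ℕ.+ length Y)))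
  N = 2 ℕ.* ℓ ℕ.+ 3
  T = relation-degree ℓ N ℕ.+ (10 ℕ.* ℓ ℕ.+ (N ℕ.+ 5))

  A≤ : length A ℕ.≤ ℓ
  A≤ = ℕₚ.m≤m+n _ _
  B≤ : length B ℕ.≤ ℓ
  B≤ = ℕₚ.≤-trans (ℕₚ.m≤m+n _ _) (ℕₚ.m≤n+m _ (length A))
  G≤ : length G ℕ.≤ ℓ
  G≤ = ℕₚ.≤-trans (ℕₚ.m≤m+n _ _) (ℕₚ.≤-trans (ℕₚ.m≤n+m _ (length B)) (ℕₚ.m≤n+m _ (length A)))
  X≤ : length X ℕ.≤ ℓ
  X≤ = ℕₚ.≤-trans (ℕₚ.m≤m+n _ _) (ℕₚ.≤-trans (ℕₚ.m≤n+m _ (length G)) (ℕₚ.≤-trans (ℕₚ.m≤n+m _ (length B)) (ℕₚ.m≤n+m _ (length A))))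
  Y≤ : length Y ℕ.≤ ℓ
  Y≤ = ℕₚ.≤-trans (ℕₚ.m≤n+m _ (length X)) (ℕₚ.≤-trans (ℕₚ.m≤n+m _ (length G)) (ℕₚ.≤-trans (ℕₚ.m≤n+m _ (length B)) (ℕₚ.m≤n+m _ (length A))))

  ℓ-multiple : ∀ m k → m ℕ.+ k ≡ 10 ℕ.* ℓ → m ℕ.≤ T
  ℓ-multiple m k e = ℕₚ.≤-trans (subst (m ℕ.≤_) e (ℕₚ.m≤m+n m k)) (ℕₚ.≤-trans (ℕₚ.m≤m+n (10 ℕ.* ℓ) (N ℕ.+ 5)) (ℕₚ.m≤n+m _ (relation-degree ℓ N)))

  2ℓ≤ : ℓ ℕ.+ ℓ ℕ.≤ T
  2ℓ≤ = ℓ-multiple (ℓ ℕ.+ ℓ) (8 ℕ.* ℓ) (lem ℓ)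
    where lem : ∀ ℓ → ℓ ℕ.+ ℓ ℕ.+ 8 ℕ.* ℓ ≡ 10 ℕ.* ℓ
          lem = ℕS.solve-∀
  ℓ≤ : ℓ ℕ.≤ T
  ℓ≤ = ℕₚ.≤-trans (ℕₚ.m≤m+n ℓ ℓ) 2ℓ≤
  3ℓ≤ : ℓ ℕ.+ ℓ ℕ.+ ℓ ℕ.≤ T
  3ℓ≤ = ℓ-multiple (ℓ ℕ.+ ℓ ℕ.+ ℓ) (7 ℕ.* ℓ) (lem ℓ)
    where lem : ∀ ℓ → ℓ ℕ.+ ℓ ℕ.+ ℓ ℕ.+ 7 ℕ.* ℓ ≡ 10 ℕ.* ℓ
          lem = ℕS.solve-∀
  4ℓ≤ : (ℓ ℕ.+ ℓ) ℕ.+ (ℓ ℕ.+ ℓ) ℕ.≤ T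
  4ℓ≤ = ℓ-multiple ((ℓ ℕ.+ ℓ) ℕ.+ (ℓ ℕ.+ ℓ)) (6 ℕ.* ℓ) (lem ℓ)
    where lem : ∀ ℓ → (ℓ ℕ.+ ℓ) ℕ.+ (ℓ ℕ.+ ℓ) ℕ.+ 6 ℕ.* ℓ ≡ 10 ℕ.* ℓ
          lem = ℕS.solve-∀
  N≤T : N ℕ.≤ T
  N≤T = ℕₚ.≤-trans (ℕₚ.m≤m+n N 5) (ℕₚ.≤-trans (ℕₚ.m≤n+m (N ℕ.+ 5) (10 ℕ.* ℓ)) (ℕₚ.m≤n+m _ (relation-degree ℓ N)))
  wronskian≤ : ℓ ℕ.+ ℓ ℕ.+ 5 ℕ.≤ T
  wronskian≤ = ℕₚ.≤-trans (ℕₚ.≤-trans (ℕₚ.m≤m+n (ℓ ℕ.+ ℓ ℕ.+ 5) (8 ℕ.* ℓ ℕ.+ N)) (ℕₚ.≤-reflexive (lem ℓ N))) (ℕₚ.m≤n+m _ (relation-degree ℓ N))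
    where lem : ∀ ℓ N → ℓ ℕ.+ ℓ ℕ.+ 5 ℕ.+ (8 ℕ.* ℓ ℕ.+ N) ≡ 10 ℕ.* ℓ ℕ.+ (N ℕ.+ 5)
          lem = ℕS.solve-∀
  degree≤ : relation-degree ℓ N ℕ.≤ T
  degree≤ = ℕₚ.m≤m+n _ _
  degree+≤ : ((ℓ ℕ.+ ℓ) ℕ.+ ℓ) ℕ.+ relation-degree ℓ N ℕ.≤ T
  degree+≤ = ℕₚ.≤-trans (ℕₚ.m≤m+n _ (7 ℕ.* ℓ ℕ.+ (N ℕ.+ 5))) (ℕₚ.≤-reflexive (lem ℓ N (relation-degree ℓ N)))
    where lem : ∀ ℓ N r → ((ℓ ℕ.+ ℓ) ℕ.+ ℓ) ℕ.+ r ℕ.+ (7 ℕ.* ℓ ℕ.+ (N ℕ.+ 5)) ≡ r ℕ.+ (10 ℕ.* ℓ ℕ.+ (N ℕ.+ 5))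
          lem = ℕS.solve-∀
  dimension : relation-degree ℓ N ℕ.< N ℕ.^ 2
  dimension = ℕₚ.≤-trans (ℕₚ.≤-trans (ℕₚ.m≤m+n _ (6 ℕ.* ℓ ℕ.+ 4)) (ℕₚ.≤-reflexive (lem ℓ))) ℕₚ.≤-refl
    where lem : ∀ ℓ → suc (((2 ℕ.* ℓ ℕ.+ 3) ℕ.* ℓ ℕ.+ 2) ℕ.+ ((2 ℕ.* ℓ ℕ.+ 3) ℕ.* ℓ ℕ.+ 2)) ℕ.+ (6 ℕ.* ℓ ℕ.+ 4) ≡ (2 ℕ.* ℓ ℕ.+ 3) ℕ.* ((2 ℕ.* ℓ ℕ.+ 3) ℕ.* 1)
          lem = ℕS.solve-∀
  1≤N : 1 ℕ.≤ N
  1≤N = ℕₚ.≤-trans (ℕ.s≤s ℕ.z≤n) (ℕₚ.m≤n+m 3 (2 ℕ.* ℓ))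

  combination : ℤ → ℤ → ZPoly
  combination α β = scale α X ⊕ scale β Y

  eval-combination : ∀ α β t → evalℤ (combination α β) t ≡ α * evalℤ X t + β * evalℤ Y t
  eval-combination α β t = trans (eval-⊕ (scale α X) (scale β Y) t) (cong₂ _+_ (eval-scale α X t) (eval-scale β Y t))

  length-combination : ∀ α β → length (combination α β) ℕ.≤ ℓ
  length-combination α β = length-⊕ (scale α X) (scale β Y) (length-scale α X X≤) (length-scale β Y Y≤)

  eval-A : ∀ t → evalℤ A t ≡ (evalℤ (deriv Qn) t * evalℤ Qd t - evalℤ Qn t * evalℤ (deriv Qd) t) * (evalℤ Pd t * evalℤ Pd t)
  eval-A t = trans (eval-⊗ (wronskian Qn Qd) (Pd ⊗ Pd) t) (cong₂ _*_ (eval-wronskian Qn Qd t) (eval-⊗ Pd Pd t))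

  eval-B : ∀ t → evalℤ B t ≡ (evalℤ (deriv Pn) t * evalℤ Pd t - evalℤ Pn t * evalℤ (deriv Pd) t) * (evalℤ Qd t * evalℤ Qd t)
  eval-B t = trans (eval-⊗ (wronskian Pn Pd) (Qd ⊗ Qd) t) (cong₂ _*_ (eval-wronskian Pn Pd t) (eval-⊗ Qd Qd t))

  eval-C₁ : ∀ t → evalℤ C₁ t ≡ evalℤ A t * (evalℤ B t * evalℤ B t)
  eval-C₁ t = trans (eval-⊗ A (B ⊗ B) t) (cong (evalℤ A t *_) (eval-⊗ B B t))

  eval-C₂ : ∀ t → evalℤ C₂ t ≡ (evalℤ A t * evalℤ A t) * evalℤ B t
  eval-C₂ t = trans (eval-⊗ (A ⊗ A) B t) (cong (_* evalℤ B t) (eval-⊗ A A t))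

  eval-C₃ : ∀ t → evalℤ C₃ t ≡ evalℤ Λ t * (evalℤ G t * evalℤ G t)
  eval-C₃ t = trans (eval-⊗ Λ (G ⊗ G) t) (cong (evalℤ Λ t *_) (eval-⊗ G G t))

  -- `combination α β` over G is αP + βQ, and B/G² = P′, A/G² = Q′.
  wronskian-combination : ∀ α β t → evalℤ (wronskian (combination α β) G) t ≡ α * evalℤ B t + β * evalℤ A t
  wronskian-combination α β t = trans (eval-wronskian (combination α β) G t)
    (trans (cong₂ (λ u v → u * evalℤ G t - v * evalℤ (deriv G) t)
       (trans (eval-deriv-⊕ (scale α X) (scale β Y) t) (cong₂ _+_ (trans (eval-deriv-scale α X t) (cong (α *_) (eval-deriv-⊗ Pn Qd t))) (trans (eval-deriv-scale β Y t) (cong (β *_) (eval-deriv-⊗ Qn Pd t)))))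
       (trans (eval-combination α β t) (cong₂ (λ u v → α * u + β * v) (eval-⊗ Pn Qd t) (eval-⊗ Qn Pd t))))
    (trans (cong₂ (λ u v → (α * (pn′ * qd + pn * qd′) + β * (qn′ * pd + qn * pd′)) * u - (α * (pn * qd) + β * (qn * pd)) * v) (eval-⊗ Pd Qd t) (eval-deriv-⊗ Pd Qd t))
    (trans (lem α β pn pn′ pd pd′ qn qn′ qd qd′) (sym (cong₂ (λ u v → α * u + β * v) (eval-B t) (eval-A t))))))
    where
    pn = evalℤ Pn t
    pn′ = evalℤ (deriv Pn) t
    pd = evalℤ Pd t
    pd′ = evalℤ (deriv Pd) t
    qn = evalℤ Qn t
    qn′ = evalℤ (deriv Qn) t
    qd = evalℤ Qd t
    qd′ = evalℤ (deriv Qd) t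
    lem : ∀ α β pn pn′ pd pd′ qn qn′ qd qd′ →
      (α * (pn′ * qd + pn * qd′) + β * (qn′ * pd + qn * pd′)) * (pd * qd) - (α * (pn * qd) + β * (qn * pd)) * (pd′ * qd + pd * qd′)
      ≡ α * ((pn′ * pd - pn * pd′) * (qd * qd)) + β * ((qn′ * qd - qn * qd′) * (pd * pd))
    lem = solve-∀

  module Generically (p : ℕ) .{{_ : NonZero p}} (1<p : 1 ℕ.< p) (dom : IsDomain p)
    (large : Roots.Large p dom T) (inverse : ∀ {a} → ¬ Mod._≈0 p a → ∃[ b ] Mod._≈0 p (a * b - + 1))
    (independent : ∀ a b c → (∀ t → Mod._≈0 p (a * evalℤ X t + b * evalℤ Y t + c * evalℤ G t)) → Mod._≈0 p a × Mod._≈0 p b × Mod._≈0 p c) where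
    open PolyDomain p 1<p dom

    1≉0 : ¬ (+ 1 ≈0)
    1≉0 = small≉0 1 (ℕ.s≤s ℕ.z≤n) 1<p

    nonvanishing : ∀ f → length f ℕ.≤ T → ¬ Zero f → ∃[ y ] ¬ (evalℤ f (+ y) ≈0)
    nonvanishing f l n = go (nonzero-or-vanish {d = length f} {u = evalℤ f} large l (f , ℕₚ.≤-refl , λ _ → refl))
      where go : (∃[ y ] ¬ (evalℤ f (+ y) ≈0)) ⊎ Zero f → ∃[ y ] ¬ (evalℤ f (+ y) ≈0)
            go (inj₁ w) = w
            go (inj₂ z) = ⊥-elim (n z)

    G≢0 : ¬ Zero G
    G≢0 z = 1≉0 (proj₂ (proj₂ (independent (+ 0) (+ 0) (+ 1) (λ t → subst _≈0 (lem (evalℤ X t) (evalℤ Y t) (evalℤ G t)) (z t)))))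
      where lem : ∀ x y g → g ≡ + 0 * x + + 0 * y + + 1 * g
            lem = solve-∀

    -- A relation αP′ + βQ′ = 0 makes αP + βQ constant by `zero-wronskian`, against the independence
    -- of P, Q and 1.
    tangent-independence : ∀ α β → (∀ t → α * evalℤ B t + β * evalℤ A t ≈0) → α ≈0 × β ≈0
    tangent-independence α β h = cancel gy (proj₁ ind) , cancel gy (proj₁ (proj₂ ind))
      where
      E = combination α β
      witness = nonvanishing G (ℕₚ.≤-trans G≤ ℓ≤) G≢0
      y = proj₁ witness
      gy = proj₂ witness
      g = evalℤ G (+ y)
      lem : ∀ g α β x y e G → g * (α * x + β * y) - e * G ≡ g * α * x + g * β * y + - e * G
      lem = solve-∀
      ind = independent (g * α) (g * β) (- evalℤ E (+ y)) (λ t → subst _≈0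
        (trans (cong (λ u → g * u - evalℤ E (+ y) * evalℤ G t) (eval-combination α β t)) (lem g α β (evalℤ X t) (evalℤ Y t) (evalℤ E (+ y)) (evalℤ G t)))
        (zero-wronskian E G y large (length-combination α β) G≤ wronskian≤ gy (λ t → subst _≈0 (sym (wronskian-combination α β t)) (h t)) t))

    A≢0 : ¬ Zero A
    A≢0 z = 1≉0 (proj₂ (tangent-independence (+ 0) (+ 1) (λ t → subst _≈0 (lem (evalℤ A t) (evalℤ B t)) (z t))))
      where lem : ∀ a b → a ≡ + 0 * b + + 1 * a
            lem = solve-∀

    B≢0 : ¬ Zero B
    B≢0 z = 1≉0 (proj₁ (tangent-independence (+ 1) (+ 0) (λ t → subst _≈0 (lem (evalℤ A t) (evalℤ B t)) (z t))))
      where lem : ∀ a b → b ≡ + 1 * b + + 0 * a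
            lem = solve-∀

    AB≢0 : ¬ Zero (A ⊗ B)
    AB≢0 z = go (zero-product A B large (ℕₚ.≤-trans (ℕₚ.+-mono-≤ A≤ B≤) 2ℓ≤) (λ t → subst _≈0 (eval-⊗ A B t) (z t)))
      where go : Zero A ⊎ Zero B → ⊥
            go (inj₁ a) = A≢0 a
            go (inj₂ b) = B≢0 b

    first = nonvanishing (A ⊗ B) (ℕₚ.≤-trans (length-⊗ A B A≤ B≤) 2ℓ≤) AB≢0
    y₁ = proj₁ first

    a₁ b₁ : ℤ
    a₁ = evalℤ A (+ y₁)
    b₁ = evalℤ B (+ y₁)

    AB₁ : ¬ (a₁ * b₁ ≈0)
    AB₁ h = proj₂ first (subst _≈0 (sym (eval-⊗ A B (+ y₁))) h)

    b₁≉0 : ¬ (b₁ ≈0)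
    b₁≉0 h = AB₁ (≈0-* a₁ h)

    pencil : ZPoly
    pencil = scale b₁ A ⊕ scale (- a₁) B

    eval-pencil : ∀ t → evalℤ pencil t ≡ - a₁ * evalℤ B t + b₁ * evalℤ A t
    eval-pencil t = trans (eval-⊕ (scale b₁ A) (scale (- a₁) B) t) (trans (cong₂ _+_ (eval-scale b₁ A t) (eval-scale (- a₁) B t)) (ℤₚ.+-comm (b₁ * evalℤ A t) (- a₁ * evalℤ B t)))

    pencil≤ : length pencil ℕ.≤ ℓ
    pencil≤ = length-⊕ (scale b₁ A) _ (length-scale b₁ A A≤) (length-scale (- a₁) B B≤)

    pencil≢0 : ¬ Zero ((A ⊗ B) ⊗ pencil)
    pencil≢0 z = go (zero-product (A ⊗ B) pencil large (ℕₚ.≤-trans (ℕₚ.+-mono-≤ (length-⊗ A B A≤ B≤) pencil≤) 3ℓ≤) (λ t → subst _≈0 (eval-⊗ (A ⊗ B) pencil t) (z t)))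
      where go : Zero (A ⊗ B) ⊎ Zero pencil → ⊥
            go (inj₁ h) = AB≢0 h
            go (inj₂ h) = b₁≉0 (proj₂ (tangent-independence (- a₁) b₁ (λ t → subst _≈0 (eval-pencil t) (h t))))

    second = nonvanishing ((A ⊗ B) ⊗ pencil) (ℕₚ.≤-trans (length-⊗ (A ⊗ B) pencil (length-⊗ A B A≤ B≤) pencil≤) 3ℓ≤) pencil≢0
    y₂ = proj₁ second

    a₂ b₂ : ℤ
    a₂ = evalℤ A (+ y₂)
    b₂ = evalℤ B (+ y₂)

    second′ : ¬ ((a₂ * b₂) * (- a₁ * b₂ + b₁ * a₂) ≈0)
    second′ h = proj₂ second (subst _≈0 (sym (trans (eval-⊗ (A ⊗ B) pencil (+ y₂)) (cong₂ _*_ (eval-⊗ A B (+ y₂)) (eval-pencil (+ y₂))))) h)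

    tangents : ¬ (tangents-independent (+ y₁) (+ y₂) ≈0)
    tangents h = second′ (≈0-* (a₂ * b₂) (subst _≈0 (lem a₁ b₁ a₂ b₂) (≈0-neg h)))
      where lem : ∀ a₁ b₁ a₂ b₂ → - (a₁ * b₂ - a₂ * b₁) ≡ - a₁ * b₂ + b₁ * a₂
            lem = solve-∀

    c₁₁ c₁₂ c₁₃ c₂₁ c₂₂ c₂₃ γ κ₁ κ₂ : ℤ
    c₁₁ = evalℤ C₁ (+ y₁)
    c₁₂ = evalℤ C₂ (+ y₁)
    c₁₃ = evalℤ C₃ (+ y₁)
    c₂₁ = evalℤ C₁ (+ y₂)
    c₂₂ = evalℤ C₂ (+ y₂)
    c₂₃ = evalℤ C₃ (+ y₂)
    κ₁ = c₁₂ * c₂₃ - c₁₃ * c₂₂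
    κ₂ = c₁₃ * c₂₁ - c₁₁ * c₂₃
    γ = c₁₁ * c₂₂ - c₁₂ * c₂₁

    -- The minor of C₁ and C₂ at the two points is a product of values of A and B with
    -- `tangents-independent`, and the second point was chosen to make all these factors non-zero.
    γ≉0 : ¬ (γ ≈0)
    γ≉0 h = ≉0-* AB₁ second′ (subst _≈0 (trans (cong₂ _-_ (cong₂ _*_ (eval-C₁ (+ y₁)) (eval-C₂ (+ y₂))) (cong₂ _*_ (eval-C₂ (+ y₁)) (eval-C₁ (+ y₂)))) (lem a₁ b₁ a₂ b₂)) h)
      where lem : ∀ a₁ b₁ a₂ b₂ → (a₁ * (b₁ * b₁)) * ((a₂ * a₂) * b₂) - ((a₁ * a₁) * b₁) * (a₂ * (b₂ * b₂)) ≡ (a₁ * b₁) * ((a₂ * b₂) * (- a₁ * b₂ + b₁ * a₂))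
            lem = solve-∀

    column : ZPoly
    column = (scale κ₁ C₁ ⊕ scale κ₂ C₂) ⊕ scale γ C₃

    eval-column : ∀ t → evalℤ column t ≡ D (+ y₁) (+ y₂) t
    eval-column t = trans (eval-⊕ (scale κ₁ C₁ ⊕ scale κ₂ C₂) (scale γ C₃) t)
      (cong₂ _+_ (trans (eval-⊕ (scale κ₁ C₁) (scale κ₂ C₂) t) (cong₂ _+_ (eval-scale κ₁ C₁ t) (eval-scale κ₂ C₂ t))) (eval-scale γ C₃ t))

    Λ≤ : length Λ ℕ.≤ ℓ ℕ.+ ℓ
    Λ≤ = length-wronskian A B A≤ B≤

    column≤ : length column ℕ.≤ T
    column≤ = length-⊕ (scale κ₁ C₁ ⊕ scale κ₂ C₂) _
      (length-⊕ (scale κ₁ C₁) _ (length-scale κ₁ C₁ (ℕₚ.≤-trans (length-⊗ A (B ⊗ B) A≤ (length-⊗ B B B≤ B≤)) (ℕₚ.≤-trans (ℕₚ.≤-reflexive (sym (ℕₚ.+-assoc ℓ ℓ ℓ))) 3ℓ≤)))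
                                (length-scale κ₂ C₂ (ℕₚ.≤-trans (length-⊗ (A ⊗ A) B (length-⊗ A A A≤ A≤) B≤) 3ℓ≤)))
      (length-scale γ C₃ (ℕₚ.≤-trans (length-⊗ Λ (G ⊗ G) Λ≤ (length-⊗ G G G≤ G≤)) 4ℓ≤))

    -- If m = A/B were constant, A and B would be proportional, and so would P′ and Q′.
    Λ≢0 : ¬ Zero Λ
    Λ≢0 z = b₁≉0 (proj₂ (tangent-independence (- a₁) b₁ (λ t → subst _≈0 (lem a₁ b₁ (evalℤ A t) (evalℤ B t)) (zero-wronskian A B y₁ large A≤ B≤ wronskian≤ b₁≉0 z t))))
      where lem : ∀ a₁ b₁ a b → b₁ * a - a₁ * b ≡ - a₁ * b + b₁ * a
            lem = solve-∀

    -- Dividing κ₁C₁ + κ₂C₂ + γC₃ = 0 by γ·A·B·G² turns it into m′/m = αP′ + βQ′. The right-hand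
    -- side is the derivative of E/G, so m would be the exponential of a rational function.
    column≢0 : ¬ Zero column
    column≢0 z = Exponential.impossible p 1<p dom A B E G ℓ N T A≤ B≤ (length-combination α β) G≤ large degree≤ degree+≤ N≤T exponential A≢0 B≢0 G≢0 W≢0 1≤N dimension
      where
      μ = proj₁ (inverse γ≉0)
      μγ = proj₂ (inverse γ≉0)
      α = - (μ * κ₁)
      β = - (μ * κ₂)
      E = combination α β
      identity : ∀ a b g λ′ κ₁ κ₂ γ μ → μ * (κ₁ * (a * (b * b)) + κ₂ * ((a * a) * b) + γ * (λ′ * (g * g))) - (λ′ * (g * g)) * (γ * μ - + 1)
               ≡ λ′ * (g * g) - a * b * (- (μ * κ₁) * b + - (μ * κ₂) * a)
      identity = solve-∀
      exponential : ∀ t → evalℤ Λ t * (evalℤ G t * evalℤ G t) - evalℤ A t * evalℤ B t * evalℤ (wronskian E G) t ≈0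
      exponential t = subst _≈0 (trans (identity (evalℤ A t) (evalℤ B t) (evalℤ G t) (evalℤ Λ t) κ₁ κ₂ γ μ)
           (cong (λ w → evalℤ Λ t * (evalℤ G t * evalℤ G t) - evalℤ A t * evalℤ B t * w) (sym (wronskian-combination α β t))))
         (≈0-- (≈0-* μ (subst _≈0 (trans (eval-column t) (cong₂ _+_ (cong₂ (λ u v → κ₁ * u + κ₂ * v) (eval-C₁ t) (eval-C₂ t)) (cong (γ *_) (eval-C₃ t)))) (z t)))
               (≈0-* (evalℤ Λ t * (evalℤ G t * evalℤ G t)) μγ))
      W≢0 : ¬ Zero (wronskian E G)
      W≢0 w = go (zero-product Λ (G ⊗ G) large (ℕₚ.≤-trans (ℕₚ.+-mono-≤ Λ≤ (length-⊗ G G G≤ G≤)) 4ℓ≤)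
          (λ t → subst _≈0 (trans (lem (evalℤ Λ t * (evalℤ G t * evalℤ G t)) (evalℤ A t * evalℤ B t * evalℤ (wronskian E G) t)) (cong (evalℤ Λ t *_) (sym (eval-⊗ G G t))))
             (≈0-+ (exponential t) (≈0-* (evalℤ A t * evalℤ B t) (w t)))))
        where
        lem : ∀ x y → (x - y) + y ≡ x
        lem = solve-∀
        go₂ : Zero G ⊎ Zero G → ⊥
        go₂ (inj₁ h) = G≢0 h
        go₂ (inj₂ h) = G≢0 h
        go : Zero Λ ⊎ Zero (G ⊗ G) → ⊥
        go (inj₁ h) = Λ≢0 h
        go (inj₂ h) = go₂ (zero-product G G large (ℕₚ.≤-trans (ℕₚ.+-mono-≤ G≤ G≤) 2ℓ≤) (λ t → subst _≈0 (eval-⊗ G G t) (h t)))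

    third = nonvanishing column column≤ column≢0
    y₃ = proj₁ third

    D≉0 : ¬ (D (+ y₁) (+ y₂) (+ y₃) ≈0)
    D≉0 h = proj₂ third (subst _≈0 (sym (eval-column (+ y₃))) h)

-- Linear independence modulo large primes

ι : ℤ → ℚ
ι z = z ℚ./ 1

toℚᵘ-ι : ∀ z → toℚᵘ (ι z) ℚᵘ.≃ mkℚᵘ z 0
toℚᵘ-ι z = ℚₚ.toℚᵘ-fromℚᵘ (mkℚᵘ z 0)

ι-+ : ∀ a b → ι (a + b) ≡ ι a ℚ.+ ι b
ι-+ a b = ℚₚ.toℚᵘ-injective (begin
    toℚᵘ (ι (a + b))              ≈⟨ toℚᵘ-ι (a + b) ⟩
    mkℚᵘ (a + b) 0                ≈⟨ *≡* (lem a b) ⟩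
    mkℚᵘ a 0 ℚᵘ.+ mkℚᵘ b 0        ≈⟨ ℚᵘₚ.+-cong (toℚᵘ-ι a) (toℚᵘ-ι b) ⟨
    toℚᵘ (ι a) ℚᵘ.+ toℚᵘ (ι b)    ≈⟨ ℚₚ.toℚᵘ-homo-+ (ι a) (ι b) ⟨
    toℚᵘ (ι a ℚ.+ ι b)            ∎)
  where
  open ℚᵘₚ.≃-Reasoning
  lem : ∀ a b → (a + b) * + 1 ≡ (a * + 1 + b * + 1) * + 1
  lem = solve-∀

ι-* : ∀ a b → ι (a * b) ≡ ι a ℚ.* ι b
ι-* a b = ℚₚ.toℚᵘ-injective (begin
    toℚᵘ (ι (a * b))              ≈⟨ toℚᵘ-ι (a * b) ⟩
    mkℚᵘ a 0 ℚᵘ.* mkℚᵘ b 0        ≈⟨ ℚᵘₚ.*-cong (toℚᵘ-ι a) (toℚᵘ-ι b) ⟨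
    toℚᵘ (ι a) ℚᵘ.* toℚᵘ (ι b)    ≈⟨ ℚₚ.toℚᵘ-homo-* (ι a) (ι b) ⟨
    toℚᵘ (ι a ℚ.* ι b)            ∎)
  where open ℚᵘₚ.≃-Reasoning

ι-zero : ∀ {a} → ι a ≡ 0ℚ → a ≡ + 0
ι-zero {a} e with ℚᵘₚ.≃-trans (ℚᵘₚ.≃-sym (toℚᵘ-ι a)) (ℚₚ.toℚᵘ-cong e)
... | *≡* h = trans (sym (ℤₚ.*-identityʳ a)) h

toQ-⊕ : ∀ f g → toQ (f ⊕ g) ≡ toQ f +ₚ toQ g
toQ-⊕ [] g = refl
toQ-⊕ (a ∷ f) [] = refl
toQ-⊕ (a ∷ f) (b ∷ g) = cong₂ _∷_ (ι-+ a b) (toQ-⊕ f g)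

toQ-scale : ∀ c f → toQ (scale c f) ≡ ι c ·ₚ toQ f
toQ-scale c [] = refl
toQ-scale c (a ∷ f) = cong₂ _∷_ (ι-* c a) (toQ-scale c f)

toQ-⊗ : ∀ f g → toQ (f ⊗ g) ≡ toQ f *ₚ toQ g
toQ-⊗ [] g = refl
toQ-⊗ (a ∷ f) g = trans (toQ-⊕ (scale a g) (+ 0 ∷ (f ⊗ g))) (cong₂ _+ₚ_ (toQ-scale a g) (cong (0ℚ ∷_) (toQ-⊗ f g)))

cramer : ∀ (a b c a₁ a₂ a₃ b₁ b₂ b₃ c₁ c₂ c₃ : ℤ) →
  (det a₁ a₂ a₃ b₁ b₂ b₃ c₁ c₂ c₃ * a ≡ (b₂ * c₃ - b₃ * c₂) * (a * a₁ + b * a₂ + c * a₃) + (c₂ * a₃ - c₃ * a₂) * (a * b₁ + b * b₂ + c * b₃) + (a₂ * b₃ - a₃ * b₂) * (a * c₁ + b * c₂ + c * c₃)) ×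
  (det a₁ a₂ a₃ b₁ b₂ b₃ c₁ c₂ c₃ * b ≡ (b₃ * c₁ - b₁ * c₃) * (a * a₁ + b * a₂ + c * a₃) + (c₃ * a₁ - c₁ * a₃) * (a * b₁ + b * b₂ + c * b₃) + (a₃ * b₁ - a₁ * b₃) * (a * c₁ + b * c₂ + c * c₃)) ×
  (det a₁ a₂ a₃ b₁ b₂ b₃ c₁ c₂ c₃ * c ≡ (b₁ * c₂ - b₂ * c₁) * (a * a₁ + b * a₂ + c * a₃) + (c₁ * a₂ - c₂ * a₁) * (a * b₁ + b * b₂ + c * b₃) + (a₁ * b₂ - a₂ * b₁) * (a * c₁ + b * c₂ + c * c₃))
cramer a b c a₁ a₂ a₃ b₁ b₂ b₃ c₁ c₂ c₃ = r₁ a b c a₁ a₂ a₃ b₁ b₂ b₃ c₁ c₂ c₃ , r₂ a b c a₁ a₂ a₃ b₁ b₂ b₃ c₁ c₂ c₃ , r₃ a b c a₁ a₂ a₃ b₁ b₂ b₃ c₁ c₂ c₃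
  where
  r₁ : ∀ (a b c a₁ a₂ a₃ b₁ b₂ b₃ c₁ c₂ c₃ : ℤ) → ((a₂ * b₃ - a₃ * b₂) * c₁ + (a₃ * b₁ - a₁ * b₃) * c₂ + (a₁ * b₂ - a₂ * b₁) * c₃) * a ≡ (b₂ * c₃ - b₃ * c₂) * (a * a₁ + b * a₂ + c * a₃) + (c₂ * a₃ - c₃ * a₂) * (a * b₁ + b * b₂ + c * b₃) + (a₂ * b₃ - a₃ * b₂) * (a * c₁ + b * c₂ + c * c₃)
  r₁ = solve-∀
  r₂ : ∀ (a b c a₁ a₂ a₃ b₁ b₂ b₃ c₁ c₂ c₃ : ℤ) → ((a₂ * b₃ - a₃ * b₂) * c₁ + (a₃ * b₁ - a₁ * b₃) * c₂ + (a₁ * b₂ - a₂ * b₁) * c₃) * b ≡ (b₃ * c₁ - b₁ * c₃) * (a * a₁ + b * a₂ + c * a₃) + (c₃ * a₁ - c₁ * a₃) * (a * b₁ + b * b₂ + c * b₃) + (a₃ * b₁ - a₁ * b₃) * (a * c₁ + b * c₂ + c * c₃)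
  r₂ = solve-∀
  r₃ : ∀ (a b c a₁ a₂ a₃ b₁ b₂ b₃ c₁ c₂ c₃ : ℤ) → ((a₂ * b₃ - a₃ * b₂) * c₁ + (a₃ * b₁ - a₁ * b₃) * c₂ + (a₁ * b₂ - a₂ * b₁) * c₃) * c ≡ (b₁ * c₂ - b₂ * c₁) * (a * a₁ + b * a₂ + c * a₃) + (c₁ * a₂ - c₂ * a₁) * (a * b₁ + b * b₂ + c * b₃) + (a₁ * b₂ - a₂ * b₁) * (a * c₁ + b * c₂ + c * c₃)
  r₃ = solve-∀

module Independence (P Q : RatFun) (ind : LinIndep1 P Q) where
  open Curve P Q
  open Mod 0
  open Roots 0 domain-0

  zero⇒≡0 : ∀ {a} → a ≈0 → a ≡ + 0
  zero⇒≡0 ⟨ divides q e ⟩ = trans e (ℤₚ.*-zeroʳ q)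

  always-large : ∀ T → Large T
  always-large T (suc k) _ _ h with zero⇒≡0 h
  ... | ()

  pencil₃ : ℤ → ℤ → ℤ → ZPoly
  pencil₃ a b c = scale a X ⊕ (scale b Y ⊕ scale c G)

  eval-pencil₃ : ∀ a b c t → evalℤ (pencil₃ a b c) t ≡ a * evalℤ X t + (b * evalℤ Y t + c * evalℤ G t)
  eval-pencil₃ a b c t = trans (eval-⊕ (scale a X) _ t) (cong₂ _+_ (eval-scale a X t) (trans (eval-⊕ (scale b Y) (scale c G) t) (cong₂ _+_ (eval-scale b Y t) (eval-scale c G t))))

  integral-independence : ∀ a b c → (∀ t → evalℤ (pencil₃ a b c) t ≈0) → a ≡ + 0 × b ≡ + 0 × c ≡ + 0
  integral-independence a b c h = ι-zero (proj₁ r) , ι-zero (proj₁ (proj₂ r)) , ι-zero (proj₂ (proj₂ r))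
    where
    coeffs : All _≈0 (pencil₃ a b c)
    coeffs = vanish-coeffs {a = 0} (pencil₃ a b c) (always-large (length (pencil₃ a b c))) ℕₚ.≤-refl (λ k _ → h (+ k))
    eq : toQ (pencil₃ a b c) ≡ (ι a ·ₚ (toQ Pn *ₚ toQ Qd)) +ₚ ((ι b ·ₚ (toQ Qn *ₚ toQ Pd)) +ₚ (ι c ·ₚ (toQ Pd *ₚ toQ Qd)))
    eq = trans (toQ-⊕ (scale a X) _) (cong₂ _+ₚ_ (trans (toQ-scale a X) (cong (ι a ·ₚ_) (toQ-⊗ Pn Qd)))
      (trans (toQ-⊕ (scale b Y) (scale c G)) (cong₂ _+ₚ_ (trans (toQ-scale b Y) (cong (ι b ·ₚ_) (toQ-⊗ Qn Pd))) (trans (toQ-scale c G) (cong (ι c ·ₚ_) (toQ-⊗ Pd Qd))))))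
    r = ind (ι a) (ι b) (ι c) (subst (All (_≡ 0ℚ)) eq (Allₚ.map⁺ (All.map (λ {z} e → cong ι (zero⇒≡0 e)) coeffs)))

  witness : ∀ a b c → ¬ (a ≡ + 0 × b ≡ + 0 × c ≡ + 0) → ∃[ y ] ¬ (evalℤ (pencil₃ a b c) (+ y) ≈0)
  witness a b c n = go (nonzero-or-vanish {d = length (pencil₃ a b c)} {u = evalℤ (pencil₃ a b c)} (always-large (length (pencil₃ a b c))) ℕₚ.≤-refl (pencil₃ a b c , ℕₚ.≤-refl , λ _ → refl))
    where go : (∃[ y ] ¬ (evalℤ (pencil₃ a b c) (+ y) ≈0)) ⊎ (∀ t → evalℤ (pencil₃ a b c) t ≈0) → ∃[ y ] ¬ (evalℤ (pencil₃ a b c) (+ y) ≈0)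
          go (inj₁ w) = w
          go (inj₂ z) = ⊥-elim (n (integral-independence a b c z))

  -- Greedy choice of three evaluation points: the first makes the value of G non-zero, the second a
  -- 2×2 minor, and the third the full determinant, which is expanded along its last row.
  point₁ = witness (+ 0) (+ 0) (+ 1) (λ { (_ , _ , ()) })
  z₁ = + proj₁ point₁
  x₁ = evalℤ X z₁
  y₁ = evalℤ Y z₁
  g₁ = evalℤ G z₁

  g₁≢0 : g₁ ≢ + 0
  g₁≢0 e = proj₂ point₁ (subst _≈0 (sym (trans (eval-pencil₃ (+ 0) (+ 0) (+ 1) z₁) (trans (lem x₁ y₁ g₁) e))) 0≈0)
    where lem : ∀ x y g → + 0 * x + (+ 0 * y + + 1 * g) ≡ g
          lem = solve-∀

  point₂ = witness (+ 0) g₁ (- y₁) (λ { (_ , e , _) → g₁≢0 e })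
  z₂ = + proj₁ point₂
  x₂ = evalℤ X z₂
  y₂ = evalℤ Y z₂
  g₂ = evalℤ G z₂

  κ₁ κ₂ κ₃ : ℤ
  κ₁ = y₁ * g₂ - g₁ * y₂
  κ₂ = g₁ * x₂ - x₁ * g₂
  κ₃ = x₁ * y₂ - y₁ * x₂

  κ₁≢0 : κ₁ ≢ + 0
  κ₁≢0 e = proj₂ point₂ (subst _≈0 (sym (trans (eval-pencil₃ (+ 0) g₁ (- y₁) z₂) (trans (lem x₂ y₂ g₂ y₁ g₁) (cong -_ e)))) 0≈0)
    where lem : ∀ x y g y₁ g₁ → + 0 * x + (g₁ * y + - y₁ * g) ≡ - (y₁ * g - g₁ * y)
          lem = solve-∀

  point₃ = witness κ₁ κ₂ κ₃ (λ { (e , _) → κ₁≢0 e })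
  z₃ = + proj₁ point₃
  x₃ = evalℤ X z₃
  y₃ = evalℤ Y z₃
  g₃ = evalℤ G z₃

  Δ : ℤ
  Δ = det x₁ y₁ g₁ x₂ y₂ g₂ x₃ y₃ g₃

  Δ≢0 : Δ ≢ + 0
  Δ≢0 e = proj₂ point₃ (subst _≈0 (sym (trans (eval-pencil₃ κ₁ κ₂ κ₃ z₃) (trans (sym (ℤₚ.+-assoc (κ₁ * x₃) (κ₂ * y₃) (κ₃ * g₃))) e))) 0≈0)

  -- Evaluate the relation at the three points and apply Cramer's rule; Δ can be cancelled because 0
  -- < |Δ| < p.
  independent-mod : ∀ p (dom : IsDomain p) → ∣ Δ ∣ ℕ.< p → ∀ a b c → (∀ t → Mod._≈0 p (a * evalℤ X t + b * evalℤ Y t + c * evalℤ G t)) → Mod._≈0 p a × Mod._≈0 p b × Mod._≈0 p c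
  independent-mod p dom Δ<p a b c h =
      R.cancel Δ≉0 (subst M._≈0 (sym (proj₁ C)) (eliminate (y₂ * g₃ - g₂ * y₃) (y₃ * g₁ - g₃ * y₁) (y₁ * g₂ - g₁ * y₂)))
    , R.cancel Δ≉0 (subst M._≈0 (sym (proj₁ (proj₂ C))) (eliminate (g₂ * x₃ - x₂ * g₃) (g₃ * x₁ - x₃ * g₁) (g₁ * x₂ - x₁ * g₂)))
    , R.cancel Δ≉0 (subst M._≈0 (sym (proj₂ (proj₂ C))) (eliminate (x₂ * y₃ - y₂ * x₃) (x₃ * y₁ - y₃ * x₁) (x₁ * y₂ - y₁ * x₂)))
    where
    module M = Mod p
    module R = Roots p dom
    C = cramer a b c x₁ y₁ g₁ x₂ y₂ g₂ x₃ y₃ g₃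
    eliminate : ∀ u v w → u * (a * x₁ + b * y₁ + c * g₁) + v * (a * x₂ + b * y₂ + c * g₂) + w * (a * x₃ + b * y₃ + c * g₃) M.≈0
    eliminate u v w = M.≈0-+ (M.≈0-+ (M.≈0-* u (h z₁)) (M.≈0-* v (h z₂))) (M.≈0-* w (h z₃))
    Δ≉0 : ¬ (Δ M.≈0)
    Δ≉0 e = ℕᵈ.>⇒∤ {{ℕ.≢-nonZero (λ z → Δ≢0 (ℤₚ.∣i∣≡0⇒i≡0 z))}} Δ<p (∣⇒∣ᵤ (M.dvd e))

-- Jets and determinants of the three systems

module _ {I : Set} {n : ℕ} where
  jet-var : ∀ (k : Fin n) f → Jet {I × Vec ℤ n × Vec ℤ n} (λ { (i , z , v) ε → evalℤ f (lookup (line z v ε) k) })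
    (λ { (i , z , v) → evalℤ f (lookup z k) }) (λ { (i , z , v) → lookup v k * evalℤ (deriv f) (lookup z k) })
  jet-var k f = jet-cong (λ { (i , z , v) ε → cong (evalℤ f) (sym (Vecₚ.lookup-zipWith (λ a b → a + ε * b) k z v)) }) (λ _ → refl) (λ _ → refl)
    (jet-eval f (jet-line (λ { (i , z , v) → lookup z k }) (λ { (i , z , v) → lookup v k })))

  jet-param : (φ : I → ℤ) → Jet {I × Vec ℤ n × Vec ℤ n} (λ { (i , z , v) ε → φ i }) (λ { (i , z , v) → φ i }) (λ _ → + 0)
  jet-param φ = jet-const (λ { (i , z , v) → φ i })

-- The equation R(a) - R(b) = φ, multiplied by both denominators.
difference : RatFun → ℤ → ℤ → ℤ → ℤ
difference R φ a b = evalℤ (num R) a * evalℤ (den R) b - evalℤ (num R) b * evalℤ (den R) a - φ * (evalℤ (den R) a * evalℤ (den R) b)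

difference′ : RatFun → ℤ → ℤ → ℤ → ℤ → ℤ → ℤ
difference′ R φ a b u w =
  u * (evalℤ (deriv (num R)) a * evalℤ (den R) b - evalℤ (num R) b * evalℤ (deriv (den R)) a - φ * (evalℤ (deriv (den R)) a * evalℤ (den R) b))
  + w * (evalℤ (num R) a * evalℤ (deriv (den R)) b - evalℤ (deriv (num R)) b * evalℤ (den R) a - φ * (evalℤ (den R) a * evalℤ (deriv (den R)) b))

difference-jet : ∀ {I : Set} {n} R (k k′ : Fin n) (φ : I → ℤ) →
  LineJet (λ i z → difference R (φ i) (lookup z k) (lookup z k′)) (λ i z v → difference′ R (φ i) (lookup z k) (lookup z k′) (lookup v k) (lookup v k′))
difference-jet R k k′ φ = jet-cong (λ _ _ → refl) (λ _ → refl)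
  (λ { (i , z , v) → lem (φ i) (lookup v k) (lookup v k′) (evalℤ (num R) (lookup z k)) (evalℤ (deriv (num R)) (lookup z k)) (evalℤ (den R) (lookup z k)) (evalℤ (deriv (den R)) (lookup z k))
     (evalℤ (num R) (lookup z k′)) (evalℤ (deriv (num R)) (lookup z k′)) (evalℤ (den R) (lookup z k′)) (evalℤ (deriv (den R)) (lookup z k′)) })
  (jet-- (jet-- (jet-* (jet-var k (num R)) (jet-var k′ (den R))) (jet-* (jet-var k′ (num R)) (jet-var k (den R))))
         (jet-* (jet-param φ) (jet-* (jet-var k (den R)) (jet-var k′ (den R)))))
  where lem : ∀ φ u w n n′ d d′ m m′ e e′ →
          ((n * (w * e′) + u * n′ * e) - (m * (u * d′) + w * m′ * d)) - (φ * (d * (w * e′) + u * d′ * e) + + 0 * (d * e))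
          ≡ u * (n′ * e - m * d′ - φ * (d′ * e)) + w * (n * e′ - m′ * d - φ * (d * e′))
        lem = solve-∀

alternating : RatFun → ℤ → ℤ → ℤ → ℤ → ℤ
alternating R c x y z = evalℤ (num R) x * (evalℤ (den R) y * evalℤ (den R) z) - evalℤ (num R) y * (evalℤ (den R) x * evalℤ (den R) z)
  + evalℤ (num R) z * (evalℤ (den R) x * evalℤ (den R) y) - c * (evalℤ (den R) x * (evalℤ (den R) y * evalℤ (den R) z))

alternating′ : RatFun → ℤ → ℤ → ℤ → ℤ → ℤ → ℤ → ℤ → ℤ
alternating′ R c x y z u v w =
  u * (n′ x * (d y * d z) - n y * (d′ x * d z) + n z * (d′ x * d y) - c * (d′ x * (d y * d z)))
  + v * (n x * (d′ y * d z) - n′ y * (d x * d z) + n z * (d x * d′ y) - c * (d x * (d′ y * d z)))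
  + w * (n x * (d y * d′ z) - n y * (d x * d′ z) + n′ z * (d x * d y) - c * (d x * (d y * d′ z)))
  where
  n = evalℤ (num R)
  n′ = evalℤ (deriv (num R))
  d = evalℤ (den R)
  d′ = evalℤ (deriv (den R))

-- With m = A/B, the equation κ·m(x)·m(z) = μ·m(y) cleared of denominators. It is the singularity
-- condition seen from three of the eight points.
binomial : ZPoly → ZPoly → ℤ → ℤ → ℤ → ℤ → ℤ → ℤ
binomial A B κ μ x y z = κ * (evalℤ A x * (evalℤ B y * evalℤ A z)) - μ * (evalℤ B x * (evalℤ A y * evalℤ B z))

binomial′ : ZPoly → ZPoly → ℤ → ℤ → ℤ → ℤ → ℤ → ℤ → ℤ → ℤ → ℤ
binomial′ A B κ μ x y z u v w =
  u * (κ * (evalℤ (deriv A) x * (evalℤ B y * evalℤ A z)) - μ * (evalℤ (deriv B) x * (evalℤ A y * evalℤ B z)))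
  + v * (κ * (evalℤ A x * (evalℤ (deriv B) y * evalℤ A z)) - μ * (evalℤ B x * (evalℤ (deriv A) y * evalℤ B z)))
  + w * (κ * (evalℤ A x * (evalℤ B y * evalℤ (deriv A) z)) - μ * (evalℤ B x * (evalℤ A y * evalℤ (deriv B) z)))

module _ {I : Set} where
  alternating-jet : ∀ R (c : I → ℤ) → LineJet {n = 3} (λ i z → alternating R (c i) (lookup z 0F) (lookup z 1F) (lookup z 2F))
    (λ i z v → alternating′ R (c i) (lookup z 0F) (lookup z 1F) (lookup z 2F) (lookup v 0F) (lookup v 1F) (lookup v 2F))
  alternating-jet R c = jet-cong (λ _ _ → refl) (λ _ → refl)
    (λ { (i , z , v) → lem (c i) (lookup v 0F) (lookup v 1F) (lookup v 2F)
       (n (lookup z 0F)) (n′ (lookup z 0F)) (d (lookup z 0F)) (d′ (lookup z 0F)) (n (lookup z 1F)) (n′ (lookup z 1F)) (d (lookup z 1F)) (d′ (lookup z 1F))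
       (n (lookup z 2F)) (n′ (lookup z 2F)) (d (lookup z 2F)) (d′ (lookup z 2F)) })
    (jet-- (jet-+ (jet-- (jet-* (N 0F) (jet-* (D 1F) (D 2F))) (jet-* (N 1F) (jet-* (D 0F) (D 2F)))) (jet-* (N 2F) (jet-* (D 0F) (D 1F))))
           (jet-* (jet-param c) (jet-* (D 0F) (jet-* (D 1F) (D 2F)))))
    where
    n = evalℤ (num R)
    n′ = evalℤ (deriv (num R))
    d = evalℤ (den R)
    d′ = evalℤ (deriv (den R))
    N = λ k → jet-var {I} {3} k (num R)
    D = λ k → jet-var {I} {3} k (den R)
    lem : ∀ c u v w nx nx′ dx dx′ ny ny′ dy dy′ nz nz′ dz dz′ →
      (((nx * (dy * (w * dz′) + v * dy′ * dz) + u * nx′ * (dy * dz)) - (ny * (dx * (w * dz′) + u * dx′ * dz) + v * ny′ * (dx * dz)))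
        + (nz * (dx * (v * dy′) + u * dx′ * dy) + w * nz′ * (dx * dy)))
      - (c * (dx * (dy * (w * dz′) + v * dy′ * dz) + u * dx′ * (dy * dz)) + + 0 * (dx * (dy * dz)))
      ≡ u * (nx′ * (dy * dz) - ny * (dx′ * dz) + nz * (dx′ * dy) - c * (dx′ * (dy * dz)))
      + v * (nx * (dy′ * dz) - ny′ * (dx * dz) + nz * (dx * dy′) - c * (dx * (dy′ * dz)))
      + w * (nx * (dy * dz′) - ny * (dx * dz′) + nz′ * (dx * dy) - c * (dx * (dy * dz′)))
    lem = solve-∀

  binomial-jet : ∀ A B (κ μ : I → ℤ) → LineJet {n = 3} (λ i z → binomial A B (κ i) (μ i) (lookup z 0F) (lookup z 1F) (lookup z 2F))
    (λ i z v → binomial′ A B (κ i) (μ i) (lookup z 0F) (lookup z 1F) (lookup z 2F) (lookup v 0F) (lookup v 1F) (lookup v 2F))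
  binomial-jet A B κ μ = jet-cong (λ _ _ → refl) (λ _ → refl)
    (λ { (i , z , v) → lem (κ i) (μ i) (lookup v 0F) (lookup v 1F) (lookup v 2F)
       (a (lookup z 0F)) (a′ (lookup z 0F)) (b (lookup z 0F)) (b′ (lookup z 0F)) (a (lookup z 1F)) (a′ (lookup z 1F)) (b (lookup z 1F)) (b′ (lookup z 1F))
       (a (lookup z 2F)) (a′ (lookup z 2F)) (b (lookup z 2F)) (b′ (lookup z 2F)) })
    (jet-- (jet-* (jet-param κ) (jet-* (α 0F) (jet-* (β 1F) (α 2F)))) (jet-* (jet-param μ) (jet-* (β 0F) (jet-* (α 1F) (β 2F)))))
    where
    a = evalℤ A
    a′ = evalℤ (deriv A)
    b = evalℤ B
    b′ = evalℤ (deriv B)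
    α = λ k → jet-var {I} {3} k A
    β = λ k → jet-var {I} {3} k B
    lem : ∀ κ μ u v w ax ax′ bx bx′ ay ay′ by by′ az az′ bz bz′ →
      (κ * (ax * (by * (w * az′) + v * by′ * az) + u * ax′ * (by * az)) + + 0 * (ax * (by * az)))
      - (μ * (bx * (ay * (w * bz′) + v * ay′ * bz) + u * bx′ * (ay * bz)) + + 0 * (bx * (ay * bz)))
      ≡ u * (κ * (ax′ * (by * az)) - μ * (bx′ * (ay * bz))) + v * (κ * (ax * (by′ * az)) - μ * (bx * (ay′ * bz))) + w * (κ * (ax * (by * az′)) - μ * (bx * (ay * bz′)))
    lem = solve-∀

-- Cyclic bidiagonal linear systems

Edge : Set
Edge = ℤ × ℤ × ℤ

-- An edge (a, b, h) is the equation a·v - b·v⁺ = h, where v⁺ is the next unknown in cyclic order.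
-- The determinant of the system is the product of the a minus the product of the b, and `path` is
-- Cramer's numerator for the first unknown.
products₁ products₂ path cyclic-det : List Edge → ℤ
products₁ [] = + 1
products₁ ((a , b , h) ∷ l) = a * products₁ l
products₂ [] = + 1
products₂ ((a , b , h) ∷ l) = b * products₂ l
path [] = + 0
path ((a , b , h) ∷ l) = h * products₁ l + b * path l
cyclic-det l = products₁ l - products₂ l

products₁-snoc : ∀ l a b h → products₁ (l ++ (a , b , h) ∷ []) ≡ a * products₁ l
products₁-snoc [] a b h = refl
products₁-snoc ((a′ , _) ∷ l) a b h = trans (cong (a′ *_) (products₁-snoc l a b h)) (lem a′ a (products₁ l))
  where lem : ∀ x y z → x * (y * z) ≡ y * (x * z)
        lem = solve-∀

products₂-snoc : ∀ l a b h → products₂ (l ++ (a , b , h) ∷ []) ≡ b * products₂ l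
products₂-snoc [] a b h = refl
products₂-snoc ((_ , b′ , _) ∷ l) a b h = trans (cong (b′ *_) (products₂-snoc l a b h)) (lem b′ b (products₂ l))
  where lem : ∀ x y z → x * (y * z) ≡ y * (x * z)
        lem = solve-∀

path-snoc : ∀ l a b h → path (l ++ (a , b , h) ∷ []) ≡ path l * a + products₂ l * h
path-snoc [] a b h = lem a b h
  where lem : ∀ a b h → h * + 1 + b * + 0 ≡ + 0 * a + + 1 * h
        lem = solve-∀
path-snoc ((a′ , b′ , h′) ∷ l) a b h = trans (cong₂ (λ x y → h′ * x + b′ * y) (products₁-snoc l a b h) (path-snoc l a b h)) (lem a b′ h h′ (products₁ l) (path l) (products₂ l))
  where lem : ∀ a b′ h h′ x y z → h′ * (a * x) + b′ * (y * a + z * h) ≡ (h′ * x + b′ * y) * a + b′ * z * h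
        lem = solve-∀

cyclic-det-rotate : ∀ l a b h → cyclic-det (l ++ (a , b , h) ∷ []) ≡ cyclic-det ((a , b , h) ∷ l)
cyclic-det-rotate l a b h = cong₂ _-_ (products₁-snoc l a b h) (products₂-snoc l a b h)

-- The first equation multiplied by the determinant. Moving the first edge to the end turns `path`
-- into the numerator of the next unknown, so rotations of this one identity verify every equation.
path-rotate : ∀ l a b h → a * path ((a , b , h) ∷ l) - b * path (l ++ (a , b , h) ∷ []) ≡ h * cyclic-det ((a , b , h) ∷ l)
path-rotate l a b h = trans (cong (λ w → a * (h * products₁ l + b * path l) - b * w) (path-snoc l a b h)) (lem a b h (products₁ l) (path l) (products₂ l))
  where lem : ∀ a b h x y z → a * (h * x + b * y) - b * (y * a + z * h) ≡ h * (a * x - b * z)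
        lem = solve-∀

module LinearAlgebra (p : ℕ) where
  open Mod p

  infix 4 _≋_
  -- A record rather than a synonym for `a - b ≈0`, so that both sides can be recovered from the
  -- type in nested products such as `octic-cong`.
  record _≋_ (a b : ℤ) : Set where
    constructor diff
    field undiff : a - b ≈0
  open _≋_ public

  ≋-* : ∀ {a b c d} → a ≋ b → c ≋ d → a * c ≋ b * d
  ≋-* {a} {b} {c} {d} (diff h) (diff k) = diff (subst _≈0 (lem a b c d) (≈0-+ (≈0-*ʳ c h) (≈0-* b k)))
    where lem : ∀ a b c d → (a - b) * c + b * (c - d) ≡ a * c - b * d
          lem = solve-∀

  ≋-- : ∀ {a b c d} → a ≋ b → c ≋ d → a - c ≋ b - d
  ≋-- {a} {b} {c} {d} (diff h) (diff k) = diff (subst _≈0 (lem a b c d) (≈0-- h k))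
    where lem : ∀ a b c d → (a - b) - (c - d) ≡ (a - c) - (b - d)
          lem = solve-∀

  rotate-solution : ∀ {Δ} l a b h μ → Δ * μ - + 1 ≈0 → cyclic-det ((a , b , h) ∷ l) ≡ Δ →
    a * (μ * path ((a , b , h) ∷ l)) - b * (μ * path (l ++ (a , b , h) ∷ [])) - h ≈0
  rotate-solution l a b h μ inv refl = subst _≈0 (trans (lem μ h (cyclic-det ((a , b , h) ∷ l)))
      (trans (cong (λ w → μ * w - h) (sym (path-rotate l a b h))) (lem₂ a b μ (path ((a , b , h) ∷ l)) (path (l ++ (a , b , h) ∷ [])) h))) (≈0-* h inv)
    where
    lem : ∀ μ h Δ → h * (Δ * μ - + 1) ≡ μ * (h * Δ) - h
    lem = solve-∀
    lem₂ : ∀ a b μ s t h → μ * (a * s - b * t) - h ≡ a * (μ * s) - b * (μ * t) - h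
    lem₂ = solve-∀

-- The singularity condition in m = A/B, cleared of denominators. The bracketing sets the first
-- three points apart, so that for fixed values at the other five it is literally a `binomial` in
-- these three.
octic : (a₀ b₀ a₁ b₁ a₂ b₂ a₃ b₃ a₄ b₄ a₅ b₅ a₆ b₆ a₇ b₇ : ℤ) → ℤ
octic a₀ b₀ a₁ b₁ a₂ b₂ a₃ b₃ a₄ b₄ a₅ b₅ a₆ b₆ a₇ b₇ =
  (b₃ * (a₄ * (b₅ * (a₆ * b₇)))) * (a₀ * (b₁ * a₂)) - (a₃ * (b₄ * (a₅ * (b₆ * a₇)))) * (b₀ * (a₁ * b₂))

product : List ℤ → ℤ
product [] = + 1
product (x ∷ xs) = x * product xs

product-zip : List (ℤ × ℤ) → ℤ
product-zip [] = + 1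
product-zip ((x , u) ∷ l) = (x * u) * product-zip l

-- Separates two interleaved families of factors; identities in 32 variables then reduce to
-- reordering products of eight.
product-zip-split : ∀ l → product-zip l ≡ product (List.map proj₁ l) * product (List.map proj₂ l)
product-zip-split [] = refl
product-zip-split ((x , u) ∷ l) = trans (cong (x * u *_) (product-zip-split l)) (lem x u (product (List.map proj₁ l)) (product (List.map proj₂ l)))
  where lem : ∀ x u a b → (x * u) * (a * b) ≡ (x * a) * (u * b)
        lem = solve-∀

rotate-product : ∀ a b c d e f g h → a * (b * (c * (d * (e * (f * (g * (h * + 1))))))) ≡ h * (a * (b * (c * (d * (e * (f * (g * + 1)))))))
rotate-product = solve-∀

unit-product : ∀ a b c d e f g h → (a * b * c * d) * (e * f * g * h) ≡ a * (b * (c * (d * (e * (f * (g * (h * + 1)))))))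
unit-product = solve-∀

octic-product : ∀ a b c d e f g h → a * (b * (c * (d * (e * (f * (g * (h * + 1))))))) ≡ (d * (e * (f * (g * h)))) * (a * (b * c))
octic-product = solve-∀

octic-unit : ∀ x₀ x₁ x₂ x₃ x₄ x₅ x₆ x₇ a b c d e f g h →
  ((x₀ * x₁ * x₂ * x₃) * (x₄ * x₅ * x₆ * x₇)) * (a * (b * (c * (d * (e * (f * (g * (h * + 1))))))))
  ≡ ((x₃ * d) * ((x₄ * e) * ((x₅ * f) * ((x₆ * g) * (x₇ * h))))) * ((x₀ * a) * ((x₁ * b) * (x₂ * c)))
octic-unit x₀ x₁ x₂ x₃ x₄ x₅ x₆ x₇ a b c d e f g h =
  trans (cong (λ w → w * product (a ∷ b ∷ c ∷ d ∷ e ∷ f ∷ g ∷ h ∷ [])) (unit-product x₀ x₁ x₂ x₃ x₄ x₅ x₆ x₇))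
  (trans (sym (product-zip-split ((x₀ , a) ∷ (x₁ , b) ∷ (x₂ , c) ∷ (x₃ , d) ∷ (x₄ , e) ∷ (x₅ , f) ∷ (x₆ , g) ∷ (x₇ , h) ∷ [])))
    (octic-product (x₀ * a) (x₁ * b) (x₂ * c) (x₃ * d) (x₄ * e) (x₅ * f) (x₆ * g) (x₇ * h)))

*-distrib-- : ∀ x a b → x * (a - b) ≡ x * a - x * b
*-distrib-- = solve-∀

-- The determinant of the cyclic system, whose entries involve s = den P, t = den Q,
-- u = P′ s and v = Q′ t at the eight points, is the octic form up to a unit.
module OcticDet (s₀ t₀ u₀ v₀ s₁ t₁ u₁ v₁ s₂ t₂ u₂ v₂ s₃ t₃ u₃ v₃ s₄ t₄ u₄ v₄ s₅ t₅ u₅ v₅ s₆ t₆ u₆ v₆ s₇ t₇ u₇ v₇ : ℤ) where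
  unit forward backward p₁ p₂ q₁ q₂ : ℤ
  unit = (s₀ * t₀ * (s₁ * t₁) * (s₂ * t₂) * (s₃ * t₃)) * (s₄ * t₄ * (s₅ * t₅) * (s₆ * t₆) * (s₇ * t₇))
  forward = (s₁ * u₀) * ((t₂ * v₁) * ((s₃ * u₂) * ((t₄ * v₃) * ((s₅ * u₄) * ((t₆ * v₅) * ((s₇ * u₆) * ((t₀ * v₇) * + 1)))))))
  backward = (s₀ * u₁) * ((t₁ * v₂) * ((s₂ * u₃) * ((t₃ * v₄) * ((s₄ * u₅) * ((t₅ * v₆) * ((s₆ * u₇) * ((t₇ * v₀) * + 1)))))))
  p₁ = (s₀ * v₀) * ((t₁ * u₁) * ((s₂ * v₂) * ((t₃ * u₃) * ((s₄ * v₄) * ((t₅ * u₅) * ((s₆ * v₆) * ((t₇ * u₇) * + 1)))))))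
  p₂ = (t₀ * u₀) * ((s₁ * v₁) * ((t₂ * u₂) * ((s₃ * v₃) * ((t₄ * u₄) * ((s₅ * v₅) * ((t₆ * u₆) * ((s₇ * v₇) * + 1)))))))
  q₁ = ((s₃ * t₃ * (t₃ * u₃)) * ((s₄ * t₄ * (s₄ * v₄)) * ((s₅ * t₅ * (t₅ * u₅)) * ((s₆ * t₆ * (s₆ * v₆)) * (s₇ * t₇ * (t₇ * u₇)))))) * ((s₀ * t₀ * (s₀ * v₀)) * ((s₁ * t₁ * (t₁ * u₁)) * (s₂ * t₂ * (s₂ * v₂))))
  q₂ = ((s₃ * t₃ * (s₃ * v₃)) * ((s₄ * t₄ * (t₄ * u₄)) * ((s₅ * t₅ * (s₅ * v₅)) * ((s₆ * t₆ * (t₆ * u₆)) * (s₇ * t₇ * (s₇ * v₇)))))) * ((s₀ * t₀ * (t₀ * u₀)) * ((s₁ * t₁ * (s₁ * v₁)) * (s₂ * t₂ * (t₂ * u₂))))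

  forward≡ : forward ≡ p₂
  forward≡ = trans (product-zip-split ((s₁ , u₀) ∷ (t₂ , v₁) ∷ (s₃ , u₂) ∷ (t₄ , v₃) ∷ (s₅ , u₄) ∷ (t₆ , v₅) ∷ (s₇ , u₆) ∷ (t₀ , v₇) ∷ []))
    (trans (cong (λ w → w * product (u₀ ∷ v₁ ∷ u₂ ∷ v₃ ∷ u₄ ∷ v₅ ∷ u₆ ∷ v₇ ∷ [])) (rotate-product s₁ t₂ s₃ t₄ s₅ t₆ s₇ t₀))
     (sym (product-zip-split ((t₀ , u₀) ∷ (s₁ , v₁) ∷ (t₂ , u₂) ∷ (s₃ , v₃) ∷ (t₄ , u₄) ∷ (s₅ , v₅) ∷ (t₆ , u₆) ∷ (s₇ , v₇) ∷ []))))
  backward≡ : backward ≡ p₁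
  backward≡ = trans (product-zip-split ((s₀ , u₁) ∷ (t₁ , v₂) ∷ (s₂ , u₃) ∷ (t₃ , v₄) ∷ (s₄ , u₅) ∷ (t₅ , v₆) ∷ (s₆ , u₇) ∷ (t₇ , v₀) ∷ []))
    (trans (cong (λ w → product (s₀ ∷ t₁ ∷ s₂ ∷ t₃ ∷ s₄ ∷ t₅ ∷ s₆ ∷ t₇ ∷ []) * w) (rotate-product u₁ v₂ u₃ v₄ u₅ v₆ u₇ v₀))
     (sym (product-zip-split ((s₀ , v₀) ∷ (t₁ , u₁) ∷ (s₂ , v₂) ∷ (t₃ , u₃) ∷ (s₄ , v₄) ∷ (t₅ , u₅) ∷ (s₆ , v₆) ∷ (t₇ , u₇) ∷ []))))
  q₁≡ : unit * p₁ ≡ q₁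
  q₁≡ = octic-unit (s₀ * t₀) (s₁ * t₁) (s₂ * t₂) (s₃ * t₃) (s₄ * t₄) (s₅ * t₅) (s₆ * t₆) (s₇ * t₇) (s₀ * v₀) (t₁ * u₁) (s₂ * v₂) (t₃ * u₃) (s₄ * v₄) (t₅ * u₅) (s₆ * v₆) (t₇ * u₇)
  q₂≡ : unit * p₂ ≡ q₂
  q₂≡ = octic-unit (s₀ * t₀) (s₁ * t₁) (s₂ * t₂) (s₃ * t₃) (s₄ * t₄) (s₅ * t₅) (s₆ * t₆) (s₇ * t₇) (t₀ * u₀) (s₁ * v₁) (t₂ * u₂) (s₃ * v₃) (t₄ * u₄) (s₅ * v₅) (t₆ * u₆) (s₇ * v₇)

  octic≡ : unit * (backward - forward) ≡ q₁ - q₂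
  octic≡ = trans (*-distrib-- unit backward forward) (cong₂ _-_ (trans (cong (unit *_) backward≡) q₁≡) (trans (cong (unit *_) forward≡) q₂≡))

cyclic : ∀ {n} → (Fin n → RatFun) → (Fin n → Fin n) → Fin n → (Fin n → ℤ) → Vec ℤ n → ℤ
cyclic R next j φ z = difference (R j) (φ j) (lookup z j) (lookup z (next j))

cyclic′ : ∀ {n} → (Fin n → RatFun) → (Fin n → Fin n) → Fin n → (Fin n → ℤ) → Vec ℤ n → Vec ℤ n → ℤ
cyclic′ R next j φ z v = difference′ (R j) (φ j) (lookup z j) (lookup z (next j)) (lookup v j) (lookup v (next j))

module Values (P Q : RatFun) (p : ℕ) .{{_ : NonZero p}} (pr : Prime p) where
  open Curve P Q
  open Mod p
  open LinearAlgebra p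
  open Fermat pr using (inverse; 1<p)

  -- Away from poles `δ R y` is den R · R′ at y, because num R = val · den R there.
  num* den* num′ den′ δ : RatFun → Fin p → ℤ
  num* R y = evalℤ (num R) (elt p y)
  den* R y = evalℤ (den R) (elt p y)
  num′ R y = evalℤ (deriv (num R)) (elt p y)
  den′ R y = evalℤ (deriv (den R)) (elt p y)
  δ R y = num′ R y - val p R y * den′ R y

  A* B* : Fin p → ℤ
  A* y = evalℤ A (elt p y)
  B* y = evalℤ B (elt p y)

  Good : Fin p → Set
  Good y = ¬ (den* P y ≈0) × ¬ (den* Q y ≈0)

  -- What the power in the definition of `val` amounts to, as a congruence without inverses; it
  -- turns later computations into polynomial identities.
  Regular : RatFun → Fin p → Set
  Regular R y = num* R y - val p R y * den* R y ≈0

  val-regular : ∀ R y → ¬ (den* R y ≈0) → Regular R y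
  val-regular R y d≉0 = subst _≈0 (lem (num* R y) (den* R y) (den* R y ^ (p ℕ.∸ 2)) (val p R y)) (≈0-neg (≈0-+ (≈0-* (den* R y) (%ℕ-≈ (num* R y * den* R y ^ (p ℕ.∸ 2)))) (≈0-* (num* R y) (inverse d≉0))))
    where lem : ∀ n d i v → - (d * (v - n * i) + n * (d * i - + 1)) ≡ n - v * d
          lem = solve-∀

  good-P : ∀ {y} → Good y → Regular P y
  good-P {y} g = val-regular P y (proj₁ g)

  good-Q : ∀ {y} → Good y → Regular Q y
  good-Q {y} g = val-regular Q y (proj₂ g)

  difference-zero : ∀ R φ x y → Regular R x → Regular R y → val p R x - val p R y - φ ≈0 → difference R φ (elt p x) (elt p y) ≈0
  difference-zero R φ x y rx ry h = subst _≈0 (lem (num* R x) (den* R x) (val p R x) (num* R y) (den* R y) (val p R y) φ)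
      (≈0-+ (≈0-- (≈0-* (den* R y) rx) (≈0-* (den* R x) ry)) (≈0-* (den* R x * den* R y) h))
    where lem : ∀ n d α m e β φ → (e * (n - α * d) - d * (m - β * e)) + d * e * (α - β - φ) ≡ n * e - m * d - φ * (d * e)
          lem = solve-∀

  -- At a zero, differentiating an equation that was multiplied by its denominators gives the
  -- denominators times the differential of the original equation.
  difference-derivative : ∀ R φ x y u w → Regular R x → Regular R y → val p R x - val p R y - φ ≈0 →
    difference′ R φ (elt p x) (elt p y) u w - (den* R y * δ R x * u - den* R x * δ R y * w) ≈0
  difference-derivative R φ x y u w rx ry h = subst _≈0 (lem u w (num* R x) (num′ R x) (den* R x) (den′ R x) (val p R x) (num* R y) (num′ R y) (den* R y) (den′ R y) (val p R y) φ)
      (≈0-+ (≈0-* (u * den′ R x) (≈0-- (≈0-* (den* R y) h) ry)) (≈0-* (w * den′ R y) (≈0-+ rx (≈0-* (den* R x) h))))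
    where lem : ∀ u w n n′ d d′ α m m′ e e′ β φ →
            (u * d′) * (e * (α - β - φ) - (m - β * e)) + (w * e′) * ((n - α * d) + d * (α - β - φ))
            ≡ (u * (n′ * e - m * d′ - φ * (d′ * e)) + w * (n * e′ - m′ * d - φ * (d * e′))) - (e * (n′ - α * d′) * u - d * (m′ - β * e′) * w)
          lem = solve-∀

  A-value : ∀ y → Regular Q y → A* y ≋ den* P y * den* Q y * (den* P y * δ Q y)
  A-value y r = diff $ subst _≈0 (trans (lem (num* Q y) (num′ Q y) (den* Q y) (den′ Q y) (val p Q y) (den* P y)) (cong (_- den* P y * den* Q y * (den* P y * δ Q y)) (sym (eval-A (elt p y))))) (≈0-neg (≈0-* (den* P y * den* P y * den′ Q y) r))
    where lem : ∀ n n′ d d′ α s → - (s * s * d′ * (n - α * d)) ≡ (n′ * d - n * d′) * (s * s) - s * d * (s * (n′ - α * d′))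
          lem = solve-∀

  B-value : ∀ y → Regular P y → B* y ≋ den* P y * den* Q y * (den* Q y * δ P y)
  B-value y r = diff $ subst _≈0 (trans (lem (num* P y) (num′ P y) (den* P y) (den′ P y) (val p P y) (den* Q y)) (cong (_- den* P y * den* Q y * (den* Q y * δ P y)) (sym (eval-B (elt p y))))) (≈0-neg (≈0-* (den* Q y * den* Q y * den′ P y) r))
    where lem : ∀ n n′ d d′ α s → - (s * s * d′ * (n - α * d)) ≡ (n′ * d - n * d′) * (s * s) - d * s * (s * (n′ - α * d′))
          lem = solve-∀

  octic-cong : ∀ {a₀ b₀ a₁ b₁ a₂ b₂ a₃ b₃ a₄ b₄ a₅ b₅ a₆ b₆ a₇ b₇ a₀′ b₀′ a₁′ b₁′ a₂′ b₂′ a₃′ b₃′ a₄′ b₄′ a₅′ b₅′ a₆′ b₆′ a₇′ b₇′} →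
    a₀ ≋ a₀′ → b₀ ≋ b₀′ → a₁ ≋ a₁′ → b₁ ≋ b₁′ → a₂ ≋ a₂′ → b₂ ≋ b₂′ → a₃ ≋ a₃′ → b₃ ≋ b₃′ →
    a₄ ≋ a₄′ → b₄ ≋ b₄′ → a₅ ≋ a₅′ → b₅ ≋ b₅′ → a₆ ≋ a₆′ → b₆ ≋ b₆′ → a₇ ≋ a₇′ → b₇ ≋ b₇′ →
    octic a₀ b₀ a₁ b₁ a₂ b₂ a₃ b₃ a₄ b₄ a₅ b₅ a₆ b₆ a₇ b₇ ≋ octic a₀′ b₀′ a₁′ b₁′ a₂′ b₂′ a₃′ b₃′ a₄′ b₄′ a₅′ b₅′ a₆′ b₆′ a₇′ b₇′
  octic-cong α₀ β₀ α₁ β₁ α₂ β₂ α₃ β₃ α₄ β₄ α₅ β₅ α₆ β₆ α₇ β₇ =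
    ≋-- (≋-* (≋-* β₃ (≋-* α₄ (≋-* β₅ (≋-* α₆ β₇)))) (≋-* α₀ (≋-* β₁ α₂)))
        (≋-* (≋-* α₃ (≋-* β₄ (≋-* α₅ (≋-* β₆ α₇)))) (≋-* β₀ (≋-* α₁ β₂)))

next₈ : Fin 8 → Fin 8
next₈ 0F = 1F
next₈ 1F = 2F
next₈ 2F = 3F
next₈ 3F = 4F
next₈ 4F = 5F
next₈ 5F = 6F
next₈ 6F = 7F
next₈ 7F = 0F

next₂ : Fin 2 → Fin 2
next₂ 0F = 1F
next₂ 1F = 0F

R₈ : RatFun → RatFun → Fin 8 → RatFun
R₈ P Q 0F = P
R₈ P Q 1F = Q
R₈ P Q 2F = P
R₈ P Q 3F = Q
R₈ P Q 4F = P
R₈ P Q 5F = Q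
R₈ P Q 6F = P
R₈ P Q 7F = Q

R₂ : RatFun → RatFun → Fin 2 → RatFun
R₂ P Q 0F = P
R₂ P Q 1F = Q

module CyclicSolution (p : ℕ) where
  open Mod p
  open LinearAlgebra p

  edge : ∀ {n} (a b η : Fin n → ℤ) → Fin n → Edge
  edge a b η j = (a j , b j , η j)

  solve₈ : ∀ (a b η : Fin 8 → ℤ) →
    ∀ μ → cyclic-det (edge a b η 0F ∷ edge a b η 1F ∷ edge a b η 2F ∷ edge a b η 3F ∷ edge a b η 4F ∷ edge a b η 5F ∷ edge a b η 6F ∷ edge a b η 7F ∷ []) * μ - + 1 ≈0 →
    ∃[ v ] (∀ j → a j * lookup v j - b j * lookup v (next₈ j) - η j ≈0)
  solve₈ a b η μ inv = v , solves
    where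
    e : Fin 8 → Edge
    e j = (a j , b j , η j)
    Δ = cyclic-det (e 0F ∷ e 1F ∷ e 2F ∷ e 3F ∷ e 4F ∷ e 5F ∷ e 6F ∷ e 7F ∷ [])
    l : Fin 8 → List Edge
    l 0F = e 1F ∷ e 2F ∷ e 3F ∷ e 4F ∷ e 5F ∷ e 6F ∷ e 7F ∷ []
    l 1F = e 2F ∷ e 3F ∷ e 4F ∷ e 5F ∷ e 6F ∷ e 7F ∷ e 0F ∷ []
    l 2F = e 3F ∷ e 4F ∷ e 5F ∷ e 6F ∷ e 7F ∷ e 0F ∷ e 1F ∷ []
    l 3F = e 4F ∷ e 5F ∷ e 6F ∷ e 7F ∷ e 0F ∷ e 1F ∷ e 2F ∷ []
    l 4F = e 5F ∷ e 6F ∷ e 7F ∷ e 0F ∷ e 1F ∷ e 2F ∷ e 3F ∷ []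
    l 5F = e 6F ∷ e 7F ∷ e 0F ∷ e 1F ∷ e 2F ∷ e 3F ∷ e 4F ∷ []
    l 6F = e 7F ∷ e 0F ∷ e 1F ∷ e 2F ∷ e 3F ∷ e 4F ∷ e 5F ∷ []
    l 7F = e 0F ∷ e 1F ∷ e 2F ∷ e 3F ∷ e 4F ∷ e 5F ∷ e 6F ∷ []
    s : Fin 8 → ℤ
    s j = μ * path (e j ∷ l j)
    v : Vec ℤ 8
    v = s 0F ∷ s 1F ∷ s 2F ∷ s 3F ∷ s 4F ∷ s 5F ∷ s 6F ∷ s 7F ∷ []
    Δ₁ : cyclic-det (e 1F ∷ l 1F) ≡ Δ
    Δ₁ = cyclic-det-rotate (l 0F) (a 0F) (b 0F) (η 0F)
    Δ₂ : cyclic-det (e 2F ∷ l 2F) ≡ Δ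
    Δ₂ = trans (cyclic-det-rotate (l 1F) (a 1F) (b 1F) (η 1F)) Δ₁
    Δ₃ : cyclic-det (e 3F ∷ l 3F) ≡ Δ
    Δ₃ = trans (cyclic-det-rotate (l 2F) (a 2F) (b 2F) (η 2F)) Δ₂
    Δ₄ : cyclic-det (e 4F ∷ l 4F) ≡ Δ
    Δ₄ = trans (cyclic-det-rotate (l 3F) (a 3F) (b 3F) (η 3F)) Δ₃
    Δ₅ : cyclic-det (e 5F ∷ l 5F) ≡ Δ
    Δ₅ = trans (cyclic-det-rotate (l 4F) (a 4F) (b 4F) (η 4F)) Δ₄
    Δ₆ : cyclic-det (e 6F ∷ l 6F) ≡ Δ
    Δ₆ = trans (cyclic-det-rotate (l 5F) (a 5F) (b 5F) (η 5F)) Δ₅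
    Δ₇ : cyclic-det (e 7F ∷ l 7F) ≡ Δ
    Δ₇ = trans (cyclic-det-rotate (l 6F) (a 6F) (b 6F) (η 6F)) Δ₆
    at : ∀ j → cyclic-det (e j ∷ l j) ≡ Δ → a j * s j - b j * (μ * path (l j ++ e j ∷ [])) - η j ≈0
    at j = rotate-solution (l j) (a j) (b j) (η j) μ inv
    solves : ∀ j → a j * lookup v j - b j * lookup v (next₈ j) - η j ≈0
    solves 0F = at 0F refl
    solves 1F = at 1F Δ₁
    solves 2F = at 2F Δ₂
    solves 3F = at 3F Δ₃
    solves 4F = at 4F Δ₄
    solves 5F = at 5F Δ₅
    solves 6F = at 6F Δ₆
    solves 7F = at 7F Δ₇

  solve₂ : ∀ (a b η : Fin 2 → ℤ) →
    ∀ μ → cyclic-det ((a 0F , b 0F , η 0F) ∷ (a 1F , b 1F , η 1F) ∷ []) * μ - + 1 ≈0 →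
    ∃[ v ] (∀ j → a j * lookup v j - b j * lookup v (next₂ j) - η j ≈0)
  solve₂ a b η μ inv = v , solves
    where
    e₀ e₁ : Edge
    e₀ = (a 0F , b 0F , η 0F)
    e₁ = (a 1F , b 1F , η 1F)
    v : Vec ℤ 2
    v = μ * path (e₀ ∷ e₁ ∷ []) ∷ μ * path (e₁ ∷ e₀ ∷ []) ∷ []
    solves : ∀ j → a j * lookup v j - b j * lookup v (next₂ j) - η j ≈0
    solves 0F = rotate-solution (e₁ ∷ []) (a 0F) (b 0F) (η 0F) μ inv refl
    solves 1F = rotate-solution (e₀ ∷ []) (a 1F) (b 1F) (η 1F) μ inv (cyclic-det-rotate (e₁ ∷ []) (a 0F) (b 0F) (η 0F))

module Nonsingularity (P Q : RatFun) (p : ℕ) .{{_ : NonZero p}} (pr : Prime p) where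
  open Curve P Q
  open Values P Q p pr
  open Mod p
  open LinearAlgebra p
  open CyclicSolution p
  open Fermat pr using (1<p) renaming (inverse to fermat-inverse)
  open Roots p (domain-prime pr) using (≉0-*; cancel)

  invert : ∀ {a} → ¬ (a ≈0) → ∃[ b ] (a * b - + 1 ≈0)
  invert {a} a≉0 = a ^ (p ℕ.∸ 2) , fermat-inverse a≉0

  module _ {n} (R : Fin n → RatFun) (next : Fin n → Fin n) (φ : Fin n → ℤ) (x : Vec (Fin p) n)
    (regular : ∀ j k → Regular (R j) (lookup x k))
    (equations : ∀ j → val p (R j) (lookup x j) - val p (R j) (lookup x (next j)) - φ j ≈0) where

    a b : Fin n → ℤ
    a j = den* (R j) (lookup x (next j)) * δ (R j) (lookup x j)
    b j = den* (R j) (lookup x j) * δ (R j) (lookup x (next j))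

    cyclic-nonsingular : (∀ η → ∃[ v ] (∀ j → a j * lookup v j - b j * lookup v (next j) - η j ≈0)) →
      NonsingularZero p (cyclic R next) (cyclic′ R next) φ (point x)
    cyclic-nonsingular solve = zeros , derivatives
      where
      zeros : ∀ j → cyclic R next j φ (point x) ≈0
      zeros j = subst₂ (λ s t → difference (R j) (φ j) s t ≈0) (sym (Vecₚ.lookup-map j (elt p) x)) (sym (Vecₚ.lookup-map (next j) (elt p) x))
        (difference-zero (R j) (φ j) (lookup x j) (lookup x (next j)) (regular j j) (regular j (next j)) (equations j))
      derivatives : ∀ η → ∃[ v ] (∀ j → cyclic′ R next j φ (point x) v - η j ≈0)
      derivatives η = v , λ j → subst₂ (λ s t → difference′ (R j) (φ j) s t (lookup v j) (lookup v (next j)) - η j ≈0) (sym (Vecₚ.lookup-map j (elt p) x)) (sym (Vecₚ.lookup-map (next j) (elt p) x))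
          (subst _≈0 (lem (difference′ (R j) (φ j) (elt p (lookup x j)) (elt p (lookup x (next j))) (lookup v j) (lookup v (next j))) (a j * lookup v j - b j * lookup v (next j)) (η j))
            (≈0-+ (difference-derivative (R j) (φ j) (lookup x j) (lookup x (next j)) (lookup v j) (lookup v (next j)) (regular j j) (regular j (next j)) (equations j)) (proj₂ (solve η) j)))
        where
        v = proj₁ (solve η)
        lem : ∀ d s h → (d - s) + (s - h) ≡ d - h
        lem = solve-∀

  octic-at : Vec (Fin p) 8 → ℤ
  octic-at x = octic (A* (lookup x 0F)) (B* (lookup x 0F)) (A* (lookup x 1F)) (B* (lookup x 1F)) (A* (lookup x 2F)) (B* (lookup x 2F)) (A* (lookup x 3F)) (B* (lookup x 3F))
                     (A* (lookup x 4F)) (B* (lookup x 4F)) (A* (lookup x 5F)) (B* (lookup x 5F)) (A* (lookup x 6F)) (B* (lookup x 6F)) (A* (lookup x 7F)) (B* (lookup x 7F))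

  octagon-nonsingular : ∀ φ x → (∀ k → Good (lookup x k)) → (∀ j → val p (R₈ P Q j) (lookup x j) - val p (R₈ P Q j) (lookup x (next₈ j)) - φ j ≈0) →
    ¬ (octic-at x ≈0) → NonsingularZero p (cyclic (R₈ P Q) next₈) (cyclic′ (R₈ P Q) next₈) φ (point x)
  octagon-nonsingular φ x good eqs J≉0 = cyclic-nonsingular (R₈ P Q) next₈ φ x regular eqs
      (λ η → solve₈ (a (R₈ P Q) next₈ φ x regular eqs) (b (R₈ P Q) next₈ φ x regular eqs) η (proj₁ inv) (proj₂ inv))
    where
    regular : ∀ j k → Regular (R₈ P Q j) (lookup x k)
    regular 0F k = good-P (good k)
    regular 1F k = good-Q (good k)
    regular 2F k = good-P (good k)
    regular 3F k = good-Q (good k)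
    regular 4F k = good-P (good k)
    regular 5F k = good-Q (good k)
    regular 6F k = good-P (good k)
    regular 7F k = good-Q (good k)
    s t u v : Fin 8 → ℤ
    s k = den* P (lookup x k)
    t k = den* Q (lookup x k)
    u k = δ P (lookup x k)
    v k = δ Q (lookup x k)
    open OcticDet (s 0F) (t 0F) (u 0F) (v 0F) (s 1F) (t 1F) (u 1F) (v 1F) (s 2F) (t 2F) (u 2F) (v 2F) (s 3F) (t 3F) (u 3F) (v 3F)
                  (s 4F) (t 4F) (u 4F) (v 4F) (s 5F) (t 5F) (u 5F) (v 5F) (s 6F) (t 6F) (u 6F) (v 6F) (s 7F) (t 7F) (u 7F) (v 7F)
    α : ∀ k → A* (lookup x k) ≋ s k * t k * (s k * v k)
    α k = A-value (lookup x k) (good-Q (good k))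
    β : ∀ k → B* (lookup x k) ≋ s k * t k * (t k * u k)
    β k = B-value (lookup x k) (good-P (good k))
    octic≋ : octic-at x ≋ q₁ - q₂
    octic≋ = octic-cong (α 0F) (β 0F) (α 1F) (β 1F) (α 2F) (β 2F) (α 3F) (β 3F) (α 4F) (β 4F) (α 5F) (β 5F) (α 6F) (β 6F) (α 7F) (β 7F)
    lem : ∀ f b → b - f ≡ - (f - b)
    lem = solve-∀
    det≉0 : ¬ (forward - backward ≈0)
    det≉0 h = J≉0 (≈0-transport (undiff octic≋) (subst _≈0 octic≡ (≈0-* unit (subst _≈0 (sym (lem forward backward)) (≈0-neg h)))))
    inv = invert det≉0

  tangents : Fin p → Fin p → ℤ
  tangents x y = A* x * B* y - A* y * B* x

  pair-nonsingular : ∀ φ x → (∀ k → Good (lookup x k)) → (∀ j → val p (R₂ P Q j) (lookup x j) - val p (R₂ P Q j) (lookup x (next₂ j)) - φ j ≈0) →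
    ¬ (tangents (lookup x 0F) (lookup x 1F) ≈0) → NonsingularZero p (cyclic (R₂ P Q) next₂) (cyclic′ (R₂ P Q) next₂) φ (point x)
  pair-nonsingular φ x good eqs J≉0 = cyclic-nonsingular (R₂ P Q) next₂ φ x regular eqs
      (λ η → solve₂ (a (R₂ P Q) next₂ φ x regular eqs) (b (R₂ P Q) next₂ φ x regular eqs) η (proj₁ inv) (proj₂ inv))
    where
    regular : ∀ j k → Regular (R₂ P Q j) (lookup x k)
    regular 0F k = good-P (good k)
    regular 1F k = good-Q (good k)
    s t u v : Fin 2 → ℤ
    s k = den* P (lookup x k)
    t k = den* Q (lookup x k)
    u k = δ P (lookup x k)
    v k = δ Q (lookup x k)
    Δ = (s 1F * u 0F) * ((t 0F * v 1F) * + 1) - (s 0F * u 1F) * ((t 1F * v 0F) * + 1)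
    α : ∀ k → A* (lookup x k) ≋ s k * t k * (s k * v k)
    α k = A-value (lookup x k) (good-Q (good k))
    β : ∀ k → B* (lookup x k) ≋ s k * t k * (t k * u k)
    β k = B-value (lookup x k) (good-P (good k))
    lem : ∀ s₀ t₀ u₀ v₀ s₁ t₁ u₁ v₁ → - (s₀ * t₀ * s₁ * t₁) * ((s₁ * u₀) * ((t₀ * v₁) * + 1) - (s₀ * u₁) * ((t₁ * v₀) * + 1))
      ≡ s₀ * t₀ * (s₀ * v₀) * (s₁ * t₁ * (t₁ * u₁)) - s₁ * t₁ * (s₁ * v₁) * (s₀ * t₀ * (t₀ * u₀))
    lem = solve-∀
    det≉0 : ¬ (Δ ≈0)
    det≉0 h = J≉0 (≈0-transport (undiff (≋-- (≋-* (α 0F) (β 1F)) (≋-* (α 1F) (β 0F))))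
      (subst _≈0 (lem (s 0F) (t 0F) (u 0F) (v 0F) (s 1F) (t 1F) (u 1F) (v 1F)) (≈0-* (- (s 0F * t 0F * s 1F * t 1F)) h)))
    inv = invert det≉0

-- The system in three variables: two additive equations and a multiplicative one

Parameters : Set
Parameters = ℤ × ℤ × ℤ × ℤ

triple : RatFun → RatFun → ZPoly → ZPoly → Fin 3 → Parameters → Vec ℤ 3 → ℤ
triple P Q A B 0F (c , d , κ , μ) z = alternating P c (lookup z 0F) (lookup z 1F) (lookup z 2F)
triple P Q A B 1F (c , d , κ , μ) z = alternating Q d (lookup z 0F) (lookup z 1F) (lookup z 2F)
triple P Q A B 2F (c , d , κ , μ) z = binomial A B κ μ (lookup z 0F) (lookup z 1F) (lookup z 2F)

triple′ : RatFun → RatFun → ZPoly → ZPoly → Fin 3 → Parameters → Vec ℤ 3 → Vec ℤ 3 → ℤ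
triple′ P Q A B 0F (c , d , κ , μ) z v = alternating′ P c (lookup z 0F) (lookup z 1F) (lookup z 2F) (lookup v 0F) (lookup v 1F) (lookup v 2F)
triple′ P Q A B 1F (c , d , κ , μ) z v = alternating′ Q d (lookup z 0F) (lookup z 1F) (lookup z 2F) (lookup v 0F) (lookup v 1F) (lookup v 2F)
triple′ P Q A B 2F (c , d , κ , μ) z v = binomial′ A B κ μ (lookup z 0F) (lookup z 1F) (lookup z 2F) (lookup v 0F) (lookup v 1F) (lookup v 2F)

triple-jet : ∀ P Q A B j → LineJet (triple P Q A B j) (triple′ P Q A B j)
triple-jet P Q A B 0F = alternating-jet P proj₁
triple-jet P Q A B 1F = alternating-jet Q (proj₁ ∘ proj₂)
triple-jet P Q A B 2F = binomial-jet A B (proj₁ ∘ proj₂ ∘ proj₂) (proj₂ ∘ proj₂ ∘ proj₂)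

cofactor : (h₁ h₂ h₃ a₁ a₂ a₃ b₁ b₂ b₃ : ℤ) → ℤ
cofactor h₁ h₂ h₃ a₁ a₂ a₃ b₁ b₂ b₃ = h₁ * (a₂ * b₃ - a₃ * b₂) + h₂ * (a₃ * b₁ - a₁ * b₃) + h₃ * (a₁ * b₂ - a₂ * b₁)

-- Cramer's rule: the cofactors are the coefficients that express (h₁, h₂, h₃), times the
-- determinant, through the three vectors x, y, z.
cofactor-expansion : ∀ h₁ h₂ h₃ x₁ x₂ x₃ y₁ y₂ y₃ z₁ z₂ z₃ →
  (x₁ * cofactor h₁ h₂ h₃ y₁ y₂ y₃ z₁ z₂ z₃ + y₁ * cofactor h₁ h₂ h₃ z₁ z₂ z₃ x₁ x₂ x₃ + z₁ * cofactor h₁ h₂ h₃ x₁ x₂ x₃ y₁ y₂ y₃ ≡ h₁ * det x₁ x₂ x₃ y₁ y₂ y₃ z₁ z₂ z₃) ×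
  (x₂ * cofactor h₁ h₂ h₃ y₁ y₂ y₃ z₁ z₂ z₃ + y₂ * cofactor h₁ h₂ h₃ z₁ z₂ z₃ x₁ x₂ x₃ + z₂ * cofactor h₁ h₂ h₃ x₁ x₂ x₃ y₁ y₂ y₃ ≡ h₂ * det x₁ x₂ x₃ y₁ y₂ y₃ z₁ z₂ z₃) ×
  (x₃ * cofactor h₁ h₂ h₃ y₁ y₂ y₃ z₁ z₂ z₃ + y₃ * cofactor h₁ h₂ h₃ z₁ z₂ z₃ x₁ x₂ x₃ + z₃ * cofactor h₁ h₂ h₃ x₁ x₂ x₃ y₁ y₂ y₃ ≡ h₃ * det x₁ x₂ x₃ y₁ y₂ y₃ z₁ z₂ z₃)
cofactor-expansion h₁ h₂ h₃ x₁ x₂ x₃ y₁ y₂ y₃ z₁ z₂ z₃ = r₁ h₁ h₂ h₃ x₁ x₂ x₃ y₁ y₂ y₃ z₁ z₂ z₃ , r₂ h₁ h₂ h₃ x₁ x₂ x₃ y₁ y₂ y₃ z₁ z₂ z₃ , r₃ h₁ h₂ h₃ x₁ x₂ x₃ y₁ y₂ y₃ z₁ z₂ z₃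
  where
  r₁ : ∀ h₁ h₂ h₃ x₁ x₂ x₃ y₁ y₂ y₃ z₁ z₂ z₃ →
    x₁ * (h₁ * (y₂ * z₃ - y₃ * z₂) + h₂ * (y₃ * z₁ - y₁ * z₃) + h₃ * (y₁ * z₂ - y₂ * z₁))
    + y₁ * (h₁ * (z₂ * x₃ - z₃ * x₂) + h₂ * (z₃ * x₁ - z₁ * x₃) + h₃ * (z₁ * x₂ - z₂ * x₁))
    + z₁ * (h₁ * (x₂ * y₃ - x₃ * y₂) + h₂ * (x₃ * y₁ - x₁ * y₃) + h₃ * (x₁ * y₂ - x₂ * y₁))
    ≡ h₁ * ((x₂ * y₃ - x₃ * y₂) * z₁ + (x₃ * y₁ - x₁ * y₃) * z₂ + (x₁ * y₂ - x₂ * y₁) * z₃)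
  r₁ = solve-∀
  r₂ : ∀ h₁ h₂ h₃ x₁ x₂ x₃ y₁ y₂ y₃ z₁ z₂ z₃ →
    x₂ * (h₁ * (y₂ * z₃ - y₃ * z₂) + h₂ * (y₃ * z₁ - y₁ * z₃) + h₃ * (y₁ * z₂ - y₂ * z₁))
    + y₂ * (h₁ * (z₂ * x₃ - z₃ * x₂) + h₂ * (z₃ * x₁ - z₁ * x₃) + h₃ * (z₁ * x₂ - z₂ * x₁))
    + z₂ * (h₁ * (x₂ * y₃ - x₃ * y₂) + h₂ * (x₃ * y₁ - x₁ * y₃) + h₃ * (x₁ * y₂ - x₂ * y₁))
    ≡ h₂ * ((x₂ * y₃ - x₃ * y₂) * z₁ + (x₃ * y₁ - x₁ * y₃) * z₂ + (x₁ * y₂ - x₂ * y₁) * z₃)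
  r₂ = solve-∀
  r₃ : ∀ h₁ h₂ h₃ x₁ x₂ x₃ y₁ y₂ y₃ z₁ z₂ z₃ →
    x₃ * (h₁ * (y₂ * z₃ - y₃ * z₂) + h₂ * (y₃ * z₁ - y₁ * z₃) + h₃ * (y₁ * z₂ - y₂ * z₁))
    + y₃ * (h₁ * (z₂ * x₃ - z₃ * x₂) + h₂ * (z₃ * x₁ - z₁ * x₃) + h₃ * (z₁ * x₂ - z₂ * x₁))
    + z₃ * (h₁ * (x₂ * y₃ - x₃ * y₂) + h₂ * (x₃ * y₁ - x₁ * y₃) + h₃ * (x₁ * y₂ - x₂ * y₁))
    ≡ h₃ * ((x₂ * y₃ - x₃ * y₂) * z₁ + (x₃ * y₁ - x₁ * y₃) * z₂ + (x₁ * y₂ - x₂ * y₁) * z₃)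
  r₃ = solve-∀

module Triples (P Q : RatFun) (p : ℕ) .{{_ : NonZero p}} (pr : Prime p) where
  open Curve P Q
  open Values P Q p pr
  open Mod p
  open LinearAlgebra p
  open Nonsingularity P Q p pr using (invert)
  open Fermat pr using (1<p)
  open Roots p (domain-prime pr) using (≉0-*; cancel)

  module _ (R : RatFun) (c : ℤ) (x y z : Fin p) (rx : Regular R x) (ry : Regular R y) (rz : Regular R z)
    (h : val p R x - val p R y + val p R z - c ≈0) where

    alternating-zero : alternating R c (elt p x) (elt p y) (elt p z) ≈0
    alternating-zero = subst _≈0 (lem (num* R x) (den* R x) (val p R x) (num* R y) (den* R y) (val p R y) (num* R z) (den* R z) (val p R z) c)
      (≈0-+ (≈0-+ (≈0-- (≈0-* (den* R y * den* R z) rx) (≈0-* (den* R x * den* R z) ry)) (≈0-* (den* R x * den* R y) rz)) (≈0-* (den* R x * (den* R y * den* R z)) h))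
      where lem : ∀ nx dx α ny dy β nz dz γ c → ((dy * dz) * (nx - α * dx) - (dx * dz) * (ny - β * dy) + (dx * dy) * (nz - γ * dz)) + (dx * (dy * dz)) * (α - β + γ - c)
                ≡ nx * (dy * dz) - ny * (dx * dz) + nz * (dx * dy) - c * (dx * (dy * dz))
            lem = solve-∀

    alternating-derivative : ∀ u v w → alternating′ R c (elt p x) (elt p y) (elt p z) u v w
      - (den* R y * den* R z * δ R x * u - den* R x * den* R z * δ R y * v + den* R x * den* R y * δ R z * w) ≈0
    alternating-derivative u v w = subst _≈0
      (trans (cong₂ _+_ (cong₂ _+_ (lem₁ u nx nx′ dx dx′ α ny dy β nz dz γ c) (lem₂ v nx dx α ny ny′ dy dy′ β nz dz γ c)) (lem₃ w nx dx α ny dy β nz nz′ dz dz′ γ c))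
        (regroup (u * (nx′ * (dy * dz) - ny * (dx′ * dz) + nz * (dx′ * dy) - c * (dx′ * (dy * dz)))) (dy * dz * (nx′ - α * dx′) * u)
                 (v * (nx * (dy′ * dz) - ny′ * (dx * dz) + nz * (dx * dy′) - c * (dx * (dy′ * dz)))) (dx * dz * (ny′ - β * dy′) * v)
                 (w * (nx * (dy * dz′) - ny * (dx * dz′) + nz′ * (dx * dy) - c * (dx * (dy * dz′)))) (dx * dy * (nz′ - γ * dz′) * w)))
      (≈0-+ (≈0-+
        (≈0-* (u * dx′) (≈0-+ (≈0-- (≈0-* dy rz) (≈0-* dz ry)) (≈0-* (dy * dz) h)))
        (≈0-* (v * dy′) (≈0-+ (≈0-+ (≈0-* dz rx) (≈0-* dx rz)) (≈0-* (dx * dz) h))))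
        (≈0-* (w * dz′) (≈0-+ (≈0-- (≈0-* dy rx) (≈0-* dx ry)) (≈0-* (dx * dy) h))))
      where
      nx = num* R x
      nx′ = num′ R x
      dx = den* R x
      dx′ = den′ R x
      α = val p R x
      ny = num* R y
      ny′ = num′ R y
      dy = den* R y
      dy′ = den′ R y
      β = val p R y
      nz = num* R z
      nz′ = num′ R z
      dz = den* R z
      dz′ = den′ R z
      γ = val p R z
      lem₁ : ∀ u nx nx′ dx dx′ α ny dy β nz dz γ c → (u * dx′) * ((dy * (nz - γ * dz) - dz * (ny - β * dy)) + (dy * dz) * (α - β + γ - c))
        ≡ u * (nx′ * (dy * dz) - ny * (dx′ * dz) + nz * (dx′ * dy) - c * (dx′ * (dy * dz))) - dy * dz * (nx′ - α * dx′) * u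
      lem₁ = solve-∀
      lem₂ : ∀ v nx dx α ny ny′ dy dy′ β nz dz γ c → (v * dy′) * ((dz * (nx - α * dx) + dx * (nz - γ * dz)) + (dx * dz) * (α - β + γ - c))
        ≡ v * (nx * (dy′ * dz) - ny′ * (dx * dz) + nz * (dx * dy′) - c * (dx * (dy′ * dz))) + dx * dz * (ny′ - β * dy′) * v
      lem₂ = solve-∀
      lem₃ : ∀ w nx dx α ny dy β nz nz′ dz dz′ γ c → (w * dz′) * ((dy * (nx - α * dx) - dx * (ny - β * dy)) + (dx * dy) * (α - β + γ - c))
        ≡ w * (nx * (dy * dz′) - ny * (dx * dz′) + nz′ * (dx * dy) - c * (dx * (dy * dz′))) - dx * dy * (nz′ - γ * dz′) * w
      lem₃ = solve-∀
      regroup : ∀ a a′ b b′ e e′ → ((a - a′) + (b + b′)) + (e - e′) ≡ (a + b + e) - (a′ - b′ + e′)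
      regroup = solve-∀

  -- Multiplying by AB·G² turns P′, Q′ and m′/m into C₁, C₂ and C₃. Scaling the direction at each
  -- point by `weight*` thus gives the linearised system the matrix whose determinant is `D*`, up to
  -- a unit in each row.
  C₁* C₂* C₃* G* weight* : Fin p → ℤ
  C₁* y = evalℤ C₁ (elt p y)
  C₂* y = evalℤ C₂ (elt p y)
  C₃* y = evalℤ C₃ (elt p y)
  G* y = den* P y * den* Q y
  weight* y = A* y * B* y * (G* y * G* y)

  scaled-P : ∀ y → Good y → ∀ d → d * δ P y * weight* y - d * den* P y * C₁* y ≈0
  scaled-P y g d = subst _≈0 (trans (lem (A* y) (B* y) (den* P y) (den* Q y) (δ P y) d) (cong (λ w → d * δ P y * weight* y - d * den* P y * w) (sym (eval-C₁ (elt p y)))))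
      (≈0-neg (≈0-* (d * A* y * B* y * den* P y) (undiff (B-value y (good-P g)))))
    where lem : ∀ a b s t u d → - (d * a * b * s * (b - s * t * (t * u))) ≡ d * u * (a * b * ((s * t) * (s * t))) - d * s * (a * (b * b))
          lem = solve-∀

  scaled-Q : ∀ y → Good y → ∀ d → d * δ Q y * weight* y - d * den* Q y * C₂* y ≈0
  scaled-Q y g d = subst _≈0 (trans (lem (A* y) (B* y) (den* P y) (den* Q y) (δ Q y) d) (cong (λ w → d * δ Q y * weight* y - d * den* Q y * w) (sym (eval-C₂ (elt p y)))))
      (≈0-neg (≈0-* (d * A* y * B* y * den* Q y) (undiff (A-value y (good-Q g)))))
    where lem : ∀ a b s t v d → - (d * a * b * t * (a - s * t * (s * v))) ≡ d * v * (a * b * ((s * t) * (s * t))) - d * t * ((a * a) * b)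
          lem = solve-∀

  C₃-value : ∀ y → C₃* y ≡ (evalℤ (deriv A) (elt p y) * B* y - A* y * evalℤ (deriv B) (elt p y)) * (G* y * G* y)
  C₃-value y = trans (eval-C₃ (elt p y)) (cong₂ _*_ (eval-wronskian A B (elt p y)) (cong₂ _*_ (eval-⊗ Pd Qd (elt p y)) (eval-⊗ Pd Qd (elt p y))))

  D* : Fin p → Fin p → Fin p → ℤ
  D* x y z = D (elt p x) (elt p y) (elt p z)

  module _ (c d κ μ : ℤ) (x y z : Fin p) (gx : Good x) (gy : Good y) (gz : Good z)
    (hP : val p P x - val p P y + val p P z - c ≈0) (hQ : val p Q x - val p Q y + val p Q z - d ≈0)
    (hB : binomial A B κ μ (elt p x) (elt p y) (elt p z) ≈0)
    (L≉0 : ¬ (κ * (A* x * (B* y * A* z)) ≈0)) (D≉0 : ¬ (D* x y z ≈0)) where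

    Lx = κ * (A* x * (B* y * A* z))
    UP = den* P x * (den* P y * den* P z)
    UQ = den* Q x * (den* Q y * den* Q z)

    invL = invert L≉0
    invP = invert (≉0-* (proj₁ gx) (≉0-* (proj₁ gy) (proj₁ gz)))
    invQ = invert (≉0-* (proj₂ gx) (≉0-* (proj₂ gy) (proj₂ gz)))
    invD = invert D≉0

    module _ (τx τy τz : ℤ) where
      u v w : ℤ
      u = weight* x * τx
      -- The sign compensates for the middle point, which is subtracted in the alternating sums and
      -- stands in the denominator of m(x)m(z)/m(y).
      v = - (weight* y * τy)
      w = weight* z * τz

      row-P : alternating′ P c (elt p x) (elt p y) (elt p z) u v w - UP * (C₁* x * τx + C₁* y * τy + C₁* z * τz) ≈0
      row-P = subst _≈0 (lem (alternating′ P c (elt p x) (elt p y) (elt p z) u v w) (den* P x) (den* P y) (den* P z) (δ P x) (δ P y) (δ P z) (weight* x) (weight* y) (weight* z) (C₁* x) (C₁* y) (C₁* z) τx τy τz)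
        (≈0-+ (alternating-derivative P c x y z (good-P gx) (good-P gy) (good-P gz) hP u v w)
          (≈0-+ (≈0-+ (≈0-* τx (scaled-P x gx (den* P y * den* P z))) (≈0-* τy (scaled-P y gy (den* P x * den* P z)))) (≈0-* τz (scaled-P z gz (den* P x * den* P y)))))
        where lem : ∀ a dx dy dz δx δy δz wx wy wz cx cy cz τx τy τz →
                (a - (dy * dz * δx * (wx * τx) - dx * dz * δy * (- (wy * τy)) + dx * dy * δz * (wz * τz)))
                + (τx * (dy * dz * δx * wx - dy * dz * dx * cx) + τy * (dx * dz * δy * wy - dx * dz * dy * cy) + τz * (dx * dy * δz * wz - dx * dy * dz * cz))
                ≡ a - dx * (dy * dz) * (cx * τx + cy * τy + cz * τz)
              lem = solve-∀

      row-Q : alternating′ Q d (elt p x) (elt p y) (elt p z) u v w - UQ * (C₂* x * τx + C₂* y * τy + C₂* z * τz) ≈0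
      row-Q = subst _≈0 (lem (alternating′ Q d (elt p x) (elt p y) (elt p z) u v w) (den* Q x) (den* Q y) (den* Q z) (δ Q x) (δ Q y) (δ Q z) (weight* x) (weight* y) (weight* z) (C₂* x) (C₂* y) (C₂* z) τx τy τz)
        (≈0-+ (alternating-derivative Q d x y z (good-Q gx) (good-Q gy) (good-Q gz) hQ u v w)
          (≈0-+ (≈0-+ (≈0-* τx (scaled-Q x gx (den* Q y * den* Q z))) (≈0-* τy (scaled-Q y gy (den* Q x * den* Q z)))) (≈0-* τz (scaled-Q z gz (den* Q x * den* Q y)))))
        where lem : ∀ a dx dy dz δx δy δz wx wy wz cx cy cz τx τy τz →
                (a - (dy * dz * δx * (wx * τx) - dx * dz * δy * (- (wy * τy)) + dx * dy * δz * (wz * τz)))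
                + (τx * (dy * dz * δx * wx - dy * dz * dx * cx) + τy * (dx * dz * δy * wy - dx * dz * dy * cy) + τz * (dx * dy * δz * wz - dx * dy * dz * cz))
                ≡ a - dx * (dy * dz) * (cx * τx + cy * τy + cz * τz)
              lem = solve-∀

      -- On the zero set the two products in `binomial` have the common value Lx, so its
      -- differential is Lx times the logarithmic differential of m(x)m(z)/m(y).
      row-B : binomial′ A B κ μ (elt p x) (elt p y) (elt p z) u v w - Lx * (C₃* x * τx + C₃* y * τy + C₃* z * τz) ≈0
      row-B = subst _≈0 (trans (sym (cong₂ _+_ (cong₂ _+_ (lem₁ κ μ ax ax′ bx bx′ ay by az bz (G* x * G* x) τx) (lem₂ κ μ ax bx ay ay′ by by′ az bz (G* y * G* y) τy)) (lem₃ κ μ ax bx ay by az az′ bz bz′ (G* z * G* z) τz)))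
          (trans (regroup (u * (κ * (ax′ * (by * az)) - μ * (bx′ * (ay * bz)))) (v * (κ * (ax * (by′ * az)) - μ * (bx * (ay′ * bz)))) (w * (κ * (ax * (by * az′)) - μ * (bx * (ay * bz′)))) Lx
               ((ax′ * bx - ax * bx′) * (G* x * G* x)) ((ay′ * by - ay * by′) * (G* y * G* y)) ((az′ * bz - az * bz′) * (G* z * G* z)) τx τy τz)
             (cong (λ s → binomial′ A B κ μ (elt p x) (elt p y) (elt p z) u v w - Lx * s)
               (sym (cong₂ _+_ (cong₂ (λ s t → s * τx + t * τy) (C₃-value x) (C₃-value y)) (cong (_* τz) (C₃-value z)))))))
         (≈0-+ (≈0-+ (≈0-* (ax * bx′ * (G* x * G* x) * τx) hB) (≈0-* (- (ay′ * by * (G* y * G* y) * τy)) hB)) (≈0-* (az * bz′ * (G* z * G* z) * τz) hB))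
        where
        ax = A* x
        ax′ = evalℤ (deriv A) (elt p x)
        bx = B* x
        bx′ = evalℤ (deriv B) (elt p x)
        ay = A* y
        ay′ = evalℤ (deriv A) (elt p y)
        by = B* y
        by′ = evalℤ (deriv B) (elt p y)
        az = A* z
        az′ = evalℤ (deriv A) (elt p z)
        bz = B* z
        bz′ = evalℤ (deriv B) (elt p z)
        lem₁ : ∀ κ μ ax ax′ bx bx′ ay by az bz g τ → (ax * bx * g * τ) * (κ * (ax′ * (by * az)) - μ * (bx′ * (ay * bz))) - (κ * (ax * (by * az))) * ((ax′ * bx - ax * bx′) * g * τ)
          ≡ (ax * bx′ * g * τ) * (κ * (ax * (by * az)) - μ * (bx * (ay * bz)))
        lem₁ = solve-∀
        lem₂ : ∀ κ μ ax bx ay ay′ by by′ az bz g τ → (- (ay * by * g * τ)) * (κ * (ax * (by′ * az)) - μ * (bx * (ay′ * bz))) - (κ * (ax * (by * az))) * ((ay′ * by - ay * by′) * g * τ)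
          ≡ - (ay′ * by * g * τ) * (κ * (ax * (by * az)) - μ * (bx * (ay * bz)))
        lem₂ = solve-∀
        lem₃ : ∀ κ μ ax bx ay by az az′ bz bz′ g τ → (az * bz * g * τ) * (κ * (ax * (by * az′)) - μ * (bx * (ay * bz′))) - (κ * (ax * (by * az))) * ((az′ * bz - az * bz′) * g * τ)
          ≡ (az * bz′ * g * τ) * (κ * (ax * (by * az)) - μ * (bx * (ay * bz)))
        lem₃ = solve-∀
        regroup : ∀ a b e L cx cy cz τx τy τz → ((a - L * (cx * τx)) + (b - L * (cy * τy))) + (e - L * (cz * τz)) ≡ (a + b + e) - L * (cx * τx + cy * τy + cz * τz)
        regroup = solve-∀

    triple-nonsingular : NonsingularZero p (triple P Q A B) (triple′ P Q A B) (c , d , κ , μ) (point (x ∷ y ∷ z ∷ []))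
    triple-nonsingular = zeros , derivatives
      where
      zeros : ∀ j → triple P Q A B j (c , d , κ , μ) (point (x ∷ y ∷ z ∷ [])) ≈0
      zeros 0F = alternating-zero P c x y z (good-P gx) (good-P gy) (good-P gz) hP
      zeros 1F = alternating-zero Q d x y z (good-Q gx) (good-Q gy) (good-Q gz) hQ
      zeros 2F = hB
      derivatives : ∀ η → ∃[ V ] (∀ j → triple′ P Q A B j (c , d , κ , μ) (point (x ∷ y ∷ z ∷ [])) V - η j ≈0)
      derivatives η = V , solves
        where
        h₁ h₂ h₃ ν τx τy τz : ℤ
        h₁ = η 0F * proj₁ invP
        h₂ = η 1F * proj₁ invQ
        h₃ = η 2F * proj₁ invL
        ν = proj₁ invD
        τx = ν * cofactor h₁ h₂ h₃ (C₁* y) (C₂* y) (C₃* y) (C₁* z) (C₂* z) (C₃* z)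
        τy = ν * cofactor h₁ h₂ h₃ (C₁* z) (C₂* z) (C₃* z) (C₁* x) (C₂* x) (C₃* x)
        τz = ν * cofactor h₁ h₂ h₃ (C₁* x) (C₂* x) (C₃* x) (C₁* y) (C₂* y) (C₃* y)
        V : Vec ℤ 3
        V = u τx τy τz ∷ v τx τy τz ∷ w τx τy τz ∷ []
        expansion = cofactor-expansion h₁ h₂ h₃ (C₁* x) (C₂* x) (C₃* x) (C₁* y) (C₂* y) (C₃* y) (C₁* z) (C₂* z) (C₃* z)
        pull : ∀ ν a b e s t r → a * (ν * s) + b * (ν * t) + e * (ν * r) ≡ ν * (a * s + b * t + e * r)
        pull = solve-∀
        finish : ∀ {row S U i h} → row - U * S ≈0 → U * i - + 1 ≈0 → S ≡ ν * ((h * i) * D* x y z) → row - h ≈0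
        finish {row} {S} {U} {i} {h} r inv refl = subst _≈0 (lem row U ν h i (D* x y z)) (≈0-+ r (≈0-+ (≈0-* (U * h * i) (proj₂ invD)) (≈0-* h inv)))
          where lem : ∀ row U ν h i D → (row - U * (ν * ((h * i) * D))) + (U * h * i * (D * ν - + 1) + h * (U * i - + 1)) ≡ row - h
                lem = solve-∀
        solves : ∀ j → triple′ P Q A B j (c , d , κ , μ) (point (x ∷ y ∷ z ∷ [])) V - η j ≈0
        solves 0F = finish {alternating′ P c (elt p x) (elt p y) (elt p z) (u τx τy τz) (v τx τy τz) (w τx τy τz)} {C₁* x * τx + C₁* y * τy + C₁* z * τz} {UP} {proj₁ invP} {η 0F} (row-P τx τy τz) (proj₂ invP)
          (trans (pull ν (C₁* x) (C₁* y) (C₁* z) _ _ _) (cong (ν *_) (proj₁ expansion)))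
        solves 1F = finish {alternating′ Q d (elt p x) (elt p y) (elt p z) (u τx τy τz) (v τx τy τz) (w τx τy τz)} {C₂* x * τx + C₂* y * τy + C₂* z * τz} {UQ} {proj₁ invQ} {η 1F} (row-Q τx τy τz) (proj₂ invQ)
          (trans (pull ν (C₂* x) (C₂* y) (C₂* z) _ _ _) (cong (ν *_) (proj₁ (proj₂ expansion))))
        solves 2F = finish {binomial′ A B κ μ (elt p x) (elt p y) (elt p z) (u τx τy τz) (v τx τy τz) (w τx τy τz)} {C₃* x * τx + C₃* y * τy + C₃* z * τz} {Lx} {proj₁ invL} {η 2F} (row-B τx τy τz) (proj₂ invL)
          (trans (pull ν (C₃* x) (C₃* y) (C₃* z) _ _ _) (cong (ν *_) (proj₂ (proj₂ expansion))))

-- Curves with few points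

atMost-pair : ∀ {p k c} {B : Set} {S : Fin p × B → Set} {T : Fin p → Set} → (∀ {a b} → S (a , b) → T a) → AtMost T k →
  (∀ a → AtMost (λ b → S (a , b)) c) → AtMost S (k ℕ.* c)
atMost-pair {B = B} {S = S} {T} h t fib = atMost-fibre Fin._≟_ proj₁ (λ {x} → h {proj₁ x} {proj₂ x}) t second
  where
  second : ∀ a → AtMost (λ x → S x × proj₁ x ≡ a) _
  second a = atMost λ xs u s → subst (ℕ._≤ _) (Listₚ.length-map proj₂ xs) (bounded (fib a) (List.map proj₂ xs) (unique xs u s) (allS xs s))
    where
    allS : ∀ xs → All (λ x → S x × proj₁ x ≡ a) xs → All (λ b → S (a , b)) (List.map proj₂ xs)
    allS [] [] = []
    allS ((_ , b) ∷ xs) ((s , refl) ∷ ss) = s ∷ allS xs ss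
    unique : ∀ xs → Unique xs → All (λ x → S x × proj₁ x ≡ a) xs → Unique (List.map proj₂ xs)
    unique [] [] [] = []
    unique ((_ , b) ∷ xs) (n ∷ u) ((_ , refl) ∷ ss) = Allₚ.map⁺ (All.zipWith (λ { {_ , c} (ne , (_ , refl)) refl → ne refl }) (n , ss)) ∷ unique xs u ss

module SmallSets (P Q : RatFun) (p : ℕ) .{{_ : NonZero p}} (pr : Prime p)
  (large : Roots.Large p (domain-prime pr) (Curve.T P Q))
  (independent : ∀ a b c → (∀ t → Mod._≈0 p (a * evalℤ (Curve.X P Q) t + b * evalℤ (Curve.Y P Q) t + c * evalℤ (Curve.G P Q) t)) → Mod._≈0 p a × Mod._≈0 p b × Mod._≈0 p c) where
  open Curve P Q
  open Values P Q p pr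
  open Nonsingularity P Q p pr using (tangents; invert)
  open Triples P Q p pr using (D*)
  open Fermat pr using (1<p)
  open PolyDomain p 1<p (domain-prime pr)
  module 𝒢 = Generically p 1<p (domain-prime pr) large invert independent

  F : Set
  F = Fin p

  full : AtMost {F} Full p
  full = atMost-Fin p

  roots-bound : ∀ f → ¬ Zero f → AtMost (λ (y : F) → evalℤ f (elt p y) ≈0) (length f)
  roots-bound f f≢0 = atMost λ xs u h → ℕₚ.≮⇒≥ (λ lt → f≢0 (eval-≈0 (roots⇒≈0 f (List.map (elt p) xs) (distinct xs u)
      (subst (length f ℕ.≤_) (sym (Listₚ.length-map (elt p) xs)) (ℕₚ.<⇒≤ lt)) (Allₚ.map⁺ h))))
    where
    distinct : ∀ xs → Unique xs → Distinct (List.map (elt p) xs)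
    distinct [] [] = []
    distinct (x ∷ xs) (n ∷ u) = Allₚ.map⁺ (All.map (λ {y} x≢y e → x≢y (Finₚ.toℕ-injective (sym (residue-unique (Finₚ.toℕ<n y) (Finₚ.toℕ<n x) e)))) n) ∷ distinct xs u

  fibre-polynomial : RatFun → ℤ → ZPoly
  fibre-polynomial R c = num R ⊕ scale (- c) (den R)

  eval-fibre-polynomial : ∀ R c t → evalℤ (fibre-polynomial R c) t ≡ evalℤ (num R) t + - c * evalℤ (den R) t
  eval-fibre-polynomial R c t = trans (eval-⊕ (num R) (scale (- c) (den R)) t) (cong (λ w → evalℤ (num R) t + w) (eval-scale (- c) (den R) t))

  -- If Pn - c·Pd vanished, multiplying by Qd would give the relation X - c·G = 0.
  fibre-polynomial≢0-P : ∀ c → ¬ Zero (fibre-polynomial P c)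
  fibre-polynomial≢0-P c z = 𝒢.1≉0 (proj₁ (independent (+ 1) (+ 0) (- c) (λ t → subst _≈0
      (trans (cong (evalℤ Qd t *_) (eval-fibre-polynomial P c t)) (trans (lem (evalℤ Qd t) (evalℤ Pn t) c (evalℤ Pd t) (evalℤ Y t))
         (cong₂ (λ x g → + 1 * x + + 0 * evalℤ Y t + - c * g) (sym (eval-⊗ Pn Qd t)) (sym (eval-⊗ Pd Qd t))))) (≈0-* (evalℤ Qd t) (z t)))))
    where lem : ∀ q n c d y → q * (n + - c * d) ≡ + 1 * (n * q) + + 0 * y + - c * (d * q)
          lem = solve-∀

  fibre-polynomial≢0-Q : ∀ c → ¬ Zero (fibre-polynomial Q c)
  fibre-polynomial≢0-Q c z = 𝒢.1≉0 (proj₁ (proj₂ (independent (+ 0) (+ 1) (- c) (λ t → subst _≈0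
      (trans (cong (evalℤ Pd t *_) (eval-fibre-polynomial Q c t)) (trans (lem (evalℤ Pd t) (evalℤ Qn t) c (evalℤ Qd t) (evalℤ X t))
         (cong₂ (λ x g → + 0 * evalℤ X t + + 1 * x + - c * g) (sym (eval-⊗ Qn Pd t)) (sym (eval-⊗ Pd Qd t))))) (≈0-* (evalℤ Pd t) (z t))))))
    where lem : ∀ q n c d x → q * (n + - c * d) ≡ + 0 * x + + 1 * (n * q) + - c * (q * d)
          lem = solve-∀

  length-fibre-polynomial : ∀ R c → length (fibre-polynomial R c) ℕ.≤ length (num R) ℕ.+ length (den R)
  length-fibre-polynomial R c = length-⊕ (num R) _ (ℕₚ.m≤m+n _ _) (length-scale (- c) (den R) (ℕₚ.m≤n+m _ (length (num R))))

  root-of-fibre : ∀ R c y → Regular R y → val p R y - c ≈0 → evalℤ (fibre-polynomial R c) (elt p y) ≈0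
  root-of-fibre R c y r h = subst _≈0 (trans (lem (num* R y) (val p R y) (den* R y) c) (sym (eval-fibre-polynomial R c (elt p y)))) (≈0-+ r (≈0-* (den* R y) h))
    where lem : ∀ n v d c → (n - v * d) + d * (v - c) ≡ n + - c * d
          lem = solve-∀

  κP κQ : ℕ
  κP = length Pn ℕ.+ length Pd
  κQ = length Qn ℕ.+ length Qd

  fibre-P : ∀ c → AtMost (λ y → Good y × val p P y - c ≈0) κP
  fibre-P c = atMost-⊆ (λ {y} (g , h) → root-of-fibre P c y (good-P g) h) (atMost-≤ (length-fibre-polynomial P c) (roots-bound (fibre-polynomial P c) (fibre-polynomial≢0-P c)))

  fibre-Q : ∀ c → AtMost (λ y → Good y × val p Q y - c ≈0) κQ
  fibre-Q c = atMost-⊆ (λ {y} (g , h) → root-of-fibre Q c y (good-Q g) h) (atMost-≤ (length-fibre-polynomial Q c) (roots-bound (fibre-polynomial Q c) (fibre-polynomial≢0-Q c)))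

  Degenerate : F → Set
  Degenerate y = A* y * B* y ≈0

  degenerate-bound : AtMost Degenerate (length (A ⊗ B))
  degenerate-bound = atMost-⊆ (λ {y} h → subst _≈0 (sym (eval-⊗ A B (elt p y))) h) (roots-bound (A ⊗ B) 𝒢.AB≢0)

  degenerate-pairs : AtMost {F × F} (λ (a , b) → Degenerate a ⊎ Degenerate b) (length (A ⊗ B) ℕ.* p ℕ.+ p ℕ.* length (A ⊗ B))
  degenerate-pairs = atMost-∪ {P = λ (a , b) → Degenerate a} {Q = λ (a , b) → Degenerate b} (λ h → h)
    (atMost-pair (λ h → h) degenerate-bound (λ a → atMost-⊆ (λ _ → tt) full))
    (atMost-pair {T = Full} (λ _ → tt) full (λ a → degenerate-bound))

  -- The curve m(a) = m(b) in the plane. Unless A(a) = 0, the point b is a root of A(a)·B - B(a)·A,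
  -- which is not zero because P′ and Q′ are independent.
  parallel-pairs : AtMost {F × F} (λ (a , b) → tangents a b ≈0) (length A ℕ.* p ℕ.+ p ℕ.* ℓ)
  parallel-pairs = atMost-∪ {P = λ (a , b) → A* a ≈0} {Q = λ (a , b) → ¬ (A* a ≈0) × tangents a b ≈0} decide
    (atMost-pair (λ h → h) (roots-bound A 𝒢.A≢0) (λ a → atMost-⊆ (λ _ → tt) full))
    (atMost-pair {T = Full} (λ _ → tt) full second)
    where
    decide : ∀ {x : F × F} → tangents (proj₁ x) (proj₂ x) ≈0 → A* (proj₁ x) ≈0 ⊎ (¬ (A* (proj₁ x) ≈0) × tangents (proj₁ x) (proj₂ x) ≈0)
    decide {a , b} h = by-cases (≈0? (A* a)) (λ z → inj₁ z) (λ n → inj₂ (n , h))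
    second : ∀ a → AtMost (λ b → ¬ (A* a ≈0) × tangents a b ≈0) ℓ
    second a = by-cases (≈0? (A* a)) (λ z → atMost-≤ ℕ.z≤n (atMost-∅ (λ (n , _) → n z))) (λ n →
        atMost-⊆ (λ {b} (_ , h) → subst _≈0 (trans (lem (A* a) (B* b) (A* b) (B* a)) (sym (eval-f (elt p b)))) h)
          (atMost-≤ (length-⊕ (scale (A* a) B) _ (length-scale (A* a) B B≤) (length-scale (- B* a) A A≤)) (roots-bound f (f≢0 n))))
      where
      f = scale (A* a) B ⊕ scale (- B* a) A
      eval-f : ∀ t → evalℤ f t ≡ A* a * evalℤ B t + - B* a * evalℤ A t
      eval-f t = trans (eval-⊕ (scale (A* a) B) (scale (- B* a) A) t) (cong₂ _+_ (eval-scale (A* a) B t) (eval-scale (- B* a) A t))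
      f≢0 : ¬ (A* a ≈0) → ¬ Zero f
      f≢0 n z = n (proj₁ (𝒢.tangent-independence (A* a) (- B* a) (λ t → subst _≈0 (eval-f t) (z t))))
      lem : ∀ a b a′ b′ → a * b - a′ * b′ ≡ a * b + - b′ * a′
      lem = solve-∀

  λC : ℕ
  λC = length C₁ ℕ.+ (length C₂ ℕ.+ length C₃)

  comb : ℤ → ℤ → ℤ → ZPoly
  comb a b c = (scale a C₁ ⊕ scale b C₂) ⊕ scale c C₃

  eval-comb : ∀ a b c t → evalℤ (comb a b c) t ≡ a * evalℤ C₁ t + b * evalℤ C₂ t + c * evalℤ C₃ t
  eval-comb a b c t = trans (eval-⊕ (scale a C₁ ⊕ scale b C₂) (scale c C₃) t)
      (cong₂ _+_ (trans (eval-⊕ (scale a C₁) (scale b C₂) t) (cong₂ _+_ (eval-scale a C₁ t) (eval-scale b C₂ t))) (eval-scale c C₃ t))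

  length-comb : ∀ a b c → length (comb a b c) ℕ.≤ λC
  length-comb a b c = length-⊕ (scale a C₁ ⊕ scale b C₂) _
    (length-⊕ (scale a C₁) _ (length-scale a C₁ (ℕₚ.m≤m+n _ _)) (length-scale b C₂ (ℕₚ.≤-trans (ℕₚ.m≤m+n _ _) (ℕₚ.m≤n+m _ (length C₁)))))
    (length-scale c C₃ (ℕₚ.≤-trans (ℕₚ.m≤n+m _ (length C₂)) (ℕₚ.m≤n+m _ (length C₁))))

  -- Every slice of D in one variable is a combination of C₁, C₂, C₃, so it has
  -- boundedly many zeros as soon as it has a non-zero value.
  slice-bound : ∀ a b c y → ¬ (a * evalℤ C₁ y + b * evalℤ C₂ y + c * evalℤ C₃ y ≈0) →
    AtMost (λ (x : F) → a * evalℤ C₁ (elt p x) + b * evalℤ C₂ (elt p x) + c * evalℤ C₃ (elt p x) ≈0) λC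
  slice-bound a b c y n = atMost-⊆ (λ {x} h → subst _≈0 (sym (eval-comb a b c (elt p x))) h)
    (atMost-≤ (length-comb a b c) (roots-bound (comb a b c) (λ z → n (subst _≈0 (eval-comb a b c y) (z y)))))

  private
    expand-x : ∀ x₁ x₂ x₃ y₁ y₂ y₃ z₁ z₂ z₃ → (x₂ * y₃ - x₃ * y₂) * z₁ + (x₃ * y₁ - x₁ * y₃) * z₂ + (x₁ * y₂ - x₂ * y₁) * z₃
      ≡ (y₂ * z₃ - y₃ * z₂) * x₁ + (y₃ * z₁ - y₁ * z₃) * x₂ + (y₁ * z₂ - y₂ * z₁) * x₃
    expand-x = solve-∀
    expand-y : ∀ x₁ x₂ x₃ y₁ y₂ y₃ z₁ z₂ z₃ → (x₂ * y₃ - x₃ * y₂) * z₁ + (x₃ * y₁ - x₁ * y₃) * z₂ + (x₁ * y₂ - x₂ * y₁) * z₃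
      ≡ (z₂ * x₃ - z₃ * x₂) * y₁ + (z₃ * x₁ - z₁ * x₃) * y₂ + (z₁ * x₂ - z₂ * x₁) * y₃
    expand-y = solve-∀

  slice-x : ∀ y z w → ¬ (D w y z ≈0) → AtMost (λ (x : F) → D (elt p x) y z ≈0) λC
  slice-x y z w n = atMost-⊆ (λ {x} h → subst _≈0 (e (elt p x)) h) (slice-bound (y₂ * z₃ - y₃ * z₂) (y₃ * z₁ - y₁ * z₃) (y₁ * z₂ - y₂ * z₁) w (λ h → n (subst _≈0 (sym (e w)) h)))
    where
    y₁ = evalℤ C₁ y
    y₂ = evalℤ C₂ y
    y₃ = evalℤ C₃ y
    z₁ = evalℤ C₁ z
    z₂ = evalℤ C₂ z
    z₃ = evalℤ C₃ z
    e : ∀ x → D x y z ≡ (y₂ * z₃ - y₃ * z₂) * evalℤ C₁ x + (y₃ * z₁ - y₁ * z₃) * evalℤ C₂ x + (y₁ * z₂ - y₂ * z₁) * evalℤ C₃ x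
    e x = expand-x (evalℤ C₁ x) (evalℤ C₂ x) (evalℤ C₃ x) y₁ y₂ y₃ z₁ z₂ z₃

  slice-y : ∀ x z w → ¬ (D x w z ≈0) → AtMost (λ (y : F) → D x (elt p y) z ≈0) λC
  slice-y x z w n = atMost-⊆ (λ {y} h → subst _≈0 (e (elt p y)) h) (slice-bound (z₂ * x₃ - z₃ * x₂) (z₃ * x₁ - z₁ * x₃) (z₁ * x₂ - z₂ * x₁) w (λ h → n (subst _≈0 (sym (e w)) h)))
    where
    x₁ = evalℤ C₁ x
    x₂ = evalℤ C₂ x
    x₃ = evalℤ C₃ x
    z₁ = evalℤ C₁ z
    z₂ = evalℤ C₂ z
    z₃ = evalℤ C₃ z
    e : ∀ y → D x y z ≡ (z₂ * x₃ - z₃ * x₂) * evalℤ C₁ y + (z₃ * x₁ - z₁ * x₃) * evalℤ C₂ y + (z₁ * x₂ - z₂ * x₁) * evalℤ C₃ y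
    e y = expand-y x₁ x₂ x₃ (evalℤ C₁ y) (evalℤ C₂ y) (evalℤ C₃ y) z₁ z₂ z₃

  slice-z : ∀ x y w → ¬ (D x y w ≈0) → AtMost (λ (z : F) → D x y (elt p z) ≈0) λC
  slice-z x y w n = slice-bound (x₂ * y₃ - x₃ * y₂) (x₃ * y₁ - x₁ * y₃) (x₁ * y₂ - x₂ * y₁) w n
    where
    x₁ = evalℤ C₁ x
    x₂ = evalℤ C₂ x
    x₃ = evalℤ C₃ x
    y₁ = evalℤ C₁ y
    y₂ = evalℤ C₂ y
    y₃ = evalℤ C₃ y

  -- Replace η₁, η₂, η₃ by x, y, z one at a time. If D vanishes at the end, it became zero at one of
  -- the three replacements, and there the new coordinate has at most λC values while the other two
  -- are free.
  dependent-triples-at : ∀ η₁ η₂ η₃ → ¬ (D η₁ η₂ η₃ ≈0) → AtMost {Vec F 3} (λ v → D* (lookup v zero) (lookup v (suc zero)) (lookup v (suc (suc zero))) ≈0)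
    (λC ℕ.* (p ℕ.* (p ℕ.* 1)) ℕ.+ (p ℕ.* (λC ℕ.* (p ℕ.* 1)) ℕ.+ p ℕ.* (p ℕ.* (λC ℕ.* 1))))
  dependent-triples-at η₁ η₂ η₃ D≉0 = atMost-∪ {P = S₁} {Q = S₂₃} decide
      (atMost-∷ {T = λ x → D (elt p x) η₂ η₃ ≈0} (λ {a} {v} → first {a} {v}) (slice-x η₂ η₃ η₁ D≉0) (λ x → atMost-⊆ (λ _ → tt) (atMost-Vec p 2)))
      (atMost-∪ {P = S₂} {Q = S₃} decide₂
        (atMost-∷ {T = Full} (λ _ → tt) full two)
        (atMost-∷ {T = Full} (λ _ → tt) full (λ x → atMost-∷ {T = Full} (λ _ → tt) full (three x))))
    where
    S₁ S₂₃ S₂ S₃ : Vec F 3 → Set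
    S₁ (x ∷ y ∷ z ∷ []) = D (elt p x) η₂ η₃ ≈0
    S₂₃ (x ∷ y ∷ z ∷ []) = ¬ (D (elt p x) η₂ η₃ ≈0) × D* x y z ≈0
    S₂ (x ∷ y ∷ z ∷ []) = ¬ (D (elt p x) η₂ η₃ ≈0) × D (elt p x) (elt p y) η₃ ≈0
    S₃ (x ∷ y ∷ z ∷ []) = ¬ (D (elt p x) (elt p y) η₃ ≈0) × D* x y z ≈0
    first : ∀ {a v} → S₁ (a ∷ v) → D (elt p a) η₂ η₃ ≈0
    first {a} {y ∷ z ∷ []} h = h
    decide : ∀ {v} → D* (lookup v zero) (lookup v (suc zero)) (lookup v (suc (suc zero))) ≈0 → S₁ v ⊎ S₂₃ v
    decide {x ∷ y ∷ z ∷ []} h = by-cases (≈0? (D (elt p x) η₂ η₃)) (λ e → inj₁ e) (λ n → inj₂ (n , h))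
    decide₂ : ∀ {v} → S₂₃ v → S₂ v ⊎ S₃ v
    decide₂ {x ∷ y ∷ z ∷ []} (n , h) = by-cases (≈0? (D (elt p x) (elt p y) η₃)) (λ e → inj₁ (n , e)) (λ m → inj₂ (m , h))
    two : ∀ x → AtMost (λ v → S₂ (x ∷ v)) (λC ℕ.* (p ℕ.* 1))
    two x = go (≈0? (D (elt p x) η₂ η₃))
      where
      head : ∀ {y v} → S₂ (x ∷ y ∷ v) → D (elt p x) (elt p y) η₃ ≈0
      head {y} {z ∷ []} (_ , h) = h
      empty : D (elt p x) η₂ η₃ ≈0 → ∀ {v} → ¬ S₂ (x ∷ v)
      empty e {y ∷ z ∷ []} (n , _) = n e
      go : Dec (D (elt p x) η₂ η₃ ≈0) → AtMost (λ v → S₂ (x ∷ v)) (λC ℕ.* (p ℕ.* 1))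
      go (yes e) = atMost-≤ ℕ.z≤n (atMost-∅ (λ {v} → empty e {v}))
      go (no n) = atMost-∷ {T = λ y → D (elt p x) (elt p y) η₃ ≈0} (λ {y} {v} → head {y} {v}) (slice-y (elt p x) η₃ η₂ n) (λ y → atMost-⊆ (λ _ → tt) (atMost-Vec p 1))
    three : ∀ x y → AtMost (λ v → S₃ (x ∷ y ∷ v)) (λC ℕ.* 1)
    three x y = go (≈0? (D (elt p x) (elt p y) η₃))
      where
      head : ∀ {z v} → S₃ (x ∷ y ∷ z ∷ v) → D (elt p x) (elt p y) (elt p z) ≈0
      head {z} {[]} (_ , h) = h
      empty : D (elt p x) (elt p y) η₃ ≈0 → ∀ {v} → ¬ S₃ (x ∷ y ∷ v)
      empty e {z ∷ []} (n , _) = n e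
      go : Dec (D (elt p x) (elt p y) η₃ ≈0) → AtMost (λ v → S₃ (x ∷ y ∷ v)) (λC ℕ.* 1)
      go (yes e) = atMost-≤ ℕ.z≤n (atMost-∅ (λ {v} → empty e {v}))
      go (no n) = atMost-∷ {T = λ z → D (elt p x) (elt p y) (elt p z) ≈0} (λ {z} {v} → head {z} {v}) (slice-z (elt p x) (elt p y) η₃ n) (λ z → atMost-[])

  dependent-triples : AtMost {Vec F 3} (λ v → D* (lookup v zero) (lookup v (suc zero)) (lookup v (suc (suc zero))) ≈0)
    (λC ℕ.* (p ℕ.* (p ℕ.* 1)) ℕ.+ (p ℕ.* (λC ℕ.* (p ℕ.* 1)) ℕ.+ p ℕ.* (p ℕ.* (λC ℕ.* 1))))
  dependent-triples = dependent-triples-at (+ 𝒢.y₁) (+ 𝒢.y₂) (+ 𝒢.y₃) 𝒢.D≉0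

-- Counting the points of the Roth variety

module Counts (P Q : RatFun) (p : ℕ) .{{_ : NonZero p}} (pr : Prime p)
  (large : Roots.Large p (domain-prime pr) (Curve.T P Q))
  (independent : ∀ a b c → (∀ t → Mod._≈0 p (a * evalℤ (Curve.X P Q) t + b * evalℤ (Curve.Y P Q) t + c * evalℤ (Curve.G P Q) t)) → Mod._≈0 p a × Mod._≈0 p b × Mod._≈0 p c)
  (n₂ n₃ n₈ : ℕ)
  (pair-finite : ∀ φ → AtMost {Vec (Fin p) 2} (λ x → NonsingularZero p (cyclic (R₂ P Q) next₂) (cyclic′ (R₂ P Q) next₂) φ (point x)) n₂)
  (triple-finite : ∀ i → AtMost {Vec (Fin p) 3} (λ x → NonsingularZero p (triple P Q (Curve.A P Q) (Curve.B P Q)) (triple′ P Q (Curve.A P Q) (Curve.B P Q)) i (point x)) n₃)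
  (octagon-finite : ∀ φ → AtMost {Vec (Fin p) 8} (λ x → NonsingularZero p (cyclic (R₈ P Q) next₈) (cyclic′ (R₈ P Q) next₈) φ (point x)) n₈)
  where
  open Curve P Q using (A; B; ℓ)
  open Mod p
  open Values P Q p pr
  open Nonsingularity P Q p pr using (tangents; octic-at; octagon-nonsingular; pair-nonsingular)
  open Triples P Q p pr using (D*; triple-nonsingular)
  open Roots p (domain-prime pr) using (≉0-*)
  open SmallSets P Q p pr large independent using (F; full; κP; κQ; fibre-P; fibre-Q; Degenerate; degenerate-pairs; parallel-pairs; λC; dependent-triples)

  Pair : Set
  Pair = F × F

  _≟ᴾ_ : DecidableEquality Pair
  _≟ᴾ_ = ×-≡-dec Fin._≟_ Fin._≟_

  _≟ⱽ_ : ∀ {n} → DecidableEquality (Vec F n)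
  _≟ⱽ_ = Vecₚ.≡-dec Fin._≟_

  _≟ᵂ_ : ∀ {n} → DecidableEquality (Vec Pair n)
  _≟ᵂ_ = Vecₚ.≡-dec _≟ᴾ_

  full-pairs : AtMost {Pair} Full (p ℕ.* p)
  full-pairs = atMost-pair {T = Full} (λ _ → tt) full (λ _ → atMost-⊆ (λ _ → tt) full)

  vl : RatFun → F → ℤ
  vl R y = val p R y

  σ : RatFun → Pair → ℤ
  σ R (a , b) = vl R a - vl R b

  total : ∀ {n} → RatFun → Vec Pair n → ℤ
  total R [] = + 0
  total R (π ∷ w) = σ R π + total R w

  AllGood : ∀ {n} → Vec Pair n → Set
  AllGood [] = ⊤
  AllGood ((a , b) ∷ w) = (Good a × Good b) × AllGood w

  W : Vec Pair 4 → Set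
  W w = AllGood w × total P w ≈0 × total Q w ≈0

  Parallel Degenerate₂ : Pair → Set
  Parallel (a , b) = tangents a b ≈0
  Degenerate₂ (a , b) = Degenerate a ⊎ Degenerate b

  OnPair : (Vec Pair 3 → Set) → Vec Pair 4 → Set
  OnPair R (π ∷ r) = W (π ∷ r) × ¬ Parallel π × R r

  -- Once the other three pairs are fixed, the first pair solves a system of two equations whose
  -- Jacobian is `tangents` up to a unit.
  on-pair-bound : ∀ {R m} → AtMost R m → AtMost (OnPair R) (m ℕ.* n₂)
  on-pair-bound {R} h = atMost-fibre _≟ᵂ_ Vec.tail (λ {w} → rest {w}) h
      (λ r → atMost-injection _≟ⱽ_ first (λ {x} {y} → inj r {x} {y}) (λ {w} → zeros r {w}) (pair-finite (φ r)))
    where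
    rest : ∀ {w} → OnPair R w → R (Vec.tail w)
    rest {π ∷ r} (_ , _ , s) = s
    first : Vec Pair 4 → Vec F 2
    first ((a , b) ∷ _) = a ∷ b ∷ []
    inj : ∀ r {x y} → OnPair R x × Vec.tail x ≡ r → OnPair R y × Vec.tail y ≡ r → first x ≡ first y → x ≡ y
    inj r {π ∷ _} {π′ ∷ _} (_ , refl) (_ , refl) refl = refl
    φ : Vec Pair 3 → Fin 2 → ℤ
    -- The signs differ because the cyclic system reads P(a) - P(b) in its first equation and Q(b) -
    -- Q(a) in its second.
    φ r 0F = - total P r
    φ r 1F = total Q r
    zeros : ∀ r {w} → OnPair R w × Vec.tail w ≡ r → NonsingularZero p (cyclic (R₂ P Q) next₂) (cyclic′ (R₂ P Q) next₂) (φ r) (point (first w))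
    zeros r {(a , b) ∷ _} ((((gs , _) , hP , hQ) , t , _) , refl) = pair-nonsingular (φ r) (a ∷ b ∷ [])
        (λ { 0F → proj₁ gs ; 1F → proj₂ gs }) (λ { 0F → subst _≈0 (lemP (vl P a) (vl P b) (total P r)) hP ; 1F → subst _≈0 (lemQ (vl Q a) (vl Q b) (total Q r)) (≈0-neg hQ) }) t
      where
      lemP : ∀ a b r → (a - b) + r ≡ a - b - - r
      lemP = solve-∀
      lemQ : ∀ a b r → - ((a - b) + r) ≡ b - a - r
      lemQ = solve-∀

  rotate : Vec Pair 4 → Vec Pair 4
  rotate (π₀ ∷ π₁ ∷ π₂ ∷ π₃ ∷ []) = π₁ ∷ π₂ ∷ π₃ ∷ π₀ ∷ []

  rotate-injective : ∀ {v w} → rotate v ≡ rotate w → v ≡ w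
  rotate-injective {_ ∷ _ ∷ _ ∷ _ ∷ []} {_ ∷ _ ∷ _ ∷ _ ∷ []} refl = refl

  rotate-W : ∀ {w} → W w → W (rotate w)
  rotate-W {π₀ ∷ π₁ ∷ π₂ ∷ π₃ ∷ []} ((g₀ , g₁ , g₂ , g₃ , _) , hP , hQ) = (g₁ , g₂ , g₃ , g₀ , tt) ,
      subst _≈0 (lem (σ P π₀) (σ P π₁) (σ P π₂) (σ P π₃)) hP , subst _≈0 (lem (σ Q π₀) (σ Q π₁) (σ Q π₂) (σ Q π₃)) hQ
    where lem : ∀ a b c d → a + (b + (c + (d + + 0))) ≡ b + (c + (d + (a + + 0)))
          lem = solve-∀

  pull-back : ∀ {S T : Vec Pair 4 → Set} {m} → (∀ {w} → S w → T (rotate w)) → AtMost T m → AtMost S m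
  pull-back h t = atMost-injection _≟ᵂ_ rotate (λ _ _ → rotate-injective) h t

  w₁ w₂ w₃ w₄ : ℕ
  w₁ = (p ℕ.* p) ℕ.* ((p ℕ.* p) ℕ.* ((p ℕ.* p) ℕ.* 1))
  w₂ = length A ℕ.* p ℕ.+ p ℕ.* ℓ
  w₃ = w₂ ℕ.* (w₂ ℕ.* ((p ℕ.* p) ℕ.* ((p ℕ.* p) ℕ.* 1)))
  w₄ = length (A ⊗ B) ℕ.* p ℕ.+ p ℕ.* length (A ⊗ B)

  cons-pairs : ∀ {n k c} {S : Vec Pair (suc n) → Set} {T : Pair → Set} → (∀ {a v} → S (a ∷ v) → T a) → AtMost T k →
    (∀ a → AtMost (λ v → S (a ∷ v)) c) → AtMost S (k ℕ.* c)
  cons-pairs {S = S} = atMost-cons {S = S} _≟ᴾ_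

  -- If one of the first two pairs is not parallel, the other three pairs determine it up to n₂
  -- choices, giving p⁶. If both are parallel, they have O(p) values each, and the other two pairs
  -- give p⁴.
  W-bound : AtMost W (w₁ ℕ.* n₂ ℕ.+ (w₁ ℕ.* n₂ ℕ.+ w₃))
  W-bound = atMost-∪ {P = OnPair Full} {Q = S₁} (λ {w} → decide₁ {w}) (on-pair-bound full₃)
      (atMost-∪ {P = S₂} {Q = S₃} (λ {w} → decide₂ {w}) (pull-back {T = OnPair Full} (λ {w} → second {w}) (on-pair-bound full₃))
        (cons-pairs {S = S₃} {T = Parallel} (λ {π} {v} → head {π} {v}) parallel-pairs
          (λ π → cons-pairs {S = λ v → S₃ (π ∷ v)} {T = Parallel} (λ {π′} {v} → head₂ π {π′} {v}) parallel-pairs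
            (λ π′ → cons-pairs {S = λ v → S₃ (π ∷ π′ ∷ v)} {T = Full} (λ _ → tt) full-pairs (λ π″ → cons-pairs {T = Full} (λ _ → tt) full-pairs (λ _ → atMost-[]))))))
    where
    full₃ : AtMost {Vec Pair 3} Full w₁
    full₃ = cons-pairs {T = Full} (λ _ → tt) full-pairs (λ _ → cons-pairs {T = Full} (λ _ → tt) full-pairs (λ _ → cons-pairs {T = Full} (λ _ → tt) full-pairs (λ _ → atMost-[])))
    S₁ S₂ S₃ : Vec Pair 4 → Set
    S₁ (π₀ ∷ π₁ ∷ π₂ ∷ π₃ ∷ []) = W (π₀ ∷ π₁ ∷ π₂ ∷ π₃ ∷ []) × Parallel π₀
    S₂ (π₀ ∷ π₁ ∷ π₂ ∷ π₃ ∷ []) = W (π₀ ∷ π₁ ∷ π₂ ∷ π₃ ∷ []) × ¬ Parallel π₁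
    S₃ (π₀ ∷ π₁ ∷ π₂ ∷ π₃ ∷ []) = Parallel π₀ × Parallel π₁
    decide₁ : ∀ {w} → W w → OnPair Full w ⊎ S₁ w
    decide₁ {π₀ ∷ π₁ ∷ π₂ ∷ π₃ ∷ []} h = by-cases (≈0? (tangents (proj₁ π₀) (proj₂ π₀))) (λ t → inj₂ (h , t)) (λ t → inj₁ (h , t , tt))
    decide₂ : ∀ {w} → S₁ w → S₂ w ⊎ S₃ w
    decide₂ {π₀ ∷ π₁ ∷ π₂ ∷ π₃ ∷ []} (h , t₀) = by-cases (≈0? (tangents (proj₁ π₁) (proj₂ π₁))) (λ t → inj₂ (t₀ , t)) (λ t → inj₁ (h , t))
    second : ∀ {w} → S₂ w → OnPair Full (rotate w)
    second {π₀ ∷ π₁ ∷ π₂ ∷ π₃ ∷ []} (h , t) = rotate-W {π₀ ∷ π₁ ∷ π₂ ∷ π₃ ∷ []} h , t , tt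
    head : ∀ {π v} → S₃ (π ∷ v) → Parallel π
    head {π} {_ ∷ _ ∷ _ ∷ []} (t , _) = t
    head₂ : ∀ π {π′ v} → S₃ (π ∷ π′ ∷ v) → Parallel π′
    head₂ π {π′} {_ ∷ _ ∷ []} (_ , t) = t

  W₀ : Vec Pair 4 → Set
  W₀ (π ∷ r) = W (π ∷ r) × Degenerate₂ π

  w₅ w₆ w₇ w₀ : ℕ
  w₅ = (p ℕ.* p) ℕ.* ((p ℕ.* p) ℕ.* (w₄ ℕ.* 1))
  w₆ = (p ℕ.* p) ℕ.* (w₄ ℕ.* ((p ℕ.* p) ℕ.* 1))
  w₇ = w₄ ℕ.* (w₂ ℕ.* (w₂ ℕ.* ((p ℕ.* p) ℕ.* 1)))
  w₀ = w₅ ℕ.* n₂ ℕ.+ (w₆ ℕ.* n₂ ℕ.+ w₇)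

  -- The degenerate pair π₀ has O(p) values. If π₁ or π₂ is not parallel, it is determined up to n₂
  -- choices by the remaining pairs, which contribute p·p⁴. Otherwise π₀, π₁ and π₂ have O(p) values
  -- each, and π₃ has p².
  W₀-bound : AtMost W₀ w₀
  W₀-bound = atMost-∪ {P = S₁} {Q = S₂} (λ {w} → decide₁ {w})
      (pull-back {T = OnPair Last} (λ {w} → one {w}) (on-pair-bound last))
      (atMost-∪ {P = S₃} {Q = S₄} (λ {w} → decide₂ {w})
        (pull-back {T = S₅} (λ {w} → two {w}) (pull-back {T = OnPair Middle} (λ {w} → three {w}) (on-pair-bound middle)))
        (cons-pairs {S = S₄} {T = Degenerate₂} (λ {π} {v} → head {π} {v}) degenerate-pairs
          (λ π → cons-pairs {S = λ v → S₄ (π ∷ v)} {T = Parallel} (λ {π′} {v} → head₂ π {π′} {v}) parallel-pairs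
            (λ π′ → cons-pairs {S = λ v → S₄ (π ∷ π′ ∷ v)} {T = Parallel} (λ {π″} {v} → head₃ π π′ {π″} {v}) parallel-pairs
              (λ π″ → cons-pairs {T = Full} (λ _ → tt) full-pairs (λ _ → atMost-[]))))))
    where
    Last Middle : Vec Pair 3 → Set
    Last (_ ∷ _ ∷ π ∷ []) = Degenerate₂ π
    Middle (_ ∷ π ∷ _ ∷ []) = Degenerate₂ π
    last : AtMost Last w₅
    last = cons-pairs {S = Last} {T = Full} (λ _ → tt) full-pairs (λ a → cons-pairs {S = λ v → Last (a ∷ v)} {T = Full} (λ _ → tt) full-pairs
      (λ b → cons-pairs {S = λ v → Last (a ∷ b ∷ v)} {T = Degenerate₂} (λ { {_} {[]} h → h }) degenerate-pairs (λ _ → atMost-[])))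
    middle : AtMost Middle w₆
    middle = cons-pairs {S = Middle} {T = Full} (λ _ → tt) full-pairs (λ a → cons-pairs {S = λ v → Middle (a ∷ v)} {T = Degenerate₂} (λ { {_} {_ ∷ []} h → h }) degenerate-pairs
      (λ b → cons-pairs {S = λ v → Middle (a ∷ b ∷ v)} {T = Full} (λ _ → tt) full-pairs (λ _ → atMost-[])))
    S₁ S₂ S₃ S₄ S₅ : Vec Pair 4 → Set
    S₁ (π₀ ∷ π₁ ∷ π₂ ∷ π₃ ∷ []) = W (π₀ ∷ π₁ ∷ π₂ ∷ π₃ ∷ []) × Degenerate₂ π₀ × ¬ Parallel π₁
    S₂ (π₀ ∷ π₁ ∷ π₂ ∷ π₃ ∷ []) = W (π₀ ∷ π₁ ∷ π₂ ∷ π₃ ∷ []) × Degenerate₂ π₀ × Parallel π₁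
    S₃ (π₀ ∷ π₁ ∷ π₂ ∷ π₃ ∷ []) = W (π₀ ∷ π₁ ∷ π₂ ∷ π₃ ∷ []) × Degenerate₂ π₀ × ¬ Parallel π₂
    S₄ (π₀ ∷ π₁ ∷ π₂ ∷ π₃ ∷ []) = Degenerate₂ π₀ × Parallel π₁ × Parallel π₂
    S₅ (π₁ ∷ π₂ ∷ π₃ ∷ π₀ ∷ []) = W (π₁ ∷ π₂ ∷ π₃ ∷ π₀ ∷ []) × Degenerate₂ π₀ × ¬ Parallel π₂
    decide₁ : ∀ {w} → W₀ w → S₁ w ⊎ S₂ w
    decide₁ {π₀ ∷ π₁ ∷ π₂ ∷ π₃ ∷ []} (h , d) = by-cases (≈0? (tangents (proj₁ π₁) (proj₂ π₁))) (λ t → inj₂ (h , d , t)) (λ t → inj₁ (h , d , t))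
    decide₂ : ∀ {w} → S₂ w → S₃ w ⊎ S₄ w
    decide₂ {π₀ ∷ π₁ ∷ π₂ ∷ π₃ ∷ []} (h , d , t₁) = by-cases (≈0? (tangents (proj₁ π₂) (proj₂ π₂))) (λ t → inj₂ (d , t₁ , t)) (λ t → inj₁ (h , d , t))
    one : ∀ {w} → S₁ w → OnPair Last (rotate w)
    one {π₀ ∷ π₁ ∷ π₂ ∷ π₃ ∷ []} (h , d , t) = rotate-W {π₀ ∷ π₁ ∷ π₂ ∷ π₃ ∷ []} h , t , d
    two : ∀ {w} → S₃ w → S₅ (rotate w)
    two {π₀ ∷ π₁ ∷ π₂ ∷ π₃ ∷ []} (h , d , t) = rotate-W {π₀ ∷ π₁ ∷ π₂ ∷ π₃ ∷ []} h , d , t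
    three : ∀ {w} → S₅ w → OnPair Middle (rotate w)
    three {π₁ ∷ π₂ ∷ π₃ ∷ π₀ ∷ []} (h , d , t) = rotate-W {π₁ ∷ π₂ ∷ π₃ ∷ π₀ ∷ []} h , t , d
    head : ∀ {π v} → S₄ (π ∷ v) → Degenerate₂ π
    head {π} {_ ∷ _ ∷ _ ∷ []} (d , _) = d
    head₂ : ∀ π {π′ v} → S₄ (π ∷ π′ ∷ v) → Parallel π′
    head₂ π {π′} {_ ∷ _ ∷ []} (_ , t , _) = t
    head₃ : ∀ π π′ {π″ v} → S₄ (π ∷ π′ ∷ π″ ∷ v) → Parallel π″
    head₃ π π′ {π″} {_ ∷ []} (_ , _ , t) = t

  flat : ∀ {n} → Vec Pair n → Vec F (n ℕ.* 2)
  flat [] = []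
  flat ((a , b) ∷ w) = a ∷ b ∷ flat w

  flat-injective : ∀ {n} {v w : Vec Pair n} → flat v ≡ flat w → v ≡ w
  flat-injective {v = []} {[]} _ = refl
  flat-injective {v = (a , b) ∷ v} {(c , d) ∷ w} e = cong₂ _∷_ (cong₂ _,_ (Vecₚ.∷-injectiveˡ e) (Vecₚ.∷-injectiveˡ (Vecₚ.∷-injectiveʳ e))) (flat-injective (Vecₚ.∷-injectiveʳ (Vecₚ.∷-injectiveʳ e)))

  octic* : Vec Pair 4 → ℤ
  octic* w = octic-at (flat w)

  Singular : Vec Pair 4 → Set
  Singular w = W w × octic* w ≈0

  SomeDegenerate : Vec Pair 4 → Set
  SomeDegenerate (π₀ ∷ π₁ ∷ π₂ ∷ π₃ ∷ []) = W (π₀ ∷ π₁ ∷ π₂ ∷ π₃ ∷ []) × (Degenerate₂ π₀ ⊎ (Degenerate₂ π₁ ⊎ (Degenerate₂ π₂ ⊎ Degenerate₂ π₃)))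

  some-degenerate-bound : AtMost SomeDegenerate (w₀ ℕ.+ (w₀ ℕ.+ (w₀ ℕ.+ w₀)))
  some-degenerate-bound = atMost-∪ {P = W₀} {Q = S₁} (λ {w} → one {w}) W₀-bound
      (atMost-∪ {P = R₁} {Q = S₂} (λ {w} → two {w}) (pull-back {T = W₀} (λ {w} → r₁ {w}) W₀-bound)
      (atMost-∪ {P = R₂′} {Q = R₃} (λ {w} → three {w}) (pull-back {T = R₁} (λ {w} → r₂ {w}) (pull-back {T = W₀} (λ {w} → r₁ {w}) W₀-bound))
         (pull-back {T = R₂′} (λ {w} → r₃ {w}) (pull-back {T = R₁} (λ {w} → r₂ {w}) (pull-back {T = W₀} (λ {w} → r₁ {w}) W₀-bound)))))
    where
    S₁ S₂ R₁ R₂′ R₃ : Vec Pair 4 → Set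
    S₁ (π₀ ∷ π₁ ∷ π₂ ∷ π₃ ∷ []) = W (π₀ ∷ π₁ ∷ π₂ ∷ π₃ ∷ []) × (Degenerate₂ π₁ ⊎ (Degenerate₂ π₂ ⊎ Degenerate₂ π₃))
    S₂ (π₀ ∷ π₁ ∷ π₂ ∷ π₃ ∷ []) = W (π₀ ∷ π₁ ∷ π₂ ∷ π₃ ∷ []) × (Degenerate₂ π₂ ⊎ Degenerate₂ π₃)
    R₁ (π₀ ∷ π₁ ∷ π₂ ∷ π₃ ∷ []) = W (π₀ ∷ π₁ ∷ π₂ ∷ π₃ ∷ []) × Degenerate₂ π₁
    R₂′ (π₀ ∷ π₁ ∷ π₂ ∷ π₃ ∷ []) = W (π₀ ∷ π₁ ∷ π₂ ∷ π₃ ∷ []) × Degenerate₂ π₂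
    R₃ (π₀ ∷ π₁ ∷ π₂ ∷ π₃ ∷ []) = W (π₀ ∷ π₁ ∷ π₂ ∷ π₃ ∷ []) × Degenerate₂ π₃
    one : ∀ {w} → SomeDegenerate w → W₀ w ⊎ S₁ w
    one {_ ∷ _ ∷ _ ∷ _ ∷ []} (h , inj₁ d) = inj₁ (h , d)
    one {_ ∷ _ ∷ _ ∷ _ ∷ []} (h , inj₂ d) = inj₂ (h , d)
    two : ∀ {w} → S₁ w → R₁ w ⊎ S₂ w
    two {_ ∷ _ ∷ _ ∷ _ ∷ []} (h , inj₁ d) = inj₁ (h , d)
    two {_ ∷ _ ∷ _ ∷ _ ∷ []} (h , inj₂ d) = inj₂ (h , d)
    three : ∀ {w} → S₂ w → R₂′ w ⊎ R₃ w
    three {_ ∷ _ ∷ _ ∷ _ ∷ []} (h , inj₁ d) = inj₁ (h , d)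
    three {_ ∷ _ ∷ _ ∷ _ ∷ []} (h , inj₂ d) = inj₂ (h , d)
    r₁ : ∀ {w} → R₁ w → W₀ (rotate w)
    r₁ {π₀ ∷ π₁ ∷ π₂ ∷ π₃ ∷ []} (h , d) = rotate-W {π₀ ∷ π₁ ∷ π₂ ∷ π₃ ∷ []} h , d
    r₂ : ∀ {w} → R₂′ w → R₁ (rotate w)
    r₂ {π₀ ∷ π₁ ∷ π₂ ∷ π₃ ∷ []} (h , d) = rotate-W {π₀ ∷ π₁ ∷ π₂ ∷ π₃ ∷ []} h , d
    r₃ : ∀ {w} → R₃ w → R₂′ (rotate w)
    r₃ {π₀ ∷ π₁ ∷ π₂ ∷ π₃ ∷ []} (h , d) = rotate-W {π₀ ∷ π₁ ∷ π₂ ∷ π₃ ∷ []} h , d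

  degenerate₂? : ∀ π → Dec (Degenerate₂ π)
  degenerate₂? (a , b) = ≈0? (A* a * B* a) ⊎-dec ≈0? (A* b * B* b)

  Generic₂ : Pair → Set
  Generic₂ π = ¬ Degenerate₂ π

  generic-A : ∀ {y} → ¬ Degenerate y → ¬ (A* y ≈0)
  generic-A {y} n h = n (≈0-*ʳ {A* y} (B* y) h)

  generic-B : ∀ {y} → ¬ Degenerate y → ¬ (B* y ≈0)
  generic-B {y} n h = n (≈0-* (A* y) h)

  AllGeneric : Vec Pair 4 → Set
  AllGeneric (π₀ ∷ π₁ ∷ π₂ ∷ π₃ ∷ []) = Generic₂ π₀ × Generic₂ π₁ × Generic₂ π₂ × Generic₂ π₃

  front back : Vec Pair 4 → Vec F 3
  front ((a₀ , b₀) ∷ (a₁ , b₁) ∷ (a₂ , b₂) ∷ (a₃ , b₃) ∷ []) = a₀ ∷ b₀ ∷ a₁ ∷ []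
  back ((a₀ , b₀) ∷ (a₁ , b₁) ∷ (a₂ , b₂) ∷ (a₃ , b₃) ∷ []) = b₁ ∷ a₂ ∷ b₂ ∷ []

  not-front not-back : Vec Pair 4 → Vec F 5
  not-front ((a₀ , b₀) ∷ (a₁ , b₁) ∷ (a₂ , b₂) ∷ (a₃ , b₃) ∷ []) = b₁ ∷ a₂ ∷ b₂ ∷ a₃ ∷ b₃ ∷ []
  not-back ((a₀ , b₀) ∷ (a₁ , b₁) ∷ (a₂ , b₂) ∷ (a₃ , b₃) ∷ []) = a₀ ∷ b₀ ∷ a₁ ∷ a₃ ∷ b₃ ∷ []

  DependentTriple : Vec F 3 → Set
  DependentTriple v = D* (lookup v 0F) (lookup v 1F) (lookup v 2F) ≈0

  FrontCase BackCase : Vec Pair 4 → Set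
  FrontCase w = Singular w × AllGeneric w × ¬ DependentTriple (front w)
  BackCase w = Singular w × AllGeneric w × ¬ DependentTriple (back w)

  -- Five coordinates are free. The front three solve the two additive equations and the singularity
  -- condition, nonsingularly because D does not vanish; genericity of all points makes the products
  -- in `binomial` non-zero, as logarithmic differentiation requires.
  front-bound : AtMost FrontCase ((p ℕ.^ 5) ℕ.* n₃)
  front-bound = atMost-fibre _≟ⱽ_ not-front (λ _ → tt) (atMost-Vec p 5)
      (λ v → atMost-injection _≟ⱽ_ front (λ {x} {y} → inj v {x} {y}) (λ {w} → zeros v {w}) (triple-finite (params v)))
    where
    inj : ∀ v {x y} → FrontCase x × not-front x ≡ v → FrontCase y × not-front y ≡ v → front x ≡ front y → x ≡ y
    inj v {_ ∷ _ ∷ _ ∷ _ ∷ []} {_ ∷ _ ∷ _ ∷ _ ∷ []} (_ , refl) (_ , refl) refl = refl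
    rest : RatFun → F → F → F → F → F → ℤ
    rest R b₁ a₂ b₂ a₃ b₃ = vl R b₁ - (vl R a₂ - vl R b₂) - (vl R a₃ - vl R b₃)
    params : Vec F 5 → Parameters
    params (b₁ ∷ a₂ ∷ b₂ ∷ a₃ ∷ b₃ ∷ []) = rest P b₁ a₂ b₂ a₃ b₃ , rest Q b₁ a₂ b₂ a₃ b₃ ,
      B* b₁ * (A* a₂ * (B* b₂ * (A* a₃ * B* b₃))) , A* b₁ * (B* a₂ * (A* b₂ * (B* a₃ * A* b₃)))
    lem : ∀ a₀ b₀ a₁ b₁ a₂ b₂ a₃ b₃ → (a₀ - b₀) + ((a₁ - b₁) + ((a₂ - b₂) + ((a₃ - b₃) + + 0))) ≡ a₀ - b₀ + a₁ - (b₁ - (a₂ - b₂) - (a₃ - b₃))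
    lem = solve-∀
    zeros : ∀ v {w} → FrontCase w × not-front w ≡ v → NonsingularZero p (triple P Q A B) (triple′ P Q A B) (params v) (point (front w))
    zeros v {(a₀ , b₀) ∷ (a₁ , b₁) ∷ (a₂ , b₂) ∷ (a₃ , b₃) ∷ []} (((((g₀ , g₁ , g₂ , g₃ , _) , hP , hQ) , hO) , (n₀ , n₁ , n₂′ , n₃′) , hD) , refl) =
      triple-nonsingular (rest P b₁ a₂ b₂ a₃ b₃) (rest Q b₁ a₂ b₂ a₃ b₃) (B* b₁ * (A* a₂ * (B* b₂ * (A* a₃ * B* b₃)))) (A* b₁ * (B* a₂ * (A* b₂ * (B* a₃ * A* b₃))))
        a₀ b₀ a₁ (proj₁ g₀) (proj₂ g₀) (proj₁ g₁)
        (subst _≈0 (lem (vl P a₀) (vl P b₀) (vl P a₁) (vl P b₁) (vl P a₂) (vl P b₂) (vl P a₃) (vl P b₃)) hP)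
        (subst _≈0 (lem (vl Q a₀) (vl Q b₀) (vl Q a₁) (vl Q b₁) (vl Q a₂) (vl Q b₂) (vl Q a₃) (vl Q b₃)) hQ)
        hO
        (≉0-* {B* b₁ * (A* a₂ * (B* b₂ * (A* a₃ * B* b₃)))} {A* a₀ * (B* b₀ * A* a₁)}
          (≉0-* {B* b₁} {A* a₂ * (B* b₂ * (A* a₃ * B* b₃))} (generic-B (n₁ ∘ inj₂)) (≉0-* {A* a₂} {B* b₂ * (A* a₃ * B* b₃)} (generic-A (n₂′ ∘ inj₁))
            (≉0-* {B* b₂} {A* a₃ * B* b₃} (generic-B (n₂′ ∘ inj₂)) (≉0-* {A* a₃} {B* b₃} (generic-A (n₃′ ∘ inj₁)) (generic-B (n₃′ ∘ inj₂))))))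
          (≉0-* {A* a₀} {B* b₀ * A* a₁} (generic-A (n₀ ∘ inj₁)) (≉0-* {B* b₀} {A* a₁} (generic-B (n₀ ∘ inj₂)) (generic-A (n₁ ∘ inj₁)))))
        hD

  back-bound : AtMost BackCase ((p ℕ.^ 5) ℕ.* n₃)
  back-bound = atMost-fibre _≟ⱽ_ not-back (λ _ → tt) (atMost-Vec p 5)
      (λ v → atMost-injection _≟ⱽ_ back (λ {x} {y} → inj v {x} {y}) (λ {w} → zeros v {w}) (triple-finite (params v)))
    where
    inj : ∀ v {x y} → BackCase x × not-back x ≡ v → BackCase y × not-back y ≡ v → back x ≡ back y → x ≡ y
    inj v {_ ∷ _ ∷ _ ∷ _ ∷ []} {_ ∷ _ ∷ _ ∷ _ ∷ []} (_ , refl) (_ , refl) refl = refl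
    rest : RatFun → F → F → F → F → F → ℤ
    rest R a₀ b₀ a₁ a₃ b₃ = (vl R a₀ - vl R b₀) + vl R a₁ + (vl R a₃ - vl R b₃)
    κ μ : F → F → F → F → F → ℤ
    κ a₀ b₀ a₁ a₃ b₃ = (B* a₃ * A* b₃) * (B* a₀ * (A* b₀ * B* a₁))
    μ a₀ b₀ a₁ a₃ b₃ = (A* a₃ * B* b₃) * (A* a₀ * (B* b₀ * A* a₁))
    params : Vec F 5 → Parameters
    params (a₀ ∷ b₀ ∷ a₁ ∷ a₃ ∷ b₃ ∷ []) = rest P a₀ b₀ a₁ a₃ b₃ , rest Q a₀ b₀ a₁ a₃ b₃ , κ a₀ b₀ a₁ a₃ b₃ , μ a₀ b₀ a₁ a₃ b₃
    lem : ∀ a₀ b₀ a₁ b₁ a₂ b₂ a₃ b₃ → - ((a₀ - b₀) + ((a₁ - b₁) + ((a₂ - b₂) + ((a₃ - b₃) + + 0)))) ≡ b₁ - a₂ + b₂ - ((a₀ - b₀) + a₁ + (a₃ - b₃))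
    lem = solve-∀
    reorder : ∀ a b c d e f g h → (d * (e * (f * (g * h)))) * (a * (b * c)) ≡ ((g * h) * (a * (b * c))) * (d * (e * f))
    reorder = solve-∀
    flip : ∀ x y → - (x - y) ≡ y - x
    flip = solve-∀
    zeros : ∀ v {w} → BackCase w × not-back w ≡ v → NonsingularZero p (triple P Q A B) (triple′ P Q A B) (params v) (point (back w))
    zeros v {(a₀ , b₀) ∷ (a₁ , b₁) ∷ (a₂ , b₂) ∷ (a₃ , b₃) ∷ []} (((((g₀ , g₁ , g₂ , g₃ , _) , hP , hQ) , hO) , (n₀ , n₁ , n₂′ , n₃′) , hD) , refl) =
      triple-nonsingular (rest P a₀ b₀ a₁ a₃ b₃) (rest Q a₀ b₀ a₁ a₃ b₃) (κ a₀ b₀ a₁ a₃ b₃) (μ a₀ b₀ a₁ a₃ b₃)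
        b₁ a₂ b₂ (proj₂ g₁) (proj₁ g₂) (proj₂ g₂)
        -- In the sums b₁, a₂, b₂ carry the signs -, +, -, so both sums are negated. For the same
        -- reason A(b₁)B(a₂)A(b₂) stands in the second product of the octic form, which is negated
        -- too.
        (subst _≈0 (lem (vl P a₀) (vl P b₀) (vl P a₁) (vl P b₁) (vl P a₂) (vl P b₂) (vl P a₃) (vl P b₃)) (≈0-neg hP))
        (subst _≈0 (lem (vl Q a₀) (vl Q b₀) (vl Q a₁) (vl Q b₁) (vl Q a₂) (vl Q b₂) (vl Q a₃) (vl Q b₃)) (≈0-neg hQ))
        (subst _≈0 (trans (flip x₁ x₂) (cong₂ _-_ (reorder (B* a₀) (A* b₀) (B* a₁) (A* b₁) (B* a₂) (A* b₂) (B* a₃) (A* b₃)) (reorder (A* a₀) (B* b₀) (A* a₁) (B* b₁) (A* a₂) (B* b₂) (A* a₃) (B* b₃)))) (≈0-neg hO))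
        (≉0-* {κ a₀ b₀ a₁ a₃ b₃} {A* b₁ * (B* a₂ * A* b₂)}
          (≉0-* {B* a₃ * A* b₃} {B* a₀ * (A* b₀ * B* a₁)} (≉0-* {B* a₃} {A* b₃} (generic-B (n₃′ ∘ inj₁)) (generic-A (n₃′ ∘ inj₂)))
            (≉0-* {B* a₀} {A* b₀ * B* a₁} (generic-B (n₀ ∘ inj₁)) (≉0-* {A* b₀} {B* a₁} (generic-A (n₀ ∘ inj₂)) (generic-B (n₁ ∘ inj₁)))))
          (≉0-* {A* b₁} {B* a₂ * A* b₂} (generic-A (n₁ ∘ inj₂)) (≉0-* {B* a₂} {A* b₂} (generic-B (n₂′ ∘ inj₁)) (generic-A (n₂′ ∘ inj₂)))))
        hD
      where
      x₁ = (B* b₁ * (A* a₂ * (B* b₂ * (A* a₃ * B* b₃)))) * (A* a₀ * (B* b₀ * A* a₁))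
      x₂ = (A* b₁ * (B* a₂ * (A* b₂ * (B* a₃ * A* b₃)))) * (B* a₀ * (A* b₀ * B* a₁))

  d₃ : ℕ
  d₃ = λC ℕ.* (p ℕ.* (p ℕ.* 1)) ℕ.+ (p ℕ.* (λC ℕ.* (p ℕ.* 1)) ℕ.+ p ℕ.* (p ℕ.* (λC ℕ.* 1)))

  BothDependent : Vec Pair 4 → Set
  BothDependent w = W w × DependentTriple (front w) × DependentTriple (back w)

  -- Two dependent triples on disjoint points have O(p²) values each. In the remaining pair a₃ is
  -- free, and the P-equation leaves at most κP values for b₃.
  both-bound : AtMost BothDependent (d₃ ℕ.* (d₃ ℕ.* (p ℕ.* κP)))
  both-bound = atMost-fibre _≟ⱽ_ front (λ (_ , f , _) → f) dependent-triples
      (λ u → atMost-fibre _≟ⱽ_ back (λ ((_ , _ , b) , _) → b) dependent-triples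
        (λ v → atMost-injection {T = End u v} _≟ᴾ_ end (λ {x} {y} → inj u v {x} {y}) (λ {w} → into u v {w})
          (atMost-pair {T = Full} (λ _ → tt) full (λ a → fibre-P (offset u v + vl P a)))))
    where
    offset : Vec F 3 → Vec F 3 → ℤ
    offset (a₀ ∷ b₀ ∷ a₁ ∷ []) (b₁ ∷ a₂ ∷ b₂ ∷ []) = (vl P a₀ - vl P b₀) + ((vl P a₁ - vl P b₁) + (vl P a₂ - vl P b₂))
    End : Vec F 3 → Vec F 3 → Pair → Set
    End u v (a , b) = Good b × vl P b - (offset u v + vl P a) ≈0
    end : Vec Pair 4 → Pair
    end (_ ∷ _ ∷ _ ∷ π ∷ []) = π
    inj : ∀ u v {x y} → (BothDependent x × front x ≡ u) × back x ≡ v → (BothDependent y × front y ≡ u) × back y ≡ v → end x ≡ end y → x ≡ y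
    inj u v {_ ∷ _ ∷ _ ∷ _ ∷ []} {_ ∷ _ ∷ _ ∷ _ ∷ []} ((_ , refl) , refl) ((_ , refl) , refl) refl = refl
    lem : ∀ a₀ b₀ a₁ b₁ a₂ b₂ a₃ b₃ → - ((a₀ - b₀) + ((a₁ - b₁) + ((a₂ - b₂) + ((a₃ - b₃) + + 0)))) ≡ b₃ - (((a₀ - b₀) + ((a₁ - b₁) + (a₂ - b₂))) + a₃)
    lem = solve-∀
    into : ∀ u v {w} → (BothDependent w × front w ≡ u) × back w ≡ v → End u v (end w)
    into u v {(a₀ , b₀) ∷ (a₁ , b₁) ∷ (a₂ , b₂) ∷ (a₃ , b₃) ∷ []} (((((_ , _ , _ , g₃ , _) , hP , _) , _) , refl) , refl) =
      proj₂ g₃ , subst _≈0 (lem (vl P a₀) (vl P b₀) (vl P a₁) (vl P b₁) (vl P a₂) (vl P b₂) (vl P a₃) (vl P b₃)) (≈0-neg hP)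

  singular-count : ℕ
  singular-count = (w₀ ℕ.+ (w₀ ℕ.+ (w₀ ℕ.+ w₀))) ℕ.+ ((p ℕ.^ 5) ℕ.* n₃ ℕ.+ ((p ℕ.^ 5) ℕ.* n₃ ℕ.+ d₃ ℕ.* (d₃ ℕ.* (p ℕ.* κP))))

  singular-bound : AtMost Singular singular-count
  singular-bound = atMost-∪ {P = SomeDegenerate} {Q = S₁} (λ {w} → one {w}) some-degenerate-bound
      (atMost-∪ {P = FrontCase} {Q = S₂} (λ {w} → two {w}) front-bound
        (atMost-∪ {P = BackCase} {Q = BothDependent} (λ {w} → three {w}) back-bound both-bound))
    where
    S₁ S₂ : Vec Pair 4 → Set
    S₁ w = Singular w × AllGeneric w
    S₂ w = Singular w × AllGeneric w × DependentTriple (front w)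
    one : ∀ {w} → Singular w → SomeDegenerate w ⊎ S₁ w
    one {π₀ ∷ π₁ ∷ π₂ ∷ π₃ ∷ []} h =
      by-cases (degenerate₂? π₀) (λ d → inj₁ (proj₁ h , inj₁ d)) (λ n₀ →
      by-cases (degenerate₂? π₁) (λ d → inj₁ (proj₁ h , inj₂ (inj₁ d))) (λ n₁ →
      by-cases (degenerate₂? π₂) (λ d → inj₁ (proj₁ h , inj₂ (inj₂ (inj₁ d)))) (λ n₂′ →
      by-cases (degenerate₂? π₃) (λ d → inj₁ (proj₁ h , inj₂ (inj₂ (inj₂ d)))) (λ n₃′ → inj₂ (h , n₀ , n₁ , n₂′ , n₃′)))))
    two : ∀ {w} → S₁ w → FrontCase w ⊎ S₂ w
    two {w} (h , g) = by-cases (≈0? (D* (lookup (front w) 0F) (lookup (front w) 1F) (lookup (front w) 2F))) (λ d → inj₂ (h , g , d)) (λ n → inj₁ (h , g , n))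
    three : ∀ {w} → S₂ w → BackCase w ⊎ BothDependent w
    three {w} (h , g , f) = by-cases (≈0? (D* (lookup (back w) 0F) (lookup (back w) 1F) (lookup (back w) 2F))) (λ d → inj₂ (proj₁ h , f , d)) (λ n → inj₁ (h , g , n))

  good-lookup : ∀ {n} (w : Vec Pair n) → AllGood w → ∀ k → Good (lookup (flat w) k)
  good-lookup ((a , b) ∷ w) ((ga , gb) , g) zero = ga
  good-lookup ((a , b) ∷ w) ((ga , gb) , g) (suc zero) = gb
  good-lookup ((a , b) ∷ w) ((ga , gb) , g) (suc (suc k)) = good-lookup w g k

  jump : Vec Pair 4 → Fin 8 → ℤ
  jump w j = vl (R₈ P Q j) (lookup (flat w) j) - vl (R₈ P Q j) (lookup (flat w) (next₈ j))

  Linked : Vec Pair 4 → Vec Pair 4 → Set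
  Linked ξ π = ∀ j → jump ξ j - jump π j ≈0

  Solution : Vec Pair 4 × Vec Pair 4 → Set
  Solution (ξ , π) = AllGood ξ × W π × Linked ξ π

  linked-sym : ∀ {ξ π} → Linked ξ π → Linked π ξ
  linked-sym {ξ} {π} h j = subst _≈0 (lem (jump ξ j) (jump π j)) (≈0-neg (h j))
    where lem : ∀ x y → - (x - y) ≡ y - x
          lem = solve-∀

  -- The P-jumps add up to `total P` and the Q-jumps to -`total Q`, so equal jumps carry the last
  -- two equations from π to ξ. This makes the two halves of a solution interchangeable.
  linked-W : ∀ ξ π → AllGood ξ → W π → Linked ξ π → W ξ
  linked-W ξ@((a₀ , b₀) ∷ (a₁ , b₁) ∷ (a₂ , b₂) ∷ (a₃ , b₃) ∷ []) π@((c₀ , d₀) ∷ (c₁ , d₁) ∷ (c₂ , d₂) ∷ (c₃ , d₃) ∷ []) g (_ , hP , hQ) L = g ,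
      subst _≈0 (lemP (σ P (a₀ , b₀)) (σ P (a₁ , b₁)) (σ P (a₂ , b₂)) (σ P (a₃ , b₃)) (σ P (c₀ , d₀)) (σ P (c₁ , d₁)) (σ P (c₂ , d₂)) (σ P (c₃ , d₃)))
        (≈0-+ hP (≈0-+ (≈0-+ (L 0F) (L 2F)) (≈0-+ (L 4F) (L 6F)))) ,
      subst _≈0 (lemQ (vl Q a₀) (vl Q b₀) (vl Q a₁) (vl Q b₁) (vl Q a₂) (vl Q b₂) (vl Q a₃) (vl Q b₃) (vl Q c₀) (vl Q d₀) (vl Q c₁) (vl Q d₁) (vl Q c₂) (vl Q d₂) (vl Q c₃) (vl Q d₃))
        (≈0-- hQ (≈0-+ (≈0-+ (L 1F) (L 3F)) (≈0-+ (L 5F) (L 7F))))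
    where
    lemP : ∀ x₀ x₁ x₂ x₃ z₀ z₁ z₂ z₃ → (z₀ + (z₁ + (z₂ + (z₃ + + 0)))) + (((x₀ - z₀) + (x₁ - z₁)) + ((x₂ - z₂) + (x₃ - z₃))) ≡ x₀ + (x₁ + (x₂ + (x₃ + + 0)))
    lemP = solve-∀
    lemQ : ∀ a₀ b₀ a₁ b₁ a₂ b₂ a₃ b₃ c₀ d₀ c₁ d₁ c₂ d₂ c₃ d₃ →
      ((c₀ - d₀) + ((c₁ - d₁) + ((c₂ - d₂) + ((c₃ - d₃) + + 0))))
      - (((((b₀ - a₁) - (d₀ - c₁)) + ((b₁ - a₂) - (d₁ - c₂)))) + (((b₂ - a₃) - (d₂ - c₃)) + ((b₃ - a₀) - (d₃ - c₀))))
      ≡ (a₀ - b₀) + ((a₁ - b₁) + ((a₂ - b₂) + ((a₃ - b₃) + + 0)))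
    lemQ = solve-∀

  wb : ℕ
  wb = w₁ ℕ.* n₂ ℕ.+ (w₁ ℕ.* n₂ ℕ.+ w₃)

  LeftRegular RightRegular BothSingular : Vec Pair 4 × Vec Pair 4 → Set
  LeftRegular (ξ , π) = Solution (ξ , π) × ¬ (octic* ξ ≈0)
  RightRegular (ξ , π) = Solution (ξ , π) × ¬ (octic* π ≈0)
  BothSingular (ξ , π) = Solution (ξ , π) × octic* π ≈0

  _≟ᵂᵂ_ : DecidableEquality (Vec Pair 4 × Vec Pair 4)
  _≟ᵂᵂ_ = ×-≡-dec _≟ᵂ_ _≟ᵂ_

  -- A point π of W fixes the right-hand sides `jump π` of the cyclic system, of which ξ is then a
  -- nonsingular zero.
  left-bound : AtMost LeftRegular (wb ℕ.* n₈)
  left-bound = atMost-fibre _≟ᵂ_ proj₂ (λ ((_ , w , _) , _) → w) W-bound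
      (λ π → atMost-injection _≟ⱽ_ (flat ∘ proj₁) (λ {x} {y} → inj π {x} {y}) (λ {x} → zeros π {x}) (octagon-finite (jump π)))
    where
    inj : ∀ π {x y} → LeftRegular x × proj₂ x ≡ π → LeftRegular y × proj₂ y ≡ π → flat (proj₁ x) ≡ flat (proj₁ y) → x ≡ y
    inj π {ξ , _} {ξ′ , _} (_ , refl) (_ , refl) e = cong (_, π) (flat-injective e)
    zeros : ∀ π {x} → LeftRegular x × proj₂ x ≡ π → NonsingularZero p (cyclic (R₈ P Q) next₈) (cyclic′ (R₈ P Q) next₈) (jump π) (point (flat (proj₁ x)))
    zeros π {ξ , _} (((g , _ , L) , n) , refl) = octagon-nonsingular (jump π) (flat ξ) (good-lookup ξ g) L n

  right-bound : AtMost RightRegular (wb ℕ.* n₈)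
  right-bound = atMost-injection {T = LeftRegular} _≟ᵂᵂ_ (λ (ξ , π) → (π , ξ)) (λ _ _ e → cong₂ _,_ (cong proj₂ e) (cong proj₁ e))
    (λ { {ξ , π} ((g , w , L) , n) → (proj₁ w , linked-W ξ π g w L , linked-sym {ξ} {π} L) , n }) left-bound

  κ : ℕ
  κ = κP ℕ.+ κQ

  Step : Set
  Step = Bool × ℤ

  Next : Step → F → F → Set
  Next (true , φ) y x = Good x × vl P y - vl P x - φ ≈0
  Next (false , φ) y x = Good x × vl Q y - vl Q x - φ ≈0

  next-bound : ∀ s y → AtMost (Next s y) κ
  next-bound (true , φ) y = atMost-⊆ (λ {x} (g , h) → g , subst _≈0 (lem (vl P y) (vl P x) φ) (≈0-neg h)) (atMost-≤ (ℕₚ.m≤m+n κP κQ) (fibre-P (vl P y - φ)))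
    where lem : ∀ y x φ → - (y - x - φ) ≡ x - (y - φ)
          lem = solve-∀
  next-bound (false , φ) y = atMost-⊆ (λ {x} (g , h) → g , subst _≈0 (lem (vl Q y) (vl Q x) φ) (≈0-neg h)) (atMost-≤ (ℕₚ.m≤n+m κQ κP) (fibre-Q (vl Q y - φ)))
    where lem : ∀ y x φ → - (y - x - φ) ≡ x - (y - φ)
          lem = solve-∀

  Chain : ∀ {n} → Vec Step n → F → Vec F n → Set
  Chain [] y [] = ⊤
  Chain (s ∷ l) y (x ∷ v) = Next s y x × Chain l x v

  chain-bound : ∀ {n} (l : Vec Step n) y → AtMost (Chain l y) (κ ℕ.^ n)
  chain-bound [] y = atMost-[]
  chain-bound (s ∷ l) y = atMost-∷ {S = Chain (s ∷ l) y} {T = Next s y} proj₁ (next-bound s y) (λ x → atMost-⊆ proj₂ (chain-bound l x))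

  -- For each singular π the first coordinate of ξ is free, and each of the seven links that follow
  -- leaves at most κ values for the next coordinate.
  both-singular-bound : AtMost BothSingular (singular-count ℕ.* (p ℕ.* κ ℕ.^ 7))
  both-singular-bound = atMost-fibre _≟ᵂ_ proj₂ (λ ((_ , w , _) , o) → w , o) singular-bound
      (λ π → atMost-injection {T = Loop π} _≟ⱽ_ (flat ∘ proj₁) (λ {x} {y} → inj π {x} {y}) (λ {x} → into π {x})
        (atMost-∷ {S = Loop π} {T = Full} (λ _ → tt) full (λ x → chain-bound (steps π) x)))
    where
    steps : Vec Pair 4 → Vec Step 7
    steps π = (true , jump π 0F) ∷ (false , jump π 1F) ∷ (true , jump π 2F) ∷ (false , jump π 3F) ∷ (true , jump π 4F) ∷ (false , jump π 5F) ∷ (true , jump π 6F) ∷ []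
    Loop : Vec Pair 4 → Vec F 8 → Set
    Loop π (x ∷ v) = Chain (steps π) x v
    inj : ∀ π {x y} → BothSingular x × proj₂ x ≡ π → BothSingular y × proj₂ y ≡ π → flat (proj₁ x) ≡ flat (proj₁ y) → x ≡ y
    inj π {ξ , _} {ξ′ , _} (_ , refl) (_ , refl) e = cong (_, π) (flat-injective e)
    into : ∀ π {x} → BothSingular x × proj₂ x ≡ π → Loop π (flat (proj₁ x))
    into π {((a₀ , b₀) ∷ (a₁ , b₁) ∷ (a₂ , b₂) ∷ (a₃ , b₃) ∷ []) , _} ((((g₀ , g₁ , g₂ , g₃ , _) , _ , L) , _) , refl) =
      (proj₂ g₀ , L 0F) , (proj₁ g₁ , L 1F) , (proj₂ g₁ , L 2F) , (proj₁ g₂ , L 3F) , (proj₂ g₂ , L 4F) , (proj₁ g₃ , L 5F) , (proj₂ g₃ , L 6F) , tt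

  solution-count : ℕ
  solution-count = wb ℕ.* n₈ ℕ.+ (wb ℕ.* n₈ ℕ.+ singular-count ℕ.* (p ℕ.* κ ℕ.^ 7))

  solution-bound : AtMost Solution solution-count
  solution-bound = atMost-∪ {P = LeftRegular} {Q = S₁} (λ {x} → one {x}) left-bound
      (atMost-∪ {P = RightRegular} {Q = BothSingular} (λ {x} → two {x}) right-bound both-singular-bound)
    where
    S₁ : Vec Pair 4 × Vec Pair 4 → Set
    S₁ = Solution
    one : ∀ {x} → Solution x → LeftRegular x ⊎ S₁ x
    one {ξ , π} s = by-cases (≈0? (octic* ξ)) (λ o → inj₂ s) (λ n → inj₁ (s , n))
    two : ∀ {x} → S₁ x → RightRegular x ⊎ BothSingular x
    two {ξ , π} s = by-cases (≈0? (octic* π)) (λ o → inj₂ (s , o)) (λ n → inj₁ (s , n))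

  Point : Vec F 16 → Set
  Point v = InY p P Q (toVector v)

  -- y₁, y₃, y₇, y₅, y₆, y₈, y₄, y₂ is the cyclic order in which the first eight equations,
  -- alternately in P and in Q, link the pairs (yᵢ, yᵢ₊₈); in this order the signs in the
  -- last two equations alternate.
  upper lower : Vec F 16 → Vec Pair 4
  upper (y₁ ∷ y₂ ∷ y₃ ∷ y₄ ∷ y₅ ∷ y₆ ∷ y₇ ∷ y₈ ∷ _) = (y₁ , y₃) ∷ (y₇ , y₅) ∷ (y₆ , y₈) ∷ (y₄ , y₂) ∷ []
  lower (_ ∷ _ ∷ _ ∷ _ ∷ _ ∷ _ ∷ _ ∷ _ ∷ y₉ ∷ y₁₀ ∷ y₁₁ ∷ y₁₂ ∷ y₁₃ ∷ y₁₄ ∷ y₁₅ ∷ y₁₆ ∷ []) = (y₉ , y₁₁) ∷ (y₁₅ , y₁₃) ∷ (y₁₄ , y₁₆) ∷ (y₁₂ , y₁₀) ∷ []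

  halves : Vec F 16 → Vec Pair 4 × Vec Pair 4
  halves v = upper v , lower v

  halves-injective : ∀ {v w} → halves v ≡ halves w → v ≡ w
  halves-injective {_ ∷ _ ∷ _ ∷ _ ∷ _ ∷ _ ∷ _ ∷ _ ∷ _ ∷ _ ∷ _ ∷ _ ∷ _ ∷ _ ∷ _ ∷ _ ∷ []} {_ ∷ _ ∷ _ ∷ _ ∷ _ ∷ _ ∷ _ ∷ _ ∷ _ ∷ _ ∷ _ ∷ _ ∷ _ ∷ _ ∷ _ ∷ _ ∷ []} refl = refl

  point-solution : ∀ {v} → Point v → Solution (upper v , lower v)
  point-solution {y₁ ∷ y₂ ∷ y₃ ∷ y₄ ∷ y₅ ∷ y₆ ∷ y₇ ∷ y₈ ∷ y₉ ∷ y₁₀ ∷ y₁₁ ∷ y₁₂ ∷ y₁₃ ∷ y₁₄ ∷ y₁₅ ∷ y₁₆ ∷ []}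
    (poleP , poleQ , z₁ , z₂ , z₃ , z₄ , z₅ , z₆ , z₇ , z₈ , z₉ , z₁₀) =
      ((good (# 0) , good (# 2)) , (good (# 6) , good (# 4)) , (good (# 5) , good (# 7)) , (good (# 3) , good (# 1)) , tt) ,
      (((good (# 8) , good (# 10)) , (good (# 14) , good (# 12)) , (good (# 13) , good (# 15)) , (good (# 11) , good (# 9)) , tt) ,
        subst _≈0 (sum₈ (vl P y₉) (vl P y₁₀) (vl P y₁₁) (vl P y₁₂) (vl P y₁₃) (vl P y₁₄) (vl P y₁₅) (vl P y₁₆)) (%ℕ≡0⇒≈0 _ z₉) ,
        subst _≈0 (sum₈ (vl Q y₉) (vl Q y₁₀) (vl Q y₁₁) (vl Q y₁₂) (vl Q y₁₃) (vl Q y₁₄) (vl Q y₁₅) (vl Q y₁₆)) (%ℕ≡0⇒≈0 _ z₁₀)) ,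
      links
    where
    good : ∀ k → Good (toVector (y₁ ∷ y₂ ∷ y₃ ∷ y₄ ∷ y₅ ∷ y₆ ∷ y₇ ∷ y₈ ∷ y₉ ∷ y₁₀ ∷ y₁₁ ∷ y₁₂ ∷ y₁₃ ∷ y₁₄ ∷ y₁₅ ∷ y₁₆ ∷ []) k)
    good k = (λ h → poleP k (≈0⇒%ℕ≡0 _ h)) , (λ h → poleQ k (≈0⇒%ℕ≡0 _ h))
    sum₈ : ∀ y₉ y₁₀ y₁₁ y₁₂ y₁₃ y₁₄ y₁₅ y₁₆ → y₉ - y₁₀ - y₁₁ + y₁₂ - y₁₃ + y₁₄ + y₁₅ - y₁₆
      ≡ (y₉ - y₁₁) + ((y₁₅ - y₁₃) + ((y₁₄ - y₁₆) + ((y₁₂ - y₁₀) + + 0)))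
    sum₈ = solve-∀
    forward : ∀ a b c d → a - b - c + d ≡ (a - b) - (c - d)
    forward = solve-∀
    backward : ∀ a b c d → - (a - b - c + d) ≡ (b - a) - (d - c)
    backward = solve-∀
    links : Linked (upper (y₁ ∷ y₂ ∷ y₃ ∷ y₄ ∷ y₅ ∷ y₆ ∷ y₇ ∷ y₈ ∷ y₉ ∷ y₁₀ ∷ y₁₁ ∷ y₁₂ ∷ y₁₃ ∷ y₁₄ ∷ y₁₅ ∷ y₁₆ ∷ [])) (lower (y₁ ∷ y₂ ∷ y₃ ∷ y₄ ∷ y₅ ∷ y₆ ∷ y₇ ∷ y₈ ∷ y₉ ∷ y₁₀ ∷ y₁₁ ∷ y₁₂ ∷ y₁₃ ∷ y₁₄ ∷ y₁₅ ∷ y₁₆ ∷ []))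
    links 0F = subst _≈0 (forward (vl P y₁) (vl P y₃) (vl P y₉) (vl P y₁₁)) (%ℕ≡0⇒≈0 _ z₁)
    links 1F = subst _≈0 (forward (vl Q y₃) (vl Q y₇) (vl Q y₁₁) (vl Q y₁₅)) (%ℕ≡0⇒≈0 _ z₆)
    -- In the cyclic order this link runs from y₇ to y₅, against the order of the equation, hence
    -- the negation; likewise for the last three links.
    links 2F = subst _≈0 (backward (vl P y₅) (vl P y₇) (vl P y₁₃) (vl P y₁₅)) (≈0-neg (%ℕ≡0⇒≈0 _ z₃))
    links 3F = subst _≈0 (forward (vl Q y₅) (vl Q y₆) (vl Q y₁₃) (vl Q y₁₄)) (%ℕ≡0⇒≈0 _ z₈)
    links 4F = subst _≈0 (forward (vl P y₆) (vl P y₈) (vl P y₁₄) (vl P y₁₆)) (%ℕ≡0⇒≈0 _ z₄)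
    links 5F = subst _≈0 (backward (vl Q y₄) (vl Q y₈) (vl Q y₁₂) (vl Q y₁₆)) (≈0-neg (%ℕ≡0⇒≈0 _ z₇))
    links 6F = subst _≈0 (backward (vl P y₂) (vl P y₄) (vl P y₁₀) (vl P y₁₂)) (≈0-neg (%ℕ≡0⇒≈0 _ z₂))
    links 7F = subst _≈0 (backward (vl Q y₁) (vl Q y₂) (vl Q y₉) (vl Q y₁₀)) (≈0-neg (%ℕ≡0⇒≈0 _ z₅))

  point-bound : AtMost Point solution-count
  point-bound = atMost-injection {T = Solution} _≟ᵂᵂ_ halves (λ {v} {w} _ _ → halves-injective {v} {w}) (λ {v} → point-solution {v}) solution-bound

-- Collecting the constants

module Constants (P Q : RatFun) (n₂ n₃ n₈ : ℕ) where
  open Curve P Q using (A; B; ℓ)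

  a e λC κP κ : ℕ
  a = length A
  e = length (A ⊗ B)
  λC = length (Curve.C₁ P Q) ℕ.+ (length (Curve.C₂ P Q) ℕ.+ length (Curve.C₃ P Q))
  κP = length (num P) ℕ.+ length (den P)
  κ = κP ℕ.+ (length (num Q) ℕ.+ length (den Q))

  -- K₆p⁶ bounds W and K₅p⁵ its singular points. In K₅ the outer 4 counts the pairs that may be
  -- degenerate, 2·n₃ the front and back cases, and 9 = 3·3 the slices of two dependent triples. In
  -- K the factor 2 stands for regular ξ and regular π.
  K₆ K₅ K : ℕ
  K₆ = n₂ ℕ.+ (n₂ ℕ.+ (a ℕ.+ ℓ) ℕ.* (a ℕ.+ ℓ))
  K₅ = 4 ℕ.* (4 ℕ.* e ℕ.* n₂ ℕ.+ 2 ℕ.* e ℕ.* ((a ℕ.+ ℓ) ℕ.* (a ℕ.+ ℓ))) ℕ.+ (2 ℕ.* n₃ ℕ.+ 9 ℕ.* (λC ℕ.* λC ℕ.* κP))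
  K = 2 ℕ.* (K₆ ℕ.* n₈) ℕ.+ K₅ ℕ.* κ ℕ.^ 7

regular-count : ∀ p n a l →
  ((p ℕ.* p) ℕ.* ((p ℕ.* p) ℕ.* ((p ℕ.* p) ℕ.* 1))) ℕ.* n ℕ.+ (((p ℕ.* p) ℕ.* ((p ℕ.* p) ℕ.* ((p ℕ.* p) ℕ.* 1))) ℕ.* n ℕ.+ (a ℕ.* p ℕ.+ p ℕ.* l) ℕ.* ((a ℕ.* p ℕ.+ p ℕ.* l) ℕ.* ((p ℕ.* p) ℕ.* ((p ℕ.* p) ℕ.* 1))))
  ≡ (n ℕ.+ (n ℕ.+ (a ℕ.+ l) ℕ.* (a ℕ.+ l))) ℕ.* (p ℕ.* (p ℕ.* (p ℕ.* (p ℕ.* (p ℕ.* (p ℕ.* 1))))))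
regular-count = ℕS.solve-∀

degenerate-count : ∀ p n a l e →
  ((p ℕ.* p) ℕ.* ((p ℕ.* p) ℕ.* ((e ℕ.* p ℕ.+ p ℕ.* e) ℕ.* 1))) ℕ.* n ℕ.+ (((p ℕ.* p) ℕ.* ((e ℕ.* p ℕ.+ p ℕ.* e) ℕ.* ((p ℕ.* p) ℕ.* 1))) ℕ.* n ℕ.+ (e ℕ.* p ℕ.+ p ℕ.* e) ℕ.* ((a ℕ.* p ℕ.+ p ℕ.* l) ℕ.* ((a ℕ.* p ℕ.+ p ℕ.* l) ℕ.* ((p ℕ.* p) ℕ.* 1))))
  ≡ (4 ℕ.* e ℕ.* n ℕ.+ 2 ℕ.* e ℕ.* ((a ℕ.+ l) ℕ.* (a ℕ.+ l))) ℕ.* (p ℕ.* (p ℕ.* (p ℕ.* (p ℕ.* (p ℕ.* 1)))))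
degenerate-count = ℕS.solve-∀

dependent-count : ∀ p λC κP →
  (λC ℕ.* (p ℕ.* (p ℕ.* 1)) ℕ.+ (p ℕ.* (λC ℕ.* (p ℕ.* 1)) ℕ.+ p ℕ.* (p ℕ.* (λC ℕ.* 1)))) ℕ.* ((λC ℕ.* (p ℕ.* (p ℕ.* 1)) ℕ.+ (p ℕ.* (λC ℕ.* (p ℕ.* 1)) ℕ.+ p ℕ.* (p ℕ.* (λC ℕ.* 1)))) ℕ.* (p ℕ.* κP))
  ≡ (9 ℕ.* (λC ℕ.* λC ℕ.* κP)) ℕ.* (p ℕ.* (p ℕ.* (p ℕ.* (p ℕ.* (p ℕ.* 1)))))
dependent-count = ℕS.solve-∀

collect₅ : ∀ x n y q → (x ℕ.* q ℕ.+ (x ℕ.* q ℕ.+ (x ℕ.* q ℕ.+ x ℕ.* q))) ℕ.+ (q ℕ.* n ℕ.+ (q ℕ.* n ℕ.+ y ℕ.* q)) ≡ (4 ℕ.* x ℕ.+ (2 ℕ.* n ℕ.+ y)) ℕ.* q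
collect₅ = ℕS.solve-∀

collect₆ : ∀ x n y p k q → (x ℕ.* (p ℕ.* q)) ℕ.* n ℕ.+ ((x ℕ.* (p ℕ.* q)) ℕ.* n ℕ.+ (y ℕ.* q) ℕ.* (p ℕ.* k)) ≡ (2 ℕ.* (x ℕ.* n) ℕ.+ y ℕ.* k) ℕ.* (p ℕ.* q)
collect₆ = ℕS.solve-∀

module LargePrime (P Q : RatFun) (p : ℕ) .{{_ : NonZero p}} (pr : Prime p) (n₂ n₃ n₈ : ℕ)
  (large : Roots.Large p (domain-prime pr) (Curve.T P Q))
  (independent : ∀ a b c → (∀ t → Mod._≈0 p (a * evalℤ (Curve.X P Q) t + b * evalℤ (Curve.Y P Q) t + c * evalℤ (Curve.G P Q) t)) → Mod._≈0 p a × Mod._≈0 p b × Mod._≈0 p c)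
  (pair-finite : ∀ φ → AtMost {Vec (Fin p) 2} (λ x → NonsingularZero p (cyclic (R₂ P Q) next₂) (cyclic′ (R₂ P Q) next₂) φ (point x)) n₂)
  (triple-finite : ∀ i → AtMost {Vec (Fin p) 3} (λ x → NonsingularZero p (triple P Q (Curve.A P Q) (Curve.B P Q)) (triple′ P Q (Curve.A P Q) (Curve.B P Q)) i (point x)) n₃)
  (octagon-finite : ∀ φ → AtMost {Vec (Fin p) 8} (λ x → NonsingularZero p (cyclic (R₈ P Q) next₈) (cyclic′ (R₈ P Q) next₈) φ (point x)) n₈)
  where
  open Constants P Q n₂ n₃ n₈
  module Count = Counts P Q p pr large independent n₂ n₃ n₈ pair-finite triple-finite octagon-finite

  singular≡ : Count.singular-count ≡ K₅ ℕ.* p ℕ.^ 5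
  singular≡ = trans (cong₂ (λ x y → (x ℕ.+ (x ℕ.+ (x ℕ.+ x))) ℕ.+ (p ℕ.^ 5 ℕ.* n₃ ℕ.+ (p ℕ.^ 5 ℕ.* n₃ ℕ.+ y))) (degenerate-count p n₂ a (Curve.ℓ P Q) e) (dependent-count p λC κP))
    (collect₅ (4 ℕ.* e ℕ.* n₂ ℕ.+ 2 ℕ.* e ℕ.* ((a ℕ.+ Curve.ℓ P Q) ℕ.* (a ℕ.+ Curve.ℓ P Q))) n₃ (9 ℕ.* (λC ℕ.* λC ℕ.* κP)) (p ℕ.^ 5))

  count≡ : Count.solution-count ≡ K ℕ.* p ℕ.^ 6
  count≡ = trans (cong₂ (λ x y → x ℕ.* n₈ ℕ.+ (x ℕ.* n₈ ℕ.+ y ℕ.* (p ℕ.* κ ℕ.^ 7))) (regular-count p n₂ a (Curve.ℓ P Q)) singular≡)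
    (collect₆ K₆ n₈ K₅ p (κ ℕ.^ 7) (p ℕ.^ 5))

  does-true : ∀ {X : Set} (d : Dec X) → does d ≡ true → X
  does-true (yes x) _ = x

  card-bound : cardY p P Q ℕ.≤ K ℕ.* p ℕ.^ 6
  card-bound = subst (cardY p P Q ℕ.≤_) count≡ (count-≤ (λ y → does (InY? p P Q y)) (atMost-⊆ (λ {v} → does-true (InY? p P Q (toVector v))) Count.point-bound))

theorem4p2 : (P Q : RatFun) → WellFormed P → WellFormed Q → LinIndep1 P Q →
    ∃[ C ] ∀ (p : ℕ) .{{_ : NonZero p}} → Prime p → cardY p P Q ℕ.≤ C ℕ.* p ℕ.^ 6
theorem4p2 P Q _ _ ind = assemble
    (nonsingular-zeros (cyclic (R₂ P Q) next₂) (cyclic′ (R₂ P Q) next₂) (λ j → difference-jet (R₂ P Q j) j (next₂ j) (λ φ → φ j)))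
    (nonsingular-zeros (triple P Q A B) (triple′ P Q A B) (triple-jet P Q A B))
    (nonsingular-zeros (cyclic (R₈ P Q) next₈) (cyclic′ (R₈ P Q) next₈) (λ j → difference-jet (R₈ P Q j) j (next₈ j) (λ φ → φ j)))
    (Curve.T P Q) (λ h → h) ∣ I.Δ ∣ (λ p pr → I.independent-mod p (domain-prime pr))
  where
  open Curve P Q using (A; B; X; Y; G)
  module I = Independence P Q ind

  Finite : ∀ {J : Set} {n} (f : Fin n → J → Vec ℤ n → ℤ) → (Fin n → J → Vec ℤ n → Vec ℤ n → ℤ) → Set
  Finite {n = n} f df = ∃[ C ] ∃[ T ] (∀ p .{{_ : NonZero p}} → 1 ℕ.< p → (dom : IsDomain p) → Roots.Large p dom T →
    ∀ i → AtMost {Vec (Fin p) n} (λ x → NonsingularZero p f df i (point x)) C)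

  assemble : Finite (cyclic (R₂ P Q) next₂) (cyclic′ (R₂ P Q) next₂) → Finite (triple P Q A B) (triple′ P Q A B) →
    Finite (cyclic (R₈ P Q) next₈) (cyclic′ (R₈ P Q) next₈) →
    ∀ t₁ → (∀ {p} {dom : IsDomain p} → Roots.Large p dom t₁ → Roots.Large p dom (Curve.T P Q)) →
    ∀ δ → (∀ p (pr : Prime p) → δ ℕ.< p → ∀ a b c → (∀ t → Mod._≈0 p (a * evalℤ X t + b * evalℤ Y t + c * evalℤ G t)) → Mod._≈0 p a × Mod._≈0 p b × Mod._≈0 p c) →
    ∃[ C ] ∀ (p : ℕ) .{{_ : NonZero p}} → Prime p → cardY p P Q ℕ.≤ C ℕ.* p ℕ.^ 6
  -- T lies above |Δ| and is at least every bound imposed on the characteristic. For p ≤ T the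
  -- trivial count p¹⁶ is at most T¹⁰·p⁶, so the sum of the two constants covers both ranges.
  assemble (n₂ , t₂ , f₂) (n₃ , t₃ , f₃) (n₈ , t₈ , f₈) t₁ reduce δ independent = K ℕ.+ T ℕ.^ 10 , card-bound
    where
    open Constants P Q n₂ n₃ n₈ using (K)
    T : ℕ
    T = suc δ ℕ.+ (t₁ ℕ.+ (t₂ ℕ.+ (t₃ ℕ.+ t₈)))
    r₁ : t₁ ℕ.+ (t₂ ℕ.+ (t₃ ℕ.+ t₈)) ℕ.≤ T
    r₁ = ℕₚ.m≤n+m _ (suc δ)
    r₂ : t₂ ℕ.+ (t₃ ℕ.+ t₈) ℕ.≤ T
    r₂ = ℕₚ.≤-trans (ℕₚ.m≤n+m _ t₁) r₁
    r₃ : t₃ ℕ.+ t₈ ℕ.≤ T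
    r₃ = ℕₚ.≤-trans (ℕₚ.m≤n+m _ t₂) r₂
    small : ∀ p .{{_ : NonZero p}} → p ℕ.≤ T → cardY p P Q ℕ.≤ T ℕ.^ 10 ℕ.* p ℕ.^ 6
    small p p≤T = ℕₚ.≤-trans (count-≤ (λ y → does (InY? p P Q y)) (atMost-⊆ (λ _ → tt) (atMost-Vec p 16)))
      (subst (ℕ._≤ T ℕ.^ 10 ℕ.* p ℕ.^ 6) (sym (ℕₚ.^-distribˡ-+-* p 10 6)) (ℕₚ.*-monoˡ-≤ (p ℕ.^ 6) (ℕₚ.^-monoˡ-≤ 10 p≤T)))
    big : ∀ p .{{_ : NonZero p}} (pr : Prime p) → T ℕ.≤ p → cardY p P Q ℕ.≤ K ℕ.* p ℕ.^ 6
    big p pr T≤p = LargePrime.card-bound P Q p pr n₂ n₃ n₈ (reduce {p} {domain-prime pr} (large (ℕₚ.≤-trans (ℕₚ.m≤m+n t₁ _) r₁)))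
        (independent p pr (ℕₚ.≤-trans (ℕₚ.m≤m+n (suc δ) _) T≤p))
        (f₂ p 1<p (domain-prime pr) (large (ℕₚ.≤-trans (ℕₚ.m≤m+n t₂ _) r₂)))
        (f₃ p 1<p (domain-prime pr) (large (ℕₚ.≤-trans (ℕₚ.m≤m+n t₃ _) r₃)))
        (f₈ p 1<p (domain-prime pr) (large (ℕₚ.≤-trans (ℕₚ.m≤n+m t₈ t₃) r₃)))
      where
      open Fermat pr using (1<p)
      large : ∀ {t} → t ℕ.≤ T → Roots.Large p (domain-prime pr) t
      large t≤T k 0<k k<t = Mod.small≉0 p k 0<k (ℕₚ.<-≤-trans k<t (ℕₚ.≤-trans t≤T T≤p))
    card-bound : ∀ (p : ℕ) .{{_ : NonZero p}} → Prime p → cardY p P Q ℕ.≤ (K ℕ.+ T ℕ.^ 10) ℕ.* p ℕ.^ 6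
    card-bound p pr = go (ℕₚ.≤-total T p)
      where
      go : T ℕ.≤ p ⊎ p ℕ.≤ T → cardY p P Q ℕ.≤ (K ℕ.+ T ℕ.^ 10) ℕ.* p ℕ.^ 6
      go (inj₁ T≤p) = ℕₚ.≤-trans (big p pr T≤p) (ℕₚ.*-monoˡ-≤ (p ℕ.^ 6) (ℕₚ.m≤m+n K (T ℕ.^ 10)))
      go (inj₂ p≤T) = ℕₚ.≤-trans (small p p≤T) (ℕₚ.*-monoˡ-≤ (p ℕ.^ 6) (ℕₚ.m≤n+m (T ℕ.^ 10) K))
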